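{- The ring $\mathbf{\Lambda}$ of symmetric functions in superspace, with its usual product and the coproduct $\Delta$, is a cocommutative and self-dual Hopf algebra (in the topologist's sense).
   Context: Let $x_1,x_2,\dots$ be commuting variables and $\theta_1,\theta_2,\dots$ anticommuting variables ($\theta_i\theta_j=-\theta_j\theta_i$, $\theta_i^2=0$). $\mathbf{\Lambda}$ is the ring of formal power series over $\mathbb Q$ of bounded degree in these variables invariant under simultaneous permutation of the pairs $(x_i,\theta_i)$. The fermionic degree (degree in the $\theta$'s) is denoted $\deg$. $\mathbf{\Lambda}$ is graded by the sum of the total degree (degree in the $x$'s) and the fermionic degree. $\mathbf{\Lambda}\otimes\mathbf{\Lambda}$ is identified with functions of two sets of variables $(x;\theta)$, $(y;\phi)$, symmetric in each, with $\theta$'s and $\phi$'s anticommuting with each other; $f\otimes g$ corresponds to $f(x;\theta)g(y;\phi)$. It is thus an algebra with $(f_1\otimes g_1)(f_2\otimes g_2)=(-1)^{\deg(g_1)\deg(f_2)}f_1f_2\otimes g_1g_2$ for homogeneous elements. The coproduct is $(\Delta f)(x,y;\theta,\phi)=f(x,y;\theta,\phi)$, i.e. $f$ evaluated on the union of the two sets of variables; the counit $\epsilon$ is the identity on constants and zero on elements homogeneous of positive degree. A Hopf algebra here means: an associative unital algebra which is a coassociative counital coalgebra such that $\Delta$ and $\epsilon$ are algebra morphisms ($\mathbf{\Lambda}\otimes\mathbf{\Lambda}$ carrying the signed product above), possessing an antipode, i.e. a linear map $S$ with $\mathrm{mult}\circ(S\otimes1)\circ\Delta=u\circ\epsilon=\mathrm{mult}\circ(1\otimes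 S)\circ\Delta$, where $\mathrm{mult}$ is the multiplication and $u$ the unit map. Cocommutative (in the topologist's sense) means $\tau\circ\Delta=\Delta$, where $\tau(g\otimes h)=(-1)^{\deg(g)\deg(h)}h\otimes g$ for homogeneous $g,h$. Self-dual (in the topologist's sense) means that there is a non-degenerate bilinear pairing $\langle\cdot,\cdot\rangle:\mathbf{\Lambda}\otimes\mathbf{\Lambda}\to\mathbb Q$ such that for all $f,g,a,b\in\mathbf{\Lambda}$: $\langle fg,a\rangle=\langle f\otimes g,\Delta(a)\rangle$, $\langle f,ab\rangle=\langle\Delta(f),a\otimes b\rangle$, $\langle1,a\rangle=\epsilon(a)$, $\langle f,1\rangle=\epsilon(f)$ and $\langle S(f),a\rangle=\langle f,S(a)\rangle$, where on tensors the pairing is $\langle f\otimes g,a\otimes b\rangle=(-1)^{\deg(g)\deg(a)}\langle f,a\rangle\langle g,b\rangle$ for homogeneous elements (obtained by applying $1\otimes\tau\otimes1$ to $f\otimes g\otimes a\otimes b$ and then pairing). -}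

module Defs where

open import Level using (0ℓ)
open import Algebra.Module.Bundles using (LeftModule)
open import Algebra.Module.Morphism.Structures using (module LeftModuleMorphisms)
import Algebra.Module.Construct.TensorUnit as TensorUnit
import Algebra.Properties.Group as GroupProperties
open import Data.Bool.Base using (Bool; true; false; if_then_else_)
open import Data.List.Base using (List; []; _∷_; _++_; _∷ʳ_; map; foldr; cartesianProductWith)
open import Data.List.Membership.Propositional using (_∈_)
open import Data.List.Membership.Propositional.Properties using (∈-map⁻; ∈-cartesianProductWith⁻)
open import Data.List.Relation.Unary.Any using (here; there)
open import Data.List.Relation.Binary.Permutation.Propositional using (_↭_; refl; prep; swap; trans)
open import Data.Nat.Base as ℕ using (ℕ; zero; suc; parity)
import Data.Nat.Properties as ℕₚ
open import Data.Parity.Base as ℙ using (Parity; 0ℙ; 1ℙ)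
import Data.Parity.Properties as ℙₚ
open import Data.Product.Base using (∃; _×_; _,_; proj₁; proj₂)
open import Data.Rational.Base using (ℚ; 0ℚ; 1ℚ; _+_; _*_; -_)
import Data.Rational.Properties as ℚₚ
open import Data.Rational.Solver using (module +-*-Solver)
open import Data.Sum.Base using (_⊎_; inj₁; inj₂)
open import Function.Bundles using (_⇔_)
open import Relation.Binary.PropositionalEquality as ≡ using (_≡_; cong; cong₂; sym; module ≡-Reasoning)
open import Relation.Binary.Structures using (IsEquivalence)
open import Relation.Nullary using (yes; no; contradiction)

------------------------------------------------------------------------
-- Vector spaces over ℚ and linear maps

Space : Set₁
Space = LeftModule ℚₚ.+-*-ring 0ℓ 0ℓ

open LeftModule public using () renaming (Carrierᴹ to ∣_∣)

module _ (V : Space) where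
  open LeftModule V

  infix 4 eq
  eq : ∣ V ∣ → ∣ V ∣ → Set
  eq = _≈ᴹ_

  syntax eq V x y = x ≈[ V ] y

-- Negation is taken to be scalar multiplication by -1.
mkSpace : (C : Set) (_≈_ : C → C → Set) (_⊕_ : C → C → C) (_·_ : ℚ → C → C) (𝟘 : C) →
  IsEquivalence _≈_ →
  (∀ {x x′ y y′} → x ≈ x′ → y ≈ y′ → (x ⊕ y) ≈ (x′ ⊕ y′)) →
  (∀ x y z → ((x ⊕ y) ⊕ z) ≈ (x ⊕ (y ⊕ z))) →
  (∀ x y → (x ⊕ y) ≈ (y ⊕ x)) →
  (∀ x → (𝟘 ⊕ x) ≈ x) →
  (∀ r {x x′} → x ≈ x′ → (r · x) ≈ (r · x′)) →
  (∀ r s x → ((r + s) · x) ≈ ((r · x) ⊕ (s · x))) →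
  (∀ r s x → ((r * s) · x) ≈ (r · (s · x))) →
  (∀ r x y → (r · (x ⊕ y)) ≈ ((r · x) ⊕ (r · y))) →
  (∀ x → (1ℚ · x) ≈ x) →
  (∀ x → (0ℚ · x) ≈ 𝟘) →
  Space
mkSpace C _≈_ _⊕_ _·_ 𝟘 equiv ⊕-cong ⊕-assoc ⊕-comm ⊕-idˡ ·-cong ·-dʳ ·-assoc ·-dˡ ·-id ·-zero = record
  { Carrierᴹ = C
  ; _≈ᴹ_ = _≈_
  ; _+ᴹ_ = _⊕_
  ; _*ₗ_ = _·_
  ; 0ᴹ = 𝟘
  ; -ᴹ_ = (- 1ℚ) ·_
  ; isLeftModule = record
    { isLeftSemimodule = record
      { +ᴹ-isCommutativeMonoid = record
        { isMonoid = record
          { isSemigroup = record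
            { isMagma = record { isEquivalence = equiv ; ∙-cong = ⊕-cong }
            ; assoc = ⊕-assoc
            }
          ; identity = ⊕-idˡ , λ x → E.trans (⊕-comm x 𝟘) (⊕-idˡ x)
          }
        ; comm = ⊕-comm
        }
      ; isPreleftSemimodule = record
        { *ₗ-cong = λ { ≡.refl x≈ → ·-cong _ x≈ }
        ; *ₗ-zeroˡ = ·-zero
        ; *ₗ-distribʳ = λ x r s → ·-dʳ r s x
        ; *ₗ-identityˡ = ·-id
        ; *ₗ-assoc = ·-assoc
        ; *ₗ-zeroʳ = λ r → E.trans (·-cong r (E.sym (·-zero 𝟘)))
            (E.trans (E.sym (·-assoc r 0ℚ 𝟘))
              (E.trans (E.reflexive (cong (_· 𝟘) (ℚₚ.*-zeroʳ r))) (·-zero 𝟘)))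
        ; *ₗ-distribˡ = ·-dˡ
        }
      }
    ; -ᴹ‿cong = ·-cong (- 1ℚ)
    ; -ᴹ‿inverse = inverseˡ , λ x → E.trans (⊕-comm x _) (inverseˡ x)
    }
  }
  where
  module E = IsEquivalence equiv
  inverseˡ : ∀ x → (((- 1ℚ) · x) ⊕ x) ≈ 𝟘
  inverseˡ x = E.trans (⊕-cong E.refl (E.sym (·-id x)))
    (E.trans (E.sym (·-dʳ (- 1ℚ) 1ℚ x)) (·-zero x))

infix 1 _⟶_
record _⟶_ (V W : Space) : Set where
  private
    module V = LeftModule V
    module W = LeftModule W
  field
    ⟦_⟧ : ∣ V ∣ → ∣ W ∣
    isLinear : LeftModuleMorphisms.IsLeftModuleHomomorphism V.rawLeftModule W.rawLeftModule ⟦_⟧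
  open LeftModuleMorphisms.IsLeftModuleHomomorphism isLinear public
    using (⟦⟧-cong; +ᴹ-homo; 0ᴹ-homo; *ₗ-homo)

open _⟶_ public using (⟦_⟧)

module _ {V W : Space} where
  private
    module V = LeftModule V
    module W = LeftModule W

  mkLinear : (h : ∣ V ∣ → ∣ W ∣) →
    (∀ {x y} → x V.≈ᴹ y → h x W.≈ᴹ h y) →
    (∀ x y → h (x V.+ᴹ y) W.≈ᴹ (h x W.+ᴹ h y)) →
    (∀ r x → h (r V.*ₗ x) W.≈ᴹ (r W.*ₗ h x)) →
    V ⟶ W
  mkLinear h h-cong h-+ h-* = record
    { ⟦_⟧ = h
    ; isLinear = record
      { +ᴹ-isGroupHomomorphism = record
        { isMonoidHomomorphism = record
          { isMagmaHomomorphism = record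
            { isRelHomomorphism = record { cong = h-cong }
            ; homo = h-+
            }
          ; ε-homo = h-0
          }
        ; ⁻¹-homo = λ x → inverseˡ-unique (h (V.-ᴹ x)) (h x)
            (W.≈ᴹ-trans (W.≈ᴹ-sym (h-+ (V.-ᴹ x) x))
              (W.≈ᴹ-trans (h-cong (V.-ᴹ‿inverseˡ x)) h-0))
        }
      ; *ₗ-homo = h-*
      }
    }
    where
    open GroupProperties W.+ᴹ-group using (inverseˡ-unique)
    h-0 : h V.0ᴹ W.≈ᴹ W.0ᴹ
    h-0 = W.≈ᴹ-trans (h-cong (V.≈ᴹ-sym (V.*ₗ-zeroˡ V.0ᴹ)))
      (W.≈ᴹ-trans (h-* 0ℚ V.0ᴹ) (W.*ₗ-zeroˡ _))

  infix 4 _≐_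
  _≐_ : (V ⟶ W) → (V ⟶ W) → Set
  h ≐ k = ∀ x → ⟦ h ⟧ x W.≈ᴹ ⟦ k ⟧ x

idₗ : ∀ {V} → V ⟶ V
idₗ {V} = mkLinear (λ x → x) (λ p → p) (λ _ _ → ≈ᴹ-refl) (λ _ _ → ≈ᴹ-refl)
  where open LeftModule V

infixr 9 _∘ₗ_
_∘ₗ_ : ∀ {U V W} → (V ⟶ W) → (U ⟶ V) → U ⟶ W
_∘ₗ_ {U} {V} {W} k h = mkLinear (λ x → ⟦ k ⟧ (⟦ h ⟧ x))
  (λ p → k.⟦⟧-cong (h.⟦⟧-cong p))
  (λ x y → ≈ᴹ-trans (k.⟦⟧-cong (h.+ᴹ-homo x y)) (k.+ᴹ-homo _ _))
  (λ r x → ≈ᴹ-trans (k.⟦⟧-cong (h.*ₗ-homo r x)) (k.*ₗ-homo r _))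
  where
  open LeftModule W
  module h = _⟶_ h
  module k = _⟶_ k

ℚ-space : Space
ℚ-space = TensorUnit.leftModule

Functions : Set → Space
Functions X = mkSpace (X → ℚ) (λ f g → ∀ x → f x ≡ g x)
  (λ f g x → f x + g x) (λ r f x → r * f x) (λ _ → 0ℚ)
  (record { refl = λ _ → ≡.refl ; sym = λ p x → sym (p x) ; trans = λ p q x → ≡.trans (p x) (q x) })
  (λ p q x → cong₂ _+_ (p x) (q x))
  (λ f g h x → ℚₚ.+-assoc (f x) (g x) (h x))
  (λ f g x → ℚₚ.+-comm (f x) (g x))
  (λ f x → ℚₚ.+-identityˡ (f x))
  (λ r p x → cong (r *_) (p x))
  (λ r s f x → ℚₚ.*-distribʳ-+ (f x) r s)
  (λ r s f x → ℚₚ.*-assoc r s (f x))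
  (λ r f g x → ℚₚ.*-distribˡ-+ r (f x) (g x))
  (λ f x → ℚₚ.*-identityˡ (f x))
  (λ f x → ℚₚ.*-zeroˡ (f x))

------------------------------------------------------------------------
-- Tensor product over ℚ

module _ (V W : Space) where
  infixl 6 _+ₜ_
  infixr 7 _⊗ₑ_

  data Tensor : Set where
    0ₜ   : Tensor
    _+ₜ_ : Tensor → Tensor → Tensor
    _⊗ₑ_ : ∣ V ∣ → ∣ W ∣ → Tensor

module _ {V W : Space} where
  private
    module V = LeftModule V
    module W = LeftModule W

  infixr 7 _·ₜ_
  _·ₜ_ : ℚ → Tensor V W → Tensor V W
  r ·ₜ 0ₜ       = 0ₜ
  r ·ₜ (x +ₜ y) = (r ·ₜ x) +ₜ (r ·ₜ y)
  r ·ₜ (v ⊗ₑ w) = (r V.*ₗ v) ⊗ₑ w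

  infix 4 _≈ₜ_

  -- The congruence generated by the vector space axioms and bilinearity of _⊗ₑ_.
  data _≈ₜ_ : Tensor V W → Tensor V W → Set where
    ≈-refl  : ∀ {x} → x ≈ₜ x
    ≈-sym   : ∀ {x y} → x ≈ₜ y → y ≈ₜ x
    ≈-trans : ∀ {x y z} → x ≈ₜ y → y ≈ₜ z → x ≈ₜ z
    +-cong  : ∀ {x x′ y y′} → x ≈ₜ x′ → y ≈ₜ y′ → x +ₜ y ≈ₜ x′ +ₜ y′
    +-assoc : ∀ x y z → (x +ₜ y) +ₜ z ≈ₜ x +ₜ (y +ₜ z)
    +-comm  : ∀ x y → x +ₜ y ≈ₜ y +ₜ x
    +-idˡ   : ∀ x → 0ₜ +ₜ x ≈ₜ x
    ⊗-cong  : ∀ {v v′ w w′} → v V.≈ᴹ v′ → w W.≈ᴹ w′ → v ⊗ₑ w ≈ₜ v′ ⊗ₑ w′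
    ⊗-distʳ : ∀ v v′ w → (v V.+ᴹ v′) ⊗ₑ w ≈ₜ v ⊗ₑ w +ₜ v′ ⊗ₑ w
    ⊗-distˡ : ∀ v w w′ → v ⊗ₑ (w W.+ᴹ w′) ≈ₜ v ⊗ₑ w +ₜ v ⊗ₑ w′
    ⊗-scale : ∀ r v w → v ⊗ₑ (r W.*ₗ w) ≈ₜ (r V.*ₗ v) ⊗ₑ w
    ⊗-zeroˡ : ∀ w → V.0ᴹ ⊗ₑ w ≈ₜ 0ₜ

  +-interchange : ∀ {a b c d : Tensor V W} → (a +ₜ b) +ₜ (c +ₜ d) ≈ₜ (a +ₜ c) +ₜ (b +ₜ d)
  +-interchange = ≈-trans (+-assoc _ _ _)
    (≈-trans (+-cong ≈-refl (≈-trans (≈-sym (+-assoc _ _ _))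
      (≈-trans (+-cong (+-comm _ _) ≈-refl) (+-assoc _ _ _))))
      (≈-sym (+-assoc _ _ _)))

  ·-cong : ∀ r {x y} → x ≈ₜ y → r ·ₜ x ≈ₜ r ·ₜ y
  ·-cong r ≈-refl          = ≈-refl
  ·-cong r (≈-sym p)       = ≈-sym (·-cong r p)
  ·-cong r (≈-trans p q)   = ≈-trans (·-cong r p) (·-cong r q)
  ·-cong r (+-cong p q)    = +-cong (·-cong r p) (·-cong r q)
  ·-cong r (+-assoc x y z) = +-assoc _ _ _
  ·-cong r (+-comm x y)    = +-comm _ _
  ·-cong r (+-idˡ x)       = +-idˡ _
  ·-cong r (⊗-cong p q)    = ⊗-cong (V.*ₗ-cong ≡.refl p) q
  ·-cong r (⊗-distʳ v v′ w) = ≈-trans (⊗-cong (V.*ₗ-distribˡ r v v′) W.≈ᴹ-refl) (⊗-distʳ _ _ _)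
  ·-cong r (⊗-distˡ v w w′) = ⊗-distˡ _ _ _
  ·-cong r (⊗-scale s v w) = ≈-trans (⊗-scale s _ w) (⊗-cong
    (V.≈ᴹ-trans (V.≈ᴹ-sym (V.*ₗ-assoc s r v))
      (V.≈ᴹ-trans (V.*ₗ-cong (ℚₚ.*-comm s r) V.≈ᴹ-refl) (V.*ₗ-assoc r s v))) W.≈ᴹ-refl)
  ·-cong r (⊗-zeroˡ w)     = ≈-trans (⊗-cong (V.*ₗ-zeroʳ r) W.≈ᴹ-refl) (⊗-zeroˡ w)

  ·-distʳ : ∀ r s x → (r + s) ·ₜ x ≈ₜ (r ·ₜ x) +ₜ (s ·ₜ x)
  ·-distʳ r s 0ₜ       = ≈-sym (+-idˡ 0ₜ)
  ·-distʳ r s (x +ₜ y) = ≈-trans (+-cong (·-distʳ r s x) (·-distʳ r s y)) +-interchange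
  ·-distʳ r s (v ⊗ₑ w) = ≈-trans (⊗-cong (V.*ₗ-distribʳ v r s) W.≈ᴹ-refl) (⊗-distʳ _ _ _)

  ·-assoc : ∀ r s x → (r * s) ·ₜ x ≈ₜ r ·ₜ (s ·ₜ x)
  ·-assoc r s 0ₜ       = ≈-refl
  ·-assoc r s (x +ₜ y) = +-cong (·-assoc r s x) (·-assoc r s y)
  ·-assoc r s (v ⊗ₑ w) = ⊗-cong (V.*ₗ-assoc r s v) W.≈ᴹ-refl

  ·-id : ∀ x → 1ℚ ·ₜ x ≈ₜ x
  ·-id 0ₜ       = ≈-refl
  ·-id (x +ₜ y) = +-cong (·-id x) (·-id y)
  ·-id (v ⊗ₑ w) = ⊗-cong (V.*ₗ-identityˡ v) W.≈ᴹ-refl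

  ·-zero : ∀ x → 0ℚ ·ₜ x ≈ₜ 0ₜ
  ·-zero 0ₜ       = ≈-refl
  ·-zero (x +ₜ y) = ≈-trans (+-cong (·-zero x) (·-zero y)) (+-idˡ 0ₜ)
  ·-zero (v ⊗ₑ w) = ≈-trans (⊗-cong (V.*ₗ-zeroˡ v) W.≈ᴹ-refl) (⊗-zeroˡ w)

  tensorSpace : Space
  tensorSpace = mkSpace (Tensor V W) _≈ₜ_ _+ₜ_ _·ₜ_ 0ₜ
    (record { refl = ≈-refl ; sym = ≈-sym ; trans = ≈-trans })
    +-cong +-assoc +-comm +-idˡ ·-cong ·-distʳ ·-assoc (λ _ _ _ → ≈-refl) ·-id ·-zero

infixr 7 _⊗_
_⊗_ : Space → Space → Space
V ⊗ W = tensorSpace {V} {W}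

record Bilinear (V W U : Space) : Set where
  private
    module V = LeftModule V
    module W = LeftModule W
    module U = LeftModule U
  field
    on    : ∣ V ∣ → ∣ W ∣ → ∣ U ∣
    on-cong : ∀ {v v′ w w′} → v V.≈ᴹ v′ → w W.≈ᴹ w′ → on v w U.≈ᴹ on v′ w′
    +ˡ    : ∀ v v′ w → on (v V.+ᴹ v′) w U.≈ᴹ (on v w U.+ᴹ on v′ w)
    +ʳ    : ∀ v w w′ → on v (w W.+ᴹ w′) U.≈ᴹ (on v w U.+ᴹ on v w′)
    *ˡ    : ∀ r v w → on (r V.*ₗ v) w U.≈ᴹ (r U.*ₗ on v w)
    *ʳ    : ∀ r v w → on v (r W.*ₗ w) U.≈ᴹ (r U.*ₗ on v w)

module _ {V W U : Space} where
  private
    module V = LeftModule V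
    module W = LeftModule W
    module U = LeftModule U
  open Bilinear

  extend : (∣ V ∣ → ∣ W ∣ → ∣ U ∣) → Tensor V W → ∣ U ∣
  extend h 0ₜ       = U.0ᴹ
  extend h (x +ₜ y) = extend h x U.+ᴹ extend h y
  extend h (v ⊗ₑ w) = h v w

  extend-cong : (b : Bilinear V W U) → ∀ {x y} → x ≈ₜ y →
    extend (on b) x U.≈ᴹ extend (on b) y
  extend-cong b ≈-refl          = U.≈ᴹ-refl
  extend-cong b (≈-sym p)       = U.≈ᴹ-sym (extend-cong b p)
  extend-cong b (≈-trans p q)   = U.≈ᴹ-trans (extend-cong b p) (extend-cong b q)
  extend-cong b (+-cong p q)    = U.+ᴹ-cong (extend-cong b p) (extend-cong b q)
  extend-cong b (+-assoc x y z) = U.+ᴹ-assoc _ _ _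
  extend-cong b (+-comm x y)    = U.+ᴹ-comm _ _
  extend-cong b (+-idˡ x)       = U.+ᴹ-identityˡ _
  extend-cong b (⊗-cong p q)    = on-cong b p q
  extend-cong b (⊗-distʳ v v′ w) = +ˡ b v v′ w
  extend-cong b (⊗-distˡ v w w′) = +ʳ b v w w′
  extend-cong b (⊗-scale r v w) = U.≈ᴹ-trans (*ʳ b r v w) (U.≈ᴹ-sym (*ˡ b r v w))
  extend-cong b (⊗-zeroˡ w)     = U.≈ᴹ-trans
    (on-cong b (V.≈ᴹ-sym (V.*ₗ-zeroˡ V.0ᴹ)) W.≈ᴹ-refl)
    (U.≈ᴹ-trans (*ˡ b 0ℚ V.0ᴹ w) (U.*ₗ-zeroˡ _))

  extend-* : (b : Bilinear V W U) → ∀ r x →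
    extend (on b) (r ·ₜ x) U.≈ᴹ (r U.*ₗ extend (on b) x)
  extend-* b r 0ₜ       = U.≈ᴹ-sym (U.*ₗ-zeroʳ r)
  extend-* b r (x +ₜ y) = U.≈ᴹ-trans (U.+ᴹ-cong (extend-* b r x) (extend-* b r y))
    (U.≈ᴹ-sym (U.*ₗ-distribˡ r _ _))
  extend-* b r (v ⊗ₑ w) = *ˡ b r v w

  lift : Bilinear V W U → V ⊗ W ⟶ U
  lift b = mkLinear (extend (on b)) (extend-cong b) (λ _ _ → U.≈ᴹ-refl) (extend-* b)

module _ {V W : Space} where
  private
    module V = LeftModule V
    module W = LeftModule W

  insertʳ : ∣ W ∣ → V ⟶ V ⊗ W
  insertʳ w = mkLinear (_⊗ₑ w) (λ p → ⊗-cong p W.≈ᴹ-refl) (λ v v′ → ⊗-distʳ v v′ w) (λ _ _ → ≈-refl)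

  insertˡ : ∣ V ∣ → W ⟶ V ⊗ W
  insertˡ v = mkLinear (v ⊗ₑ_) (⊗-cong V.≈ᴹ-refl) (⊗-distˡ v) (λ r w → ⊗-scale r v w)

infixr 7 _⊗₁_
_⊗₁_ : ∀ {V V′ W W′} → (V ⟶ V′) → (W ⟶ W′) → V ⊗ W ⟶ V′ ⊗ W′
_⊗₁_ {V} {V′} {W} {W′} h k = lift record
  { on = λ v w → ⟦ h ⟧ v ⊗ₑ ⟦ k ⟧ w
  ; on-cong = λ p q → ⊗-cong (h.⟦⟧-cong p) (k.⟦⟧-cong q)
  ; +ˡ = λ v v′ w → ≈-trans (⊗-cong (h.+ᴹ-homo v v′) W′.≈ᴹ-refl) (⊗-distʳ _ _ _)
  ; +ʳ = λ v w w′ → ≈-trans (⊗-cong V′.≈ᴹ-refl (k.+ᴹ-homo w w′)) (⊗-distˡ _ _ _)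
  ; *ˡ = λ r v w → ⊗-cong (h.*ₗ-homo r v) W′.≈ᴹ-refl
  ; *ʳ = λ r v w → ≈-trans (⊗-cong V′.≈ᴹ-refl (k.*ₗ-homo r w)) (⊗-scale r _ _)
  }
  where
  module h = _⟶_ h
  module k = _⟶_ k
  module V′ = LeftModule V′
  module W′ = LeftModule W′

module _ {V W U : Space} where
  private
    module U = LeftModule U

  extend-≈ : ∀ {h k : ∣ V ∣ → ∣ W ∣ → ∣ U ∣} → (∀ v w → h v w U.≈ᴹ k v w) →
    ∀ x → extend {V} {W} {U} h x U.≈ᴹ extend {V} {W} {U} k x
  extend-≈ p 0ₜ       = U.≈ᴹ-refl
  extend-≈ p (x +ₜ y) = U.+ᴹ-cong (extend-≈ p x) (extend-≈ p y)
  extend-≈ p (v ⊗ₑ w) = p v w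

  extend-+ : ∀ (h k : ∣ V ∣ → ∣ W ∣ → ∣ U ∣) x →
    extend {V} {W} {U} (λ v w → h v w U.+ᴹ k v w) x
      U.≈ᴹ (extend {V} {W} {U} h x U.+ᴹ extend {V} {W} {U} k x)
  extend-+ h k 0ₜ       = U.≈ᴹ-sym (U.+ᴹ-identityˡ U.0ᴹ)
  extend-+ h k (x +ₜ y) = U.≈ᴹ-trans (U.+ᴹ-cong (extend-+ h k x) (extend-+ h k y))
    (U.≈ᴹ-trans (U.+ᴹ-assoc _ _ _) (U.≈ᴹ-trans (U.+ᴹ-cong U.≈ᴹ-refl
      (U.≈ᴹ-trans (U.≈ᴹ-sym (U.+ᴹ-assoc _ _ _))
        (U.≈ᴹ-trans (U.+ᴹ-cong (U.+ᴹ-comm _ _) U.≈ᴹ-refl) (U.+ᴹ-assoc _ _ _))))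
      (U.≈ᴹ-sym (U.+ᴹ-assoc _ _ _))))
  extend-+ h k (v ⊗ₑ w) = U.≈ᴹ-refl

  extend-· : ∀ r (h : ∣ V ∣ → ∣ W ∣ → ∣ U ∣) x →
    extend {V} {W} {U} (λ v w → r U.*ₗ h v w) x U.≈ᴹ (r U.*ₗ extend {V} {W} {U} h x)
  extend-· r h 0ₜ       = U.≈ᴹ-sym (U.*ₗ-zeroʳ r)
  extend-· r h (x +ₜ y) = U.≈ᴹ-trans (U.+ᴹ-cong (extend-· r h x) (extend-· r h y))
    (U.≈ᴹ-sym (U.*ₗ-distribˡ r _ _))
  extend-· r h (v ⊗ₑ w) = U.≈ᴹ-refl

  -- A trilinear map P × V × W → U, viewed as a bilinear map P × (V ⊗ W) → U.
  liftTrilinear : ∀ {P : Space} (b : ∣ P ∣ → Bilinear V W U) →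
    (∀ {p q} → p ≈[ P ] q → ∀ v w → Bilinear.on (b p) v w U.≈ᴹ Bilinear.on (b q) v w) →
    (∀ p q v w → Bilinear.on (b (LeftModule._+ᴹ_ P p q)) v w
      U.≈ᴹ (Bilinear.on (b p) v w U.+ᴹ Bilinear.on (b q) v w)) →
    (∀ r p v w → Bilinear.on (b (LeftModule._*ₗ_ P r p)) v w U.≈ᴹ (r U.*ₗ Bilinear.on (b p) v w)) →
    Bilinear P (V ⊗ W) U
  liftTrilinear b b-cong b-+ b-* = record
    { on = λ p → ⟦ lift (b p) ⟧
    ; on-cong = λ {p} {q} {x} p≈q x≈y → U.≈ᴹ-trans (extend-≈ (b-cong p≈q) x)
        (_⟶_.⟦⟧-cong (lift (b q)) x≈y)
    ; +ˡ = λ p q x → U.≈ᴹ-trans (extend-≈ (b-+ p q) x) (extend-+ _ _ x)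
    ; +ʳ = λ p x y → U.≈ᴹ-refl
    ; *ˡ = λ r p x → U.≈ᴹ-trans (extend-≈ (b-* r p) x) (extend-· r _ x)
    ; *ʳ = λ r p x → _⟶_.*ₗ-homo (lift (b p)) r x
    }

flip : ∀ {V W U} → Bilinear V W U → Bilinear W V U
flip b = record
  { on = λ w v → on v w ; on-cong = λ p q → on-cong q p
  ; +ˡ = λ w w′ v → +ʳ v w w′ ; +ʳ = λ w v v′ → +ˡ v v′ w
  ; *ˡ = λ r w v → *ʳ r v w ; *ʳ = λ r w v → *ˡ r v w
  }
  where open Bilinear b

module _ {U V W : Space} where
  private
    module U = LeftModule U
    module V = LeftModule V
    module W = LeftModule W

  assocʳ : (U ⊗ V) ⊗ W ⟶ U ⊗ (V ⊗ W)
  assocʳ = lift (flip (liftTrilinear {P = W}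
    (λ w → record
      { on = λ u v → u ⊗ₑ (v ⊗ₑ w)
      ; on-cong = λ p q → ⊗-cong p (⊗-cong q W.≈ᴹ-refl)
      ; +ˡ = λ u u′ v → ⊗-distʳ _ _ _
      ; +ʳ = λ u v v′ → ≈-trans (⊗-cong U.≈ᴹ-refl (⊗-distʳ _ _ _)) (⊗-distˡ _ _ _)
      ; *ˡ = λ r u v → ≈-refl
      ; *ʳ = λ r u v → ⊗-scale r u (v ⊗ₑ w)
      })
    (λ p u v → ⊗-cong U.≈ᴹ-refl (⊗-cong V.≈ᴹ-refl p))
    (λ w w′ u v → ≈-trans (⊗-cong U.≈ᴹ-refl (⊗-distˡ v w w′)) (⊗-distˡ _ _ _))
    (λ r w u v → ≈-trans (⊗-cong U.≈ᴹ-refl (⊗-scale r v w)) (⊗-scale r u (v ⊗ₑ w)))))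

  assocˡ : U ⊗ (V ⊗ W) ⟶ (U ⊗ V) ⊗ W
  assocˡ = lift (liftTrilinear {P = U}
    (λ u → record
      { on = λ v w → (u ⊗ₑ v) ⊗ₑ w
      ; on-cong = λ p q → ⊗-cong (⊗-cong U.≈ᴹ-refl p) q
      ; +ˡ = λ v v′ w → ≈-trans (⊗-cong (⊗-distˡ _ _ _) W.≈ᴹ-refl) (⊗-distʳ _ _ _)
      ; +ʳ = λ v w w′ → ⊗-distˡ _ _ _
      ; *ˡ = λ r v w → ⊗-cong (⊗-scale r u v) W.≈ᴹ-refl
      ; *ʳ = λ r v w → ⊗-scale r (u ⊗ₑ v) w
      })
    (λ p v w → ⊗-cong (⊗-cong p V.≈ᴹ-refl) W.≈ᴹ-refl)
    (λ u u′ v w → ≈-trans (⊗-cong (⊗-distʳ u u′ v) W.≈ᴹ-refl) (⊗-distʳ _ _ _))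
    (λ r u v w → ≈-refl))

scalars : ∀ {V} → Bilinear ℚ-space V V
scalars {V} = record
  { on = _*ₗ_
  ; on-cong = *ₗ-cong
  ; +ˡ = λ r s v → *ₗ-distribʳ v r s
  ; +ʳ = *ₗ-distribˡ
  ; *ˡ = *ₗ-assoc
  ; *ʳ = λ r s v → ≈ᴹ-trans (≈ᴹ-sym (*ₗ-assoc s r v))
      (≈ᴹ-trans (*ₗ-cong (ℚₚ.*-comm s r) ≈ᴹ-refl) (*ₗ-assoc r s v))
  }
  where open LeftModule V

unitorˡ : ∀ {V} → ℚ-space ⊗ V ⟶ V
unitorˡ = lift scalars

unitorʳ : ∀ {V} → V ⊗ ℚ-space ⟶ V
unitorʳ = lift (flip scalars)

------------------------------------------------------------------------
-- Superspaces

-- (-1)^p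
sgn : Parity → ℚ
sgn 0ℙ = 1ℚ
sgn 1ℙ = - 1ℚ

-- A decomposition into an even and an odd subspace, given by the two projections.
record SuperSpace : Set₁ where
  field
    space : Space
    part  : Parity → space ⟶ space
  open LeftModule space
  field
    part-idem : ∀ p v → ⟦ part p ⟧ (⟦ part p ⟧ v) ≈ᴹ ⟦ part p ⟧ v
    part-orth : ∀ p v → ⟦ part (p ℙ.⁻¹) ⟧ (⟦ part p ⟧ v) ≈ᴹ 0ᴹ
    part-sum  : ∀ v → (⟦ part 0ℙ ⟧ v +ᴹ ⟦ part 1ℙ ⟧ v) ≈ᴹ v

module Super (A : SuperSpace) where
  open SuperSpace A
  open LeftModule space

  scaled-swap : Parity → Parity → Bilinear space space (space ⊗ space)
  scaled-swap p q = record
    { on = λ v w → sgn (p ℙ.* q) ·ₜ (⟦ part q ⟧ w ⊗ₑ ⟦ part p ⟧ v)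
    ; on-cong = λ v≈ w≈ → ⊗-cong (*ₗ-cong ≡.refl (q.⟦⟧-cong w≈)) (p.⟦⟧-cong v≈)
    ; +ˡ = λ v v′ w → ≈-trans (⊗-cong ≈ᴹ-refl (p.+ᴹ-homo v v′)) (⊗-distˡ _ _ _)
    ; +ʳ = λ v w w′ → ≈-trans (⊗-cong (≈ᴹ-trans (*ₗ-cong ≡.refl (q.+ᴹ-homo w w′)) (*ₗ-distribˡ _ _ _)) ≈ᴹ-refl) (⊗-distʳ _ _ _)
    ; *ˡ = λ r v w → ≈-trans (⊗-cong ≈ᴹ-refl (p.*ₗ-homo r v)) (⊗-scale r _ _)
    ; *ʳ = λ r v w → ⊗-cong (≈ᴹ-trans (*ₗ-cong ≡.refl (q.*ₗ-homo r w)) (swap-scalars _ r _)) ≈ᴹ-refl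
    }
    where
    module p = _⟶_ (part p)
    module q = _⟶_ (part q)
    swap-scalars : ∀ s r v → (s *ₗ (r *ₗ v)) ≈ᴹ (r *ₗ (s *ₗ v))
    swap-scalars s r v = Bilinear.*ʳ (scalars {space}) r s v

  infixl 6 _⊕_
  _⊕_ : ∀ {V W} → (V ⟶ W) → (V ⟶ W) → V ⟶ W
  _⊕_ {V} {W} h k = mkLinear (λ x → ⟦ h ⟧ x W.+ᴹ ⟦ k ⟧ x)
    (λ p → W.+ᴹ-cong (h.⟦⟧-cong p) (k.⟦⟧-cong p))
    (λ x y → W.≈ᴹ-trans (W.+ᴹ-cong (h.+ᴹ-homo x y) (k.+ᴹ-homo x y)) (interchange _ _ _ _))
    (λ r x → W.≈ᴹ-trans (W.+ᴹ-cong (h.*ₗ-homo r x) (k.*ₗ-homo r x)) (W.≈ᴹ-sym (W.*ₗ-distribˡ r _ _)))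
    where
    module W = LeftModule W
    module h = _⟶_ h
    module k = _⟶_ k
    interchange : ∀ a b c d → ((a W.+ᴹ b) W.+ᴹ (c W.+ᴹ d)) W.≈ᴹ ((a W.+ᴹ c) W.+ᴹ (b W.+ᴹ d))
    interchange a b c d = W.≈ᴹ-trans (W.+ᴹ-assoc _ _ _)
      (W.≈ᴹ-trans (W.+ᴹ-cong W.≈ᴹ-refl (W.≈ᴹ-trans (W.≈ᴹ-sym (W.+ᴹ-assoc _ _ _))
        (W.≈ᴹ-trans (W.+ᴹ-cong (W.+ᴹ-comm _ _) W.≈ᴹ-refl) (W.+ᴹ-assoc _ _ _))))
        (W.≈ᴹ-sym (W.+ᴹ-assoc _ _ _)))

  -- The sign rule for homogeneous elements, extended bilinearly:
  -- v ⊗ w ↦ Σ_{p,q} (-1)^{pq} w_q ⊗ v_p.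
  τ : space ⊗ space ⟶ space ⊗ space
  τ = lift (scaled-swap 0ℙ 0ℙ) ⊕ lift (scaled-swap 0ℙ 1ℙ)
    ⊕ lift (scaled-swap 1ℙ 0ℙ) ⊕ lift (scaled-swap 1ℙ 1ℙ)

  -- 1 ⊗ τ ⊗ 1
  τ-middle : (space ⊗ space) ⊗ (space ⊗ space) ⟶ (space ⊗ space) ⊗ (space ⊗ space)
  τ-middle = assocˡ ∘ₗ (idₗ ⊗₁ (assocʳ ∘ₗ (τ ⊗₁ idₗ) ∘ₗ assocˡ)) ∘ₗ assocʳ

  -- v has parity p iff part p fixes it, so this is τ(v ⊗ w) = (-1)^{pq} w ⊗ v.
  τ-homogeneous : ∀ p q {v w} → ⟦ part p ⟧ v ≈ᴹ v → ⟦ part q ⟧ w ≈ᴹ w →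
    ⟦ τ ⟧ (v ⊗ₑ w) ≈[ space ⊗ space ] _·ₜ_ {space} {space} (sgn (p ℙ.* q)) (w ⊗ₑ v)
  τ-homogeneous p q {v} {w} hv hw = pick p q hv hw
    where
    infixr 2 _▸_
    _▸_ : ∀ {x y z : Tensor space space} → x ≈ₜ y → y ≈ₜ z → x ≈ₜ z
    _▸_ = ≈-trans
    T : Space
    T = space ⊗ space
    module T = LeftModule T
    vanish : ∀ p {v} → ⟦ part p ⟧ v ≈ᴹ v → ⟦ part (p ℙ.⁻¹) ⟧ v ≈ᴹ 0ᴹ
    vanish p {v} h = ≈ᴹ-trans (_⟶_.⟦⟧-cong (part (p ℙ.⁻¹)) (≈ᴹ-sym h)) (part-orth p v)
    term : ℚ → ∣ space ∣ → ∣ space ∣ → Tensor space space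
    term r x y = (r *ₗ x) ⊗ₑ y
    keep : ∀ r {x y x′ y′} → x ≈ᴹ x′ → y ≈ᴹ y′ → term r x y ≈ₜ term r x′ y′
    keep r h k = ⊗-cong (*ₗ-cong {x = r} ≡.refl h) k
    zeroˡ : ∀ r {x y} → x ≈ᴹ 0ᴹ → term r x y ≈ₜ 0ₜ
    zeroˡ r {y = y} h = ⊗-cong (≈ᴹ-trans (*ₗ-cong {x = r} ≡.refl h) (*ₗ-zeroʳ r)) ≈ᴹ-refl ▸ ⊗-zeroˡ y
    zeroʳ : ∀ r {x y} → y ≈ᴹ 0ᴹ → term r x y ≈ₜ 0ₜ
    zeroʳ r {x} h = ⊗-cong {v = r *ₗ x} ≈ᴹ-refl h ▸ _⟶_.0ᴹ-homo (insertˡ {space} {space} (r *ₗ x))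
    idʳ : ∀ {x z y : Tensor space space} → x ≈ₜ z → y ≈ₜ 0ₜ → x +ₜ y ≈ₜ z
    idʳ h k = +-cong h k ▸ T.+ᴹ-identityʳ _
    idˡ : ∀ {x y z : Tensor space space} → x ≈ₜ 0ₜ → y ≈ₜ z → x +ₜ y ≈ₜ z
    idˡ h k = +-cong h k ▸ +-idˡ _
    pick : ∀ p q → ⟦ part p ⟧ v ≈ᴹ v → ⟦ part q ⟧ w ≈ᴹ w →
      ⟦ τ ⟧ (v ⊗ₑ w) ≈[ space ⊗ space ] _·ₜ_ {space} {space} (sgn (p ℙ.* q)) (w ⊗ₑ v)
    pick 0ℙ 0ℙ hv hw = idʳ (idʳ (idʳ (keep (sgn (0ℙ ℙ.* 0ℙ)) hw hv)
        (zeroˡ (sgn (0ℙ ℙ.* 1ℙ)) (vanish 0ℙ hw)))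
        (zeroʳ (sgn (1ℙ ℙ.* 0ℙ)) (vanish 0ℙ hv)))
        (zeroʳ (sgn (1ℙ ℙ.* 1ℙ)) (vanish 0ℙ hv))
    pick 0ℙ 1ℙ hv hw = idʳ (idʳ (idˡ (zeroˡ (sgn (0ℙ ℙ.* 0ℙ)) (vanish 1ℙ hw))
        (keep (sgn (0ℙ ℙ.* 1ℙ)) hw hv))
        (zeroʳ (sgn (1ℙ ℙ.* 0ℙ)) (vanish 0ℙ hv)))
        (zeroʳ (sgn (1ℙ ℙ.* 1ℙ)) (vanish 0ℙ hv))
    pick 1ℙ 0ℙ hv hw = idʳ (idˡ (idʳ (zeroʳ (sgn (0ℙ ℙ.* 0ℙ)) (vanish 1ℙ hv)) (zeroʳ (sgn (0ℙ ℙ.* 1ℙ)) (vanish 1ℙ hv)))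
        (keep (sgn (1ℙ ℙ.* 0ℙ)) hw hv))
        (zeroˡ (sgn (1ℙ ℙ.* 1ℙ)) (vanish 0ℙ hw))
    pick 1ℙ 1ℙ hv hw = idˡ (idʳ (idʳ (zeroʳ (sgn (0ℙ ℙ.* 0ℙ)) (vanish 1ℙ hv)) (zeroʳ (sgn (0ℙ ℙ.* 1ℙ)) (vanish 1ℙ hv))) (zeroˡ (sgn (1ℙ ℙ.* 0ℙ)) (vanish 1ℙ hw)))
        (keep (sgn (1ℙ ℙ.* 1ℙ)) hw hv)

------------------------------------------------------------------------
-- Hopf algebras, cocommutativity and self-duality, with super signs

module HopfStructure (A : SuperSpace)
  (mult : SuperSpace.space A ⊗ SuperSpace.space A ⟶ SuperSpace.space A)
  (u : ℚ-space ⟶ SuperSpace.space A)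
  (Δ : SuperSpace.space A ⟶ SuperSpace.space A ⊗ SuperSpace.space A)
  (ε : SuperSpace.space A ⟶ ℚ-space)
  where
  open SuperSpace A using (space)
  open LeftModule space using (_≈ᴹ_; 0ᴹ)
  open Super A

  infixl 8 _∙_ _∙₂_
  _∙_ : ∣ space ∣ → ∣ space ∣ → ∣ space ∣
  x ∙ y = ⟦ mult ⟧ (x ⊗ₑ y)

  𝟏 : ∣ space ∣
  𝟏 = ⟦ u ⟧ 1ℚ

  _∙₂_ : ∣ space ⊗ space ∣ → ∣ space ⊗ space ∣ → ∣ space ⊗ space ∣
  x ∙₂ y = ⟦ (mult ⊗₁ mult) ∘ₗ τ-middle ⟧ (x ⊗ₑ y)

  record IsHopfAlgebra : Set where
    field
      ∙-assoc     : ∀ x y z → (x ∙ y) ∙ z ≈ᴹ x ∙ (y ∙ z)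
      ∙-identityˡ : ∀ x → 𝟏 ∙ x ≈ᴹ x
      ∙-identityʳ : ∀ x → x ∙ 𝟏 ≈ᴹ x

      coassoc     : assocʳ ∘ₗ (Δ ⊗₁ idₗ) ∘ₗ Δ ≐ (idₗ ⊗₁ Δ) ∘ₗ Δ
      counitˡ     : unitorˡ ∘ₗ (ε ⊗₁ idₗ) ∘ₗ Δ ≐ idₗ
      counitʳ     : unitorʳ ∘ₗ (idₗ ⊗₁ ε) ∘ₗ Δ ≐ idₗ

      Δ-∙         : ∀ x y → ⟦ Δ ⟧ (x ∙ y) ≈[ space ⊗ space ] ⟦ Δ ⟧ x ∙₂ ⟦ Δ ⟧ y
      Δ-𝟏         : ⟦ Δ ⟧ 𝟏 ≈[ space ⊗ space ] 𝟏 ⊗ₑ 𝟏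
      ε-∙         : ∀ x y → ⟦ ε ⟧ (x ∙ y) ≡ ⟦ ε ⟧ x * ⟦ ε ⟧ y
      ε-𝟏         : ⟦ ε ⟧ 𝟏 ≡ 1ℚ

      S           : space ⟶ space
      antipodeˡ   : mult ∘ₗ (S ⊗₁ idₗ) ∘ₗ Δ ≐ u ∘ₗ ε
      antipodeʳ   : mult ∘ₗ (idₗ ⊗₁ S) ∘ₗ Δ ≐ u ∘ₗ ε

  Cocommutative : Set
  Cocommutative = τ ∘ₗ Δ ≐ Δ

  record SelfDual (H : IsHopfAlgebra) : Set where
    open IsHopfAlgebra H using (S)
    field
      pairing : space ⊗ space ⟶ ℚ-space

    pairing₂ : (space ⊗ space) ⊗ (space ⊗ space) ⟶ ℚ-space
    pairing₂ = unitorˡ ∘ₗ (pairing ⊗₁ pairing) ∘ₗ τ-middle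

    ⟨_,_⟩ : ∣ space ∣ → ∣ space ∣ → ℚ
    ⟨ f , a ⟩ = ⟦ pairing ⟧ (f ⊗ₑ a)

    ⟨_,_⟩₂ : ∣ space ⊗ space ∣ → ∣ space ⊗ space ∣ → ℚ
    ⟨ x , y ⟩₂ = ⟦ pairing₂ ⟧ (x ⊗ₑ y)

    field
      nondegenerateˡ : ∀ f → (∀ a → ⟨ f , a ⟩ ≡ 0ℚ) → f ≈ᴹ 0ᴹ
      nondegenerateʳ : ∀ a → (∀ f → ⟨ f , a ⟩ ≡ 0ℚ) → a ≈ᴹ 0ᴹ
      ∙-Δ : ∀ f g a → ⟨ f ∙ g , a ⟩ ≡ ⟨ f ⊗ₑ g , ⟦ Δ ⟧ a ⟩₂
      Δ-∙ : ∀ f a b → ⟨ f , a ∙ b ⟩ ≡ ⟨ ⟦ Δ ⟧ f , a ⊗ₑ b ⟩₂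
      𝟏-ε : ∀ a → ⟨ 𝟏 , a ⟩ ≡ ⟦ ε ⟧ a
      ε-𝟏 : ∀ f → ⟨ f , 𝟏 ⟩ ≡ ⟦ ε ⟧ f
      S-S : ∀ f a → ⟨ ⟦ S ⟧ f , a ⟩ ≡ ⟨ f , ⟦ S ⟧ a ⟩

------------------------------------------------------------------------
-- Monomials in x₁, x₂, … and θ₁, θ₂, …

-- (a₁ , b₁) ∷ … ∷ (aₙ , bₙ) ∷ [] is x₁^a₁ θ₁^b₁ ⋯ xₙ^aₙ θₙ^bₙ, where θᵢ occurs
-- iff bᵢ is true.  Appending (0 , false) does not change the monomial.
Factor : Set
Factor = ℕ × Bool

Monomial : Set
Monomial = List Factor

fdeg₁ : Factor → ℕ
fdeg₁ (a , b) = if b then 1 else 0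

deg₁ : Factor → ℕ
deg₁ u = proj₁ u ℕ.+ fdeg₁ u

fermionicDegree : Monomial → ℕ
fermionicDegree []      = 0
fermionicDegree (u ∷ m) = fdeg₁ u ℕ.+ fermionicDegree m

-- Degree in the x's plus fermionic degree.
degree : Monomial → ℕ
degree []      = 0
degree (u ∷ m) = deg₁ u ℕ.+ degree m

∣_∣₁ : Factor → Parity
∣ u ∣₁ = parity (fdeg₁ u)

∣_∣ₘ : Monomial → Parity
∣ m ∣ₘ = parity (fermionicDegree m)

-- Parity of the number of transpositions of θ's made by a rearrangement.
inversions : ∀ {m n : Monomial} → m ↭ n → Parity
inversions refl         = 0ℙ
inversions (prep u π)   = inversions π
inversions (swap u v π) = ∣ u ∣₁ ℙ.* ∣ v ∣₁ ℙ.+ inversions π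
inversions (trans π ρ)  = inversions π ℙ.+ inversions ρ

-- A family c of coefficients stands for the formal power series Σ_m c(m) m.
-- A permutation of the pairs (xᵢ , θᵢ) permutes the factors of each monomial, and
-- putting the θ's back in increasing order produces the sign.
record IsSymmetricFunction (c : Monomial → ℚ) : Set where
  field
    stable    : ∀ m → c (m ∷ʳ (0 , false)) ≡ c m
    symmetric : ∀ {m n} (π : m ↭ n) → c m ≡ sgn (inversions π) * c n
    bounded   : ∃ λ N → ∀ m → N ℕ.< degree m → c m ≡ 0ℚ

record SymmetricFunction : Set where
  constructor mkSymmetricFunction
  field
    coeff : Monomial → ℚ
    isSymmetricFunction : IsSymmetricFunction coeff
  open IsSymmetricFunction isSymmetricFunction public

open SymmetricFunction public using (coeff)

Homogeneous : ℕ → SymmetricFunction → Set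
Homogeneous d f = ∀ m → coeff f m ≡ 0ℚ ⊎ fermionicDegree m ≡ d

isSF : (f : SymmetricFunction) → IsSymmetricFunction (coeff f)
isSF = SymmetricFunction.isSymmetricFunction

parity-suc : ∀ n → parity (suc n) ≡ parity n ℙ.⁻¹
parity-suc zero          = ≡.refl
parity-suc (suc zero)    = ≡.refl
parity-suc (suc (suc n)) = parity-suc n

∣∣-∷ : ∀ u m → ∣ u ∷ m ∣ₘ ≡ ∣ u ∣₁ ℙ.+ ∣ m ∣ₘ
∣∣-∷ (a , false) m = ≡.refl
∣∣-∷ (a , true)  m = parity-suc (fermionicDegree m)

swap-+ : ∀ a b c → a ℕ.+ (b ℕ.+ c) ≡ b ℕ.+ (a ℕ.+ c)
swap-+ a b c = ≡.trans (sym (ℕₚ.+-assoc a b c))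
  (≡.trans (cong (ℕ._+ c) (ℕₚ.+-comm a b)) (ℕₚ.+-assoc b a c))

fdeg-↭ : ∀ {m n} → m ↭ n → fermionicDegree m ≡ fermionicDegree n
fdeg-↭ refl         = ≡.refl
fdeg-↭ (prep u π)   = cong (fdeg₁ u ℕ.+_) (fdeg-↭ π)
fdeg-↭ (swap u v π) = ≡.trans (swap-+ (fdeg₁ u) (fdeg₁ v) _)
  (cong (λ k → fdeg₁ v ℕ.+ (fdeg₁ u ℕ.+ k)) (fdeg-↭ π))
fdeg-↭ (trans π ρ)  = ≡.trans (fdeg-↭ π) (fdeg-↭ ρ)

deg-↭ : ∀ {m n} → m ↭ n → degree m ≡ degree n
deg-↭ refl         = ≡.refl
deg-↭ (prep u π)   = cong (deg₁ u ℕ.+_) (deg-↭ π)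
deg-↭ (swap u v π) = ≡.trans (swap-+ (deg₁ u) (deg₁ v) _)
  (cong (λ k → deg₁ v ℕ.+ (deg₁ u ℕ.+ k)) (deg-↭ π))
deg-↭ (trans π ρ)  = ≡.trans (deg-↭ π) (deg-↭ ρ)

fdeg-∷ʳ : ∀ m → fermionicDegree (m ∷ʳ (0 , false)) ≡ fermionicDegree m
fdeg-∷ʳ []      = ≡.refl
fdeg-∷ʳ (u ∷ m) = cong (fdeg₁ u ℕ.+_) (fdeg-∷ʳ m)

deg-∷ʳ : ∀ m → degree (m ∷ʳ (0 , false)) ≡ degree m
deg-∷ʳ []      = ≡.refl
deg-∷ʳ (u ∷ m) = cong (deg₁ u ℕ.+_) (deg-∷ʳ m)

∣∣-↭ : ∀ {m n} → m ↭ n → ∣ m ∣ₘ ≡ ∣ n ∣ₘ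
∣∣-↭ π = cong parity (fdeg-↭ π)

∣∣-∷ʳ : ∀ m → ∣ m ∷ʳ (0 , false) ∣ₘ ≡ ∣ m ∣ₘ
∣∣-∷ʳ m = cong parity (fdeg-∷ʳ m)

deg-zero-inversions : ∀ {m n} (π : m ↭ n) → degree m ≡ 0 → inversions π ≡ 0ℙ
deg-zero-inversions refl d = ≡.refl
deg-zero-inversions (prep u π) d = deg-zero-inversions π (ℕₚ.m+n≡0⇒n≡0 (deg₁ u) d)
deg-zero-inversions (swap (a , true) v π) d =
  contradiction (ℕₚ.m+n≡0⇒n≡0 a (ℕₚ.m+n≡0⇒m≡0 (a ℕ.+ 1) d)) λ ()
deg-zero-inversions (swap (a , false) v π) d =
  deg-zero-inversions π (ℕₚ.m+n≡0⇒n≡0 (deg₁ v) (ℕₚ.m+n≡0⇒n≡0 (a ℕ.+ 0) d))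
deg-zero-inversions (trans π ρ) d = cong₂ ℙ._+_ (deg-zero-inversions π d)
  (deg-zero-inversions ρ (≡.trans (sym (deg-↭ π)) d))

sgn-+ : ∀ p q → sgn (p ℙ.+ q) ≡ sgn p * sgn q
sgn-+ 0ℙ q  = sym (ℚₚ.*-identityˡ (sgn q))
sgn-+ 1ℙ 0ℙ = ≡.refl
sgn-+ 1ℙ 1ℙ = ≡.refl

*-swap : ∀ a b c → a * (b * c) ≡ b * (a * c)
*-swap = solve 3 (λ a b c → a :* (b :* c) := b :* (a :* c)) ≡.refl
  where open +-*-Solver

------------------------------------------------------------------------
-- The vector space Λ, its unit and counit

Λ-space : Space
Λ-space = mkSpace SymmetricFunction (λ f g → ∀ m → coeff f m ≡ coeff g m) add scale zeroF
  (record { refl = λ _ → ≡.refl ; sym = λ p m → sym (p m) ; trans = λ p q m → ≡.trans (p m) (q m) })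
  (λ p q m → cong₂ _+_ (p m) (q m))
  (λ f g h m → ℚₚ.+-assoc (coeff f m) (coeff g m) (coeff h m))
  (λ f g m → ℚₚ.+-comm (coeff f m) (coeff g m))
  (λ f m → ℚₚ.+-identityˡ (coeff f m))
  (λ r p m → cong (r *_) (p m))
  (λ r s f m → ℚₚ.*-distribʳ-+ (coeff f m) r s)
  (λ r s f m → ℚₚ.*-assoc r s (coeff f m))
  (λ r f g m → ℚₚ.*-distribˡ-+ r (coeff f m) (coeff g m))
  (λ f m → ℚₚ.*-identityˡ (coeff f m))
  (λ f m → ℚₚ.*-zeroˡ (coeff f m))
  where
  open IsSymmetricFunction
  add : SymmetricFunction → SymmetricFunction → SymmetricFunction
  add f g = mkSymmetricFunction (λ m → coeff f m + coeff g m) record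
    { stable = λ m → cong₂ _+_ (stable (isSF f) m) (stable (isSF g) m)
    ; symmetric = λ {m} {n} π → ≡.trans (cong₂ _+_ (symmetric (isSF f) π) (symmetric (isSF g) π))
        (sym (ℚₚ.*-distribˡ-+ (sgn (inversions π)) (coeff f n) (coeff g n)))
    ; bounded = proj₁ (bounded (isSF f)) ℕ.+ proj₁ (bounded (isSF g)) , λ m N< → cong₂ _+_
        (proj₂ (bounded (isSF f)) m (ℕₚ.≤-<-trans (ℕₚ.m≤m+n _ _) N<))
        (proj₂ (bounded (isSF g)) m (ℕₚ.≤-<-trans (ℕₚ.m≤n+m _ (proj₁ (bounded (isSF f)))) N<))
    }
  scale : ℚ → SymmetricFunction → SymmetricFunction
  scale r f = mkSymmetricFunction (λ m → r * coeff f m) record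
    { stable = λ m → cong (r *_) (stable (isSF f) m)
    ; symmetric = λ {m} {n} π → ≡.trans (cong (r *_) (symmetric (isSF f) π))
        (*-swap r (sgn (inversions π)) (coeff f n))
    ; bounded = proj₁ (bounded (isSF f)) , λ m N< →
        ≡.trans (cong (r *_) (proj₂ (bounded (isSF f)) m N<)) (ℚₚ.*-zeroʳ r)
    }
  zeroF : SymmetricFunction
  zeroF = mkSymmetricFunction (λ _ → 0ℚ) record
    { stable = λ _ → ≡.refl
    ; symmetric = λ π → sym (ℚₚ.*-zeroʳ (sgn (inversions π)))
    ; bounded = 0 , λ _ _ → ≡.refl
    }

δ : Parity → Parity → ℚ
δ 0ℙ 0ℙ = 1ℚ
δ 0ℙ 1ℙ = 0ℚ
δ 1ℙ 0ℙ = 0ℚ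
δ 1ℙ 1ℙ = 1ℚ

-- The terms of f whose fermionic degree has parity p.
parityPart : Parity → SymmetricFunction → SymmetricFunction
parityPart p f = mkSymmetricFunction (λ m → δ p ∣ m ∣ₘ * coeff f m) record
  { stable = λ m → cong₂ _*_ (cong (δ p) (∣∣-∷ʳ m)) (stable (isSF f) m)
  ; symmetric = λ {m} {n} π → ≡.trans (cong₂ _*_ (cong (δ p) (∣∣-↭ π)) (symmetric (isSF f) π))
      (*-swap (δ p ∣ n ∣ₘ) (sgn (inversions π)) (coeff f n))
  ; bounded = proj₁ (bounded (isSF f)) , λ m N< →
      ≡.trans (cong (δ p ∣ m ∣ₘ *_) (proj₂ (bounded (isSF f)) m N<)) (ℚₚ.*-zeroʳ (δ p ∣ m ∣ₘ))
  }
  where open IsSymmetricFunction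

Λ : SuperSpace
Λ = record
  { space = Λ-space
  ; part = λ p → mkLinear (parityPart p)
      (λ f≈ m → cong (δ p ∣ m ∣ₘ *_) (f≈ m))
      (λ f g m → ℚₚ.*-distribˡ-+ (δ p ∣ m ∣ₘ) (coeff f m) (coeff g m))
      (λ r f m → *-swap (δ p ∣ m ∣ₘ) r (coeff f m))
  ; part-idem = λ p f m → idem p ∣ m ∣ₘ (coeff f m)
  ; part-orth = λ p f m → orth p ∣ m ∣ₘ (coeff f m)
  ; part-sum = λ f m → total ∣ m ∣ₘ (coeff f m)
  }
  where
  idem : ∀ p q r → δ p q * (δ p q * r) ≡ δ p q * r
  idem 0ℙ 0ℙ r = ℚₚ.*-identityˡ (1ℚ * r)
  idem 0ℙ 1ℙ r = ≡.trans (ℚₚ.*-zeroˡ (0ℚ * r)) (sym (ℚₚ.*-zeroˡ r))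
  idem 1ℙ 0ℙ r = ≡.trans (ℚₚ.*-zeroˡ (0ℚ * r)) (sym (ℚₚ.*-zeroˡ r))
  idem 1ℙ 1ℙ r = ℚₚ.*-identityˡ (1ℚ * r)
  orth : ∀ p q r → δ (p ℙ.⁻¹) q * (δ p q * r) ≡ 0ℚ
  orth 0ℙ 0ℙ r = ℚₚ.*-zeroˡ (1ℚ * r)
  orth 0ℙ 1ℙ r = ≡.trans (cong (1ℚ *_) (ℚₚ.*-zeroˡ r)) (ℚₚ.*-zeroʳ 1ℚ)
  orth 1ℙ 0ℙ r = ≡.trans (cong (1ℚ *_) (ℚₚ.*-zeroˡ r)) (ℚₚ.*-zeroʳ 1ℚ)
  orth 1ℙ 1ℙ r = ℚₚ.*-zeroˡ (1ℚ * r)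
  total : ∀ q r → δ 0ℙ q * r + δ 1ℙ q * r ≡ r
  total 0ℙ r = ≡.trans (cong₂ _+_ (ℚₚ.*-identityˡ r) (ℚₚ.*-zeroˡ r)) (ℚₚ.+-identityʳ r)
  total 1ℙ r = ≡.trans (cong₂ _+_ (ℚₚ.*-zeroˡ r) (ℚₚ.*-identityˡ r)) (ℚₚ.+-identityˡ r)

part-homogeneous : ∀ d f → Homogeneous d f → ⟦ SuperSpace.part Λ (parity d) ⟧ f ≈[ Λ-space ] f
part-homogeneous d f h m with h m
... | inj₁ f≡0 rewrite f≡0 = ℚₚ.*-zeroʳ (δ (parity d) ∣ m ∣ₘ)
... | inj₂ ≡.refl = ≡.trans (cong (_* coeff f m) (δ-refl ∣ m ∣ₘ)) (ℚₚ.*-identityˡ (coeff f m))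
  where
  δ-refl : ∀ p → δ p p ≡ 1ℚ
  δ-refl 0ℙ = ≡.refl
  δ-refl 1ℙ = ≡.refl

Λ-counit : Λ-space ⟶ ℚ-space
Λ-counit = mkLinear (λ f → coeff f []) (λ f≈ → f≈ []) (λ _ _ → ≡.refl) (λ _ _ → ≡.refl)

isZero : ℕ → ℚ
isZero zero    = 1ℚ
isZero (suc _) = 0ℚ

-- The constant power series r.
constant : ℚ → SymmetricFunction
constant r = mkSymmetricFunction (λ m → r * isZero (degree m)) record
  { stable = λ m → cong (λ d → r * isZero d) (deg-∷ʳ m)
  ; symmetric = λ {m} {n} π → ≡.trans (cong (r *_) (sign π (degree m) ≡.refl))
      (*-swap r (sgn (inversions π)) (isZero (degree n)))
  ; bounded = 0 , λ m 0< → ≡.trans (cong (r *_) (positive 0<)) (ℚₚ.*-zeroʳ r)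
  }
  where
  sign : ∀ {m n} (π : m ↭ n) d → degree m ≡ d →
    isZero (degree m) ≡ sgn (inversions π) * isZero (degree n)
  sign π zero    d rewrite sym (deg-↭ π) | d | deg-zero-inversions π d = ≡.refl
  sign π (suc _) d rewrite sym (deg-↭ π) | d = sym (ℚₚ.*-zeroʳ (sgn (inversions π)))
  positive : ∀ {d} → 0 ℕ.< d → isZero d ≡ 0ℚ
  positive (ℕ.s≤s _) = ≡.refl

Λ-unit : ℚ-space ⟶ Λ-space
Λ-unit = mkLinear constant
  (λ r≡ m → cong (_* isZero (degree m)) r≡)
  (λ r s m → ℚₚ.*-distribʳ-+ (isZero (degree m)) r s)
  (λ r s m → ℚₚ.*-assoc r s (isZero (degree m)))

------------------------------------------------------------------------
-- Products of power series

sumOver : ∀ {X : Set} → List X → (X → ℚ) → ℚ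
sumOver xs h = foldr (λ x s → h x + s) 0ℚ xs

splitsℕ : ℕ → List (ℕ × ℕ)
splitsℕ zero    = (0 , 0) ∷ []
splitsℕ (suc a) = (0 , suc a) ∷ map (λ ij → suc (proj₁ ij) , proj₂ ij) (splitsℕ a)

splitsθ : Bool → List (Bool × Bool)
splitsθ false = (false , false) ∷ []
splitsθ true  = (true , false) ∷ (false , true) ∷ []

-- All (v , w) with v w = u.
splits : Factor → List (Factor × Factor)
splits (a , b) = cartesianProductWith
  (λ ij cd → (proj₁ ij , proj₁ cd) , (proj₂ ij , proj₂ cd)) (splitsℕ a) (splitsθ b)

-- ∑⟨ m ⟩ F is the sum of ± F m₁ m₂ over the pairs of monomials with m₁ m₂ = ± m.
-- The sign in the second clause comes from (v m₁)(w m₂) = (-1)^{|m₁||w|} (v w)(m₁ m₂).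
∑⟨_⟩ : Monomial → (Monomial → Monomial → ℚ) → ℚ
∑⟨ [] ⟩    F = F [] []
∑⟨ u ∷ m ⟩ F = sumOver (splits u) λ vw → ∑⟨ m ⟩ λ m₁ m₂ →
  sgn (∣ m₁ ∣ₘ ℙ.* ∣ proj₂ vw ∣₁) * F (proj₁ vw ∷ m₁) (proj₂ vw ∷ m₂)

extendBy : (Monomial → Monomial → ℚ) → Factor × Factor → Monomial → Monomial → ℚ
extendBy F vw m₁ m₂ =
  sgn (∣ m₁ ∣ₘ ℙ.* ∣ proj₂ vw ∣₁) * F (proj₁ vw ∷ m₁) (proj₂ vw ∷ m₂)

sum-cong : ∀ {X : Set} (xs : List X) {h k : X → ℚ} → (∀ x → x ∈ xs → h x ≡ k x) →
  sumOver xs h ≡ sumOver xs k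
sum-cong []       p = ≡.refl
sum-cong (x ∷ xs) p = cong₂ _+_ (p x (here ≡.refl)) (sum-cong xs λ y y∈ → p y (there y∈))

sum-zero : ∀ {X : Set} (xs : List X) → sumOver xs (λ _ → 0ℚ) ≡ 0ℚ
sum-zero []       = ≡.refl
sum-zero (x ∷ xs) = ≡.trans (ℚₚ.+-identityˡ (sumOver xs (λ _ → 0ℚ))) (sum-zero xs)

+-interchangeℚ : ∀ a b c d → (a + b) + (c + d) ≡ (a + c) + (b + d)
+-interchangeℚ = solve 4 (λ a b c d → (a :+ b) :+ (c :+ d) := (a :+ c) :+ (b :+ d)) ≡.refl
  where open +-*-Solver

sum-+ : ∀ {X : Set} (xs : List X) (h k : X → ℚ) →
  sumOver xs (λ x → h x + k x) ≡ sumOver xs h + sumOver xs k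
sum-+ []       h k = ≡.refl
sum-+ (x ∷ xs) h k = ≡.trans (cong (h x + k x +_) (sum-+ xs h k)) (+-interchangeℚ (h x) (k x) (sumOver xs h) (sumOver xs k))

sum-* : ∀ {X : Set} (xs : List X) r (h : X → ℚ) →
  sumOver xs (λ x → r * h x) ≡ r * sumOver xs h
sum-* []       r h = sym (ℚₚ.*-zeroʳ r)
sum-* (x ∷ xs) r h = ≡.trans (cong (r * h x +_) (sum-* xs r h)) (sym (ℚₚ.*-distribˡ-+ r (h x) (sumOver xs h)))

sum-swap : ∀ {X Y : Set} (xs : List X) (ys : List Y) (h : X → Y → ℚ) →
  sumOver xs (λ x → sumOver ys (h x)) ≡ sumOver ys (λ y → sumOver xs (λ x → h x y))
sum-swap []       ys h = sym (sum-zero ys)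
sum-swap (x ∷ xs) ys h = ≡.trans (cong (sumOver ys (h x) +_) (sum-swap xs ys h))
  (sym (sum-+ ys (h x) (λ y → sumOver xs (λ x → h x y))))

splitsℕ-sum : ∀ a {ij} → ij ∈ splitsℕ a → proj₁ ij ℕ.+ proj₂ ij ≡ a
splitsℕ-sum zero    (here ≡.refl) = ≡.refl
splitsℕ-sum (suc a) (here ≡.refl) = ≡.refl
splitsℕ-sum (suc a) (there ij∈) with ∈-map⁻ _ ij∈
... | kl , kl∈ , ≡.refl = cong suc (splitsℕ-sum a kl∈)

splitsθ-sum : ∀ b {cd} → cd ∈ splitsθ b →
  fdeg₁ (0 , proj₁ cd) ℕ.+ fdeg₁ (0 , proj₂ cd) ≡ fdeg₁ (0 , b)
splitsθ-sum false (here ≡.refl)         = ≡.refl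
splitsθ-sum true  (here ≡.refl)         = ≡.refl
splitsθ-sum true  (there (here ≡.refl)) = ≡.refl

+-interchangeℕ : ∀ a b c d → (a ℕ.+ b) ℕ.+ (c ℕ.+ d) ≡ (a ℕ.+ c) ℕ.+ (b ℕ.+ d)
+-interchangeℕ a b c d = ≡.trans (ℕₚ.+-assoc a b (c ℕ.+ d))
  (≡.trans (cong (a ℕ.+_) (swap-+ b c d)) (sym (ℕₚ.+-assoc a c (b ℕ.+ d))))

splits-fdeg : ∀ u {vw} → vw ∈ splits u → fdeg₁ (proj₁ vw) ℕ.+ fdeg₁ (proj₂ vw) ≡ fdeg₁ u
splits-fdeg (a , b) vw∈ with ∈-cartesianProductWith⁻ _ (splitsℕ a) (splitsθ b) vw∈
... | ij , cd , ij∈ , cd∈ , ≡.refl = splitsθ-sum b cd∈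

splits-deg : ∀ u {vw} → vw ∈ splits u → deg₁ (proj₁ vw) ℕ.+ deg₁ (proj₂ vw) ≡ deg₁ u
splits-deg (a , b) vw∈ with ∈-cartesianProductWith⁻ _ (splitsℕ a) (splitsθ b) vw∈
... | ij , cd , ij∈ , cd∈ , ≡.refl = ≡.trans (+-interchangeℕ (proj₁ ij) _ (proj₂ ij) _)
  (cong₂ ℕ._+_ (splitsℕ-sum a ij∈) (splitsθ-sum b cd∈))

parity-+ : ∀ m n → parity (m ℕ.+ n) ≡ parity m ℙ.+ parity n
parity-+ zero          n = ≡.refl
parity-+ (suc zero)    n = parity-suc n
parity-+ (suc (suc m)) n = parity-+ m n

splits-parity : ∀ u {vw} → vw ∈ splits u → ∣ u ∣₁ ≡ ∣ proj₁ vw ∣₁ ℙ.+ ∣ proj₂ vw ∣₁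
splits-parity u {vw} vw∈ = ≡.trans (cong parity (sym (splits-fdeg u vw∈)))
  (parity-+ (fdeg₁ (proj₁ vw)) _)

∑-cong : ∀ m {F G} → (∀ m₁ m₂ → degree m₁ ℕ.+ degree m₂ ≡ degree m → F m₁ m₂ ≡ G m₁ m₂) →
  ∑⟨ m ⟩ F ≡ ∑⟨ m ⟩ G
∑-cong []      p = p [] [] ≡.refl
∑-cong (u ∷ m) p = sum-cong (splits u) λ vw vw∈ → ∑-cong m λ m₁ m₂ d →
  cong (sgn (∣ m₁ ∣ₘ ℙ.* ∣ proj₂ vw ∣₁) *_) (p _ _
    (≡.trans (+-interchangeℕ (deg₁ (proj₁ vw)) (degree m₁) (deg₁ (proj₂ vw)) (degree m₂))
      (cong₂ ℕ._+_ (splits-deg u vw∈) d)))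

∑-ext : ∀ m {F G} → (∀ m₁ m₂ → F m₁ m₂ ≡ G m₁ m₂) → ∑⟨ m ⟩ F ≡ ∑⟨ m ⟩ G
∑-ext m p = ∑-cong m λ m₁ m₂ _ → p m₁ m₂

∑-zero : ∀ m → ∑⟨ m ⟩ (λ _ _ → 0ℚ) ≡ 0ℚ
∑-zero []      = ≡.refl
∑-zero (u ∷ m) = ≡.trans
  (sum-cong (splits u) λ vw _ → ≡.trans
    (∑-ext m λ m₁ m₂ → ℚₚ.*-zeroʳ (sgn (∣ m₁ ∣ₘ ℙ.* ∣ proj₂ vw ∣₁))) (∑-zero m))
  (sum-zero (splits u))

∑-+ : ∀ m F G → ∑⟨ m ⟩ (λ m₁ m₂ → F m₁ m₂ + G m₁ m₂) ≡ ∑⟨ m ⟩ F + ∑⟨ m ⟩ G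
∑-+ []      F G = ≡.refl
∑-+ (u ∷ m) F G = ≡.trans
  (sum-cong (splits u) λ vw _ → ≡.trans
    (∑-ext m λ m₁ m₂ → ℚₚ.*-distribˡ-+ (sgn (∣ m₁ ∣ₘ ℙ.* ∣ proj₂ vw ∣₁))
      (F (proj₁ vw ∷ m₁) (proj₂ vw ∷ m₂)) (G (proj₁ vw ∷ m₁) (proj₂ vw ∷ m₂)))
    (∑-+ m (extendBy F vw) (extendBy G vw)))
  (sum-+ (splits u) (λ vw → ∑⟨ m ⟩ (extendBy F vw)) (λ vw → ∑⟨ m ⟩ (extendBy G vw)))

∑-* : ∀ m r F → ∑⟨ m ⟩ (λ m₁ m₂ → r * F m₁ m₂) ≡ r * ∑⟨ m ⟩ F
∑-* []      r F = ≡.refl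
∑-* (u ∷ m) r F = ≡.trans
  (sum-cong (splits u) λ vw _ → ≡.trans
    (∑-ext m λ m₁ m₂ → *-swap (sgn (∣ m₁ ∣ₘ ℙ.* ∣ proj₂ vw ∣₁)) r
      (F (proj₁ vw ∷ m₁) (proj₂ vw ∷ m₂)))
    (∑-* m r (extendBy F vw)))
  (sum-* (splits u) r (λ vw → ∑⟨ m ⟩ (extendBy F vw)))

∑-stable : ∀ m F → (∀ m₁ m₂ → F (m₁ ∷ʳ (0 , false)) (m₂ ∷ʳ (0 , false)) ≡ F m₁ m₂) →
  ∑⟨ m ∷ʳ (0 , false) ⟩ F ≡ ∑⟨ m ⟩ F
∑-stable []      F p = ≡.trans (ℚₚ.+-identityʳ (1ℚ * last)) (≡.trans (ℚₚ.*-identityˡ last) (p [] []))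
  where last = F ((0 , false) ∷ []) ((0 , false) ∷ [])
∑-stable (u ∷ m) F p = sum-cong (splits u) λ vw _ → ∑-stable m (extendBy F vw) λ m₁ m₂ →
  cong₂ (λ k c → sgn (k ℙ.* ∣ proj₂ vw ∣₁) * c) (∣∣-∷ʳ m₁) (p (proj₁ vw ∷ m₁) (proj₂ vw ∷ m₂))

record BiSymmetric (F : Monomial → Monomial → ℚ) : Set where
  field
    left  : ∀ {m n} (π : m ↭ n) k → F m k ≡ sgn (inversions π) * F n k
    right : ∀ {m n} (π : m ↭ n) k → F k m ≡ sgn (inversions π) * F k n
open BiSymmetric

BiSymmetric-∷ : ∀ {F} vw → BiSymmetric F → BiSymmetric (extendBy F vw)
BiSymmetric-∷ {F} (v , w) S = record
  { left = λ {m} {n} π k → ≡.trans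
      (cong₂ (λ p c → sgn (p ℙ.* ∣ w ∣₁) * c) (∣∣-↭ π) (left S (prep v π) (w ∷ k)))
      (*-swap (sgn (∣ n ∣ₘ ℙ.* ∣ w ∣₁)) (sgn (inversions π)) (F (v ∷ n) (w ∷ k)))
  ; right = λ {m} {n} π k → ≡.trans
      (cong (sgn (∣ k ∣ₘ ℙ.* ∣ w ∣₁) *_) (right S (prep w π) (v ∷ k)))
      (*-swap (sgn (∣ k ∣ₘ ℙ.* ∣ w ∣₁)) (sgn (inversions π)) (F (v ∷ k) (w ∷ n)))
  }

swap-sign : ∀ v₁ w₁ v₂ w₂ μ →
  ((v₂ ℙ.+ μ) ℙ.* w₁) ℙ.+ (μ ℙ.* w₂) ℙ.+ (v₁ ℙ.* v₂) ℙ.+ (w₁ ℙ.* w₂)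
    ≡ ((v₁ ℙ.+ w₁) ℙ.* (v₂ ℙ.+ w₂)) ℙ.+ (((v₁ ℙ.+ μ) ℙ.* w₂) ℙ.+ (μ ℙ.* w₁))
swap-sign 0ℙ 0ℙ 0ℙ 0ℙ 0ℙ = ≡.refl
swap-sign 0ℙ 0ℙ 0ℙ 0ℙ 1ℙ = ≡.refl
swap-sign 0ℙ 0ℙ 0ℙ 1ℙ 0ℙ = ≡.refl
swap-sign 0ℙ 0ℙ 0ℙ 1ℙ 1ℙ = ≡.refl
swap-sign 0ℙ 0ℙ 1ℙ 0ℙ 0ℙ = ≡.refl
swap-sign 0ℙ 0ℙ 1ℙ 0ℙ 1ℙ = ≡.refl
swap-sign 0ℙ 0ℙ 1ℙ 1ℙ 0ℙ = ≡.refl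
swap-sign 0ℙ 0ℙ 1ℙ 1ℙ 1ℙ = ≡.refl
swap-sign 0ℙ 1ℙ 0ℙ 0ℙ 0ℙ = ≡.refl
swap-sign 0ℙ 1ℙ 0ℙ 0ℙ 1ℙ = ≡.refl
swap-sign 0ℙ 1ℙ 0ℙ 1ℙ 0ℙ = ≡.refl
swap-sign 0ℙ 1ℙ 0ℙ 1ℙ 1ℙ = ≡.refl
swap-sign 0ℙ 1ℙ 1ℙ 0ℙ 0ℙ = ≡.refl
swap-sign 0ℙ 1ℙ 1ℙ 0ℙ 1ℙ = ≡.refl
swap-sign 0ℙ 1ℙ 1ℙ 1ℙ 0ℙ = ≡.refl
swap-sign 0ℙ 1ℙ 1ℙ 1ℙ 1ℙ = ≡.refl
swap-sign 1ℙ 0ℙ 0ℙ 0ℙ 0ℙ = ≡.refl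
swap-sign 1ℙ 0ℙ 0ℙ 0ℙ 1ℙ = ≡.refl
swap-sign 1ℙ 0ℙ 0ℙ 1ℙ 0ℙ = ≡.refl
swap-sign 1ℙ 0ℙ 0ℙ 1ℙ 1ℙ = ≡.refl
swap-sign 1ℙ 0ℙ 1ℙ 0ℙ 0ℙ = ≡.refl
swap-sign 1ℙ 0ℙ 1ℙ 0ℙ 1ℙ = ≡.refl
swap-sign 1ℙ 0ℙ 1ℙ 1ℙ 0ℙ = ≡.refl
swap-sign 1ℙ 0ℙ 1ℙ 1ℙ 1ℙ = ≡.refl
swap-sign 1ℙ 1ℙ 0ℙ 0ℙ 0ℙ = ≡.refl
swap-sign 1ℙ 1ℙ 0ℙ 0ℙ 1ℙ = ≡.refl
swap-sign 1ℙ 1ℙ 0ℙ 1ℙ 0ℙ = ≡.refl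
swap-sign 1ℙ 1ℙ 0ℙ 1ℙ 1ℙ = ≡.refl
swap-sign 1ℙ 1ℙ 1ℙ 0ℙ 0ℙ = ≡.refl
swap-sign 1ℙ 1ℙ 1ℙ 0ℙ 1ℙ = ≡.refl
swap-sign 1ℙ 1ℙ 1ℙ 1ℙ 0ℙ = ≡.refl
swap-sign 1ℙ 1ℙ 1ℙ 1ℙ 1ℙ = ≡.refl

signs₄ : ∀ p q r s c →
  sgn p * (sgn q * (sgn r * (sgn s * c))) ≡ sgn (q ℙ.+ p ℙ.+ r ℙ.+ s) * c
signs₄ p q r s c rewrite sgn-+ (q ℙ.+ p ℙ.+ r) s | sgn-+ (q ℙ.+ p) r | sgn-+ q p =
  solve 5 (λ p q r s c → p :* (q :* (r :* (s :* c))) := (((q :* p) :* r) :* s) :* c) ≡.refl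
    (sgn p) (sgn q) (sgn r) (sgn s) c
  where open +-*-Solver

signs₃ : ∀ p q r c → sgn (p ℙ.+ (q ℙ.+ r)) * c ≡ sgn p * (sgn r * (sgn q * c))
signs₃ p q r c rewrite sgn-+ p (q ℙ.+ r) | sgn-+ q r =
  solve 4 (λ p q r c → (p :* (q :* r)) :* c := p :* (r :* (q :* c))) ≡.refl
    (sgn p) (sgn q) (sgn r) c
  where open +-*-Solver

signs₂ : ∀ p q c → sgn p * (sgn q * c) ≡ sgn (q ℙ.+ p) * c
signs₂ p q c rewrite sgn-+ q p =
  solve 3 (λ p q c → p :* (q :* c) := (q :* p) :* c) ≡.refl (sgn p) (sgn q) c
  where open +-*-Solver

∑-symmetric : ∀ {m n} (π : m ↭ n) {F} → BiSymmetric F →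
  ∑⟨ m ⟩ F ≡ sgn (inversions π) * ∑⟨ n ⟩ F
∑-symmetric {m} refl {F} S = sym (ℚₚ.*-identityˡ (∑⟨ m ⟩ F))
∑-symmetric {_} {_ ∷ n} (prep u π) {F} S = ≡.trans
  (sum-cong (splits u) λ vw _ → ∑-symmetric π (BiSymmetric-∷ vw S))
  (sum-* (splits u) (sgn (inversions π)) (λ vw → ∑⟨ n ⟩ (extendBy F vw)))
∑-symmetric {_} {n} (trans π ρ) {F} S = ≡.trans (∑-symmetric π S)
  (≡.trans (cong (sgn (inversions π) *_) (∑-symmetric ρ S))
    (≡.trans (sym (ℚₚ.*-assoc (sgn (inversions π)) (sgn (inversions ρ)) (∑⟨ n ⟩ F)))
      (cong (_* ∑⟨ n ⟩ F) (sym (sgn-+ (inversions π) (inversions ρ))))))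
∑-symmetric (swap {xs = m} {ys = n} u₁ u₂ π) {F} S = begin
  sumOver (splits u₁) (λ p → sumOver (splits u₂) λ q → ∑⟨ m ⟩ (A p q))
    ≡⟨ sum-cong (splits u₁) (λ p p∈ → sum-cong (splits u₂) λ q q∈ → inner p q p∈ q∈) ⟩
  sumOver (splits u₁) (λ p → sumOver (splits u₂) λ q → s * ∑⟨ n ⟩ (B p q))
    ≡⟨ sum-swap (splits u₁) (splits u₂) (λ p q → s * ∑⟨ n ⟩ (B p q)) ⟩
  sumOver (splits u₂) (λ q → sumOver (splits u₁) λ p → s * ∑⟨ n ⟩ (B p q))
    ≡⟨ sum-cong (splits u₂) (λ q _ → sum-* (splits u₁) s (λ p → ∑⟨ n ⟩ (B p q))) ⟩
  sumOver (splits u₂) (λ q → s * sumOver (splits u₁) λ p → ∑⟨ n ⟩ (B p q))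
    ≡⟨ sum-* (splits u₂) s (λ q → sumOver (splits u₁) λ p → ∑⟨ n ⟩ (B p q)) ⟩
  s * sumOver (splits u₂) (λ q → sumOver (splits u₁) λ p → ∑⟨ n ⟩ (B p q)) ∎
  where
  open ≡-Reasoning
  s₁₂ s : ℚ
  s₁₂ = sgn (∣ u₁ ∣₁ ℙ.* ∣ u₂ ∣₁)
  s = sgn (∣ u₁ ∣₁ ℙ.* ∣ u₂ ∣₁ ℙ.+ inversions π)
  A B : Factor × Factor → Factor × Factor → Monomial → Monomial → ℚ
  A p q = extendBy (extendBy F p) q
  B p q = extendBy (extendBy F q) p
  point : ∀ p q → p ∈ splits u₁ → q ∈ splits u₂ → ∀ m₁ m₂ →
    A p q m₁ m₂ ≡ s₁₂ * B p q m₁ m₂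
  point (v₁ , w₁) (v₂ , w₂) p∈ q∈ m₁ m₂ = begin
    sgn a * (sgn ∣v₂m₁w₁∣ * F (v₁ ∷ v₂ ∷ m₁) (w₁ ∷ w₂ ∷ m₂))
      ≡⟨ cong (λ x → sgn a * (sgn ∣v₂m₁w₁∣ * x)) (≡.trans
           (left S (swap v₁ v₂ (refl {xs = m₁})) (w₁ ∷ w₂ ∷ m₂))
           (cong₂ (λ k x → sgn k * x) (+0 ∣ v₁ ∣₁ ∣ v₂ ∣₁) (≡.trans
             (right S (swap w₁ w₂ (refl {xs = m₂})) (v₂ ∷ v₁ ∷ m₁))
             (cong (λ k → sgn k * c) (+0 ∣ w₁ ∣₁ ∣ w₂ ∣₁))))) ⟩
    sgn a * (sgn ∣v₂m₁w₁∣ * (sgn (∣ v₁ ∣₁ ℙ.* ∣ v₂ ∣₁) * (sgn (∣ w₁ ∣₁ ℙ.* ∣ w₂ ∣₁) * c)))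
      ≡⟨ cong (λ k → sgn a * (sgn (k ℙ.* ∣ w₁ ∣₁) * (sgn (∣ v₁ ∣₁ ℙ.* ∣ v₂ ∣₁) * (sgn (∣ w₁ ∣₁ ℙ.* ∣ w₂ ∣₁) * c))))
           (∣∣-∷ v₂ m₁) ⟩
    sgn a * (sgn ((∣ v₂ ∣₁ ℙ.+ ∣ m₁ ∣ₘ) ℙ.* ∣ w₁ ∣₁) * (sgn (∣ v₁ ∣₁ ℙ.* ∣ v₂ ∣₁) * (sgn (∣ w₁ ∣₁ ℙ.* ∣ w₂ ∣₁) * c)))
      ≡⟨ signs₄ a ((∣ v₂ ∣₁ ℙ.+ ∣ m₁ ∣ₘ) ℙ.* ∣ w₁ ∣₁) (∣ v₁ ∣₁ ℙ.* ∣ v₂ ∣₁) (∣ w₁ ∣₁ ℙ.* ∣ w₂ ∣₁) c ⟩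
    sgn (((∣ v₂ ∣₁ ℙ.+ ∣ m₁ ∣ₘ) ℙ.* ∣ w₁ ∣₁) ℙ.+ a ℙ.+ (∣ v₁ ∣₁ ℙ.* ∣ v₂ ∣₁) ℙ.+ (∣ w₁ ∣₁ ℙ.* ∣ w₂ ∣₁)) * c
      ≡⟨ cong (λ k → sgn k * c) (swap-sign ∣ v₁ ∣₁ ∣ w₁ ∣₁ ∣ v₂ ∣₁ ∣ w₂ ∣₁ ∣ m₁ ∣ₘ) ⟩
    sgn (((∣ v₁ ∣₁ ℙ.+ ∣ w₁ ∣₁) ℙ.* (∣ v₂ ∣₁ ℙ.+ ∣ w₂ ∣₁)) ℙ.+ (((∣ v₁ ∣₁ ℙ.+ ∣ m₁ ∣ₘ) ℙ.* ∣ w₂ ∣₁) ℙ.+ b)) * c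
      ≡⟨ signs₃ ((∣ v₁ ∣₁ ℙ.+ ∣ w₁ ∣₁) ℙ.* (∣ v₂ ∣₁ ℙ.+ ∣ w₂ ∣₁)) ((∣ v₁ ∣₁ ℙ.+ ∣ m₁ ∣ₘ) ℙ.* ∣ w₂ ∣₁) b c ⟩
    sgn ((∣ v₁ ∣₁ ℙ.+ ∣ w₁ ∣₁) ℙ.* (∣ v₂ ∣₁ ℙ.+ ∣ w₂ ∣₁)) * (sgn b * (sgn ((∣ v₁ ∣₁ ℙ.+ ∣ m₁ ∣ₘ) ℙ.* ∣ w₂ ∣₁) * c))
      ≡⟨ cong₂ (λ j k → sgn j * (sgn b * (sgn (k ℙ.* ∣ w₂ ∣₁) * c)))
           (sym (cong₂ ℙ._*_ (splits-parity u₁ p∈) (splits-parity u₂ q∈))) (sym (∣∣-∷ v₁ m₁)) ⟩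
    s₁₂ * (sgn b * (sgn (∣ v₁ ∷ m₁ ∣ₘ ℙ.* ∣ w₂ ∣₁) * c)) ∎
    where
    a b ∣v₂m₁w₁∣ : Parity
    a = ∣ m₁ ∣ₘ ℙ.* ∣ w₂ ∣₁
    b = ∣ m₁ ∣ₘ ℙ.* ∣ w₁ ∣₁
    ∣v₂m₁w₁∣ = ∣ v₂ ∷ m₁ ∣ₘ ℙ.* ∣ w₁ ∣₁
    c : ℚ
    c = F (v₂ ∷ v₁ ∷ m₁) (w₂ ∷ w₁ ∷ m₂)
    +0 : ∀ p q → p ℙ.* q ℙ.+ 0ℙ ≡ p ℙ.* q
    +0 p q = ℙₚ.+-identityʳ (p ℙ.* q)
  inner : ∀ p q → p ∈ splits u₁ → q ∈ splits u₂ → ∑⟨ m ⟩ (A p q) ≡ s * ∑⟨ n ⟩ (B p q)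
  inner p q p∈ q∈ = begin
    ∑⟨ m ⟩ (A p q)
      ≡⟨ ∑-symmetric π (BiSymmetric-∷ q (BiSymmetric-∷ p S)) ⟩
    sgn (inversions π) * ∑⟨ n ⟩ (A p q)
      ≡⟨ cong (sgn (inversions π) *_) (∑-ext n (point p q p∈ q∈)) ⟩
    sgn (inversions π) * ∑⟨ n ⟩ (λ m₁ m₂ → s₁₂ * B p q m₁ m₂)
      ≡⟨ cong (sgn (inversions π) *_) (∑-* n s₁₂ (B p q)) ⟩
    sgn (inversions π) * (s₁₂ * ∑⟨ n ⟩ (B p q))
      ≡⟨ signs₂ (inversions π) (∣ u₁ ∣₁ ℙ.* ∣ u₂ ∣₁) (∑⟨ n ⟩ (B p q)) ⟩
    s * ∑⟨ n ⟩ (B p q) ∎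

product : SymmetricFunction → SymmetricFunction → SymmetricFunction
product f g = mkSymmetricFunction (λ m → ∑⟨ m ⟩ λ m₁ m₂ → coeff f m₁ * coeff g m₂) record
  { stable = λ m → ∑-stable m (λ m₁ m₂ → coeff f m₁ * coeff g m₂) λ m₁ m₂ →
      cong₂ _*_ (stable (isSF f) m₁) (stable (isSF g) m₂)
  ; symmetric = λ π → ∑-symmetric π record
      { left = λ {m} {n} π k → ≡.trans (cong (_* coeff g k) (symmetric (isSF f) π))
          (ℚₚ.*-assoc (sgn (inversions π)) (coeff f n) (coeff g k))
      ; right = λ {m} {n} π k → ≡.trans (cong (coeff f k *_) (symmetric (isSF g) π))
          (*-swap (coeff f k) (sgn (inversions π)) (coeff g n))
      }
  ; bounded = M ℕ.+ N , λ m MN< → ≡.trans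
      (∑-cong m λ m₁ m₂ d → vanish m₁ m₂ (≡.subst (M ℕ.+ N ℕ.<_) (sym d) MN<)) (∑-zero m)
  }
  where
  open IsSymmetricFunction
  M N : ℕ
  M = proj₁ (bounded (isSF f))
  N = proj₁ (bounded (isSF g))
  vanish : ∀ m₁ m₂ → M ℕ.+ N ℕ.< degree m₁ ℕ.+ degree m₂ → coeff f m₁ * coeff g m₂ ≡ 0ℚ
  vanish m₁ m₂ MN< with M ℕₚ.<? degree m₁
  ... | yes M< = ≡.trans (cong (_* coeff g m₂) (proj₂ (bounded (isSF f)) m₁ M<)) (ℚₚ.*-zeroˡ (coeff g m₂))
  ... | no M≮ with N ℕₚ.<? degree m₂
  ...   | yes N< = ≡.trans (cong (coeff f m₁ *_) (proj₂ (bounded (isSF g)) m₂ N<)) (ℚₚ.*-zeroʳ (coeff f m₁))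
  ...   | no N≮ = contradiction MN< (ℕₚ.≤⇒≯ (ℕₚ.+-mono-≤ (ℕₚ.≮⇒≥ M≮) (ℕₚ.≮⇒≥ N≮)))

Λ-mult : Λ-space ⊗ Λ-space ⟶ Λ-space
Λ-mult = lift record
  { on = product
  ; on-cong = λ f≈ g≈ m → ∑-ext m λ m₁ m₂ → cong₂ _*_ (f≈ m₁) (g≈ m₂)
  ; +ˡ = λ f f′ g m → ≡.trans
      (∑-ext m λ m₁ m₂ → ℚₚ.*-distribʳ-+ (coeff g m₂) (coeff f m₁) (coeff f′ m₁))
      (∑-+ m (λ m₁ m₂ → coeff f m₁ * coeff g m₂) (λ m₁ m₂ → coeff f′ m₁ * coeff g m₂))
  ; +ʳ = λ f g g′ m → ≡.trans
      (∑-ext m λ m₁ m₂ → ℚₚ.*-distribˡ-+ (coeff f m₁) (coeff g m₂) (coeff g′ m₂))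
      (∑-+ m (λ m₁ m₂ → coeff f m₁ * coeff g m₂) (λ m₁ m₂ → coeff f m₁ * coeff g′ m₂))
  ; *ˡ = λ r f g m → ≡.trans (∑-ext m λ m₁ m₂ → ℚₚ.*-assoc r (coeff f m₁) (coeff g m₂))
      (∑-* m r (λ m₁ m₂ → coeff f m₁ * coeff g m₂))
  ; *ʳ = λ r f g m → ≡.trans (∑-ext m λ m₁ m₂ → *-swap (coeff f m₁) r (coeff g m₂))
      (∑-* m r (λ m₁ m₂ → coeff f m₁ * coeff g m₂))
  }

------------------------------------------------------------------------
-- Functions of two sets of variables and the coproduct

-- Formal sums Σ c(m,n) m(x;θ) n(y;φ), with the θ's placed before the φ's.
Functions₂ : Space
Functions₂ = Functions (Monomial × Monomial)

-- f ⊗ g ↦ f(x;θ) g(y;φ)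
evaluate₂ : Λ-space ⊗ Λ-space ⟶ Functions₂
evaluate₂ = lift record
  { on = λ f g mn → coeff f (proj₁ mn) * coeff g (proj₂ mn)
  ; on-cong = λ f≈ g≈ mn → cong₂ _*_ (f≈ (proj₁ mn)) (g≈ (proj₂ mn))
  ; +ˡ = λ f f′ g mn → ℚₚ.*-distribʳ-+ (coeff g (proj₂ mn)) (coeff f (proj₁ mn)) (coeff f′ (proj₁ mn))
  ; +ʳ = λ f g g′ mn → ℚₚ.*-distribˡ-+ (coeff f (proj₁ mn)) (coeff g (proj₂ mn)) (coeff g′ (proj₂ mn))
  ; *ˡ = λ r f g mn → ℚₚ.*-assoc r (coeff f (proj₁ mn)) (coeff g (proj₂ mn))
  ; *ʳ = λ r f g mn → *-swap (coeff f (proj₁ mn)) r (coeff g (proj₂ mn))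
  }

-- f(x,y;θ,φ).  If m involves x₁,…,xₖ only, the coefficient of m(x;θ) n(y;φ) is found
-- by listing the variables as x₁,…,xₖ,y₁,y₂,…; by symmetry the order is immaterial.
onUnion : SymmetricFunction → ∣ Functions₂ ∣
onUnion f mn = coeff f (proj₁ mn ++ proj₂ mn)

-- Δ f is the one and only element of Λ ⊗ Λ that is f(x,y;θ,φ) as a function of two
-- sets of variables.
IsCoproduct : (Λ-space ⟶ Λ-space ⊗ Λ-space) → Set
IsCoproduct Δ = ∀ f F → (⟦ evaluate₂ ⟧ F ≈[ Functions₂ ] onUnion f) ⇔ (F ≈[ Λ-space ⊗ Λ-space ] ⟦ Δ ⟧ f)

{-# OPTIONS --safe #-}
-- Λ is the free supercommutative algebra on the power sums Σᵢ xᵢ^(k+1) and Σᵢ xᵢ^k θᵢ, and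
-- these are primitive.  Products of power sums are independent because such a product
-- takes, at a monomial with at least as many factors, the number of matchings of the two
-- as its coefficient; and averaging over the matchings recovers a supersymmetric function
-- of words from its values on words of one length, so they also span, by induction on the
-- number of factors.  Hence Δ is a finite sum of tensors, an element of a tensor power of Λ
-- is determined by its values as a function of several sets of variables, and linear maps
-- may be prescribed on products of power sums: the antipode negates each power sum,
-- ∂ v is the derivation dual to the power sum v, and the pairing is determined by
-- ⟨ x , 1 ⟩ = ε x and ⟨ x , v a ⟩ = ⟨ ∂ v x , a ⟩.
module Submission where

open import Defs
open import Algebra.Module.Bundles using (LeftModule)
import Algebra.Module.Construct.DirectProduct as DirectProduct
open import Data.Bool.Base using (Bool; true; false; if_then_else_)
import Data.Bool.Properties as 𝔹ₚ
open import Data.List.Base using (List; []; _∷_; _++_; _∷ʳ_; map; foldr; length; cartesianProductWith; cartesianProduct; concatMap; deduplicate; filter; upTo)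
import Data.List.Properties as Listₚ
import Data.List.Membership.DecPropositional as DecMembership
open import Data.List.Membership.Propositional using (_∈_)
open import Data.List.Membership.Propositional.Properties using (∈-cartesianProductWith⁻; ∈-cartesianProduct⁺; ∈-deduplicate⁺; ∈-concatMap⁺; ∈-upTo⁺; ∈-filter⁻)
open import Data.List.Relation.Binary.Permutation.Propositional using (_↭_; refl; prep; swap; trans)
open import Data.List.Relation.Unary.All using (All; []; _∷_)
import Data.List.Relation.Unary.All as All
open import Data.List.Relation.Unary.Any as Any using (here; there)
open import Data.List.Relation.Unary.Unique.Propositional using (Unique; []; _∷_)
import Data.List.Relation.Unary.Unique.Propositional.Properties as Uniqueₚ
open import Data.List.Relation.Unary.Unique.DecPropositional.Properties using (deduplicate-!)
open import Data.Nat.Base as ℕ using (ℕ; zero; suc)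
import Data.Nat.Properties as ℕₚ
open import Data.Parity.Base as ℙ using (Parity; 0ℙ; 1ℙ)
import Data.Parity.Properties as ℙₚ
open import Data.Product.Base using (∃; Σ; _×_; _,_; proj₁; proj₂)
open import Data.Product.Properties using (≡-dec)
open import Data.Rational.Base as ℚ using (ℚ; 0ℚ; 1ℚ; _+_; _*_; -_)
import Data.Rational.Properties as ℚₚ
open import Data.Rational.Solver using (module +-*-Solver)
open import Data.Sum.Base using (_⊎_; inj₁; inj₂) renaming (map to map-⊎)
open import Relation.Binary.PropositionalEquality as ≡ using (_≡_; _≢_; cong; cong₂; sym; module ≡-Reasoning)
open import Function.Bundles using (mk⇔)
import Relation.Binary.Reasoning.Setoid as SetoidReasoning
open import Relation.Nullary using (Dec; yes; no; does; ¬_; ¬?; contradiction)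

open +-*-Solver using (solve; _:=_; _:+_; _:*_; con)

-- Finite sums in a vector space

-- Words are neither sorted nor freed of repeated odd letters, so `powers` is not a basis indexed by
-- words: rearranging a word repeats the element up to sign, and a word with an odd letter twice
-- gives 0. Instead of choosing normal forms, with signs of sorting, the proof controls the
-- relations among words by the matrix `matchings`. Since `reproduce` writes `Φ κ`, for any
-- supersymmetric `Φ`, through the numbers `matchings κ μ`, a combination of words killed by
-- `matchings` is killed by every such `Φ` (`combine-vanish`). This fact, which rests on division by
-- k!, makes the prescribed linear maps well defined, makes evaluation of tensors injective, and
-- makes the pairing nondegenerate, because the matrix of the pairing is `matchings` up to the sign
-- `ω`. Tensors are formal expressions modulo a generated congruence, so an equation between them
-- must be derived, not only observed on values; this is why combinations of words carry
-- coefficients in an arbitrary space `W`. Elements that mix parities are treated by twists, x ↦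
-- (-1)^(q deg x) x, which carry the signs without decomposing x.

variable
  I J : Set

module Sum (V : Space) where
  open LeftModule V
  open SetoidReasoning ≈ᴹ-setoid

  infixr 7 _·_
  _·_ : ℚ → ∣ V ∣ → ∣ V ∣
  _·_ = _*ₗ_

  ·-congʳ : ∀ r {x y} → x ≈ᴹ y → r · x ≈ᴹ r · y
  ·-congʳ r = *ₗ-cong ≡.refl

  ·-congˡ : ∀ {r s} x → r ≡ s → r · x ≈ᴹ s · x
  ·-congˡ x r≡s = *ₗ-cong r≡s ≈ᴹ-refl

  ·-comm : ∀ r s x → r · (s · x) ≈ᴹ s · (r · x)
  ·-comm r s = Bilinear.*ʳ (scalars {V}) s r

  sum : List I → (I → ∣ V ∣) → ∣ V ∣
  sum xs h = foldr (λ x s → h x +ᴹ s) 0ᴹ xs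

  sum-congᴹ : ∀ (xs : List I) {h k : I → ∣ V ∣} → (∀ x → x ∈ xs → h x ≈ᴹ k x) → sum xs h ≈ᴹ sum xs k
  sum-congᴹ []       p = ≈ᴹ-refl
  sum-congᴹ (x ∷ xs) p = +ᴹ-cong (p x (here ≡.refl)) (sum-congᴹ xs λ y y∈ → p y (there y∈))

  sum-ext : ∀ (xs : List I) {h k : I → ∣ V ∣} → (∀ x → h x ≈ᴹ k x) → sum xs h ≈ᴹ sum xs k
  sum-ext xs p = sum-congᴹ xs λ x _ → p x

  sum-0 : ∀ (xs : List I) → sum xs (λ _ → 0ᴹ) ≈ᴹ 0ᴹ
  sum-0 []       = ≈ᴹ-refl
  sum-0 (x ∷ xs) = ≈ᴹ-trans (+ᴹ-identityˡ _) (sum-0 xs)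

  sum-vanish : ∀ (xs : List I) {h : I → ∣ V ∣} → (∀ x → x ∈ xs → h x ≈ᴹ 0ᴹ) → sum xs h ≈ᴹ 0ᴹ
  sum-vanish xs p = ≈ᴹ-trans (sum-congᴹ xs p) (sum-0 xs)

  sum-single : ∀ {xs : List I} {x} {h : I → ∣ V ∣} → Unique xs → x ∈ xs →
    (∀ y → y ≢ x → h y ≈ᴹ 0ᴹ) → sum xs h ≈ᴹ h x
  sum-single {xs = x ∷ xs} {h = h} (x∉ ∷ _) (here ≡.refl) p = ≈ᴹ-trans
    (+ᴹ-cong ≈ᴹ-refl (sum-vanish xs λ y y∈ → p y λ y≡x → All.lookup x∉ y∈ (sym y≡x)))
    (+ᴹ-identityʳ (h x))
  sum-single {xs = y ∷ xs} {x} {h} (y∉ ∷ xs!) (there x∈) p = ≈ᴹ-trans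
    (+ᴹ-cong (p y λ y≡x → All.lookup y∉ x∈ y≡x) (sum-single xs! x∈ p))
    (+ᴹ-identityˡ (h x))

  +-interchangeᴹ : ∀ a b c d → (a +ᴹ b) +ᴹ (c +ᴹ d) ≈ᴹ (a +ᴹ c) +ᴹ (b +ᴹ d)
  +-interchangeᴹ a b c d = begin
    (a +ᴹ b) +ᴹ (c +ᴹ d)  ≈⟨ +ᴹ-assoc a b (c +ᴹ d) ⟩
    a +ᴹ (b +ᴹ (c +ᴹ d))  ≈⟨ +ᴹ-cong ≈ᴹ-refl (+ᴹ-assoc b c d) ⟨
    a +ᴹ ((b +ᴹ c) +ᴹ d)  ≈⟨ +ᴹ-cong ≈ᴹ-refl (+ᴹ-cong (+ᴹ-comm b c) ≈ᴹ-refl) ⟩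
    a +ᴹ ((c +ᴹ b) +ᴹ d)  ≈⟨ +ᴹ-cong ≈ᴹ-refl (+ᴹ-assoc c b d) ⟩
    a +ᴹ (c +ᴹ (b +ᴹ d))  ≈⟨ +ᴹ-assoc a c (b +ᴹ d) ⟨
    (a +ᴹ c) +ᴹ (b +ᴹ d)  ∎

  sum-+ᴹ : ∀ (xs : List I) (h k : I → ∣ V ∣) → sum xs (λ x → h x +ᴹ k x) ≈ᴹ sum xs h +ᴹ sum xs k
  sum-+ᴹ []       h k = ≈ᴹ-sym (+ᴹ-identityˡ 0ᴹ)
  sum-+ᴹ (x ∷ xs) h k = ≈ᴹ-trans (+ᴹ-cong ≈ᴹ-refl (sum-+ᴹ xs h k)) (+-interchangeᴹ _ _ _ _)

  sum-· : ∀ (xs : List I) r (h : I → ∣ V ∣) → sum xs (λ x → r · h x) ≈ᴹ r · sum xs h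
  sum-· []       r h = ≈ᴹ-sym (*ₗ-zeroʳ r)
  sum-· (x ∷ xs) r h = ≈ᴹ-trans (+ᴹ-cong ≈ᴹ-refl (sum-· xs r h)) (≈ᴹ-sym (*ₗ-distribˡ r _ _))

  sum-swapᴹ : ∀ (xs : List I) (ys : List J) (h : I → J → ∣ V ∣) →
    sum xs (λ x → sum ys (h x)) ≈ᴹ sum ys (λ y → sum xs (λ x → h x y))
  sum-swapᴹ []       ys h = ≈ᴹ-sym (sum-0 ys)
  sum-swapᴹ (x ∷ xs) ys h = ≈ᴹ-trans (+ᴹ-cong ≈ᴹ-refl (sum-swapᴹ xs ys h))
    (≈ᴹ-sym (sum-+ᴹ ys (h x) _))

  sum-++ : ∀ (xs ys : List I) (h : I → ∣ V ∣) → sum (xs ++ ys) h ≈ᴹ sum xs h +ᴹ sum ys h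
  sum-++ []       ys h = ≈ᴹ-sym (+ᴹ-identityˡ _)
  sum-++ (x ∷ xs) ys h = ≈ᴹ-trans (+ᴹ-cong ≈ᴹ-refl (sum-++ xs ys h)) (≈ᴹ-sym (+ᴹ-assoc _ _ _))

  sum-map : ∀ (g : I → J) (xs : List I) (h : J → ∣ V ∣) → sum (map g xs) h ≡ sum xs (λ x → h (g x))
  sum-map g []       h = ≡.refl
  sum-map g (x ∷ xs) h = cong (h (g x) +ᴹ_) (sum-map g xs h)

  sum-product : ∀ {Z : Set} (f : I → J → Z) (xs : List I) (ys : List J) (h : Z → ∣ V ∣) →
    sum (cartesianProductWith f xs ys) h ≈ᴹ sum xs (λ x → sum ys (λ y → h (f x y)))
  sum-product f []       ys h = ≈ᴹ-refl
  sum-product f (x ∷ xs) ys h = ≈ᴹ-trans (sum-++ (map (f x) ys) (cartesianProductWith f xs ys) h)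
    (+ᴹ-cong (≈ᴹ-reflexive (sum-map (f x) ys h)) (sum-product f xs ys h))

  sum-filter : ∀ {P : I → Set} (P? : ∀ x → Dec (P x)) (xs : List I) (h : I → ∣ V ∣) →
    sum xs h ≈ᴹ sum (filter P? xs) h +ᴹ sum (filter (λ x → ¬? (P? x)) xs) h
  sum-filter P? []       h = ≈ᴹ-sym (+ᴹ-identityˡ 0ᴹ)
  sum-filter P? (x ∷ xs) h with P? x
  ... | yes _ = ≈ᴹ-trans (+ᴹ-cong ≈ᴹ-refl (sum-filter P? xs h)) (≈ᴹ-sym (+ᴹ-assoc _ _ _))
  ... | no  _ = begin
    h x +ᴹ sum xs h          ≈⟨ +ᴹ-cong ≈ᴹ-refl (sum-filter P? xs h) ⟩
    h x +ᴹ (S +ᴹ T)          ≈⟨ +ᴹ-assoc (h x) S T ⟨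
    (h x +ᴹ S) +ᴹ T          ≈⟨ +ᴹ-cong (+ᴹ-comm (h x) S) ≈ᴹ-refl ⟩
    (S +ᴹ h x) +ᴹ T          ≈⟨ +ᴹ-assoc S (h x) T ⟩
    S +ᴹ (h x +ᴹ T)          ∎
    where
    S T : ∣ V ∣
    S = sum (filter P? xs) h
    T = sum (filter (λ x → ¬? (P? x)) xs) h

map-sum : ∀ {V W} (k : V ⟶ W) (xs : List I) (h : I → ∣ V ∣) →
  eq W (⟦ k ⟧ (Sum.sum V xs h)) (Sum.sum W xs (λ x → ⟦ k ⟧ (h x)))
map-sum k []       h = _⟶_.0ᴹ-homo k
map-sum {W = W} k (x ∷ xs) h = ≈ᴹ-trans (_⟶_.+ᴹ-homo k _ _) (+ᴹ-cong ≈ᴹ-refl (map-sum k xs h))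
  where open LeftModule W

infixl 7 _⋆_
_⋆_ : ∀ {V W} (r : ℚ) → V ⟶ W → V ⟶ W
_⋆_ {W = W} r h = mkLinear (λ x → r *ₗ ⟦ h ⟧ x)
  (λ p → *ₗ-cong ≡.refl (h.⟦⟧-cong p))
  (λ x y → ≈ᴹ-trans (*ₗ-cong ≡.refl (h.+ᴹ-homo x y)) (*ₗ-distribˡ r _ _))
  (λ s x → ≈ᴹ-trans (*ₗ-cong ≡.refl (h.*ₗ-homo s x)) (Sum.·-comm W r s _))
  where
  open LeftModule W
  module h = _⟶_ h

multiples : ∀ {V} → ∣ V ∣ → ℚ-space ⟶ V
multiples {V} v = mkLinear (_*ₗ v) (λ p → *ₗ-cong p ≈ᴹ-refl) (λ r s → *ₗ-distribʳ v r s) (λ r s → *ₗ-assoc r s v)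
  where open LeftModule V

-- Words and their rearrangements

sgn-self : ∀ p → sgn p * sgn p ≡ 1ℚ
sgn-self 0ℙ = ≡.refl
sgn-self 1ℙ = ≡.refl

sgn-self-cancel : ∀ p x → sgn p * (sgn p * x) ≡ x
sgn-self-cancel p x = ≡.trans (sym (ℚₚ.*-assoc (sgn p) (sgn p) x))
  (≡.trans (cong (_* x) (sgn-self p)) (ℚₚ.*-identityˡ x))

sgn-distribˡ : ∀ p q r → sgn (p ℙ.* (q ℙ.+ r)) ≡ sgn (p ℙ.* q) * sgn (p ℙ.* r)
sgn-distribˡ p q r = ≡.trans (cong sgn (ℙₚ.*-distribˡ-+ p q r)) (sgn-+ (p ℙ.* q) (p ℙ.* r))

-- Words in letters other than 1: as a letter, (k , false) stands for x^(k+1) and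
-- (k , true) for x^k θ.
Word : Set
Word = Monomial

-- A bijection onto the factors other than 1 (`factor-view`, `letter-injective`), so that no word
-- needs a side condition excluding 1. The θ component is kept, hence `∣ letter u ∣₁` is `∣ u ∣₁` by
-- definition.
letter : Factor → Factor
letter (k , b) = (if b then k else suc k) , b

monomial : Word → Monomial
monomial = map letter

_≟_ : (u v : Factor) → Dec (u ≡ v)
_≟_ = ≡-dec ℕₚ._≟_ 𝔹ₚ._≟_

abstract
  -- Abstract, so that the decision procedure never unfolds in goals; the proofs use its values on
  -- equal and on distinct letters.
  [_≡_] : Factor → Factor → ℚ
  [ u ≡ v ] = if does (u ≟ v) then 1ℚ else 0ℚ

  [≡]-refl : ∀ u → [ u ≡ u ] ≡ 1ℚ
  [≡]-refl u with u ≟ u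
  ... | yes _   = ≡.refl
  ... | no  u≢u = contradiction ≡.refl u≢u

  [≢]-zero : ∀ {u v} → u ≢ v → [ u ≡ v ] ≡ 0ℚ
  [≢]-zero {u} {v} u≢v with u ≟ v
  ... | yes u≡v = contradiction u≡v u≢v
  ... | no  _   = ≡.refl

-- Each letter `v` that is passed contributes `∣ u ∣₁ ℙ.* ∣ v ∣₁`. The rearrangement is returned
-- with its sign because `inversions` is computed from the derivation of `_↭_`, not from its
-- endpoints.
shift : ∀ α u β → Σ (α ++ u ∷ β ↭ u ∷ α ++ β) λ π → inversions π ≡ ∣ u ∣₁ ℙ.* ∣ α ∣ₘ
shift []      u β = refl , sym (ℙₚ.*-zeroʳ ∣ u ∣₁)
shift (v ∷ α) u β = trans (prep v π) (swap v u refl) , (begin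
  inversions π ℙ.+ (∣ v ∣₁ ℙ.* ∣ u ∣₁ ℙ.+ 0ℙ)
    ≡⟨ cong₂ ℙ._+_ π-sign (≡.trans (ℙₚ.+-identityʳ _) (ℙₚ.*-comm ∣ v ∣₁ ∣ u ∣₁)) ⟩
  (∣ u ∣₁ ℙ.* ∣ α ∣ₘ) ℙ.+ (∣ u ∣₁ ℙ.* ∣ v ∣₁)
    ≡⟨ ℙₚ.+-comm (∣ u ∣₁ ℙ.* ∣ α ∣ₘ) (∣ u ∣₁ ℙ.* ∣ v ∣₁) ⟩
  (∣ u ∣₁ ℙ.* ∣ v ∣₁) ℙ.+ (∣ u ∣₁ ℙ.* ∣ α ∣ₘ)
    ≡⟨ ℙₚ.*-distribˡ-+ ∣ u ∣₁ ∣ v ∣₁ ∣ α ∣ₘ ⟨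
  ∣ u ∣₁ ℙ.* (∣ v ∣₁ ℙ.+ ∣ α ∣ₘ)
    ≡⟨ cong (∣ u ∣₁ ℙ.*_) (∣∣-∷ v α) ⟨
  ∣ u ∣₁ ℙ.* ∣ v ∷ α ∣ₘ ∎)
  where
  open ≡-Reasoning
  π = proj₁ (shift α u β)
  π-sign = proj₂ (shift α u β)

words : List Factor → ℕ → List Word
words A zero    = [] ∷ []
words A (suc k) = cartesianProductWith _∷_ A (words A k)

words-length : ∀ A k {λ′} → λ′ ∈ words A k → length λ′ ≡ k
words-length A zero    (here ≡.refl) = ≡.refl
words-length A (suc k) λ∈ with ∈-cartesianProductWith⁻ _∷_ A (words A k) λ∈
... | u , μ , _ , μ∈ , ≡.refl = cong suc (words-length A k μ∈)

words-letters : ∀ A k {λ′} → λ′ ∈ words A k → All (_∈ A) λ′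
words-letters A zero    (here ≡.refl) = []
words-letters A (suc k) λ∈ with ∈-cartesianProductWith⁻ _∷_ A (words A k) λ∈
... | u , μ , u∈ , μ∈ , ≡.refl = u∈ ∷ words-letters A k μ∈

-- Factorials in ℚ

natural : ℕ → ℚ
natural zero    = 0ℚ
natural (suc n) = 1ℚ + natural n

factorial : ℕ → ℚ
factorial zero    = 1ℚ
factorial (suc n) = natural (suc n) * factorial n

natural-nonneg : ∀ n → 0ℚ ℚ.≤ natural n
natural-nonneg zero    = ℚₚ.≤-refl
natural-nonneg (suc n) = ℚₚ.+-mono-≤ (ℚₚ.nonNegative⁻¹ 1ℚ) (natural-nonneg n)

invertible : ∀ q → 0ℚ ℚ.< q → ∃ λ r → r * q ≡ 1ℚ
invertible q q>0 = ℚ.1/ q , ℚₚ.*-inverseˡ q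
  where instance _ = ℚₚ.pos⇒nonZero q {{ℚ.positive q>0}}

-- Averaging divides by the number of rearrangements; characteristic 0 enters here, through
-- positivity of `natural (suc n)`.
factorial-invertible : ∀ n → ∃ λ r → r * factorial n ≡ 1ℚ
factorial-invertible zero    = 1ℚ , ≡.refl
factorial-invertible (suc n) = r * s , (begin
  (r * s) * (natural (suc n) * factorial n) ≡⟨ regroup r s (natural (suc n)) (factorial n) ⟩
  (s * natural (suc n)) * (r * factorial n) ≡⟨ cong₂ _*_ s-inverse r-inverse ⟩
  1ℚ * 1ℚ                                   ≡⟨⟩
  1ℚ                                        ∎)
  where
  open ≡-Reasoning
  r = proj₁ (factorial-invertible n)
  r-inverse = proj₂ (factorial-invertible n)
  s,inverse = invertible (natural (suc n))
    (ℚₚ.+-mono-<-≤ (ℚₚ.positive⁻¹ 1ℚ) (natural-nonneg n))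
  s = proj₁ s,inverse
  s-inverse = proj₂ s,inverse
  regroup : ∀ a b c d → (a * b) * (c * d) ≡ (b * c) * (a * d)
  regroup = solve 4 (λ a b c d → (a :* b) :* (c :* d) := (b :* c) :* (a :* d)) ≡.refl

-- Deletion of a letter from a word

module Delete (V : Space) where
  open LeftModule V
  open Sum V
  open SetoidReasoning ≈ᴹ-setoid

  Supersymmetric : (Word → ∣ V ∣) → Set
  Supersymmetric Φ = ∀ {μ ν} (π : μ ↭ ν) → Φ μ ≈ᴹ sgn (inversions π) · Φ ν

  -- The sum of Φ over the words obtained by moving a letter u to the front and
  -- deleting it.
  delete : Factor → (Word → ∣ V ∣) → Word → ∣ V ∣
  delete u Φ []      = 0ᴹ
  delete u Φ (v ∷ μ) = ([ u ≡ v ] · Φ μ) +ᴹ (sgn (∣ u ∣₁ ℙ.* ∣ v ∣₁) · delete u (λ ν → Φ (v ∷ ν)) μ)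

  -- Agreement is asked only at words that arise from `μ` by removing one entry; inductions on the
  -- length or on the letters of a word draw their information from this decomposition.
  delete-cong : ∀ u {Φ Ψ} μ → (∀ α v β → μ ≡ α ++ v ∷ β → Φ (α ++ β) ≈ᴹ Ψ (α ++ β)) →
    delete u Φ μ ≈ᴹ delete u Ψ μ
  delete-cong u []      p = ≈ᴹ-refl
  delete-cong u (v ∷ μ) p = +ᴹ-cong (·-congʳ _ (p [] v μ ≡.refl))
    (·-congʳ _ (delete-cong u μ λ α w β eq → p (v ∷ α) w β (cong (v ∷_) eq)))

  delete-ext : ∀ u {Φ Ψ} μ → (∀ ν → Φ ν ≈ᴹ Ψ ν) → delete u Φ μ ≈ᴹ delete u Ψ μ
  delete-ext u μ p = delete-cong u μ λ α _ β _ → p (α ++ β)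

  delete-0 : ∀ u μ → delete u (λ _ → 0ᴹ) μ ≈ᴹ 0ᴹ
  delete-0 u []      = ≈ᴹ-refl
  delete-0 u (v ∷ μ) = begin
    ([ u ≡ v ] · 0ᴹ) +ᴹ (_ · delete u (λ _ → 0ᴹ) μ)
      ≈⟨ +ᴹ-cong (*ₗ-zeroʳ _) (≈ᴹ-trans (·-congʳ _ (delete-0 u μ)) (*ₗ-zeroʳ _)) ⟩
    0ᴹ +ᴹ 0ᴹ ≈⟨ +ᴹ-identityˡ 0ᴹ ⟩
    0ᴹ       ∎

  delete-+ : ∀ u Φ Ψ μ → delete u (λ ν → Φ ν +ᴹ Ψ ν) μ ≈ᴹ delete u Φ μ +ᴹ delete u Ψ μ
  delete-+ u Φ Ψ []      = ≈ᴹ-sym (+ᴹ-identityˡ 0ᴹ)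
  delete-+ u Φ Ψ (v ∷ μ) = begin
    ([ u ≡ v ] · (Φ μ +ᴹ Ψ μ)) +ᴹ (_ · delete u (λ ν → Φ (v ∷ ν) +ᴹ Ψ (v ∷ ν)) μ)
      ≈⟨ +ᴹ-cong (*ₗ-distribˡ _ _ _)
           (≈ᴹ-trans (·-congʳ _ (delete-+ u (λ ν → Φ (v ∷ ν)) (λ ν → Ψ (v ∷ ν)) μ)) (*ₗ-distribˡ _ _ _)) ⟩
    (([ u ≡ v ] · Φ μ) +ᴹ ([ u ≡ v ] · Ψ μ)) +ᴹ ((_ · delete u (λ ν → Φ (v ∷ ν)) μ) +ᴹ (_ · delete u (λ ν → Ψ (v ∷ ν)) μ))
      ≈⟨ +-interchangeᴹ _ _ _ _ ⟩
    delete u Φ (v ∷ μ) +ᴹ delete u Ψ (v ∷ μ) ∎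

  delete-· : ∀ u r Φ μ → delete u (λ ν → r · Φ ν) μ ≈ᴹ r · delete u Φ μ
  delete-· u r Φ []      = ≈ᴹ-sym (*ₗ-zeroʳ r)
  delete-· u r Φ (v ∷ μ) = begin
    ([ u ≡ v ] · (r · Φ μ)) +ᴹ (_ · delete u (λ ν → r · Φ (v ∷ ν)) μ)
      ≈⟨ +ᴹ-cong (·-comm _ r _) (≈ᴹ-trans (·-congʳ _ (delete-· u r (λ ν → Φ (v ∷ ν)) μ)) (·-comm _ r _)) ⟩
    (r · ([ u ≡ v ] · Φ μ)) +ᴹ (r · (_ · delete u (λ ν → Φ (v ∷ ν)) μ))
      ≈⟨ *ₗ-distribˡ r _ _ ⟨
    r · delete u Φ (v ∷ μ) ∎

  delete-sum : ∀ u (xs : List I) (Φ : I → Word → ∣ V ∣) μ →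
    delete u (λ ν → sum xs (λ x → Φ x ν)) μ ≈ᴹ sum xs (λ x → delete u (Φ x) μ)
  delete-sum u []       Φ μ = delete-0 u μ
  delete-sum u (x ∷ xs) Φ μ = ≈ᴹ-trans (delete-+ u (Φ x) (λ ν → sum xs (λ x → Φ x ν)) μ)
    (+ᴹ-cong ≈ᴹ-refl (delete-sum u xs Φ μ))

  delete-vanish : ∀ u Φ μ → All (u ≢_) μ → delete u Φ μ ≈ᴹ 0ᴹ
  delete-vanish u Φ []      []         = ≈ᴹ-refl
  delete-vanish u Φ (v ∷ μ) (u≢v ∷ u∉) = begin
    ([ u ≡ v ] · Φ μ) +ᴹ (_ · delete u (λ ν → Φ (v ∷ ν)) μ)
      ≈⟨ +ᴹ-cong (≈ᴹ-trans (·-congˡ _ ([≢]-zero u≢v)) (*ₗ-zeroˡ _))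
           (≈ᴹ-trans (·-congʳ _ (delete-vanish u (λ ν → Φ (v ∷ ν)) μ u∉)) (*ₗ-zeroʳ _)) ⟩
    0ᴹ +ᴹ 0ᴹ ≈⟨ +ᴹ-identityˡ 0ᴹ ⟩
    0ᴹ       ∎

  indicator-sum : ∀ {A v} → Unique A → v ∈ A → (h : Factor → ∣ V ∣) →
    sum A (λ u → [ u ≡ v ] · h u) ≈ᴹ h v
  indicator-sum {A} {v} A! v∈ h = ≈ᴹ-trans
    (sum-single A! v∈ λ u u≢v → ≈ᴹ-trans (·-congˡ _ ([≢]-zero u≢v)) (*ₗ-zeroˡ _))
    (≈ᴹ-trans (·-congˡ _ ([≡]-refl v)) (*ₗ-identityˡ _))

  sgn-self-· : ∀ p x → sgn p · (sgn p · x) ≈ᴹ x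
  sgn-self-· p x = ≈ᴹ-trans (≈ᴹ-sym (*ₗ-assoc (sgn p) (sgn p) x))
    (≈ᴹ-trans (·-congˡ x (sgn-self p)) (*ₗ-identityˡ x))

  -- Each position of `μ` contributes once, through the single entry of the duplicate-free `A` that
  -- equals its letter. By hypothesis all positions contribute the same `x`, the sign being that of
  -- moving the letter to the front.
  delete-collect : ∀ {A} → Unique A → ∀ μ (Ψ : Factor → Word → ∣ V ∣) x → All (_∈ A) μ →
    (∀ α u β → μ ≡ α ++ u ∷ β → sgn (∣ u ∣₁ ℙ.* ∣ α ∣ₘ) · Ψ u (α ++ β) ≈ᴹ x) →
    sum A (λ u → delete u (Ψ u) μ) ≈ᴹ natural (length μ) · x
  delete-collect {A} A! []      Ψ x []        p = ≈ᴹ-trans (sum-0 A) (≈ᴹ-sym (*ₗ-zeroˡ x))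
  delete-collect {A} A! (v ∷ μ) Ψ x (v∈ ∷ μ⊆) p = begin
    sum A (λ u → ([ u ≡ v ] · Ψ u μ) +ᴹ (sgn (∣ u ∣₁ ℙ.* ∣ v ∣₁) · delete u (λ ν → Ψ u (v ∷ ν)) μ))
      ≈⟨ sum-+ᴹ A _ _ ⟩
    sum A (λ u → [ u ≡ v ] · Ψ u μ) +ᴹ sum A (λ u → sgn (∣ u ∣₁ ℙ.* ∣ v ∣₁) · delete u (λ ν → Ψ u (v ∷ ν)) μ)
      ≈⟨ +ᴹ-cong (indicator-sum A! v∈ (λ u → Ψ u μ)) (sum-ext A λ u → ≈ᴹ-sym (delete-· u _ _ μ)) ⟩
    Ψ v μ +ᴹ sum A (λ u → delete u (λ ν → sgn (∣ u ∣₁ ℙ.* ∣ v ∣₁) · Ψ u (v ∷ ν)) μ)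
      ≈⟨ +ᴹ-cong (≈ᴹ-trans (≈ᴹ-sym (≈ᴹ-trans (·-congˡ _ (cong sgn (ℙₚ.*-zeroʳ ∣ v ∣₁))) (*ₗ-identityˡ _))) (p [] v μ ≡.refl))
           (delete-collect A! μ (λ u ν → sgn (∣ u ∣₁ ℙ.* ∣ v ∣₁) · Ψ u (v ∷ ν)) x μ⊆ λ α u β eq →
             ≈ᴹ-trans (tail-sign α u β) (p (v ∷ α) u β (cong (v ∷_) eq))) ⟩
    x +ᴹ (natural (length μ) · x)
      ≈⟨ +ᴹ-cong (*ₗ-identityˡ x) ≈ᴹ-refl ⟨
    (1ℚ · x) +ᴹ (natural (length μ) · x)
      ≈⟨ *ₗ-distribʳ x 1ℚ (natural (length μ)) ⟨
    natural (suc (length μ)) · x ∎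
    where
    tail-sign : ∀ α u β → sgn (∣ u ∣₁ ℙ.* ∣ α ∣ₘ) · (sgn (∣ u ∣₁ ℙ.* ∣ v ∣₁) · Ψ u (v ∷ α ++ β))
      ≈ᴹ sgn (∣ u ∣₁ ℙ.* ∣ v ∷ α ∣ₘ) · Ψ u (v ∷ α ++ β)
    tail-sign α u β = ≈ᴹ-trans (·-comm _ _ _) (≈ᴹ-trans (≈ᴹ-sym (*ₗ-assoc _ _ _)) (·-congˡ _ (≡.trans
      (sym (sgn-distribˡ ∣ u ∣₁ ∣ v ∣₁ ∣ α ∣ₘ)) (cong (λ p → sgn (∣ u ∣₁ ℙ.* p)) (sym (∣∣-∷ v α))))))

delete-natural : ∀ {V W} (h : V ⟶ W) u Φ μ →
  eq W (Delete.delete W u (λ ν → ⟦ h ⟧ (Φ ν)) μ) (⟦ h ⟧ (Delete.delete V u Φ μ))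
delete-natural {W = W} h u Φ []      = LeftModule.≈ᴹ-sym W (_⟶_.0ᴹ-homo h)
delete-natural {V} {W} h u Φ (v ∷ μ) = begin
  ([ u ≡ v ] · ⟦ h ⟧ (Φ μ)) +ᴹ (s · Delete.delete W u (λ ν → ⟦ h ⟧ (Φ (v ∷ ν))) μ)
    ≈⟨ +ᴹ-cong (≈ᴹ-sym (_⟶_.*ₗ-homo h _ _)) (≈ᴹ-trans (·-congʳ s (delete-natural h u (λ ν → Φ (v ∷ ν)) μ)) (≈ᴹ-sym (_⟶_.*ₗ-homo h _ _))) ⟩
  ⟦ h ⟧ ([ u ≡ v ] V.*ₗ Φ μ) +ᴹ ⟦ h ⟧ (s V.*ₗ Delete.delete V u (λ ν → Φ (v ∷ ν)) μ)
    ≈⟨ _⟶_.+ᴹ-homo h _ _ ⟨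
  ⟦ h ⟧ (Delete.delete V u Φ (v ∷ μ)) ∎
  where
  open LeftModule W
  module V = LeftModule V
  open Sum W
  open SetoidReasoning ≈ᴹ-setoid
  s : ℚ
  s = sgn (∣ u ∣₁ ℙ.* ∣ v ∣₁)

-- Signed matchings of two words

open Delete ℚ-space public using ()
  renaming (delete to deleteℚ; delete-cong to deleteℚ-cong; delete-ext to deleteℚ-ext; delete-+ to deleteℚ-+; delete-· to deleteℚ-·; delete-0 to deleteℚ-0; delete-vanish to deleteℚ-vanish)

-- The number of ways to match equal letters of two words one to one, counted with
-- the sign of the rearrangement.
matchings : Word → Word → ℚ
matchings []       []      = 1ℚ
matchings []       (_ ∷ _) = 0ℚ
matchings (u ∷ κ) μ        = deleteℚ u (matchings κ) μ

length-delete : ∀ (α : Word) v β → length (α ++ v ∷ β) ≡ suc (length (α ++ β))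
length-delete []      v β = ≡.refl
length-delete (u ∷ α) v β = cong suc (length-delete α v β)

All-delete : ∀ {P : Factor → Set} α {v β} → All P (α ++ v ∷ β) → P v × All P (α ++ β)
All-delete []      (p ∷ ps) = p , ps
All-delete (u ∷ α) (p ∷ ps) = proj₁ (All-delete α ps) , p ∷ proj₂ (All-delete α ps)

matchings-length : ∀ κ μ → length κ ≢ length μ → matchings κ μ ≡ 0ℚ
matchings-length []      []      κ≢μ = contradiction ≡.refl κ≢μ
matchings-length []      (v ∷ μ) κ≢μ = ≡.refl
matchings-length (u ∷ κ) μ       κ≢μ = ≡.trans
  (deleteℚ-cong u μ λ α v β μ≡ → matchings-length κ (α ++ β) λ κ≡ →
    κ≢μ (≡.trans (cong suc κ≡) (sym (≡.trans (cong length μ≡) (length-delete α v β)))))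
  (deleteℚ-0 u μ)

-- The two deletions act on different arguments of `F`, so they commute without a sign.
delete-delete : ∀ u v (F : Word → Word → ℚ) κ μ →
  deleteℚ u (λ ν → deleteℚ v (λ ξ → F ξ ν) κ) μ ≡ deleteℚ v (λ ξ → deleteℚ u (F ξ) μ) κ
delete-delete u v F []      μ = deleteℚ-0 u μ
delete-delete u v F (w ∷ κ) μ = begin
  deleteℚ u (λ ν → [ v ≡ w ] * F κ ν + s * deleteℚ v (λ ξ → F (w ∷ ξ) ν) κ) μ
    ≡⟨ deleteℚ-+ u (λ ν → [ v ≡ w ] * F κ ν) (λ ν → s * deleteℚ v (λ ξ → F (w ∷ ξ) ν) κ) μ ⟩
  deleteℚ u (λ ν → [ v ≡ w ] * F κ ν) μ + deleteℚ u (λ ν → s * deleteℚ v (λ ξ → F (w ∷ ξ) ν) κ) μ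
    ≡⟨ cong₂ _+_ (deleteℚ-· u [ v ≡ w ] (F κ) μ) (deleteℚ-· u s (λ ν → deleteℚ v (λ ξ → F (w ∷ ξ) ν) κ) μ) ⟩
  [ v ≡ w ] * deleteℚ u (F κ) μ + s * deleteℚ u (λ ν → deleteℚ v (λ ξ → F (w ∷ ξ) ν) κ) μ
    ≡⟨ cong (λ x → [ v ≡ w ] * deleteℚ u (F κ) μ + s * x) (delete-delete u v (λ ξ → F (w ∷ ξ)) κ μ) ⟩
  [ v ≡ w ] * deleteℚ u (F κ) μ + s * deleteℚ v (λ ξ → deleteℚ u (F (w ∷ ξ)) μ) κ ∎
  where
  open ≡-Reasoning
  s : ℚ
  s = sgn (∣ v ∣₁ ℙ.* ∣ w ∣₁)

[≡]-sym : ∀ u v → [ u ≡ v ] ≡ [ v ≡ u ]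
[≡]-sym u v with u ≟ v
... | yes ≡.refl = ≡.refl
... | no u≢v     = ≡.trans ([≢]-zero u≢v) (sym ([≢]-zero λ v≡u → u≢v (sym v≡u)))

-- Expansion along the second word in place of the first, as a determinant may be expanded along a
-- column instead of a row.
matchings-∷ʳ : ∀ κ v μ → matchings κ (v ∷ μ) ≡ deleteℚ v (λ ξ → matchings ξ μ) κ
matchings-∷ʳ []      v μ = ≡.refl
matchings-∷ʳ (u ∷ κ) v μ = cong₂ _+_ (cong (_* matchings κ μ) ([≡]-sym u v)) (cong₂ _*_
  (cong sgn (ℙₚ.*-comm ∣ u ∣₁ ∣ v ∣₁))
  (≡.trans (deleteℚ-ext u μ (matchings-∷ʳ κ v)) (delete-delete u v matchings κ μ)))

matchings-sym : ∀ κ μ → matchings κ μ ≡ matchings μ κ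
matchings-sym []      []      = ≡.refl
matchings-sym []      (v ∷ μ) = ≡.refl
matchings-sym (u ∷ κ) μ       = ≡.trans (deleteℚ-ext u μ (matchings-sym κ)) (sym (matchings-∷ʳ μ u κ))

-- A letter outside `A` finds no partner in `κ`. This serves `spanned-below`, where the alphabet is
-- finite and a word may leave it.
matchings-outside : ∀ {A} κ μ → All (_∈ A) κ → ¬ All (_∈ A) μ → matchings κ μ ≡ 0ℚ
matchings-outside κ []      κ⊆ μ⊈ = contradiction [] μ⊈
matchings-outside {A} κ (v ∷ μ) κ⊆ μ⊈ = ≡.trans (matchings-∷ʳ κ v μ) zeroᵥ
  where
  open DecMembership _≟_ using (_∈?_)
  zeroᵥ : deleteℚ v (λ ξ → matchings ξ μ) κ ≡ 0ℚ
  zeroᵥ with v ∈? A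
  ... | no  v∉ = deleteℚ-vanish v _ κ (All.map (λ { w∈ ≡.refl → v∉ w∈ }) κ⊆)
  ... | yes v∈ = ≡.trans
    (deleteℚ-cong v κ λ { α w β ≡.refl →
      matchings-outside (α ++ β) μ (proj₂ (All-delete α κ⊆)) λ μ⊆ → μ⊈ (v∈ ∷ μ⊆) })
    (deleteℚ-0 v κ)

-- Only the rearrangements of μ contribute, and these are equal up to sign.
average : ∀ V {A} → Unique A → ∀ k {Φ} → Delete.Supersymmetric V Φ → ∀ μ → length μ ≡ k → All (_∈ A) μ →
  let open LeftModule V in
  Sum.sum V (words A k) (λ κ → matchings κ μ *ₗ Φ κ) ≈ᴹ (factorial k *ₗ Φ μ)
average V A! zero    S [] _ _ = LeftModule.+ᴹ-identityʳ V _
average V {A} A! (suc k) {Φ} S μ μ-length μ⊆ = begin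
  sum (words A (suc k)) (λ κ → matchings κ μ · Φ κ)
    ≈⟨ sum-product _∷_ A (words A k) _ ⟩
  sum A (λ u → sum (words A k) (λ κ → deleteℚ u (matchings κ) μ · Φ (u ∷ κ)))
    -- Scaling the fixed vector `Φ (u ∷ κ)` is linear in the scalar, so the deletion can be moved
    -- outside the sum over `κ`.
    ≈⟨ sum-ext A (λ u → ≈ᴹ-sym (≈ᴹ-trans (delete-sum u (words A k) _ μ)
         (sum-ext (words A k) λ κ → delete-natural (multiples {V} (Φ (u ∷ κ))) u (matchings κ) μ))) ⟩
  sum A (λ u → delete u (λ ν → sum (words A k) (λ κ → matchings κ ν · Φ (u ∷ κ))) μ)
    ≈⟨ sum-ext A (λ u → delete-cong u μ λ { α v β ≡.refl →
         average V A! k (λ π → S (prep u π)) (α ++ β)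
           (ℕₚ.suc-injective (≡.trans (sym (length-delete α v β)) μ-length)) (proj₂ (All-delete α μ⊆)) }) ⟩
  sum A (λ u → delete u (λ ν → factorial k · Φ (u ∷ ν)) μ)
    ≈⟨ delete-collect A! μ (λ u ν → factorial k · Φ (u ∷ ν)) (factorial k · Φ μ) μ⊆ front ⟩
  natural (length μ) · (factorial k · Φ μ)
    ≈⟨ *ₗ-assoc (natural (length μ)) (factorial k) (Φ μ) ⟨
  (natural (length μ) * factorial k) · Φ μ
    ≈⟨ ·-congˡ (Φ μ) (cong (λ l → natural l * factorial k) μ-length) ⟩
  factorial (suc k) · Φ μ ∎
  where
  open LeftModule V
  open Sum V
  open Delete V
  open SetoidReasoning ≈ᴹ-setoid
  front : ∀ α u β → μ ≡ α ++ u ∷ β →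
    (sgn (∣ u ∣₁ ℙ.* ∣ α ∣ₘ) · (factorial k · Φ (u ∷ α ++ β))) ≈ᴹ (factorial k · Φ μ)
  front α u β ≡.refl = ≈ᴹ-trans (·-comm _ (factorial k) _) (·-congʳ (factorial k) (≈ᴹ-sym (≈ᴹ-trans
    (S (proj₁ (shift α u β))) (·-congˡ _ (cong sgn (proj₂ (shift α u β)))))))

reciprocal-factorial : ℕ → ℚ
reciprocal-factorial k = proj₁ (factorial-invertible k)

average⁻¹ : ∀ V {A} → Unique A → ∀ {Φ} → Delete.Supersymmetric V Φ → ∀ μ → All (_∈ A) μ →
  let open LeftModule V in
  Sum.sum V (words A (length μ)) (λ κ → (reciprocal-factorial (length μ) * matchings κ μ) *ₗ Φ κ) ≈ᴹ Φ μ
average⁻¹ V {A} A! {Φ} S μ μ⊆ = begin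
  sum (words A k) (λ κ → (r * matchings κ μ) · Φ κ)
    ≈⟨ sum-ext (words A k) (λ κ → *ₗ-assoc r (matchings κ μ) (Φ κ)) ⟩
  sum (words A k) (λ κ → r · (matchings κ μ · Φ κ))
    ≈⟨ sum-· (words A k) r _ ⟩
  r · sum (words A k) (λ κ → matchings κ μ · Φ κ)
    ≈⟨ ·-congʳ r (average V A! k S μ ≡.refl μ⊆) ⟩
  r · (factorial k · Φ μ)
    ≈⟨ *ₗ-assoc r (factorial k) (Φ μ) ⟨
  (r * factorial k) · Φ μ
    ≈⟨ ·-congˡ (Φ μ) (proj₂ (factorial-invertible k)) ⟩
  1ℚ · Φ μ
    ≈⟨ *ₗ-identityˡ (Φ μ) ⟩
  Φ μ ∎
  where
  open LeftModule V
  open Sum V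
  open SetoidReasoning ≈ᴹ-setoid
  k : ℕ
  k = length μ
  r : ℚ
  r = reciprocal-factorial k

-- average⁻¹ with the roles of the words exchanged and a range of summation that does
-- not depend on the word.
reproduce : ∀ V {A} → Unique A → ∀ n {Φ} → Delete.Supersymmetric V Φ → ∀ κ → length κ ℕ.< n → All (_∈ A) κ →
  let open LeftModule V in
  Sum.sum V (upTo n) (λ k → Sum.sum V (words A k) (λ μ → (reciprocal-factorial k * matchings κ μ) *ₗ Φ μ)) ≈ᴹ Φ κ
reproduce V {A} A! n {Φ} S κ κ<n κ⊆ = begin
  sum (upTo n) (λ k → sum (words A k) (λ μ → (reciprocal-factorial k * matchings κ μ) · Φ μ))
    ≈⟨ sum-single (Uniqueₚ.upTo⁺ n) (∈-upTo⁺ κ<n) (λ k k≢ → sum-vanish (words A k) λ μ μ∈ → ≈ᴹ-trans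
         (·-congˡ (Φ μ) (≡.trans (cong (reciprocal-factorial k *_) (matchings-length κ μ λ eq →
           k≢ (sym (≡.trans eq (words-length A k μ∈))))) (ℚₚ.*-zeroʳ (reciprocal-factorial k))))
         (*ₗ-zeroˡ (Φ μ))) ⟩
  sum (words A (length κ)) (λ μ → (reciprocal-factorial (length κ) * matchings κ μ) · Φ μ)
    ≈⟨ sum-ext (words A (length κ)) (λ μ → ·-congˡ (Φ μ) (cong (reciprocal-factorial (length κ) *_) (matchings-sym κ μ))) ⟩
  sum (words A (length κ)) (λ μ → (reciprocal-factorial (length κ) * matchings μ κ) · Φ μ)
    ≈⟨ average⁻¹ V A! S κ κ⊆ ⟩
  Φ κ ∎
  where
  open LeftModule V
  open Sum V
  open SetoidReasoning ≈ᴹ-setoid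

-- Products of power series

module ℚ-sum = Sum ℚ-space

sum-splitsℕ : ∀ a (h : ℕ × ℕ → ℚ) → sumOver (splitsℕ (suc a)) h
  ≡ h (0 , suc a) + sumOver (splitsℕ a) (λ ij → h (suc (proj₁ ij) , proj₂ ij))
sum-splitsℕ a h = cong (h (0 , suc a) +_) (ℚ-sum.sum-map _ (splitsℕ a) h)

-- `splitsℕ` recurses through the first component; this is the mirror recursion through the second,
-- by which the components can be exchanged inductively.
sum-splitsℕ-last : ∀ a (h : ℕ × ℕ → ℚ) → sumOver (splitsℕ (suc a)) h
  ≡ h (suc a , 0) + sumOver (splitsℕ a) (λ ij → h (proj₁ ij , suc (proj₂ ij)))
sum-splitsℕ-last zero    h = swap₂ (h (0 , 1)) (h (1 , 0))
  where
  swap₂ : ∀ x y → x + (y + 0ℚ) ≡ y + (x + 0ℚ)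
  swap₂ = solve 2 (λ x y → x :+ (y :+ con 0ℚ) := y :+ (x :+ con 0ℚ)) ≡.refl
sum-splitsℕ-last (suc a) h = begin
  sumOver (splitsℕ (suc (suc a))) h
    ≡⟨ sum-splitsℕ (suc a) h ⟩
  h (0 , suc (suc a)) + sumOver (splitsℕ (suc a)) h₁
    ≡⟨ cong (h (0 , suc (suc a)) +_) (sum-splitsℕ-last a h₁) ⟩
  h (0 , suc (suc a)) + (h (suc (suc a) , 0) + sumOver (splitsℕ a) h₁₂)
    ≡⟨ swap₃ (h (0 , suc (suc a))) (h (suc (suc a) , 0)) (sumOver (splitsℕ a) h₁₂) ⟩
  h (suc (suc a) , 0) + (h (0 , suc (suc a)) + sumOver (splitsℕ a) h₁₂)
    ≡⟨ cong (h (suc (suc a) , 0) +_) (sum-splitsℕ a h₂) ⟨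
  h (suc (suc a) , 0) + sumOver (splitsℕ (suc a)) h₂ ∎
  where
  open ≡-Reasoning
  h₁ h₂ h₁₂ : ℕ × ℕ → ℚ
  h₁ ij = h (suc (proj₁ ij) , proj₂ ij)
  h₂ ij = h (proj₁ ij , suc (proj₂ ij))
  h₁₂ ij = h (suc (proj₁ ij) , suc (proj₂ ij))
  swap₃ : ∀ x y z → x + (y + z) ≡ y + (x + z)
  swap₃ = solve 3 (λ x y z → x :+ (y :+ z) := y :+ (x :+ z)) ≡.refl

splitsℕ-comm : ∀ a (h : ℕ → ℕ → ℚ) →
  sumOver (splitsℕ a) (λ ij → h (proj₁ ij) (proj₂ ij)) ≡ sumOver (splitsℕ a) (λ ij → h (proj₂ ij) (proj₁ ij))
splitsℕ-comm zero    h = ≡.refl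
splitsℕ-comm (suc a) h = begin
  sumOver (splitsℕ (suc a)) (λ ij → h (proj₁ ij) (proj₂ ij))
    ≡⟨ sum-splitsℕ a (λ ij → h (proj₁ ij) (proj₂ ij)) ⟩
  h 0 (suc a) + sumOver (splitsℕ a) (λ ij → h (suc (proj₁ ij)) (proj₂ ij))
    ≡⟨ cong (h 0 (suc a) +_) (splitsℕ-comm a (λ i j → h (suc i) j)) ⟩
  h 0 (suc a) + sumOver (splitsℕ a) (λ ij → h (suc (proj₂ ij)) (proj₁ ij))
    ≡⟨ sum-splitsℕ-last a (λ ij → h (proj₂ ij) (proj₁ ij)) ⟨
  sumOver (splitsℕ (suc a)) (λ ij → h (proj₂ ij) (proj₁ ij)) ∎
  where open ≡-Reasoning

-- Both sides run over the triples with sum `a`; the induction separates those whose first entry is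
-- 0.
splitsℕ-assoc : ∀ a (h : ℕ → ℕ → ℕ → ℚ) →
  sumOver (splitsℕ a) (λ ij → sumOver (splitsℕ (proj₁ ij)) (λ kl → h (proj₁ kl) (proj₂ kl) (proj₂ ij)))
  ≡ sumOver (splitsℕ a) (λ ij → sumOver (splitsℕ (proj₂ ij)) (λ kl → h (proj₁ ij) (proj₁ kl) (proj₂ kl)))
splitsℕ-assoc zero    h = ≡.refl
splitsℕ-assoc (suc a) h = begin
  sumOver (splitsℕ (suc a)) L
    ≡⟨ sum-splitsℕ a L ⟩
  (h 0 0 (suc a) + 0ℚ) + sumOver (splitsℕ a) (λ ij → sumOver (splitsℕ (suc (proj₁ ij))) (λ kl → h (proj₁ kl) (proj₂ kl) (proj₂ ij)))
    ≡⟨ cong ((h 0 0 (suc a) + 0ℚ) +_) (≡.trans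
         (ℚ-sum.sum-ext (splitsℕ a) λ ij → sum-splitsℕ (proj₁ ij) (λ kl → h (proj₁ kl) (proj₂ kl) (proj₂ ij)))
         (sum-+ (splitsℕ a) (λ ij → h 0 (suc (proj₁ ij)) (proj₂ ij)) L₁)) ⟩
  (h 0 0 (suc a) + 0ℚ) + (A + sumOver (splitsℕ a) L₁)
    ≡⟨ cong (λ x → (h 0 0 (suc a) + 0ℚ) + (A + x)) (splitsℕ-assoc a (λ k → h (suc k))) ⟩
  (h 0 0 (suc a) + 0ℚ) + (A + B)
    ≡⟨ regroup (h 0 0 (suc a)) A B ⟩
  (h 0 0 (suc a) + A) + B
    ≡⟨ cong (_+ B) (sum-splitsℕ a (λ kl → h 0 (proj₁ kl) (proj₂ kl))) ⟨
  sumOver (splitsℕ (suc a)) (λ kl → h 0 (proj₁ kl) (proj₂ kl)) + B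
    ≡⟨ sum-splitsℕ a R ⟨
  sumOver (splitsℕ (suc a)) R ∎
  where
  open ≡-Reasoning
  L L₁ R : ℕ × ℕ → ℚ
  L ij = sumOver (splitsℕ (proj₁ ij)) (λ kl → h (proj₁ kl) (proj₂ kl) (proj₂ ij))
  L₁ ij = sumOver (splitsℕ (proj₁ ij)) (λ kl → h (suc (proj₁ kl)) (proj₂ kl) (proj₂ ij))
  R ij = sumOver (splitsℕ (proj₂ ij)) (λ kl → h (proj₁ ij) (proj₁ kl) (proj₂ kl))
  A B : ℚ
  A = sumOver (splitsℕ a) (λ ij → h 0 (suc (proj₁ ij)) (proj₂ ij))
  B = sumOver (splitsℕ a) (λ ij → sumOver (splitsℕ (proj₂ ij)) (λ kl → h (suc (proj₁ ij)) (proj₁ kl) (proj₂ kl)))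
  regroup : ∀ x y z → (x + 0ℚ) + (y + z) ≡ (x + y) + z
  regroup = solve 3 (λ x y z → (x :+ con 0ℚ) :+ (y :+ z) := (x :+ y) :+ z) ≡.refl

splitsθ-comm : ∀ b (h : Bool → Bool → ℚ) →
  sumOver (splitsθ b) (λ cd → h (proj₁ cd) (proj₂ cd)) ≡ sumOver (splitsθ b) (λ cd → h (proj₂ cd) (proj₁ cd))
splitsθ-comm false h = ≡.refl
splitsθ-comm true  h = swap₂ (h true false) (h false true)
  where
  swap₂ : ∀ x y → x + (y + 0ℚ) ≡ y + (x + 0ℚ)
  swap₂ = solve 2 (λ x y → x :+ (y :+ con 0ℚ) := y :+ (x :+ con 0ℚ)) ≡.refl

splitsθ-assoc : ∀ b (h : Bool → Bool → Bool → ℚ) →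
  sumOver (splitsθ b) (λ cd → sumOver (splitsθ (proj₁ cd)) (λ ef → h (proj₁ ef) (proj₂ ef) (proj₂ cd)))
  ≡ sumOver (splitsθ b) (λ cd → sumOver (splitsθ (proj₂ cd)) (λ ef → h (proj₁ cd) (proj₁ ef) (proj₂ ef)))
splitsθ-assoc false h = ≡.refl
splitsθ-assoc true  h = regroup (h true false false) (h false true false) (h false false true)
  where
  regroup : ∀ x y z → (x + (y + 0ℚ)) + ((z + 0ℚ) + 0ℚ) ≡ (x + 0ℚ) + ((y + (z + 0ℚ)) + 0ℚ)
  regroup = solve 3 (λ x y z → (x :+ (y :+ con 0ℚ)) :+ ((z :+ con 0ℚ) :+ con 0ℚ)
    := (x :+ con 0ℚ) :+ ((y :+ (z :+ con 0ℚ)) :+ con 0ℚ)) ≡.refl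

sum-splits : ∀ a b (h : Factor → Factor → ℚ) → sumOver (splits (a , b)) (λ vw → h (proj₁ vw) (proj₂ vw))
  ≡ sumOver (splitsℕ a) (λ ij → sumOver (splitsθ b) (λ cd → h (proj₁ ij , proj₁ cd) (proj₂ ij , proj₂ cd)))
sum-splits a b h = ℚ-sum.sum-product
  (λ ij cd → (proj₁ ij , proj₁ cd) , (proj₂ ij , proj₂ cd)) (splitsℕ a) (splitsθ b) (λ vw → h (proj₁ vw) (proj₂ vw))

splits-comm : ∀ u (h : Factor → Factor → ℚ) →
  sumOver (splits u) (λ vw → h (proj₁ vw) (proj₂ vw)) ≡ sumOver (splits u) (λ vw → h (proj₂ vw) (proj₁ vw))
splits-comm (a , b) h = begin
  sumOver (splits (a , b)) (λ vw → h (proj₁ vw) (proj₂ vw))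
    ≡⟨ sum-splits a b h ⟩
  sumOver (splitsℕ a) (λ ij → sumOver (splitsθ b) (λ cd → h (proj₁ ij , proj₁ cd) (proj₂ ij , proj₂ cd)))
    ≡⟨ splitsℕ-comm a (λ i j → sumOver (splitsθ b) (λ cd → h (i , proj₁ cd) (j , proj₂ cd))) ⟩
  sumOver (splitsℕ a) (λ ij → sumOver (splitsθ b) (λ cd → h (proj₂ ij , proj₁ cd) (proj₁ ij , proj₂ cd)))
    ≡⟨ ℚ-sum.sum-ext (splitsℕ a) (λ ij → splitsθ-comm b (λ c d → h (proj₂ ij , c) (proj₁ ij , d))) ⟩
  sumOver (splitsℕ a) (λ ij → sumOver (splitsθ b) (λ cd → h (proj₂ ij , proj₂ cd) (proj₁ ij , proj₁ cd)))
    ≡⟨ sum-splits a b (λ v w → h w v) ⟨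
  sumOver (splits (a , b)) (λ vw → h (proj₂ vw) (proj₁ vw)) ∎
  where open ≡-Reasoning

splits-assoc : ∀ u (h : Factor → Factor → Factor → ℚ) →
  sumOver (splits u) (λ vw → sumOver (splits (proj₁ vw)) (λ xy → h (proj₁ xy) (proj₂ xy) (proj₂ vw)))
  ≡ sumOver (splits u) (λ vw → sumOver (splits (proj₂ vw)) (λ xy → h (proj₁ vw) (proj₁ xy) (proj₂ xy)))
splits-assoc (a , b) h = begin
  sumOver (splits (a , b)) (λ vw → sumOver (splits (proj₁ vw)) (λ xy → h (proj₁ xy) (proj₂ xy) (proj₂ vw)))
    ≡⟨ sum-splits a b (λ v w → sumOver (splits v) (λ xy → h (proj₁ xy) (proj₂ xy) w)) ⟩
  sumOver (splitsℕ a) (λ ij → sumOver (splitsθ b) (λ cd → sumOver (splits (proj₁ ij , proj₁ cd)) (λ xy → h (proj₁ xy) (proj₂ xy) (proj₂ ij , proj₂ cd))))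
    ≡⟨ ℚ-sum.sum-ext (splitsℕ a) (λ ij → ≡.trans
         (ℚ-sum.sum-ext (splitsθ b) λ cd → sum-splits (proj₁ ij) (proj₁ cd) (λ x y → h x y (proj₂ ij , proj₂ cd)))
         (sum-swap (splitsθ b) (splitsℕ (proj₁ ij)) (λ cd kl → sumOver (splitsθ (proj₁ cd)) (λ ef →
           h (proj₁ kl , proj₁ ef) (proj₂ kl , proj₂ ef) (proj₂ ij , proj₂ cd))))) ⟩
  sumOver (splitsℕ a) (λ ij → sumOver (splitsℕ (proj₁ ij)) (λ kl → H (proj₁ kl) (proj₂ kl) (proj₂ ij)))
    ≡⟨ splitsℕ-assoc a H ⟩
  sumOver (splitsℕ a) (λ ij → sumOver (splitsℕ (proj₂ ij)) (λ kl → H (proj₁ ij) (proj₁ kl) (proj₂ kl)))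
    ≡⟨ ℚ-sum.sum-ext (splitsℕ a) (λ ij → ≡.trans
         (ℚ-sum.sum-ext (splitsℕ (proj₂ ij)) λ kl →
           splitsθ-assoc b (λ e f d → h (proj₁ ij , e) (proj₁ kl , f) (proj₂ kl , d)))
         (≡.trans (sum-swap (splitsℕ (proj₂ ij)) (splitsθ b) (λ kl cd → sumOver (splitsθ (proj₂ cd)) (λ ef →
             h (proj₁ ij , proj₁ cd) (proj₁ kl , proj₁ ef) (proj₂ kl , proj₂ ef))))
           (ℚ-sum.sum-ext (splitsθ b) λ cd → sym (sum-splits (proj₂ ij) (proj₂ cd) (λ x y → h (proj₁ ij , proj₁ cd) x y))))) ⟩
  sumOver (splitsℕ a) (λ ij → sumOver (splitsθ b) (λ cd → sumOver (splits (proj₂ ij , proj₂ cd)) (λ xy → h (proj₁ ij , proj₁ cd) (proj₁ xy) (proj₂ xy))))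
    ≡⟨ sum-splits a b (λ v w → sumOver (splits w) (λ xy → h v (proj₁ xy) (proj₂ xy))) ⟨
  sumOver (splits (a , b)) (λ vw → sumOver (splits (proj₂ vw)) (λ xy → h (proj₁ vw) (proj₁ xy) (proj₂ xy))) ∎
  where
  open ≡-Reasoning
  H : ℕ → ℕ → ℕ → ℚ
  H k l j = sumOver (splitsθ b) (λ cd → sumOver (splitsθ (proj₁ cd)) (λ ef → h (k , proj₁ ef) (l , proj₂ ef) (j , proj₂ cd)))

splitsθ-odd : ∀ b {cd} → cd ∈ splitsθ b → ∀ i j → ∣ i , proj₁ cd ∣₁ ℙ.* ∣ j , proj₂ cd ∣₁ ≡ 0ℙ
splitsθ-odd false (here ≡.refl)         i j = ≡.refl
splitsθ-odd true  (here ≡.refl)         i j = ≡.refl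
splitsθ-odd true  (there (here ≡.refl)) i j = ≡.refl

-- θ² = 0
splits-odd : ∀ u {vw} → vw ∈ splits u → ∣ proj₁ vw ∣₁ ℙ.* ∣ proj₂ vw ∣₁ ≡ 0ℙ
splits-odd (a , b) vw∈ with ∈-cartesianProductWith⁻ _ (splitsℕ a) (splitsθ b) vw∈
... | ij , cd , ij∈ , cd∈ , ≡.refl = splitsθ-odd b cd∈ (proj₁ ij) (proj₂ ij)

one₁ : Factor → ℚ
one₁ u = isZero (deg₁ u)

one : Monomial → ℚ
one m = isZero (degree m)

one-∷ : ∀ u m → one (u ∷ m) ≡ one₁ u * one m
one-∷ (zero , false)  m = sym (ℚₚ.*-identityˡ (one m))
one-∷ (zero , true)   m = sym (ℚₚ.*-zeroˡ (one m))
one-∷ (suc a , b)     m = sym (ℚₚ.*-zeroˡ (one m))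

splitsℕ-unitˡ : ∀ a (h : ℕ → ℕ → ℚ) → (∀ i j → h (suc i) j ≡ 0ℚ) →
  sumOver (splitsℕ a) (λ ij → h (proj₁ ij) (proj₂ ij)) ≡ h 0 a
splitsℕ-unitˡ zero    h p = ℚₚ.+-identityʳ (h 0 0)
splitsℕ-unitˡ (suc a) h p = ≡.trans (sum-splitsℕ a (λ ij → h (proj₁ ij) (proj₂ ij)))
  (≡.trans (cong (h 0 (suc a) +_) (ℚ-sum.sum-vanish (splitsℕ a) {λ ij → h (suc (proj₁ ij)) (proj₂ ij)} λ ij _ → p (proj₁ ij) (proj₂ ij)))
    (ℚₚ.+-identityʳ (h 0 (suc a))))

splits-unitˡ : ∀ u (h : Factor → ℚ) →
  sumOver (splits u) (λ vw → one₁ (proj₁ vw) * h (proj₂ vw)) ≡ h u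
splits-unitˡ (a , b) h = ≡.trans (sum-splits a b (λ v w → one₁ v * h w))
  (≡.trans (splitsℕ-unitˡ a (λ i j → sumOver (splitsθ b) (λ cd → one₁ (i , proj₁ cd) * h (j , proj₂ cd)))
    λ i j → ℚ-sum.sum-vanish (splitsθ b) λ cd _ → ℚₚ.*-zeroˡ (h (j , proj₂ cd)))
    (unitθ b))
  where
  unitθ : ∀ b → sumOver (splitsθ b) (λ cd → one₁ (0 , proj₁ cd) * h (a , proj₂ cd)) ≡ h (a , b)
  unitθ false = ≡.trans (ℚₚ.+-identityʳ (1ℚ * h (a , false))) (ℚₚ.*-identityˡ (h (a , false)))
  unitθ true  = collapse (h (a , false)) (h (a , true))
    where
    collapse : ∀ x y → 0ℚ * x + (1ℚ * y + 0ℚ) ≡ y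
    collapse = solve 2 (λ x y → con 0ℚ :* x :+ (con 1ℚ :* y :+ con 0ℚ) := y) ≡.refl

splits-unitʳ : ∀ u (h : Factor → ℚ) →
  sumOver (splits u) (λ vw → h (proj₁ vw) * one₁ (proj₂ vw)) ≡ h u
splits-unitʳ u h = ≡.trans (splits-comm u (λ v w → h v * one₁ w))
  (≡.trans (ℚ-sum.sum-ext (splits u) λ vw → ℚₚ.*-comm (h (proj₂ vw)) (one₁ (proj₁ vw))) (splits-unitˡ u h))

HasParity : Parity → (Monomial → ℚ) → Set
HasParity p G = ∀ m → G m ≡ 0ℚ ⊎ ∣ m ∣ₘ ≡ p

-- Where `G m` is nonzero the parity of `m` is known, and elsewhere both sides vanish. A sign that
-- varies with the monomial is thereby replaced by a constant one.
sgn-parity : ∀ {p G} → HasParity p G → ∀ q m → sgn (∣ m ∣ₘ ℙ.* q) * G m ≡ sgn (p ℙ.* q) * G m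
sgn-parity {p} {G} h q m with h m
... | inj₁ Gm≡0   = ≡.trans (cong (sgn (∣ m ∣ₘ ℙ.* q) *_) Gm≡0) (≡.trans (ℚₚ.*-zeroʳ (sgn (∣ m ∣ₘ ℙ.* q)))
  (sym (≡.trans (cong (sgn (p ℙ.* q) *_) Gm≡0) (ℚₚ.*-zeroʳ (sgn (p ℙ.* q))))))
... | inj₂ ≡.refl = ≡.refl

one₁-support : ∀ u → one₁ u ≡ 0ℚ ⊎ u ≡ (0 , false)
one₁-support (zero , false) = inj₂ ≡.refl
one₁-support (zero , true)  = inj₁ ≡.refl
one₁-support (suc a , b)    = inj₁ ≡.refl

sgn-one₁ : ∀ u q → sgn (∣ u ∣₁ ℙ.* q) * one₁ u ≡ one₁ u
sgn-one₁ u q with one₁-support u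
... | inj₁ u≡0    = ≡.trans (cong (sgn (∣ u ∣₁ ℙ.* q) *_) u≡0) (≡.trans (ℚₚ.*-zeroʳ (sgn (∣ u ∣₁ ℙ.* q))) (sym u≡0))
... | inj₂ ≡.refl = ≡.refl

one-support : ∀ m → one m ≡ 0ℚ ⊎ (∣ m ∣ₘ ≡ 0ℙ × degree m ≡ 0)
one-support []      = inj₂ (≡.refl , ≡.refl)
one-support (u ∷ m) with one₁-support u
... | inj₁ u≡0    = inj₁ (≡.trans (one-∷ u m) (≡.trans (cong (_* one m) u≡0) (ℚₚ.*-zeroˡ (one m))))
... | inj₂ ≡.refl = one-support m

one-parity : HasParity 0ℙ one
one-parity m with one-support m
... | inj₁ m≡0       = inj₁ m≡0
... | inj₂ (∣m∣ , _) = inj₂ ∣m∣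

one-symmetric : ∀ {m n} (π : m ↭ n) → one m ≡ sgn (inversions π) * one n
one-symmetric {m} {n} π = begin
  one m                             ≡⟨ ℚₚ.*-identityˡ (one m) ⟨
  1ℚ * one m                        ≡⟨ SymmetricFunction.symmetric (constant 1ℚ) π ⟩
  sgn (inversions π) * (1ℚ * one n) ≡⟨ cong (sgn (inversions π) *_) (ℚₚ.*-identityˡ (one n)) ⟩
  sgn (inversions π) * one n        ∎
  where open ≡-Reasoning

-- Associativity, supercommutativity and unit law for `∑⟨_⟩`

+-interchangeℙ : ∀ p q r s → (p ℙ.+ q) ℙ.+ (r ℙ.+ s) ≡ (p ℙ.+ r) ℙ.+ (q ℙ.+ s)
+-interchangeℙ p q r s = begin
  (p ℙ.+ q) ℙ.+ (r ℙ.+ s) ≡⟨ ℙₚ.+-assoc p q (r ℙ.+ s) ⟩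
  p ℙ.+ (q ℙ.+ (r ℙ.+ s)) ≡⟨ cong (p ℙ.+_) (ℙₚ.+-assoc q r s) ⟨
  p ℙ.+ ((q ℙ.+ r) ℙ.+ s) ≡⟨ cong (λ x → p ℙ.+ (x ℙ.+ s)) (ℙₚ.+-comm q r) ⟩
  p ℙ.+ ((r ℙ.+ q) ℙ.+ s) ≡⟨ cong (p ℙ.+_) (ℙₚ.+-assoc r q s) ⟩
  p ℙ.+ (r ℙ.+ (q ℙ.+ s)) ≡⟨ ℙₚ.+-assoc p r (q ℙ.+ s) ⟨
  (p ℙ.+ r) ℙ.+ (q ℙ.+ s) ∎
  where open ≡-Reasoning

-- Counterpart of `∑-cong` that remembers parities instead of degrees, for the comparison of signs.
∑-congᵖ : ∀ m {F G} → (∀ m₁ m₂ → ∣ m ∣ₘ ≡ ∣ m₁ ∣ₘ ℙ.+ ∣ m₂ ∣ₘ → F m₁ m₂ ≡ G m₁ m₂) → ∑⟨ m ⟩ F ≡ ∑⟨ m ⟩ G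
∑-congᵖ []      p = p [] [] ≡.refl
∑-congᵖ (u ∷ m) p = sum-cong (splits u) λ vw vw∈ → ∑-congᵖ m λ m₁ m₂ eq →
  cong (sgn (∣ m₁ ∣ₘ ℙ.* ∣ proj₂ vw ∣₁) *_) (p _ _ (begin
    ∣ u ∷ m ∣ₘ
      ≡⟨ ∣∣-∷ u m ⟩
    ∣ u ∣₁ ℙ.+ ∣ m ∣ₘ
      ≡⟨ cong₂ ℙ._+_ (splits-parity u vw∈) eq ⟩
    (∣ proj₁ vw ∣₁ ℙ.+ ∣ proj₂ vw ∣₁) ℙ.+ (∣ m₁ ∣ₘ ℙ.+ ∣ m₂ ∣ₘ)
      ≡⟨ +-interchangeℙ ∣ proj₁ vw ∣₁ ∣ proj₂ vw ∣₁ ∣ m₁ ∣ₘ ∣ m₂ ∣ₘ ⟩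
    (∣ proj₁ vw ∣₁ ℙ.+ ∣ m₁ ∣ₘ) ℙ.+ (∣ proj₂ vw ∣₁ ℙ.+ ∣ m₂ ∣ₘ)
      ≡⟨ cong₂ ℙ._+_ (∣∣-∷ (proj₁ vw) m₁) (∣∣-∷ (proj₂ vw) m₂) ⟨
    ∣ proj₁ vw ∷ m₁ ∣ₘ ℙ.+ ∣ proj₂ vw ∷ m₂ ∣ₘ ∎))
  where open ≡-Reasoning

∑-sum : ∀ m (xs : List I) (F : I → Monomial → Monomial → ℚ) →
  ∑⟨ m ⟩ (λ m₁ m₂ → sumOver xs (λ x → F x m₁ m₂)) ≡ sumOver xs (λ x → ∑⟨ m ⟩ (F x))
∑-sum m []       F = ∑-zero m
∑-sum m (x ∷ xs) F = ≡.trans (∑-+ m (F x) (λ m₁ m₂ → sumOver xs (λ x → F x m₁ m₂)))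
  (cong (∑⟨ m ⟩ (F x) +_) (∑-sum m xs F))

-- Either order of splitting gives the triple x m₁, y m₂, w m₃ the sign with exponent (|m₁| +
-- |m₂|)|w| + |m₁||y|. This common form is `G`, and the rest is associativity of `splits`.
∑-assoc : ∀ m (F : Monomial → Monomial → Monomial → ℚ) →
  ∑⟨ m ⟩ (λ n m₃ → ∑⟨ n ⟩ (λ m₁ m₂ → F m₁ m₂ m₃)) ≡ ∑⟨ m ⟩ (λ m₁ n → ∑⟨ n ⟩ (λ m₂ m₃ → F m₁ m₂ m₃))
∑-assoc []      F = ≡.refl
∑-assoc (u ∷ m) F = begin
  ∑⟨ u ∷ m ⟩ (λ n m₃ → ∑⟨ n ⟩ (λ m₁ m₂ → F m₁ m₂ m₃))
    ≡⟨ ℚ-sum.sum-ext (splits u) (λ vw → ≡.trans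
         (∑-ext m λ n m₃ → left vw n m₃)
         (∑-sum m (splits (proj₁ vw)) λ xy n m₃ → ∑⟨ n ⟩ λ m₁ m₂ → G (proj₁ xy) (proj₂ xy) (proj₂ vw) m₁ m₂ m₃)) ⟩
  sumOver (splits u) (λ vw → sumOver (splits (proj₁ vw)) λ xy →
    ∑⟨ m ⟩ λ n m₃ → ∑⟨ n ⟩ λ m₁ m₂ → G (proj₁ xy) (proj₂ xy) (proj₂ vw) m₁ m₂ m₃)
    ≡⟨ ℚ-sum.sum-ext (splits u) (λ vw → ℚ-sum.sum-ext (splits (proj₁ vw)) λ xy →
         ∑-assoc m (G (proj₁ xy) (proj₂ xy) (proj₂ vw))) ⟩
  sumOver (splits u) (λ vw → sumOver (splits (proj₁ vw)) λ xy → T (proj₁ xy) (proj₂ xy) (proj₂ vw))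
    ≡⟨ splits-assoc u T ⟩
  sumOver (splits u) (λ vw → sumOver (splits (proj₂ vw)) λ xy → T (proj₁ vw) (proj₁ xy) (proj₂ xy))
    ≡⟨ ℚ-sum.sum-ext (splits u) (λ vw → ≡.trans
         (sym (∑-sum m (splits (proj₂ vw)) λ xy m₁ n → ∑⟨ n ⟩ λ m₂ m₃ → G (proj₁ vw) (proj₁ xy) (proj₂ xy) m₁ m₂ m₃))
         (∑-ext m λ m₁ n → sym (right vw m₁ n))) ⟩
  ∑⟨ u ∷ m ⟩ (λ m₁ n → ∑⟨ n ⟩ (λ m₂ m₃ → F m₁ m₂ m₃)) ∎
  where
  open ≡-Reasoning
  G : Factor → Factor → Factor → Monomial → Monomial → Monomial → ℚ
  G x y w m₁ m₂ m₃ = sgn ((∣ m₁ ∣ₘ ℙ.+ ∣ m₂ ∣ₘ) ℙ.* ∣ w ∣₁) * (sgn (∣ m₁ ∣ₘ ℙ.* ∣ y ∣₁) * F (x ∷ m₁) (y ∷ m₂) (w ∷ m₃))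
  T : Factor → Factor → Factor → ℚ
  T x y w = ∑⟨ m ⟩ λ m₁ n → ∑⟨ n ⟩ λ m₂ m₃ → G x y w m₁ m₂ m₃
  pull : ∀ s u n (H : Monomial → Monomial → ℚ) → s * ∑⟨ u ∷ n ⟩ H
    ≡ sumOver (splits u) (λ xy → ∑⟨ n ⟩ λ m₁ m₂ → s * extendBy H xy m₁ m₂)
  pull s u n H = ≡.trans (sym (sum-* (splits u) s (λ xy → ∑⟨ n ⟩ (extendBy H xy))))
    (ℚ-sum.sum-ext (splits u) λ xy → sym (∑-* n s (extendBy H xy)))
  left : ∀ vw n m₃ → sgn (∣ n ∣ₘ ℙ.* ∣ proj₂ vw ∣₁) * ∑⟨ proj₁ vw ∷ n ⟩ (λ m₁ m₂ → F m₁ m₂ (proj₂ vw ∷ m₃))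
    ≡ sumOver (splits (proj₁ vw)) (λ xy → ∑⟨ n ⟩ λ m₁ m₂ → G (proj₁ xy) (proj₂ xy) (proj₂ vw) m₁ m₂ m₃)
  left (v , w) n m₃ = ≡.trans (pull (sgn (∣ n ∣ₘ ℙ.* ∣ w ∣₁)) v n (λ m₁ m₂ → F m₁ m₂ (w ∷ m₃)))
    (ℚ-sum.sum-ext (splits v) λ xy → ∑-congᵖ n λ m₁ m₂ eq →
      cong (λ p → sgn (p ℙ.* ∣ w ∣₁) * extendBy (λ m₁ m₂ → F m₁ m₂ (w ∷ m₃)) xy m₁ m₂) eq)
  signs : ∀ p q y w c → sgn (p ℙ.* (y ℙ.+ w)) * (sgn (q ℙ.* w) * c) ≡ sgn ((p ℙ.+ q) ℙ.* w) * (sgn (p ℙ.* y) * c)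
  signs p q y w c rewrite sgn-distribˡ p y w | ℙₚ.*-distribʳ-+ w p q | sgn-+ (p ℙ.* w) (q ℙ.* w) =
    solve 4 (λ a b d c → (a :* b) :* (d :* c) := (b :* d) :* (a :* c)) ≡.refl
      (sgn (p ℙ.* y)) (sgn (p ℙ.* w)) (sgn (q ℙ.* w)) c
  right : ∀ vw m₁ n → sgn (∣ m₁ ∣ₘ ℙ.* ∣ proj₂ vw ∣₁) * ∑⟨ proj₂ vw ∷ n ⟩ (λ m₂ m₃ → F (proj₁ vw ∷ m₁) m₂ m₃)
    ≡ sumOver (splits (proj₂ vw)) (λ xy → ∑⟨ n ⟩ λ m₂ m₃ → G (proj₁ vw) (proj₁ xy) (proj₂ xy) m₁ m₂ m₃)
  right (x , z) m₁ n = ≡.trans (pull (sgn (∣ m₁ ∣ₘ ℙ.* ∣ z ∣₁)) z n (F (x ∷ m₁)))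
    (sum-cong (splits z) λ yw yw∈ → ∑-ext n λ m₂ m₃ → ≡.trans
      (cong (λ p → sgn (∣ m₁ ∣ₘ ℙ.* p) * extendBy (F (x ∷ m₁)) yw m₂ m₃) (splits-parity z yw∈))
      (signs ∣ m₁ ∣ₘ ∣ m₂ ∣ₘ ∣ proj₁ yw ∣₁ ∣ proj₂ yw ∣₁ (F (x ∷ m₁) (proj₁ yw ∷ m₂) (proj₂ yw ∷ m₃))))

-- The exchange sign of v m₁ and w m₂ has exponent |v||w| + |v||m₂| + |m₁||w| + |m₁||m₂|. Its first
-- term vanishes by `splits-odd`: the θ of a factor cannot go to both parts.
∑-comm : ∀ m (F : Monomial → Monomial → ℚ) → ∑⟨ m ⟩ F ≡ ∑⟨ m ⟩ (λ m₁ m₂ → sgn (∣ m₁ ∣ₘ ℙ.* ∣ m₂ ∣ₘ) * F m₂ m₁)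
∑-comm []      F = sym (ℚₚ.*-identityˡ (F [] []))
∑-comm (u ∷ m) F = begin
  sumOver (splits u) (λ vw → ∑⟨ m ⟩ (extendBy F vw))
    ≡⟨ ℚ-sum.sum-ext (splits u) (λ vw → ∑-comm m (extendBy F vw)) ⟩
  sumOver (splits u) (λ vw → T (proj₁ vw) (proj₂ vw))
    ≡⟨ splits-comm u T ⟩
  sumOver (splits u) (λ vw → T (proj₂ vw) (proj₁ vw))
    ≡⟨ sum-cong (splits u) (λ vw vw∈ → ∑-ext m λ m₁ m₂ → ≡.trans
         (signs ∣ m₁ ∣ₘ ∣ m₂ ∣ₘ ∣ proj₁ vw ∣₁ ∣ proj₂ vw ∣₁ (F (proj₂ vw ∷ m₂) (proj₁ vw ∷ m₁)) (splits-odd u vw∈))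
         (cong₂ (λ p q → sgn (∣ m₁ ∣ₘ ℙ.* ∣ proj₂ vw ∣₁) * (sgn (p ℙ.* q) * F (proj₂ vw ∷ m₂) (proj₁ vw ∷ m₁)))
           (sym (∣∣-∷ (proj₁ vw) m₁)) (sym (∣∣-∷ (proj₂ vw) m₂)))) ⟩
  ∑⟨ u ∷ m ⟩ (λ m₁ m₂ → sgn (∣ m₁ ∣ₘ ℙ.* ∣ m₂ ∣ₘ) * F m₂ m₁) ∎
  where
  open ≡-Reasoning
  T : Factor → Factor → ℚ
  T v w = ∑⟨ m ⟩ λ m₁ m₂ → sgn (∣ m₁ ∣ₘ ℙ.* ∣ m₂ ∣ₘ) * (sgn (∣ m₂ ∣ₘ ℙ.* ∣ w ∣₁) * F (v ∷ m₂) (w ∷ m₁))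
  signs : ∀ p q v w c → v ℙ.* w ≡ 0ℙ →
    sgn (p ℙ.* q) * (sgn (q ℙ.* v) * c) ≡ sgn (p ℙ.* w) * (sgn ((v ℙ.+ p) ℙ.* (w ℙ.+ q)) * c)
  signs p q v w c vw≡0
    rewrite sgn-distribˡ (v ℙ.+ p) w q | ℙₚ.*-distribʳ-+ w v p | ℙₚ.*-distribʳ-+ q v p
          | sgn-+ (v ℙ.* w) (p ℙ.* w) | sgn-+ (v ℙ.* q) (p ℙ.* q) | vw≡0 | ℙₚ.*-comm q v = sym (begin
    sgn (p ℙ.* w) * (((1ℚ * sgn (p ℙ.* w)) * (sgn (v ℙ.* q) * sgn (p ℙ.* q))) * c)
      ≡⟨ solve 4 (λ a b d c → a :* (((con 1ℚ :* a) :* (b :* d)) :* c) := (a :* a) :* (d :* (b :* c))) ≡.refl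
           (sgn (p ℙ.* w)) (sgn (v ℙ.* q)) (sgn (p ℙ.* q)) c ⟩
    (sgn (p ℙ.* w) * sgn (p ℙ.* w)) * (sgn (p ℙ.* q) * (sgn (v ℙ.* q) * c))
      ≡⟨ cong (_* (sgn (p ℙ.* q) * (sgn (v ℙ.* q) * c))) (sgn-self (p ℙ.* w)) ⟩
    1ℚ * (sgn (p ℙ.* q) * (sgn (v ℙ.* q) * c))
      ≡⟨ ℚₚ.*-identityˡ (sgn (p ℙ.* q) * (sgn (v ℙ.* q) * c)) ⟩
    sgn (p ℙ.* q) * (sgn (v ℙ.* q) * c) ∎)

∑-unitˡ : ∀ m (G : Monomial → ℚ) → ∑⟨ m ⟩ (λ m₁ m₂ → one m₁ * G m₂) ≡ G m
∑-unitˡ []      G = ℚₚ.*-identityˡ (G [])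
∑-unitˡ (u ∷ m) G = begin
  sumOver (splits u) (λ vw → ∑⟨ m ⟩ λ m₁ m₂ → sgn (∣ m₁ ∣ₘ ℙ.* ∣ proj₂ vw ∣₁) * (one (proj₁ vw ∷ m₁) * G (proj₂ vw ∷ m₂)))
    ≡⟨ ℚ-sum.sum-ext (splits u) (λ vw → ≡.trans
         (∑-ext m λ m₁ m₂ → term (proj₁ vw) (proj₂ vw) m₁ m₂)
         (≡.trans (∑-* m (one₁ (proj₁ vw)) (λ m₁ m₂ → one m₁ * G (proj₂ vw ∷ m₂)))
           (cong (one₁ (proj₁ vw) *_) (∑-unitˡ m (λ m₂ → G (proj₂ vw ∷ m₂)))))) ⟩
  sumOver (splits u) (λ vw → one₁ (proj₁ vw) * G (proj₂ vw ∷ m))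
    ≡⟨ splits-unitˡ u (λ w → G (w ∷ m)) ⟩
  G (u ∷ m) ∎
  where
  open ≡-Reasoning
  term : ∀ v w m₁ m₂ → sgn (∣ m₁ ∣ₘ ℙ.* ∣ w ∣₁) * (one (v ∷ m₁) * G (w ∷ m₂)) ≡ one₁ v * (one m₁ * G (w ∷ m₂))
  term v w m₁ m₂ = begin
    sgn (∣ m₁ ∣ₘ ℙ.* ∣ w ∣₁) * (one (v ∷ m₁) * G (w ∷ m₂))
      ≡⟨ cong (λ x → sgn (∣ m₁ ∣ₘ ℙ.* ∣ w ∣₁) * (x * G (w ∷ m₂))) (one-∷ v m₁) ⟩
    sgn (∣ m₁ ∣ₘ ℙ.* ∣ w ∣₁) * ((one₁ v * one m₁) * G (w ∷ m₂))
      ≡⟨ solve 4 (λ s a b g → s :* ((a :* b) :* g) := a :* ((s :* b) :* g)) ≡.refl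
           (sgn (∣ m₁ ∣ₘ ℙ.* ∣ w ∣₁)) (one₁ v) (one m₁) (G (w ∷ m₂)) ⟩
    one₁ v * ((sgn (∣ m₁ ∣ₘ ℙ.* ∣ w ∣₁) * one m₁) * G (w ∷ m₂))
      ≡⟨ cong (λ x → one₁ v * (x * G (w ∷ m₂))) (≡.trans (sgn-parity one-parity ∣ w ∣₁ m₁) (ℚₚ.*-identityˡ (one m₁))) ⟩
    one₁ v * (one m₁ * G (w ∷ m₂)) ∎

-- Power sums

letter-≢1 : ∀ u → letter u ≢ (0 , false)
letter-≢1 (k , true)  ()
letter-≢1 (k , false) ()

one₁-letter : ∀ u → one₁ (letter u) ≡ 0ℚ
one₁-letter (zero , true)   = ≡.refl
one₁-letter (suc k , true)  = ≡.refl
one₁-letter (k , false)     = ≡.refl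

-- The coefficients of the power sum Σᵢ u(xᵢ , θᵢ).
power : Factor → Monomial → ℚ
power u []      = 0ℚ
power u (v ∷ m) = [ letter u ≡ v ] * one m + one₁ v * power u m

power-∷-unit : ∀ u m → power u ((0 , false) ∷ m) ≡ power u m
power-∷-unit u m = ≡.trans
  (cong (λ x → x * one m + 1ℚ * power u m) ([≢]-zero (letter-≢1 u)))
  (collapse (one m) (power u m))
  where
  collapse : ∀ x y → 0ℚ * x + 1ℚ * y ≡ y
  collapse = solve 2 (λ x y → con 0ℚ :* x :+ con 1ℚ :* y := y) ≡.refl

power-∷-letter : ∀ u v m → power u (letter v ∷ m) ≡ [ letter u ≡ letter v ] * one m
power-∷-letter u v m = ≡.trans
  (cong (λ x → [ letter u ≡ letter v ] * one m + x * power u m) (one₁-letter v))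
  (≡.trans (cong ([ letter u ≡ letter v ] * one m +_) (ℚₚ.*-zeroˡ (power u m)))
    (ℚₚ.+-identityʳ ([ letter u ≡ letter v ] * one m)))

factor-view : ∀ v → v ≡ (0 , false) ⊎ ∃ λ u → v ≡ letter u
factor-view (zero , false)  = inj₁ ≡.refl
factor-view (suc k , false) = inj₂ ((k , false) , ≡.refl)
factor-view (k , true)      = inj₂ ((k , true) , ≡.refl)

power-support : ∀ u m → power u m ≡ 0ℚ ⊎ (∣ m ∣ₘ ≡ ∣ u ∣₁ × degree m ≡ deg₁ (letter u))
power-support u []      = inj₁ ≡.refl
power-support u (v ∷ m) with factor-view v
... | inj₁ ≡.refl with power-support u m
...   | inj₁ ≡0 = inj₁ (≡.trans (power-∷-unit u m) ≡0)
...   | inj₂ s  = inj₂ s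
power-support u (v ∷ m) | inj₂ (w , ≡.refl) with letter u ≟ letter w | one-support m
... | no  u≢w | _ = inj₁ (≡.trans (power-∷-letter u w m)
  (≡.trans (cong (_* one m) ([≢]-zero u≢w)) (ℚₚ.*-zeroˡ (one m))))
... | yes _   | inj₁ m≡0 = inj₁ (≡.trans (power-∷-letter u w m)
  (≡.trans (cong ([ letter u ≡ letter w ] *_) m≡0) (ℚₚ.*-zeroʳ [ letter u ≡ letter w ])))
... | yes u≡w | inj₂ (∣m∣≡0 , m≡0) = inj₂
  ( ≡.trans (∣∣-∷ (letter w) m) (≡.trans (cong₂ (λ v p → ∣ v ∣₁ ℙ.+ p) (sym u≡w) ∣m∣≡0) (ℙₚ.+-identityʳ ∣ u ∣₁))
  , ≡.trans (cong₂ (λ v d → deg₁ v ℕ.+ d) (sym u≡w) m≡0) (ℕₚ.+-identityʳ (deg₁ (letter u))) )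

power-parity : ∀ u → HasParity ∣ u ∣₁ (power u)
power-parity u m with power-support u m
... | inj₁ ≡0 = inj₁ ≡0
... | inj₂ s  = inj₂ (proj₁ s)

one-∷ʳ : ∀ m → one (m ∷ʳ (0 , false)) ≡ one m
one-∷ʳ m = cong isZero (deg-∷ʳ m)

power-stable : ∀ u m → power u (m ∷ʳ (0 , false)) ≡ power u m
power-stable u []      = power-∷-unit u []
power-stable u (v ∷ m) = cong₂ (λ x y → [ letter u ≡ v ] * x + one₁ v * y) (one-∷ʳ m) (power-stable u m)

power-symmetric : ∀ u {m n} (π : m ↭ n) → power u m ≡ sgn (inversions π) * power u n
power-symmetric u {m} refl = sym (ℚₚ.*-identityˡ (power u m))
power-symmetric u {_ ∷ m} {_ ∷ n} (prep v π) = begin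
  [ letter u ≡ v ] * one m + one₁ v * power u m
    ≡⟨ cong₂ (λ x y → [ letter u ≡ v ] * x + one₁ v * y) (one-symmetric π) (power-symmetric u π) ⟩
  [ letter u ≡ v ] * (sgn (inversions π) * one n) + one₁ v * (sgn (inversions π) * power u n)
    ≡⟨ solve 5 (λ a s x b y → a :* (s :* x) :+ b :* (s :* y) := s :* (a :* x :+ b :* y)) ≡.refl
         [ letter u ≡ v ] (sgn (inversions π)) (one n) (one₁ v) (power u n) ⟩
  sgn (inversions π) * ([ letter u ≡ v ] * one n + one₁ v * power u n) ∎
  where
  open ≡-Reasoning
power-symmetric u (trans {l} {m} {n} π ρ) = begin
  power u l
    ≡⟨ power-symmetric u π ⟩
  sgn (inversions π) * power u m
    ≡⟨ cong (sgn (inversions π) *_) (power-symmetric u ρ) ⟩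
  sgn (inversions π) * (sgn (inversions ρ) * power u n)
    ≡⟨ ℚₚ.*-assoc (sgn (inversions π)) (sgn (inversions ρ)) (power u n) ⟨
  (sgn (inversions π) * sgn (inversions ρ)) * power u n
    ≡⟨ cong (_* power u n) (sgn-+ (inversions π) (inversions ρ)) ⟨
  sgn (inversions π ℙ.+ inversions ρ) * power u n ∎
  where open ≡-Reasoning
power-symmetric u (swap {xs = m} {ys = n} v w π) = begin
  a * one (w ∷ m) + one₁ v * (b * one m + one₁ w * power u m)
    ≡⟨ cong₂ (λ x y → a * x + one₁ v * y) (≡.trans (one-∷ w m) (cong (one₁ w *_) (one-symmetric π)))
         (cong₂ (λ x y → b * x + one₁ w * y) (one-symmetric π) (power-symmetric u π)) ⟩
  a * (one₁ w * (t * one n)) + one₁ v * (b * (t * one n) + one₁ w * (t * power u n))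
    -- In every term one of the two exchanged factors is 1, hence even, so the exchange sign `s` may
    -- be inserted.
    ≡⟨ cong₂ (λ x y → a * (x * (t * one n)) + y * (b * (t * one n) + one₁ w * (t * power u n)))
         (sym s-w) (sym (sgn-one₁ v ∣ w ∣₁)) ⟩
  a * ((s * one₁ w) * (t * one n)) + (s * one₁ v) * (b * (t * one n) + one₁ w * (t * power u n))
    ≡⟨ solve 8 (λ a b x y s t o p →
         a :* ((s :* y) :* (t :* o)) :+ (s :* x) :* (b :* (t :* o) :+ y :* (t :* p))
           := (s :* t) :* (b :* (x :* o) :+ y :* (a :* o :+ x :* p))) ≡.refl
         a b (one₁ v) (one₁ w) s t (one n) (power u n) ⟩
  (s * t) * (b * (one₁ v * one n) + one₁ w * (a * one n + one₁ v * power u n))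
    ≡⟨ cong₂ (λ x y → x * (b * y + one₁ w * (a * one n + one₁ v * power u n)))
         (sgn-+ (∣ v ∣₁ ℙ.* ∣ w ∣₁) (inversions π)) (one-∷ v n) ⟨
  sgn ((∣ v ∣₁ ℙ.* ∣ w ∣₁) ℙ.+ inversions π) * (b * one (v ∷ n) + one₁ w * (a * one n + one₁ v * power u n)) ∎
  where
  open ≡-Reasoning
  a b s t : ℚ
  a = [ letter u ≡ v ]
  b = [ letter u ≡ w ]
  s = sgn (∣ v ∣₁ ℙ.* ∣ w ∣₁)
  t = sgn (inversions π)
  s-w : s * one₁ w ≡ one₁ w
  s-w = ≡.trans (cong (λ p → sgn p * one₁ w) (ℙₚ.*-comm ∣ v ∣₁ ∣ w ∣₁)) (sgn-one₁ w ∣ v ∣₁)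

powerSum : Factor → SymmetricFunction
powerSum u = mkSymmetricFunction (power u) record
  { stable = power-stable u
  ; symmetric = power-symmetric u
  ; bounded = deg₁ (letter u) , λ m u<m → bounded m u<m (power-support u m)
  }
  where
  bounded : ∀ m → deg₁ (letter u) ℕ.< degree m →
    power u m ≡ 0ℚ ⊎ (∣ m ∣ₘ ≡ ∣ u ∣₁ × degree m ≡ deg₁ (letter u)) → power u m ≡ 0ℚ
  bounded m u<m (inj₁ ≡0)      = ≡0
  bounded m u<m (inj₂ (_ , d)) = contradiction u<m (ℕₚ.<-irrefl (sym d))

-- The sum of G over the monomials obtained by moving a divisor u of a factor to the
-- front and cancelling it.
divide : Factor → (Monomial → ℚ) → Monomial → ℚ
divide u G []      = 0ℚ
divide u G (x ∷ m) = sumOver (splits x) (λ vw → [ letter u ≡ proj₁ vw ] * G (proj₂ vw ∷ m))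
  + sgn (∣ u ∣₁ ℙ.* ∣ x ∣₁) * divide u (λ n → G (x ∷ n)) m

-- The power sum either takes its whole letter from the first factor, and then 1 from all others, or
-- takes 1 from it. Multiplication by a power sum thus becomes a recursion along the monomial, of
-- the same shape as `delete`.
∑-power : ∀ u m (G : Monomial → ℚ) → ∑⟨ m ⟩ (λ m₁ m₂ → power u m₁ * G m₂) ≡ divide u G m
∑-power u []      G = ℚₚ.*-zeroˡ (G [])
∑-power u (x ∷ m) G = begin
  sumOver (splits x) (λ vw → ∑⟨ m ⟩ λ m₁ m₂ → sgn (∣ m₁ ∣ₘ ℙ.* ∣ proj₂ vw ∣₁) * (power u (proj₁ vw ∷ m₁) * G (proj₂ vw ∷ m₂)))
    ≡⟨ ℚ-sum.sum-ext (splits x) (λ vw → term (proj₁ vw) (proj₂ vw)) ⟩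
  sumOver (splits x) (λ vw → [ letter u ≡ proj₁ vw ] * G (proj₂ vw ∷ m)
    + one₁ (proj₁ vw) * (sgn (∣ u ∣₁ ℙ.* ∣ proj₂ vw ∣₁) * divide u (λ n → G (proj₂ vw ∷ n)) m))
    ≡⟨ sum-+ (splits x) (λ vw → [ letter u ≡ proj₁ vw ] * G (proj₂ vw ∷ m))
         (λ vw → one₁ (proj₁ vw) * (sgn (∣ u ∣₁ ℙ.* ∣ proj₂ vw ∣₁) * divide u (λ n → G (proj₂ vw ∷ n)) m)) ⟩
  sumOver (splits x) (λ vw → [ letter u ≡ proj₁ vw ] * G (proj₂ vw ∷ m))
    + sumOver (splits x) (λ vw → one₁ (proj₁ vw) * (sgn (∣ u ∣₁ ℙ.* ∣ proj₂ vw ∣₁) * divide u (λ n → G (proj₂ vw ∷ n)) m))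
    ≡⟨ cong (sumOver (splits x) (λ vw → [ letter u ≡ proj₁ vw ] * G (proj₂ vw ∷ m)) +_)
         (splits-unitˡ x (λ w → sgn (∣ u ∣₁ ℙ.* ∣ w ∣₁) * divide u (λ n → G (w ∷ n)) m)) ⟩
  divide u G (x ∷ m) ∎
  where
  open ≡-Reasoning
  term : ∀ v w → ∑⟨ m ⟩ (λ m₁ m₂ → sgn (∣ m₁ ∣ₘ ℙ.* ∣ w ∣₁) * (power u (v ∷ m₁) * G (w ∷ m₂)))
    ≡ [ letter u ≡ v ] * G (w ∷ m) + one₁ v * (sgn (∣ u ∣₁ ℙ.* ∣ w ∣₁) * divide u (λ n → G (w ∷ n)) m)
  term v w = begin
    ∑⟨ m ⟩ (λ m₁ m₂ → sgn (∣ m₁ ∣ₘ ℙ.* ∣ w ∣₁) * (power u (v ∷ m₁) * G (w ∷ m₂)))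
      ≡⟨ ∑-ext m pointwise ⟩
    ∑⟨ m ⟩ (λ m₁ m₂ → a * (one m₁ * G (w ∷ m₂)) + (one₁ v * s) * (power u m₁ * G (w ∷ m₂)))
      ≡⟨ ∑-+ m (λ m₁ m₂ → a * (one m₁ * G (w ∷ m₂))) (λ m₁ m₂ → (one₁ v * s) * (power u m₁ * G (w ∷ m₂))) ⟩
    ∑⟨ m ⟩ (λ m₁ m₂ → a * (one m₁ * G (w ∷ m₂))) + ∑⟨ m ⟩ (λ m₁ m₂ → (one₁ v * s) * (power u m₁ * G (w ∷ m₂)))
      ≡⟨ cong₂ _+_ (∑-* m a (λ m₁ m₂ → one m₁ * G (w ∷ m₂))) (∑-* m (one₁ v * s) (λ m₁ m₂ → power u m₁ * G (w ∷ m₂))) ⟩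
    a * ∑⟨ m ⟩ (λ m₁ m₂ → one m₁ * G (w ∷ m₂)) + (one₁ v * s) * ∑⟨ m ⟩ (λ m₁ m₂ → power u m₁ * G (w ∷ m₂))
      ≡⟨ cong₂ (λ x y → a * x + (one₁ v * s) * y) (∑-unitˡ m (λ n → G (w ∷ n))) (∑-power u m (λ n → G (w ∷ n))) ⟩
    a * G (w ∷ m) + (one₁ v * s) * divide u (λ n → G (w ∷ n)) m
      ≡⟨ cong (a * G (w ∷ m) +_) (ℚₚ.*-assoc (one₁ v) s (divide u (λ n → G (w ∷ n)) m)) ⟩
    a * G (w ∷ m) + one₁ v * (s * divide u (λ n → G (w ∷ n)) m) ∎
    where
    a s : ℚ
    a = [ letter u ≡ v ]
    s = sgn (∣ u ∣₁ ℙ.* ∣ w ∣₁)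
    pointwise : ∀ m₁ m₂ → sgn (∣ m₁ ∣ₘ ℙ.* ∣ w ∣₁) * ((a * one m₁ + one₁ v * power u m₁) * G (w ∷ m₂))
      ≡ a * (one m₁ * G (w ∷ m₂)) + (one₁ v * s) * (power u m₁ * G (w ∷ m₂))
    pointwise m₁ m₂ = begin
      t * ((a * one m₁ + one₁ v * power u m₁) * G (w ∷ m₂))
        ≡⟨ solve 6 (λ t a o b p g → t :* ((a :* o :+ b :* p) :* g) := a :* ((t :* o) :* g) :+ b :* ((t :* p) :* g)) ≡.refl
             t a (one m₁) (one₁ v) (power u m₁) (G (w ∷ m₂)) ⟩
      a * ((t * one m₁) * G (w ∷ m₂)) + one₁ v * ((t * power u m₁) * G (w ∷ m₂))
        ≡⟨ cong₂ (λ x y → a * (x * G (w ∷ m₂)) + one₁ v * (y * G (w ∷ m₂)))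
             (≡.trans (sgn-parity one-parity ∣ w ∣₁ m₁) (ℚₚ.*-identityˡ (one m₁))) (sgn-parity (power-parity u) ∣ w ∣₁ m₁) ⟩
      a * (one m₁ * G (w ∷ m₂)) + one₁ v * ((s * power u m₁) * G (w ∷ m₂))
        ≡⟨ solve 6 (λ a o g b s p → a :* (o :* g) :+ b :* ((s :* p) :* g) := a :* (o :* g) :+ (b :* s) :* (p :* g)) ≡.refl
             a (one m₁) (G (w ∷ m₂)) (one₁ v) s (power u m₁) ⟩
      a * (one m₁ * G (w ∷ m₂)) + (one₁ v * s) * (power u m₁ * G (w ∷ m₂)) ∎
      where
      t : ℚ
      t = sgn (∣ m₁ ∣ₘ ℙ.* ∣ w ∣₁)

-- The product of symmetric functions

_≈Λ_ : SymmetricFunction → SymmetricFunction → Set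
f ≈Λ g = f ≈[ Λ-space ] g

module Λᴹ = LeftModule Λ-space

infixr 7 _·Λ_
_·Λ_ : ℚ → SymmetricFunction → SymmetricFunction
_·Λ_ = Λᴹ._*ₗ_

𝟙 : SymmetricFunction
𝟙 = constant 1ℚ

coeff-𝟙 : ∀ m → coeff 𝟙 m ≡ one m
coeff-𝟙 m = ℚₚ.*-identityˡ (one m)

product-congˡ : ∀ g {f f′} → f ≈Λ f′ → product f g ≈Λ product f′ g
product-congˡ g f≈ m = ∑-ext m λ m₁ m₂ → cong (_* coeff g m₂) (f≈ m₁)

product-·ˡ : ∀ r f g → product (r ·Λ f) g ≈Λ (r ·Λ product f g)
product-·ˡ r f g m = ≡.trans (∑-ext m λ m₁ m₂ → ℚₚ.*-assoc r (coeff f m₁) (coeff g m₂))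
  (∑-* m r (λ m₁ m₂ → coeff f m₁ * coeff g m₂))

product-assoc : ∀ f g h → product (product f g) h ≈Λ product f (product g h)
product-assoc f g h m = begin
  ∑⟨ m ⟩ (λ n m₃ → ∑⟨ n ⟩ (λ m₁ m₂ → coeff f m₁ * coeff g m₂) * coeff h m₃)
    ≡⟨ ∑-ext m (λ n m₃ → ≡.trans (ℚₚ.*-comm (coeff (product f g) n) (coeff h m₃))
         (≡.trans (sym (∑-* n (coeff h m₃) (λ m₁ m₂ → coeff f m₁ * coeff g m₂)))
           (∑-ext n λ m₁ m₂ → rotate (coeff f m₁) (coeff g m₂) (coeff h m₃)))) ⟩
  ∑⟨ m ⟩ (λ n m₃ → ∑⟨ n ⟩ (λ m₁ m₂ → coeff f m₁ * (coeff g m₂ * coeff h m₃)))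
    ≡⟨ ∑-assoc m (λ m₁ m₂ m₃ → coeff f m₁ * (coeff g m₂ * coeff h m₃)) ⟩
  ∑⟨ m ⟩ (λ m₁ n → ∑⟨ n ⟩ (λ m₂ m₃ → coeff f m₁ * (coeff g m₂ * coeff h m₃)))
    ≡⟨ ∑-ext m (λ m₁ n → ∑-* n (coeff f m₁) (λ m₂ m₃ → coeff g m₂ * coeff h m₃)) ⟩
  ∑⟨ m ⟩ (λ m₁ n → coeff f m₁ * ∑⟨ n ⟩ (λ m₂ m₃ → coeff g m₂ * coeff h m₃)) ∎
  where
  open ≡-Reasoning
  rotate : ∀ x y z → z * (x * y) ≡ x * (y * z)
  rotate = solve 3 (λ x y z → z :* (x :* y) := x :* (y :* z)) ≡.refl

product-identityˡ : ∀ f → product 𝟙 f ≈Λ f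
product-identityˡ f m = ≡.trans (∑-ext m λ m₁ m₂ → cong (_* coeff f m₂) (coeff-𝟙 m₁)) (∑-unitˡ m (coeff f))

product-comm : ∀ {p q} f g → HasParity p (coeff f) → HasParity q (coeff g) →
  product f g ≈Λ (sgn (p ℙ.* q) ·Λ product g f)
product-comm {p} {q} f g fₚ gₚ m = begin
  ∑⟨ m ⟩ (λ m₁ m₂ → coeff f m₁ * coeff g m₂)
    ≡⟨ ∑-comm m (λ m₁ m₂ → coeff f m₁ * coeff g m₂) ⟩
  ∑⟨ m ⟩ (λ m₁ m₂ → sgn (∣ m₁ ∣ₘ ℙ.* ∣ m₂ ∣ₘ) * (coeff f m₂ * coeff g m₁))
    ≡⟨ ∑-ext m (λ m₁ m₂ → begin
         sgn (∣ m₁ ∣ₘ ℙ.* ∣ m₂ ∣ₘ) * (coeff f m₂ * coeff g m₁)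
           ≡⟨ solve 3 (λ s x y → s :* (x :* y) := x :* (s :* y)) ≡.refl (sgn (∣ m₁ ∣ₘ ℙ.* ∣ m₂ ∣ₘ)) (coeff f m₂) (coeff g m₁) ⟩
         coeff f m₂ * (sgn (∣ m₁ ∣ₘ ℙ.* ∣ m₂ ∣ₘ) * coeff g m₁)
           ≡⟨ cong (coeff f m₂ *_) (sgn-parity gₚ ∣ m₂ ∣ₘ m₁) ⟩
         coeff f m₂ * (sgn (q ℙ.* ∣ m₂ ∣ₘ) * coeff g m₁)
           ≡⟨ solve 3 (λ s x y → x :* (s :* y) := (s :* x) :* y) ≡.refl (sgn (q ℙ.* ∣ m₂ ∣ₘ)) (coeff f m₂) (coeff g m₁) ⟩
         (sgn (q ℙ.* ∣ m₂ ∣ₘ) * coeff f m₂) * coeff g m₁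
           ≡⟨ cong (λ r → (sgn r * coeff f m₂) * coeff g m₁) (ℙₚ.*-comm q ∣ m₂ ∣ₘ) ⟩
         (sgn (∣ m₂ ∣ₘ ℙ.* q) * coeff f m₂) * coeff g m₁
           ≡⟨ cong (_* coeff g m₁) (sgn-parity fₚ q m₂) ⟩
         (sgn (p ℙ.* q) * coeff f m₂) * coeff g m₁
           ≡⟨ solve 3 (λ s x y → (s :* x) :* y := s :* (y :* x)) ≡.refl (sgn (p ℙ.* q)) (coeff f m₂) (coeff g m₁) ⟩
         sgn (p ℙ.* q) * (coeff g m₁ * coeff f m₂) ∎) ⟩
  ∑⟨ m ⟩ (λ m₁ m₂ → sgn (p ℙ.* q) * (coeff g m₁ * coeff f m₂))
    ≡⟨ ∑-* m (sgn (p ℙ.* q)) (λ m₁ m₂ → coeff g m₁ * coeff f m₂) ⟩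
  sgn (p ℙ.* q) * coeff (product g f) m ∎
  where
  open ≡-Reasoning

product-parity : ∀ {p q} f g → HasParity p (coeff f) → HasParity q (coeff g) → HasParity (p ℙ.+ q) (coeff (product f g))
product-parity {p} {q} f g fₚ gₚ m with ∣ m ∣ₘ ℙₚ.≟ p ℙ.+ q
... | yes m≡ = inj₂ m≡
... | no  m≢ = inj₁ (≡.trans (∑-congᵖ m λ m₁ m₂ m≡ → vanish m₁ m₂ m≡ (fₚ m₁) (gₚ m₂)) (∑-zero m))
  where
  vanish : ∀ m₁ m₂ → ∣ m ∣ₘ ≡ ∣ m₁ ∣ₘ ℙ.+ ∣ m₂ ∣ₘ → coeff f m₁ ≡ 0ℚ ⊎ ∣ m₁ ∣ₘ ≡ p → coeff g m₂ ≡ 0ℚ ⊎ ∣ m₂ ∣ₘ ≡ q →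
    coeff f m₁ * coeff g m₂ ≡ 0ℚ
  vanish m₁ m₂ m≡ (inj₁ f≡0) _          = ≡.trans (cong (_* coeff g m₂) f≡0) (ℚₚ.*-zeroˡ (coeff g m₂))
  vanish m₁ m₂ m≡ (inj₂ _)   (inj₁ g≡0) = ≡.trans (cong (coeff f m₁ *_) g≡0) (ℚₚ.*-zeroʳ (coeff f m₁))
  vanish m₁ m₂ m≡ (inj₂ f≡)  (inj₂ g≡)  = contradiction (≡.trans m≡ (cong₂ ℙ._+_ f≡ g≡)) m≢

product-identityʳ : ∀ f → product f 𝟙 ≈Λ f
product-identityʳ f m = begin
  ∑⟨ m ⟩ (λ m₁ m₂ → coeff f m₁ * coeff 𝟙 m₂)
    -- The sign of the exchange is absorbed by the even factor 1, so the right unit law follows from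
    -- the left one for any `f`, homogeneous or not.
    ≡⟨ ∑-comm m (λ m₁ m₂ → coeff f m₁ * coeff 𝟙 m₂) ⟩
  ∑⟨ m ⟩ (λ m₁ m₂ → sgn (∣ m₁ ∣ₘ ℙ.* ∣ m₂ ∣ₘ) * (coeff f m₂ * coeff 𝟙 m₁))
    ≡⟨ ∑-ext m (λ m₁ m₂ → begin
         sgn (∣ m₁ ∣ₘ ℙ.* ∣ m₂ ∣ₘ) * (coeff f m₂ * coeff 𝟙 m₁)
           ≡⟨ cong (λ x → sgn (∣ m₁ ∣ₘ ℙ.* ∣ m₂ ∣ₘ) * (coeff f m₂ * x)) (coeff-𝟙 m₁) ⟩
         sgn (∣ m₁ ∣ₘ ℙ.* ∣ m₂ ∣ₘ) * (coeff f m₂ * one m₁)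
           ≡⟨ solve 3 (λ s x o → s :* (x :* o) := (s :* o) :* x) ≡.refl (sgn (∣ m₁ ∣ₘ ℙ.* ∣ m₂ ∣ₘ)) (coeff f m₂) (one m₁) ⟩
         (sgn (∣ m₁ ∣ₘ ℙ.* ∣ m₂ ∣ₘ) * one m₁) * coeff f m₂
           ≡⟨ cong (_* coeff f m₂) (≡.trans (sgn-parity one-parity ∣ m₂ ∣ₘ m₁) (ℚₚ.*-identityˡ (one m₁))) ⟩
         one m₁ * coeff f m₂ ∎) ⟩
  ∑⟨ m ⟩ (λ m₁ m₂ → one m₁ * coeff f m₂)
    ≡⟨ ∑-unitˡ m (coeff f) ⟩
  coeff f m ∎
  where
  open ≡-Reasoning

infix 10 _∙ₗ
_∙ₗ : SymmetricFunction → Λ-space ⟶ Λ-space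
f ∙ₗ = Λ-mult ∘ₗ insertˡ f

iterate : ∀ {V} → (Factor → V ⟶ V) → ∣ V ∣ → Word → ∣ V ∣
iterate L x []      = x
iterate L x (u ∷ κ) = ⟦ L u ⟧ (iterate L x κ)

Supercommute : ∀ {V} → (Factor → V ⟶ V) → Set
Supercommute {V} L = ∀ u v x →
  ⟦ L u ⟧ (⟦ L v ⟧ x) ≈[ V ] LeftModule._*ₗ_ V (sgn (∣ u ∣₁ ℙ.* ∣ v ∣₁)) (⟦ L v ⟧ (⟦ L u ⟧ x))

-- A rearrangement is built from adjacent exchanges, each of which costs the sign in `Supercommute`.
-- Supercommuting operators thus supply the functions of words to which the universal property
-- applies.
iterate-supersymmetric : ∀ {V} {L : Factor → V ⟶ V} → Supercommute L → ∀ x → Delete.Supersymmetric V (iterate L x)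
iterate-supersymmetric {V} {L} c x {μ} refl = LeftModule.≈ᴹ-sym V (LeftModule.*ₗ-identityˡ V (iterate L x μ))
iterate-supersymmetric {V} {L} c x (prep u π) = LeftModule.≈ᴹ-trans V
  (_⟶_.⟦⟧-cong (L u) (iterate-supersymmetric {V} {L} c x π)) (_⟶_.*ₗ-homo (L u) _ _)
iterate-supersymmetric {V} {L} c x (swap {xs = μ} {ys = ν} u v π) = begin
  ⟦ L u ⟧ (⟦ L v ⟧ (iterate L x μ))
    ≈⟨ c u v (iterate L x μ) ⟩
  s · ⟦ L v ⟧ (⟦ L u ⟧ (iterate L x μ))
    ≈⟨ ·-congʳ s (≈ᴹ-trans
         (_⟶_.⟦⟧-cong (L v ∘ₗ L u) (iterate-supersymmetric {V} {L} c x π))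
         (_⟶_.*ₗ-homo (L v ∘ₗ L u) t (iterate L x ν))) ⟩
  s · t · ⟦ L v ⟧ (⟦ L u ⟧ (iterate L x ν))
    ≈⟨ *ₗ-assoc s t _ ⟨
  (s * t) · ⟦ L v ⟧ (⟦ L u ⟧ (iterate L x ν))
    ≈⟨ ·-congˡ _ (sgn-+ (∣ u ∣₁ ℙ.* ∣ v ∣₁) (inversions π)) ⟨
  sgn ((∣ u ∣₁ ℙ.* ∣ v ∣₁) ℙ.+ inversions π) · ⟦ L v ⟧ (⟦ L u ⟧ (iterate L x ν)) ∎
  where
  open LeftModule V
  open Sum V
  open SetoidReasoning ≈ᴹ-setoid
  s t : ℚ
  s = sgn (∣ u ∣₁ ℙ.* ∣ v ∣₁)
  t = sgn (inversions π)
iterate-supersymmetric {V} {L} c x (trans {κ} {μ} {ν} π ρ) = begin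
  iterate L x κ
    ≈⟨ iterate-supersymmetric {V} {L} c x π ⟩
  sgn (inversions π) · iterate L x μ
    ≈⟨ ·-congʳ _ (iterate-supersymmetric {V} {L} c x ρ) ⟩
  sgn (inversions π) · sgn (inversions ρ) · iterate L x ν
    ≈⟨ *ₗ-assoc _ _ _ ⟨
  (sgn (inversions π) * sgn (inversions ρ)) · iterate L x ν
    ≈⟨ ·-congˡ _ (sgn-+ (inversions π) (inversions ρ)) ⟨
  sgn (inversions π ℙ.+ inversions ρ) · iterate L x ν ∎
  where
  open LeftModule V
  open Sum V
  open SetoidReasoning ≈ᴹ-setoid

powers : Word → SymmetricFunction
powers = iterate (λ u → powerSum u ∙ₗ) 𝟙

powerSum-swap : Supercommute (λ u → powerSum u ∙ₗ)
powerSum-swap u v f m = begin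
  coeff (product (powerSum u) (product (powerSum v) f)) m
    ≡⟨ product-assoc (powerSum u) (powerSum v) f m ⟨
  coeff (product (product (powerSum u) (powerSum v)) f) m
    ≡⟨ product-congˡ f {product (powerSum u) (powerSum v)} {s ·Λ product (powerSum v) (powerSum u)}
         (product-comm (powerSum u) (powerSum v) (power-parity u) (power-parity v)) m ⟩
  coeff (product (s ·Λ product (powerSum v) (powerSum u)) f) m
    ≡⟨ product-·ˡ s (product (powerSum v) (powerSum u)) f m ⟩
  s * coeff (product (product (powerSum v) (powerSum u)) f) m
    ≡⟨ cong (s *_) (product-assoc (powerSum v) (powerSum u) f m) ⟩
  s * coeff (product (powerSum v) (product (powerSum u) f)) m ∎
  where
  open ≡-Reasoning
  s : ℚ
  s = sgn (∣ u ∣₁ ℙ.* ∣ v ∣₁)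

powers-supersymmetric : Delete.Supersymmetric Λ-space powers
powers-supersymmetric = iterate-supersymmetric {L = λ u → powerSum u ∙ₗ} powerSum-swap 𝟙

𝟙-parity : HasParity 0ℙ (coeff 𝟙)
𝟙-parity m with one-parity m
... | inj₁ ≡0  = inj₁ (≡.trans (coeff-𝟙 m) ≡0)
... | inj₂ ∣m∣ = inj₂ ∣m∣

powers-parity : ∀ κ → HasParity ∣ κ ∣ₘ (coeff (powers κ))
powers-parity []      = 𝟙-parity
powers-parity (u ∷ κ) = ≡.subst (λ p → HasParity p (coeff (powers (u ∷ κ)))) (sym (∣∣-∷ u κ))
  (product-parity (powerSum u) (powers κ) (power-parity u) (powers-parity κ))

-- Symmetric functions as functions of words

module _ (f : SymmetricFunction) where

  -- `stable` concerns a factor 1 at the end only; being even, it moves to the front without a sign.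
  coeff-unit-∷ : ∀ m → coeff f ((0 , false) ∷ m) ≡ coeff f m
  coeff-unit-∷ m = sym (begin
    coeff f m
      ≡⟨ SymmetricFunction.stable f m ⟨
    coeff f (m ++ (0 , false) ∷ [])
      ≡⟨ SymmetricFunction.symmetric f (proj₁ π) ⟩
    sgn (inversions (proj₁ π)) * coeff f ((0 , false) ∷ (m ++ []))
      ≡⟨ cong₂ (λ p n → sgn p * coeff f ((0 , false) ∷ n)) (proj₂ π) (Listₚ.++-identityʳ m) ⟩
    1ℚ * coeff f ((0 , false) ∷ m)
      ≡⟨ ℚₚ.*-identityˡ (coeff f ((0 , false) ∷ m)) ⟩
    coeff f ((0 , false) ∷ m) ∎)
    where
    open ≡-Reasoning
    π = shift m (0 , false) []

  coeff-unit : ∀ α β → coeff f (α ++ (0 , false) ∷ β) ≡ coeff f (α ++ β)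
  coeff-unit α β = begin
    coeff f (α ++ (0 , false) ∷ β)
      ≡⟨ SymmetricFunction.symmetric f (proj₁ π) ⟩
    sgn (inversions (proj₁ π)) * coeff f ((0 , false) ∷ α ++ β)
      ≡⟨ cong₂ (λ p x → sgn p * x) (proj₂ π) (coeff-unit-∷ (α ++ β)) ⟩
    1ℚ * coeff f (α ++ β)
      ≡⟨ ℚₚ.*-identityˡ (coeff f (α ++ β)) ⟩
    coeff f (α ++ β) ∎
    where
    open ≡-Reasoning
    π = shift α (0 , false) β

strip : Monomial → Word
strip []      = []
strip (v ∷ m) with factor-view v
... | inj₁ _       = strip m
... | inj₂ (u , _) = u ∷ strip m

-- The prefix `α` holds the letters already passed, so that `coeff-unit` can drop a 1 from the
-- middle of the monomial.
coeff-strip-++ : ∀ f α m → coeff f (α ++ m) ≡ coeff f (α ++ monomial (strip m))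
coeff-strip-++ f α []      = ≡.refl
coeff-strip-++ f α (v ∷ m) with factor-view v
... | inj₁ ≡.refl       = ≡.trans (coeff-unit f α m) (coeff-strip-++ f α m)
... | inj₂ (u , ≡.refl) = begin
  coeff f (α ++ letter u ∷ m)                       ≡⟨ cong (coeff f) (Listₚ.++-assoc α (letter u ∷ []) m) ⟨
  coeff f ((α ∷ʳ letter u) ++ m)                    ≡⟨ coeff-strip-++ f (α ∷ʳ letter u) m ⟩
  coeff f ((α ∷ʳ letter u) ++ monomial (strip m))   ≡⟨ cong (coeff f) (Listₚ.++-assoc α (letter u ∷ []) (monomial (strip m))) ⟩
  coeff f (α ++ letter u ∷ monomial (strip m))      ∎
  where open ≡-Reasoning

coeff-strip : ∀ f m → coeff f m ≡ coeff f (monomial (strip m))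
coeff-strip f = coeff-strip-++ f []

monomial-↭ : ∀ {μ ν} (π : μ ↭ ν) → Σ (monomial μ ↭ monomial ν) λ ρ → inversions ρ ≡ inversions π
monomial-↭ refl         = refl , ≡.refl
monomial-↭ (prep u π)   = prep (letter u) (proj₁ (monomial-↭ π)) , proj₂ (monomial-↭ π)
monomial-↭ (swap u v π) = swap (letter u) (letter v) (proj₁ (monomial-↭ π))
  , cong ((∣ u ∣₁ ℙ.* ∣ v ∣₁) ℙ.+_) (proj₂ (monomial-↭ π))
monomial-↭ (trans π ρ)  = trans (proj₁ (monomial-↭ π)) (proj₁ (monomial-↭ ρ))
  , cong₂ ℙ._+_ (proj₂ (monomial-↭ π)) (proj₂ (monomial-↭ ρ))

coeff-supersymmetric : ∀ f → Delete.Supersymmetric ℚ-space (λ μ → coeff f (monomial μ))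
coeff-supersymmetric f {μ} {ν} π = ≡.trans (SymmetricFunction.symmetric f (proj₁ (monomial-↭ π)))
  (cong (λ p → sgn p * coeff f (monomial ν)) (proj₂ (monomial-↭ π)))

letter-injective : ∀ u v → letter u ≡ letter v → u ≡ v
letter-injective (k , true)  (l , true)  ≡.refl = ≡.refl
letter-injective (k , false) (l , false) ≡.refl = ≡.refl

[letter≡] : ∀ u v → [ letter u ≡ letter v ] ≡ [ u ≡ v ]
[letter≡] u v with u ≟ v
... | yes ≡.refl = ≡.trans ([≡]-refl (letter u)) (sym ([≡]-refl u))
... | no  u≢v    = ≡.trans ([≢]-zero λ e → u≢v (letter-injective u v e)) (sym ([≢]-zero u≢v))

-- A letter that is divided by `u` either cancels, leaving 1, or leaves another letter. If the
-- second kind of term vanishes, division is deletion.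
divide-monomial : ∀ u (G : Monomial → ℚ) (Γ : Word → ℚ) μ →
  (∀ α y β → μ ≡ α ++ y ∷ β → G (monomial α ++ (0 , false) ∷ monomial β) ≡ Γ (α ++ β)) →
  (∀ α y z β → μ ≡ α ++ y ∷ β → G (monomial α ++ letter z ∷ monomial β) ≡ 0ℚ) →
  divide u G (monomial μ) ≡ deleteℚ u Γ μ
divide-monomial u G Γ []      cancel vanish = ≡.refl
divide-monomial u G Γ (y ∷ μ) cancel vanish = cong₂ _+_
  (begin
    sumOver (splits (letter y)) (λ vw → [ letter u ≡ proj₁ vw ] * G (proj₂ vw ∷ monomial μ))
      ≡⟨ ℚ-sum.sum-ext (splits (letter y)) (λ vw → only-unit (proj₁ vw) (proj₂ vw)) ⟩
    sumOver (splits (letter y)) (λ vw → ([ letter u ≡ proj₁ vw ] * G ((0 , false) ∷ monomial μ)) * one₁ (proj₂ vw))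
      ≡⟨ splits-unitʳ (letter y) (λ v → [ letter u ≡ v ] * G ((0 , false) ∷ monomial μ)) ⟩
    [ letter u ≡ letter y ] * G ((0 , false) ∷ monomial μ)
      ≡⟨ cong₂ _*_ ([letter≡] u y) (cancel [] y μ ≡.refl) ⟩
    [ u ≡ y ] * Γ μ ∎)
  (cong (sgn (∣ u ∣₁ ℙ.* ∣ y ∣₁) *_) (divide-monomial u (λ n → G (letter y ∷ n)) (λ ν → Γ (y ∷ ν)) μ
    (λ α x β e → cancel (y ∷ α) x β (cong (y ∷_) e))
    (λ α x z β e → vanish (y ∷ α) x z β (cong (y ∷_) e))))
  where
  open ≡-Reasoning
  only-unit : ∀ v w → [ letter u ≡ v ] * G (w ∷ monomial μ) ≡ ([ letter u ≡ v ] * G ((0 , false) ∷ monomial μ)) * one₁ w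
  only-unit v w with factor-view w
  ... | inj₁ ≡.refl       = sym (ℚₚ.*-identityʳ ([ letter u ≡ v ] * G ((0 , false) ∷ monomial μ)))
  ... | inj₂ (z , ≡.refl) = ≡.trans (cong ([ letter u ≡ v ] *_) (vanish [] y z μ ≡.refl))
    (≡.trans (ℚₚ.*-zeroʳ [ letter u ≡ v ])
      (sym (≡.trans (cong (([ letter u ≡ v ] * G ((0 , false) ∷ monomial μ)) *_) (one₁-letter z))
        (ℚₚ.*-zeroʳ ([ letter u ≡ v ] * G ((0 , false) ∷ monomial μ))))))

coeff-powerSum-∙ : ∀ u f m → coeff (product (powerSum u) f) m ≡ divide u (coeff f) m
coeff-powerSum-∙ u f m = ∑-power u m (coeff f)

-- A word that is not shorter than κ is a product of factors in powers κ only if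
-- every factor comes from one power sum.
coeff-powers : ∀ κ μ → length κ ℕ.≤ length μ → coeff (powers κ) (monomial μ) ≡ matchings κ μ
coeff-powers []      []      κ≤μ = ≡.refl
coeff-powers []      (y ∷ μ) κ≤μ = ≡.trans (coeff-𝟙 (monomial (y ∷ μ)))
  (≡.trans (one-∷ (letter y) (monomial μ)) (≡.trans (cong (_* one (monomial μ)) (one₁-letter y)) (ℚₚ.*-zeroˡ (one (monomial μ)))))
coeff-powers (u ∷ κ) μ       κ<μ = ≡.trans (coeff-powerSum-∙ u (powers κ) (monomial μ))
  (divide-monomial u (coeff (powers κ)) (matchings κ) μ
    (λ { α y β ≡.refl → ≡.trans (coeff-unit (powers κ) (monomial α) (monomial β))
      (≡.trans (cong (coeff (powers κ)) (sym (Listₚ.map-++ letter α β)))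
        (coeff-powers κ (α ++ β) (shorter α y β κ<μ))) })
    -- A letter that is divided without cancelling leaves a word still longer than `κ`, and words of
    -- different lengths have no matchings.
    (λ { α y z β ≡.refl → ≡.trans (cong (coeff (powers κ)) (sym (Listₚ.map-++ letter α (z ∷ β))))
      (≡.trans (coeff-powers κ (α ++ z ∷ β) (ℕₚ.<⇒≤ (longer α y z β κ<μ)))
        (matchings-length κ (α ++ z ∷ β) (ℕₚ.<⇒≢ (longer α y z β κ<μ)))) }))
  where
  shorter : ∀ α y β → suc (length κ) ℕ.≤ length (α ++ y ∷ β) → length κ ℕ.≤ length (α ++ β)
  shorter α y β l = ℕ.s≤s⁻¹ (≡.subst (suc (length κ) ℕ.≤_) (length-delete α y β) l)
  longer : ∀ α y z β → suc (length κ) ℕ.≤ length (α ++ y ∷ β) → length κ ℕ.< length (α ++ z ∷ β)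
  longer α y z β l = ≡.subst (suc (length κ) ℕ.≤_) (≡.trans (length-delete α y β) (sym (length-delete α z β))) l

-- The products of power sums form a basis

coefficient : Monomial → Λ-space ⟶ ℚ-space
coefficient m = mkLinear (λ f → coeff f m) (λ f≈ → f≈ m) (λ _ _ → ≡.refl) (λ _ _ → ≡.refl)

-- Formal sums of words, repetitions allowed. With `W = ℚ-space` they stand for linear combinations
-- of products of power sums, with general `W` for elements of a tensor product with `W`.
Combination : Space → Set
Combination W = List (Word × ∣ W ∣)

module _ {W : Space} where
  private
    module W = LeftModule W

  weigh : (Word → ℚ) → Combination W → ∣ W ∣
  weigh G X = Sum.sum W X (λ t → G (proj₁ t) W.*ₗ proj₂ t)

  combine : ∀ {V} → (Word → ∣ V ∣) → Combination W → ∣ V ⊗ W ∣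
  combine {V} Φ X = Sum.sum (V ⊗ W) X (λ t → Φ (proj₁ t) ⊗ₑ proj₂ t)

  alphabet : Combination W → List Factor
  alphabet X = deduplicate _≟_ (concatMap proj₁ X)

  length-bound : Combination W → ℕ
  length-bound X = suc (foldr (λ t n → length (proj₁ t) ℕ.+ n) 0 X)

  ∈-length-bound : ∀ X {t} → t ∈ X → length (proj₁ t) ℕ.< length-bound X
  ∈-length-bound (t ∷ X) (here ≡.refl) = ℕ.s≤s (ℕₚ.m≤m+n (length (proj₁ t)) _)
  ∈-length-bound (t ∷ X) (there t∈)    = ℕₚ.≤-trans (∈-length-bound X t∈) (ℕ.s≤s (ℕₚ.m≤n+m _ (length (proj₁ t))))

  ∈-alphabet : ∀ {X t} → t ∈ X → All (_∈ alphabet X) (proj₁ t)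
  ∈-alphabet {X} {t} t∈ = All.tabulate λ u∈ → ∈-deduplicate⁺ _≟_ (∈-concatMap⁺ proj₁ (Any.map (λ { ≡.refl → u∈ }) t∈))

  -- By `reproduce` each `Φ κ` is a sum of multiples of `Φ μ` with coefficients proportional to
  -- `matchings κ μ`. Collecting the terms with the same `μ` leaves `Φ μ` tensored with a multiple
  -- of the sum that vanishes by hypothesis.
  combine-vanish : ∀ {V} {Φ : Word → ∣ V ∣} → Delete.Supersymmetric V Φ → ∀ X →
    (∀ ν → weigh (λ κ → matchings κ ν) X ≈[ W ] W.0ᴹ) → combine {V} Φ X ≈[ V ⊗ W ] 0ₜ
  combine-vanish {V} {Φ} S X zero-sum = begin
    combine {V} Φ X
      ≈⟨ T.sum-congᴹ X (λ t t∈ → ⊗-cong (V.≈ᴹ-sym (reproduce V A! n S (proj₁ t) (∈-length-bound X t∈) (∈-alphabet t∈))) W.≈ᴹ-refl) ⟩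
    T.sum X (λ t → Sum.sum V (upTo n) (λ k → Sum.sum V (words A k) (λ μ → c k (proj₁ t) μ V.*ₗ Φ μ)) ⊗ₑ proj₂ t)
      ≈⟨ T.sum-ext X (λ t → ≈-trans (map-sum (insertʳ (proj₂ t)) (upTo n) _) (T.sum-ext (upTo n) λ k →
           ≈-trans (map-sum (insertʳ (proj₂ t)) (words A k) _) (T.sum-ext (words A k) λ μ →
             ≈-sym (⊗-scale (c k (proj₁ t) μ) (Φ μ) (proj₂ t))))) ⟩
    T.sum X (λ t → T.sum (upTo n) (λ k → T.sum (words A k) (λ μ → Φ μ ⊗ₑ (c k (proj₁ t) μ W.*ₗ proj₂ t))))
      ≈⟨ T.sum-swapᴹ X (upTo n) _ ⟩
    T.sum (upTo n) (λ k → T.sum X (λ t → T.sum (words A k) (λ μ → Φ μ ⊗ₑ (c k (proj₁ t) μ W.*ₗ proj₂ t))))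
      ≈⟨ T.sum-vanish (upTo n) (λ k _ → ≈-trans (T.sum-swapᴹ X (words A k) _) (T.sum-vanish (words A k) λ μ _ → inner k μ)) ⟩
    0ₜ ∎
    where
    module V = LeftModule V
    module T = Sum (V ⊗ W)
    open SetoidReasoning (LeftModule.≈ᴹ-setoid (V ⊗ W))
    n : ℕ
    n = length-bound X
    A : List Factor
    A = alphabet X
    A! : Unique A
    A! = deduplicate-! _≟_ (concatMap proj₁ X)
    c : ℕ → Word → Word → ℚ
    c k κ μ = reciprocal-factorial k * matchings κ μ
    inner : ∀ k μ → T.sum X (λ t → Φ μ ⊗ₑ (c k (proj₁ t) μ W.*ₗ proj₂ t)) ≈[ V ⊗ W ] 0ₜ
    inner k μ = begin
      T.sum X (λ t → Φ μ ⊗ₑ (c k (proj₁ t) μ W.*ₗ proj₂ t))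
        ≈⟨ map-sum (insertˡ {V} {W} (Φ μ)) X (λ t → c k (proj₁ t) μ W.*ₗ proj₂ t) ⟨
      Φ μ ⊗ₑ Sum.sum W X (λ t → c k (proj₁ t) μ W.*ₗ proj₂ t)
        ≈⟨ ⊗-cong V.≈ᴹ-refl (W.≈ᴹ-trans (Sum.sum-ext W X λ t → W.*ₗ-assoc (reciprocal-factorial k) (matchings (proj₁ t) μ) (proj₂ t))
             (W.≈ᴹ-trans (Sum.sum-· W X (reciprocal-factorial k) _)
               (W.≈ᴹ-trans (Sum.·-congʳ W (reciprocal-factorial k) (zero-sum μ)) (W.*ₗ-zeroʳ (reciprocal-factorial k))))) ⟩
      Φ μ ⊗ₑ W.0ᴹ
        ≈⟨ _⟶_.0ᴹ-homo (insertˡ {V} {W} (Φ μ)) ⟩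
      0ₜ ∎

  -- Takes a coefficient in the first tensor factor alone, so that tensors can be treated one factor
  -- at a time.
  contract : Monomial → Λ-space ⊗ W ⟶ W
  contract m = lift record
    { on = λ f w → coeff f m W.*ₗ w
    ; on-cong = λ f≈ w≈ → W.*ₗ-cong (f≈ m) w≈
    ; +ˡ = λ f g w → W.*ₗ-distribʳ w (coeff f m) (coeff g m)
    ; +ʳ = λ f → W.*ₗ-distribˡ (coeff f m)
    ; *ˡ = λ r f w → W.*ₗ-assoc r (coeff f m) w
    ; *ʳ = λ r f w → Sum.·-comm W (coeff f m) r w
    }

  contract-combine : ∀ m X → ⟦ contract m ⟧ (combine {Λ-space} powers X) ≈[ W ] weigh (λ κ → coeff (powers κ) m) X
  contract-combine m X = map-sum (contract m) X (λ t → powers (proj₁ t) ⊗ₑ proj₂ t)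

  weigh-vanish : ∀ {G : Word → ℚ} X → (∀ t → t ∈ X → G (proj₁ t) ≡ 0ℚ) → weigh G X ≈[ W ] W.0ᴹ
  weigh-vanish X p = Sum.sum-vanish W X λ t t∈ → W.≈ᴹ-trans (Sum.·-congˡ W (proj₂ t) (p t t∈)) (W.*ₗ-zeroˡ (proj₂ t))

  -- The power sum products of the greatest length are independent by coeff-powers, so
  -- they cancel among themselves.
  independent : ∀ n X → (∀ t → t ∈ X → length (proj₁ t) ℕ.< n) →
    (∀ ν → weigh (λ κ → coeff (powers κ) (monomial ν)) X ≈[ W ] W.0ᴹ) →
    ∀ ν → weigh (λ κ → matchings κ ν) X ≈[ W ] W.0ᴹ
  independent zero    []      _  _  ν = W.≈ᴹ-refl
  independent zero    (t ∷ X) <0 _  ν = contradiction (<0 t (here ≡.refl)) λ ()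
  independent (suc n) X       <n X0 ν = W.≈ᴹ-trans (split (λ κ → matchings κ ν))
    (W.≈ᴹ-trans (W.+ᴹ-cong (top ν) (independent n low low<n low0 ν)) (W.+ᴹ-identityˡ W.0ᴹ))
    where
    high low : Combination W
    high = filter (λ t → length (proj₁ t) ℕₚ.≟ n) X
    low = filter (λ t → ¬? (length (proj₁ t) ℕₚ.≟ n)) X
    split : ∀ G → weigh G X ≈[ W ] weigh G high W.+ᴹ weigh G low
    split G = Sum.sum-filter W (λ t → length (proj₁ t) ℕₚ.≟ n) X (λ t → G (proj₁ t) W.*ₗ proj₂ t)
    high≡n : ∀ t → t ∈ high → length (proj₁ t) ≡ n
    high≡n t t∈ = proj₂ (∈-filter⁻ (λ t → length (proj₁ t) ℕₚ.≟ n) {xs = X} t∈)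
    low<n : ∀ t → t ∈ low → length (proj₁ t) ℕ.< n
    low<n t t∈ = ℕₚ.≤∧≢⇒< (ℕ.s≤s⁻¹ (<n t (proj₁ t∈′))) (proj₂ t∈′)
      where t∈′ = ∈-filter⁻ (λ t → ¬? (length (proj₁ t) ℕₚ.≟ n)) {xs = X} t∈
    top : ∀ ν → weigh (λ κ → matchings κ ν) high ≈[ W ] W.0ᴹ
    top ν = by-length (length ν ℕₚ.≟ n)
      where
      open SetoidReasoning W.≈ᴹ-setoid
      by-length : Dec (length ν ≡ n) → weigh (λ κ → matchings κ ν) high ≈[ W ] W.0ᴹ
      by-length (no  ν≢n) = weigh-vanish high λ t t∈ → matchings-length (proj₁ t) ν λ e → ν≢n (≡.trans (sym e) (high≡n t t∈))
      by-length (yes ν≡n) = begin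
        weigh (λ κ → matchings κ ν) high
          ≈⟨ Sum.sum-congᴹ W high (λ t t∈ → Sum.·-congˡ W (proj₂ t)
               (coeff-powers (proj₁ t) ν (ℕₚ.≤-reflexive (≡.trans (high≡n t t∈) (sym ν≡n))))) ⟨
        weigh (λ κ → coeff (powers κ) (monomial ν)) high
          ≈⟨ W.+ᴹ-identityʳ _ ⟨
        weigh (λ κ → coeff (powers κ) (monomial ν)) high W.+ᴹ W.0ᴹ
          -- At words of length `n` the shorter products have coefficient 0, so there `X0` speaks of
          -- `high` alone.
          ≈⟨ W.+ᴹ-cong W.≈ᴹ-refl (weigh-vanish low λ t t∈ → let κ<ν = ≡.subst (length (proj₁ t) ℕ.<_) (sym ν≡n) (low<n t t∈) in
               ≡.trans (coeff-powers (proj₁ t) ν (ℕₚ.<⇒≤ κ<ν)) (matchings-length (proj₁ t) ν (ℕₚ.<⇒≢ κ<ν))) ⟨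
        weigh (λ κ → coeff (powers κ) (monomial ν)) high W.+ᴹ weigh (λ κ → coeff (powers κ) (monomial ν)) low
          ≈⟨ split (λ κ → coeff (powers κ) (monomial ν)) ⟨
        weigh (λ κ → coeff (powers κ) (monomial ν)) X
          ≈⟨ X0 ν ⟩
        W.0ᴹ ∎
    low0 : ∀ ν → weigh (λ κ → coeff (powers κ) (monomial ν)) low ≈[ W ] W.0ᴹ
    low0 ν = begin
      weigh G low
        ≈⟨ W.+ᴹ-identityˡ _ ⟨
      W.0ᴹ W.+ᴹ weigh G low
        -- `top` is a statement about matchings, and `coeff-powers` is silent about words shorter
        -- than `n`. But `combine-vanish` makes the whole tensor of `high` zero, hence all its
        -- coefficients, so the relation passes to `low`.
        ≈⟨ W.+ᴹ-cong (W.≈ᴹ-trans (W.≈ᴹ-sym (contract-combine (monomial ν) high))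
             (_⟶_.⟦⟧-cong (contract (monomial ν)) (combine-vanish {Λ-space} {powers} powers-supersymmetric high top))) W.≈ᴹ-refl ⟨
      weigh G high W.+ᴹ weigh G low
        ≈⟨ split G ⟨
      weigh G X
        ≈⟨ X0 ν ⟩
      W.0ᴹ ∎
      where
      open SetoidReasoning W.≈ᴹ-setoid
      G : Word → ℚ
      G κ = coeff (powers κ) (monomial ν)

  combine-vanishᵖ : ∀ {V} {Φ : Word → ∣ V ∣} → Delete.Supersymmetric V Φ → ∀ X →
    (∀ ν → weigh (λ κ → coeff (powers κ) (monomial ν)) X ≈[ W ] W.0ᴹ) → combine {V} Φ X ≈[ V ⊗ W ] 0ₜ
  combine-vanishᵖ {V} {Φ} S X X0 = combine-vanish {V} {Φ} S X
    (independent (length-bound X) X (λ t → ∈-length-bound X) X0)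

-- Spanning by products of power sums

letters : ℕ → List Factor
letters N = cartesianProduct (upTo (suc N)) (false ∷ true ∷ [])

letters-! : ∀ N → Unique (letters N)
letters-! N = Uniqueₚ.cartesianProduct⁺ (Uniqueₚ.upTo⁺ (suc N)) (((λ ()) ∷ []) ∷ [] ∷ [])

∈-letters : ∀ {N} u → proj₁ u ℕ.≤ N → u ∈ letters N
∈-letters (k , false) k≤N = ∈-cartesianProduct⁺ (∈-upTo⁺ (ℕ.s≤s k≤N)) (here ≡.refl)
∈-letters (k , true)  k≤N = ∈-cartesianProduct⁺ (∈-upTo⁺ (ℕ.s≤s k≤N)) (there (here ≡.refl))

deg₁-letter : ∀ u → suc (proj₁ u) ≡ deg₁ (letter u)
deg₁-letter (k , false) = sym (ℕₚ.+-identityʳ (suc k))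
deg₁-letter (k , true)  = sym (ℕₚ.+-comm k 1)

degree-letters : ∀ N ν → degree (monomial ν) ℕ.≤ N → All (_∈ letters N) ν
degree-letters N []      d≤N = []
degree-letters N (u ∷ ν) d≤N =
  ∈-letters u (ℕₚ.≤-trans (ℕₚ.n≤1+n (proj₁ u)) (ℕₚ.≤-trans (ℕₚ.≤-reflexive (deg₁-letter u)) (ℕₚ.m+n≤o⇒m≤o _ d≤N)))
  ∷ degree-letters N ν (ℕₚ.m+n≤o⇒n≤o (deg₁ (letter u)) d≤N)

length-degree : ∀ ν → length ν ℕ.≤ degree (monomial ν)
length-degree []      = ℕ.z≤n
length-degree (u ∷ ν) = ℕₚ.+-mono-≤ (≡.subst (1 ℕ.≤_) (deg₁-letter u) (ℕ.s≤s ℕ.z≤n)) (length-degree ν)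

total : Combination ℚ-space → SymmetricFunction
total X = Sum.sum Λ-space X (λ t → proj₂ t ·Λ powers (proj₁ t))

coeff-total : ∀ X m → coeff (total X) m ≡ sumOver X (λ t → proj₂ t * coeff (powers (proj₁ t)) m)
coeff-total X m = map-sum (coefficient m) X (λ t → proj₂ t ·Λ powers (proj₁ t))

Spanned : SymmetricFunction → Set
Spanned f = ∃ λ X → f ≈Λ total X

-- A product of `n` power sums also has coefficients at shorter monomials, but none at longer ones.
-- Matching `f` at words of length `n` therefore preserves the vanishing at longer words, and the
-- remainder is handled by induction.
spanned-below : ∀ n f → (∀ ν → n ℕ.≤ length ν → coeff f (monomial ν) ≡ 0ℚ) → Spanned f
spanned-below zero    f f0 = [] , λ m → ≡.trans (coeff-strip f m) (f0 (strip m) ℕ.z≤n)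
spanned-below (suc n) f f0 = X ++ proj₁ rest , λ m → begin
  coeff f m
    ≡⟨ cancel (coeff f m) (coeff (total X) m) ⟨
  coeff (total X) m + coeff g m
    ≡⟨ cong (coeff (total X) m +_) (proj₂ rest m) ⟩
  coeff (total X) m + coeff (total (proj₁ rest)) m
    ≡⟨ Sum.sum-++ Λ-space X (proj₁ rest) (λ t → proj₂ t ·Λ powers (proj₁ t)) m ⟨
  coeff (total (X ++ proj₁ rest)) m ∎
  where
  open ≡-Reasoning
  N : ℕ
  N = proj₁ (SymmetricFunction.bounded f)
  A : List Factor
  A = letters N
  r : ℚ
  r = reciprocal-factorial n
  X : Combination ℚ-space
  -- The coefficients come from `average⁻¹`: the factor 1/n! makes up for summing over all words
  -- instead of one from each class of rearrangements.
  X = map (λ μ → μ , r * coeff f (monomial μ)) (words A n)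
  g : SymmetricFunction
  g = f Λᴹ.+ᴹ (- 1ℚ ·Λ total X)
  cancel : ∀ x y → y + (x + - 1ℚ * y) ≡ x
  cancel = solve 2 (λ x y → y :+ (x :+ con (- 1ℚ) :* y) := x) ≡.refl
  cancel′ : ∀ x → x + - 1ℚ * x ≡ 0ℚ
  cancel′ = solve 1 (λ x → x :+ con (- 1ℚ) :* x := con 0ℚ) ≡.refl
  terms : ∀ ν → n ℕ.≤ length ν → coeff (total X) (monomial ν)
    ≡ sumOver (words A n) (λ μ → (r * matchings μ ν) * coeff f (monomial μ))
  terms ν n≤ν = begin
    coeff (total X) (monomial ν)
      ≡⟨ coeff-total X (monomial ν) ⟩
    sumOver X (λ t → proj₂ t * coeff (powers (proj₁ t)) (monomial ν))
      ≡⟨ ℚ-sum.sum-map (λ μ → μ , r * coeff f (monomial μ)) (words A n) (λ t → proj₂ t * coeff (powers (proj₁ t)) (monomial ν)) ⟩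
    sumOver (words A n) (λ μ → (r * coeff f (monomial μ)) * coeff (powers μ) (monomial ν))
      ≡⟨ sum-cong (words A n) (λ μ μ∈ → ≡.trans
           (cong ((r * coeff f (monomial μ)) *_) (coeff-powers μ ν (≡.subst (ℕ._≤ length ν) (sym (words-length A n μ∈)) n≤ν)))
           (exchange r (coeff f (monomial μ)) (matchings μ ν))) ⟩
    sumOver (words A n) (λ μ → (r * matchings μ ν) * coeff f (monomial μ)) ∎
    where
    exchange : ∀ x y z → (x * y) * z ≡ (x * z) * y
    exchange = solve 3 (λ x y z → (x :* y) :* z := (x :* z) :* y) ≡.refl
  vanishing : ∀ ν → (∀ μ → μ ∈ words A n → matchings μ ν ≡ 0ℚ) →
    sumOver (words A n) (λ μ → (r * matchings μ ν) * coeff f (monomial μ)) ≡ 0ℚ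
  vanishing ν p = ℚ-sum.sum-vanish (words A n) λ μ μ∈ → ≡.trans
    (cong (λ x → (r * x) * coeff f (monomial μ)) (p μ μ∈))
    (≡.trans (cong (_* coeff f (monomial μ)) (ℚₚ.*-zeroʳ r)) (ℚₚ.*-zeroˡ (coeff f (monomial μ))))
  agree : ∀ ν → n ℕ.≤ length ν → sumOver (words A n) (λ μ → (r * matchings μ ν) * coeff f (monomial μ)) ≡ coeff f (monomial ν)
  agree ν n≤ν with n ℕₚ.≟ length ν
  ... | no n≢ν = ≡.trans
    (vanishing ν λ μ μ∈ → matchings-length μ ν λ e → n≢ν (≡.trans (sym (words-length A n μ∈)) e))
    (sym (f0 ν (ℕₚ.≤∧≢⇒< n≤ν n≢ν)))
  ... | yes ≡.refl with degree (monomial ν) ℕₚ.≤? N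
  ...   | yes d≤N = average⁻¹ ℚ-space (letters-! N) (coeff-supersymmetric f) ν (degree-letters N ν d≤N)
  -- Above the degree bound of `f`, a word over `A` is still covered by averaging; any other word
  -- has no matchings with words over `A`, and `f` vanishes at it.
  ...   | no  d≰N with All.all? (λ u → DecMembership._∈?_ _≟_ u A) ν
  ...     | yes ν⊆ = average⁻¹ ℚ-space (letters-! N) (coeff-supersymmetric f) ν ν⊆
  ...     | no  ν⊈ = ≡.trans
    (vanishing ν λ μ μ∈ → matchings-outside μ ν (words-letters A (length ν) μ∈) ν⊈)
    (sym (proj₂ (SymmetricFunction.bounded f) (monomial ν) (ℕₚ.≰⇒> d≰N)))
  rest : Spanned g
  rest = spanned-below n g λ ν n≤ν → begin
    coeff f (monomial ν) + - 1ℚ * coeff (total X) (monomial ν)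
      ≡⟨ cong (λ x → coeff f (monomial ν) + - 1ℚ * x) (≡.trans (terms ν n≤ν) (agree ν n≤ν)) ⟩
    coeff f (monomial ν) + - 1ℚ * coeff f (monomial ν)
      ≡⟨ cancel′ (coeff f (monomial ν)) ⟩
    0ℚ ∎

abstract
  -- Every letter has positive degree, so the degree bound also bounds the number of letters.
  -- Abstract, so that the chosen combination is never computed.
  spanned : ∀ f → Spanned f
  spanned f = spanned-below (suc N) f λ ν N<ν →
    proj₂ (SymmetricFunction.bounded f) (monomial ν) (ℕₚ.≤-trans N<ν (length-degree ν))
    where
    N : ℕ
    N = proj₁ (SymmetricFunction.bounded f)

-- Linear maps prescribed on products of power sums

scale : ∀ {W} → ℚ → Combination W → Combination W
scale {W} r = map (λ t → proj₁ t , LeftModule._*ₗ_ W r (proj₂ t))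

module _ {V : Space} (Φ : Word → ∣ V ∣) where
  open LeftModule V
  open Sum V

  value : Combination ℚ-space → ∣ V ∣
  value X = sum X (λ t → proj₂ t · Φ (proj₁ t))

  value-++ : ∀ X Y → value (X ++ Y) ≈ᴹ value X +ᴹ value Y
  value-++ X Y = sum-++ X Y (λ t → proj₂ t · Φ (proj₁ t))

  value-scale : ∀ r X → value (scale {ℚ-space} r X) ≈ᴹ r · value X
  value-scale r X = ≈ᴹ-trans (≈ᴹ-reflexive (sum-map (λ t → proj₁ t , r * proj₂ t) X (λ t → proj₂ t · Φ (proj₁ t))))
    (≈ᴹ-trans (sum-ext X λ t → *ₗ-assoc r (proj₂ t) (Φ (proj₁ t))) (sum-· X r (λ t → proj₂ t · Φ (proj₁ t))))

  value-combine : ∀ X → ⟦ unitorʳ {V} ⟧ (combine {ℚ-space} {V} Φ X) ≈ᴹ value X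
  value-combine X = map-sum (unitorʳ {V}) X (λ t → Φ (proj₁ t) ⊗ₑ proj₂ t)

difference-zero : ∀ (V : Space) (x y : ∣ V ∣) → let open LeftModule V in (x +ᴹ (- 1ℚ *ₗ y)) ≈ᴹ 0ᴹ → x ≈ᴹ y
difference-zero V x y x-y≈0 = begin
  x                             ≈⟨ +ᴹ-identityʳ x ⟨
  x +ᴹ 0ᴹ                       ≈⟨ +ᴹ-cong ≈ᴹ-refl negated ⟨
  x +ᴹ ((- 1ℚ *ₗ y) +ᴹ y)       ≈⟨ +ᴹ-assoc x (- 1ℚ *ₗ y) y ⟨
  (x +ᴹ (- 1ℚ *ₗ y)) +ᴹ y       ≈⟨ +ᴹ-cong x-y≈0 ≈ᴹ-refl ⟩
  0ᴹ +ᴹ y                       ≈⟨ +ᴹ-identityˡ y ⟩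
  y                             ∎
  where
  open LeftModule V
  open SetoidReasoning ≈ᴹ-setoid
  negated : ((- 1ℚ *ₗ y) +ᴹ y) ≈ᴹ 0ᴹ
  negated = begin
    (- 1ℚ *ₗ y) +ᴹ y            ≈⟨ +ᴹ-cong ≈ᴹ-refl (*ₗ-identityˡ y) ⟨
    (- 1ℚ *ₗ y) +ᴹ (1ℚ *ₗ y)    ≈⟨ *ₗ-distribʳ y (- 1ℚ) 1ℚ ⟨
    0ℚ *ₗ y                     ≈⟨ *ₗ-zeroˡ y ⟩
    0ᴹ                          ∎

zero-difference : ∀ (V : Space) (x y : ∣ V ∣) → let open LeftModule V in x ≈ᴹ y → (x +ᴹ (- 1ℚ *ₗ y)) ≈ᴹ 0ᴹ
zero-difference V x y x≈y = begin
  x +ᴹ (- 1ℚ *ₗ y)            ≈⟨ +ᴹ-cong (≈ᴹ-trans x≈y (≈ᴹ-sym (*ₗ-identityˡ y))) ≈ᴹ-refl ⟩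
  (1ℚ *ₗ y) +ᴹ (- 1ℚ *ₗ y)    ≈⟨ *ₗ-distribʳ y 1ℚ (- 1ℚ) ⟨
  0ℚ *ₗ y                     ≈⟨ *ₗ-zeroˡ y ⟩
  0ᴹ                          ∎
  where
  open LeftModule V
  open SetoidReasoning ≈ᴹ-setoid

module _ {V : Space} {Φ : Word → ∣ V ∣} (S : Delete.Supersymmetric V Φ) where
  open LeftModule V
  open Sum V

  value-vanish : ∀ X → total X ≈Λ Λᴹ.0ᴹ → value {V} Φ X ≈ᴹ 0ᴹ
  value-vanish X X0 = ≈ᴹ-trans (≈ᴹ-sym (value-combine {V} Φ X)) (_⟶_.⟦⟧-cong (unitorʳ {V})
    (combine-vanishᵖ {ℚ-space} {V} {Φ} S X λ ν → begin
      sumOver X (λ t → coeff (powers (proj₁ t)) (monomial ν) * proj₂ t)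
        ≡⟨ ℚ-sum.sum-ext X (λ t → ℚₚ.*-comm (coeff (powers (proj₁ t)) (monomial ν)) (proj₂ t)) ⟩
      sumOver X (λ t → proj₂ t * coeff (powers (proj₁ t)) (monomial ν))
        ≡⟨ coeff-total X (monomial ν) ⟨
      coeff (total X) (monomial ν)
        ≡⟨ X0 (monomial ν) ⟩
      0ℚ ∎))
    where open ≡-Reasoning

  -- The expansion chosen by `spanned` has no reason to be additive in the function; linearity of
  -- the prescribed map comes from this independence of the expansion.
  value-unique : ∀ X Y → total X ≈Λ total Y → value {V} Φ X ≈ᴹ value {V} Φ Y
  value-unique X Y X≈Y = difference-zero V (value {V} Φ X) (value {V} Φ Y) (≈ᴹ-trans (≈ᴹ-sym (expand {V} Φ)) (value-vanish Z λ m → ≡.trans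
    (expand {Λ-space} powers m) (zero-difference Λ-space (total X) (total Y) X≈Y m)))
    where
    Z : Combination ℚ-space
    Z = X ++ scale {ℚ-space} (- 1ℚ) Y
    expand : ∀ {U} (Ψ : Word → ∣ U ∣) → value {U} Ψ Z ≈[ U ] LeftModule._+ᴹ_ U (value {U} Ψ X) (LeftModule._*ₗ_ U (- 1ℚ) (value {U} Ψ Y))
    expand {U} Ψ = LeftModule.≈ᴹ-trans U (value-++ {U} Ψ X (scale {ℚ-space} (- 1ℚ) Y))
      (LeftModule.+ᴹ-cong U (LeftModule.≈ᴹ-refl U) (value-scale {U} Ψ (- 1ℚ) Y))

  private
    section : SymmetricFunction → Combination ℚ-space
    section f = proj₁ (spanned f)

    section-total : ∀ f m → coeff f m ≡ coeff (total (section f)) m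
    section-total f = proj₂ (spanned f)

  abstract
    -- The products of power sums form a free supercommutative algebra, so they can be
    -- sent to the values of any supersymmetric function of words.
    universal : Λ-space ⟶ V
    universal = mkLinear (λ f → value {V} Φ (section f))
      (λ {f} {g} f≈g → value-unique (section f) (section g) λ m →
        ≡.trans (sym (section-total f m)) (≡.trans (f≈g m) (section-total g m)))
      (λ f g → ≈ᴹ-trans
        (value-unique (section (f Λᴹ.+ᴹ g)) (section f ++ section g) λ m → ≡.trans (sym (section-total (f Λᴹ.+ᴹ g) m))
          (≡.trans (cong₂ _+_ (section-total f m) (section-total g m))
            (sym (value-++ {Λ-space} powers (section f) (section g) m))))
        (value-++ {V} Φ (section f) (section g)))
      (λ r f → ≈ᴹ-trans
        (value-unique (section (r ·Λ f)) (scale {ℚ-space} r (section f)) λ m → ≡.trans (sym (section-total (r ·Λ f) m))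
          (≡.trans (cong (r *_) (section-total f m)) (sym (value-scale {Λ-space} powers r (section f) m))))
        (value-scale {V} Φ r (section f)))

    universal-powers : ∀ κ → ⟦ universal ⟧ (powers κ) ≈ᴹ Φ κ
    universal-powers κ = ≈ᴹ-trans
      (value-unique (section (powers κ)) ((κ , 1ℚ) ∷ []) λ m → ≡.trans (sym (section-total (powers κ) m))
        (sym (≡.trans (ℚₚ.+-identityʳ (1ℚ * coeff (powers κ) m)) (ℚₚ.*-identityˡ (coeff (powers κ) m)))))
      (≈ᴹ-trans (+ᴹ-identityʳ (1ℚ · Φ κ)) (*ₗ-identityˡ (Φ κ)))

module _ {V : Space} (h k : Λ-space ⟶ V) where
  open LeftModule V

  ext-powers : (∀ κ → ⟦ h ⟧ (powers κ) ≈ᴹ ⟦ k ⟧ (powers κ)) → h ≐ k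
  ext-powers p f = begin
    ⟦ h ⟧ f                                          ≈⟨ expand h ⟩
    Sum.sum V X (λ t → proj₂ t *ₗ ⟦ h ⟧ (powers (proj₁ t)))  ≈⟨ Sum.sum-ext V X (λ t → Sum.·-congʳ V (proj₂ t) (p (proj₁ t))) ⟩
    Sum.sum V X (λ t → proj₂ t *ₗ ⟦ k ⟧ (powers (proj₁ t)))  ≈⟨ expand k ⟨
    ⟦ k ⟧ f                                          ∎
    where
    open SetoidReasoning ≈ᴹ-setoid
    X : Combination ℚ-space
    X = proj₁ (spanned f)
    expand : (l : Λ-space ⟶ V) → ⟦ l ⟧ f ≈ᴹ Sum.sum V X (λ t → proj₂ t *ₗ ⟦ l ⟧ (powers (proj₁ t)))
    expand l = ≈ᴹ-trans (_⟶_.⟦⟧-cong l {f} {total X} (proj₂ (spanned f)))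
      (≈ᴹ-trans (map-sum l X (λ t → proj₂ t ·Λ powers (proj₁ t)))
        (Sum.sum-ext V X λ t → _⟶_.*ₗ-homo l (proj₂ t) (powers (proj₁ t))))

-- Equality of maps and elements in tensor products

module _ {V W U : Space} (h k : V ⊗ W ⟶ U) where
  open LeftModule U

  ext-⊗ : (∀ v w → ⟦ h ⟧ (v ⊗ₑ w) ≈ᴹ ⟦ k ⟧ (v ⊗ₑ w)) → h ≐ k
  ext-⊗ p 0ₜ       = ≈ᴹ-trans (_⟶_.0ᴹ-homo h) (≈ᴹ-sym (_⟶_.0ᴹ-homo k))
  ext-⊗ p (x +ₜ y) = ≈ᴹ-trans (_⟶_.+ᴹ-homo h x y)
    (≈ᴹ-trans (+ᴹ-cong (ext-⊗ p x) (ext-⊗ p y)) (≈ᴹ-sym (_⟶_.+ᴹ-homo k x y)))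
  ext-⊗ p (v ⊗ₑ w) = p v w

module _ {W : Space} where
  private
    module W = LeftModule W

  combine-++ : ∀ X Y → combine {W} {Λ-space} powers (X ++ Y) ≈[ Λ-space ⊗ W ] combine {W} {Λ-space} powers X +ₜ combine {W} {Λ-space} powers Y
  combine-++ X Y = Sum.sum-++ (Λ-space ⊗ W) X Y (λ t → powers (proj₁ t) ⊗ₑ proj₂ t)

  spanned-⊗ : (F : ∣ Λ-space ⊗ W ∣) → ∃ λ X → F ≈[ Λ-space ⊗ W ] combine {W} {Λ-space} powers X
  spanned-⊗ 0ₜ       = [] , ≈-refl
  spanned-⊗ (F +ₜ G) = proj₁ (spanned-⊗ F) ++ proj₁ (spanned-⊗ G)
    , ≈-trans (+-cong (proj₂ (spanned-⊗ F)) (proj₂ (spanned-⊗ G))) (≈-sym (combine-++ (proj₁ (spanned-⊗ F)) (proj₁ (spanned-⊗ G))))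
  spanned-⊗ (f ⊗ₑ w) = map g X , (begin
    f ⊗ₑ w
      ≈⟨ ⊗-cong {v = f} {v′ = total X} (proj₂ (spanned f)) W.≈ᴹ-refl ⟩
    total X ⊗ₑ w
      ≈⟨ map-sum (insertʳ {Λ-space} {W} w) X (λ t → proj₂ t ·Λ powers (proj₁ t)) ⟩
    Sum.sum (Λ-space ⊗ W) X (λ t → (proj₂ t ·Λ powers (proj₁ t)) ⊗ₑ w)
      ≈⟨ Sum.sum-ext (Λ-space ⊗ W) X (λ t → ⊗-scale (proj₂ t) (powers (proj₁ t)) w) ⟨
    Sum.sum (Λ-space ⊗ W) X (λ t → powers (proj₁ t) ⊗ₑ (proj₂ t W.*ₗ w))
      ≡⟨ Sum.sum-map (Λ-space ⊗ W) g X (λ t → powers (proj₁ t) ⊗ₑ proj₂ t) ⟨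
    combine {W} {Λ-space} powers (map g X) ∎)
    where
    open SetoidReasoning (LeftModule.≈ᴹ-setoid (Λ-space ⊗ W))
    X : Combination ℚ-space
    X = proj₁ (spanned f)
    g : Word × ℚ → Word × ∣ W ∣
    g t = proj₁ t , (proj₂ t W.*ₗ w)

  -- Once the first tensor factors are expanded in products of power sums, vanishing coefficients
  -- are the hypothesis of `combine-vanishᵖ`. Equations in the tensor product may henceforth be
  -- checked on coefficients.
  contract-injective₀ : ∀ F → (∀ m → ⟦ contract {W} m ⟧ F ≈[ W ] W.0ᴹ) → F ≈[ Λ-space ⊗ W ] 0ₜ
  contract-injective₀ F F0 = ≈-trans (proj₂ (spanned-⊗ F)) (combine-vanishᵖ {W} {Λ-space} {powers} powers-supersymmetric X λ ν →
    W.≈ᴹ-trans (W.≈ᴹ-sym (contract-combine {W} (monomial ν) X))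
      (W.≈ᴹ-trans (_⟶_.⟦⟧-cong (contract {W} (monomial ν)) (≈-sym (proj₂ (spanned-⊗ F)))) (F0 (monomial ν))))
    where
    X : Combination W
    X = proj₁ (spanned-⊗ F)

  contract-injective : ∀ F G → (∀ m → ⟦ contract {W} m ⟧ F ≈[ W ] ⟦ contract {W} m ⟧ G) → F ≈[ Λ-space ⊗ W ] G
  contract-injective F G F≈G = difference-zero (Λ-space ⊗ W) F G (contract-injective₀ (F +ₜ (- 1ℚ ·ₜ G)) λ m →
    W.≈ᴹ-trans (W.+ᴹ-cong (W.≈ᴹ-refl {⟦ contract {W} m ⟧ F}) (_⟶_.*ₗ-homo (contract {W} m) (- 1ℚ) G)) (zero-difference W (⟦ contract {W} m ⟧ F) (⟦ contract {W} m ⟧ G) (F≈G m)))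

-- The coproduct

module SΛ = Super Λ

Λ⊗Λ : Space
Λ⊗Λ = Λ-space ⊗ Λ-space

-- f ↦ (-1)^(p deg f) f
Λ-twist : Parity → Λ-space ⟶ Λ-space
Λ-twist p = mkLinear twisted
  (λ f≈ m → cong (sgn (∣ m ∣ₘ ℙ.* p) *_) (f≈ m))
  (λ f g m → ℚₚ.*-distribˡ-+ (sgn (∣ m ∣ₘ ℙ.* p)) (coeff f m) (coeff g m))
  (λ r f m → *-swap (sgn (∣ m ∣ₘ ℙ.* p)) r (coeff f m))
  where
  twisted : SymmetricFunction → SymmetricFunction
  twisted f = mkSymmetricFunction (λ m → sgn (∣ m ∣ₘ ℙ.* p) * coeff f m) record
    { stable = λ m → cong₂ (λ q x → sgn (q ℙ.* p) * x) (∣∣-∷ʳ m) (SymmetricFunction.stable f m)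
    ; symmetric = λ {m} {n} π → ≡.trans
        (cong₂ (λ q x → sgn (q ℙ.* p) * x) (∣∣-↭ π) (SymmetricFunction.symmetric f π))
        (*-swap (sgn (∣ n ∣ₘ ℙ.* p)) (sgn (inversions π)) (coeff f n))
    ; bounded = proj₁ (SymmetricFunction.bounded f) , λ m N< → ≡.trans
        (cong (sgn (∣ m ∣ₘ ℙ.* p) *_) (proj₂ (SymmetricFunction.bounded f) m N<)) (ℚₚ.*-zeroʳ (sgn (∣ m ∣ₘ ℙ.* p)))
    }

-- `∑-power` transfers extensionality and linearity from `∑⟨_⟩` to `divide`, here and in the next
-- three lemmas.
divide-ext : ∀ u {G H} m → (∀ n → G n ≡ H n) → divide u G m ≡ divide u H m
divide-ext u {G} {H} m p = ≡.trans (sym (∑-power u m G))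
  (≡.trans (∑-ext m λ m₁ m₂ → cong (power u m₁ *_) (p m₂)) (∑-power u m H))

divide-0 : ∀ u m → divide u (λ _ → 0ℚ) m ≡ 0ℚ
divide-0 u m = ≡.trans (sym (∑-power u m (λ _ → 0ℚ)))
  (≡.trans (∑-ext m λ m₁ m₂ → ℚₚ.*-zeroʳ (power u m₁)) (∑-zero m))

divide-+ : ∀ u G H m → divide u (λ n → G n + H n) m ≡ divide u G m + divide u H m
divide-+ u G H m = begin
  divide u (λ n → G n + H n) m
    ≡⟨ ∑-power u m (λ n → G n + H n) ⟨
  ∑⟨ m ⟩ (λ m₁ m₂ → power u m₁ * (G m₂ + H m₂))
    ≡⟨ ∑-ext m (λ m₁ m₂ → ℚₚ.*-distribˡ-+ (power u m₁) (G m₂) (H m₂)) ⟩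
  ∑⟨ m ⟩ (λ m₁ m₂ → power u m₁ * G m₂ + power u m₁ * H m₂)
    ≡⟨ ∑-+ m (λ m₁ m₂ → power u m₁ * G m₂) (λ m₁ m₂ → power u m₁ * H m₂) ⟩
  ∑⟨ m ⟩ (λ m₁ m₂ → power u m₁ * G m₂) + ∑⟨ m ⟩ (λ m₁ m₂ → power u m₁ * H m₂)
    ≡⟨ cong₂ _+_ (∑-power u m G) (∑-power u m H) ⟩
  divide u G m + divide u H m ∎
  where open ≡-Reasoning

divide-* : ∀ u r G m → divide u (λ n → r * G n) m ≡ r * divide u G m
divide-* u r G m = begin
  divide u (λ n → r * G n) m
    ≡⟨ ∑-power u m (λ n → r * G n) ⟨
  ∑⟨ m ⟩ (λ m₁ m₂ → power u m₁ * (r * G m₂))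
    ≡⟨ ∑-ext m (λ m₁ m₂ → *-swap (power u m₁) r (G m₂)) ⟩
  ∑⟨ m ⟩ (λ m₁ m₂ → r * (power u m₁ * G m₂))
    ≡⟨ ∑-* m r (λ m₁ m₂ → power u m₁ * G m₂) ⟩
  r * ∑⟨ m ⟩ (λ m₁ m₂ → power u m₁ * G m₂)
    ≡⟨ cong (r *_) (∑-power u m G) ⟩
  r * divide u G m ∎
  where open ≡-Reasoning

-- The divided factor lies in `m` or in `n`; in the second case `u` passes all of `m` on its way to
-- the front. This is the primitivity of power sums on the level of coefficients.
divide-++ : ∀ u G m n → divide u G (m ++ n)
  ≡ divide u (λ a → G (a ++ n)) m + sgn (∣ m ∣ₘ ℙ.* ∣ u ∣₁) * divide u (λ b → G (m ++ b)) n
divide-++ u G []      n = sym (≡.trans (ℚₚ.+-identityˡ (1ℚ * divide u G n)) (ℚₚ.*-identityˡ (divide u G n)))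
divide-++ u G (x ∷ m) n = begin
  a + s * divide u (λ k → G (x ∷ k)) (m ++ n)
    ≡⟨ cong (λ y → a + s * y) (divide-++ u (λ k → G (x ∷ k)) m n) ⟩
  a + s * (b + t * c)
    ≡⟨ solve 5 (λ a s b t c → a :+ s :* (b :+ t :* c) := (a :+ s :* b) :+ (s :* t) :* c) ≡.refl a s b t c ⟩
  (a + s * b) + (s * t) * c
    ≡⟨ cong (λ y → (a + s * b) + y * c) signs ⟩
  (a + s * b) + sgn (∣ x ∷ m ∣ₘ ℙ.* ∣ u ∣₁) * c ∎
  where
  open ≡-Reasoning
  a b c s t : ℚ
  a = sumOver (splits x) (λ vw → [ letter u ≡ proj₁ vw ] * G (proj₂ vw ∷ (m ++ n)))
  b = divide u (λ k → G (x ∷ (k ++ n))) m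
  c = divide u (λ k → G (x ∷ (m ++ k))) n
  s = sgn (∣ u ∣₁ ℙ.* ∣ x ∣₁)
  t = sgn (∣ m ∣ₘ ℙ.* ∣ u ∣₁)
  signs : s * t ≡ sgn (∣ x ∷ m ∣ₘ ℙ.* ∣ u ∣₁)
  signs = begin
    s * t
      ≡⟨ cong (λ p → sgn p * t) (ℙₚ.*-comm ∣ u ∣₁ ∣ x ∣₁) ⟩
    sgn (∣ x ∣₁ ℙ.* ∣ u ∣₁) * t
      ≡⟨ sgn-+ (∣ x ∣₁ ℙ.* ∣ u ∣₁) (∣ m ∣ₘ ℙ.* ∣ u ∣₁) ⟨
    sgn ((∣ x ∣₁ ℙ.* ∣ u ∣₁) ℙ.+ (∣ m ∣ₘ ℙ.* ∣ u ∣₁))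
      ≡⟨ cong sgn (ℙₚ.*-distribʳ-+ ∣ u ∣₁ ∣ x ∣₁ ∣ m ∣ₘ) ⟨
    sgn ((∣ x ∣₁ ℙ.+ ∣ m ∣ₘ) ℙ.* ∣ u ∣₁)
      ≡⟨ cong (λ p → sgn (p ℙ.* ∣ u ∣₁)) (∣∣-∷ x m) ⟨
    sgn (∣ x ∷ m ∣ₘ ℙ.* ∣ u ∣₁) ∎

evaluate : ∣ Λ⊗Λ ∣ → Monomial → Monomial → ℚ
evaluate X m n = ⟦ evaluate₂ ⟧ X (m , n)

-- Multiplication by p ⊗ 1 + 1 ⊗ p, where p is the power sum of u.
Λ-leibniz : Factor → Λ⊗Λ ⟶ Λ⊗Λ
Λ-leibniz u = SΛ._⊕_ ((powerSum u ∙ₗ) ⊗₁ idₗ) (Λ-twist ∣ u ∣₁ ⊗₁ (powerSum u ∙ₗ))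

evaluate-leibniz : ∀ u X m n → evaluate (⟦ Λ-leibniz u ⟧ X) m n
  ≡ divide u (λ a → evaluate X a n) m + sgn (∣ m ∣ₘ ℙ.* ∣ u ∣₁) * divide u (λ b → evaluate X m b) n
evaluate-leibniz u 0ₜ       m n = sym (≡.trans
  (cong₂ (λ x y → x + sgn (∣ m ∣ₘ ℙ.* ∣ u ∣₁) * y) (divide-0 u m) (divide-0 u n))
  (cong (0ℚ +_) (ℚₚ.*-zeroʳ (sgn (∣ m ∣ₘ ℙ.* ∣ u ∣₁)))))
evaluate-leibniz u (X +ₜ Y) m n = begin
  (evaluate X₁ m n + evaluate Y₁ m n) + (evaluate X₂ m n + evaluate Y₂ m n)
    ≡⟨ +-interchangeℚ (evaluate X₁ m n) (evaluate Y₁ m n) (evaluate X₂ m n) (evaluate Y₂ m n) ⟩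
  evaluate (⟦ Λ-leibniz u ⟧ X) m n + evaluate (⟦ Λ-leibniz u ⟧ Y) m n
    ≡⟨ cong₂ _+_ (evaluate-leibniz u X m n) (evaluate-leibniz u Y m n) ⟩
  (divide u (λ a → evaluate X a n) m + s * divide u (λ b → evaluate X m b) n)
    + (divide u (λ a → evaluate Y a n) m + s * divide u (λ b → evaluate Y m b) n)
    ≡⟨ solve 5 (λ s a b c d → (a :+ s :* b) :+ (c :+ s :* d) := (a :+ c) :+ s :* (b :+ d)) ≡.refl
         s (divide u (λ a → evaluate X a n) m) (divide u (λ b → evaluate X m b) n)
         (divide u (λ a → evaluate Y a n) m) (divide u (λ b → evaluate Y m b) n) ⟩
  (divide u (λ a → evaluate X a n) m + divide u (λ a → evaluate Y a n) m)
    + s * (divide u (λ b → evaluate X m b) n + divide u (λ b → evaluate Y m b) n)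
    ≡⟨ cong₂ (λ x y → x + s * y) (divide-+ u (λ a → evaluate X a n) (λ a → evaluate Y a n) m)
         (divide-+ u (λ b → evaluate X m b) (λ b → evaluate Y m b) n) ⟨
  divide u (λ a → evaluate (X +ₜ Y) a n) m + s * divide u (λ b → evaluate (X +ₜ Y) m b) n ∎
  where
  open ≡-Reasoning
  s : ℚ
  s = sgn (∣ m ∣ₘ ℙ.* ∣ u ∣₁)
  X₁ X₂ Y₁ Y₂ : ∣ Λ⊗Λ ∣
  X₁ = ⟦ _⊗₁_ {Λ-space} {Λ-space} {Λ-space} {Λ-space} (powerSum u ∙ₗ) idₗ ⟧ X
  X₂ = ⟦ Λ-twist ∣ u ∣₁ ⊗₁ (powerSum u ∙ₗ) ⟧ X
  Y₁ = ⟦ _⊗₁_ {Λ-space} {Λ-space} {Λ-space} {Λ-space} (powerSum u ∙ₗ) idₗ ⟧ Y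
  Y₂ = ⟦ Λ-twist ∣ u ∣₁ ⊗₁ (powerSum u ∙ₗ) ⟧ Y
evaluate-leibniz u (f ⊗ₑ g) m n = cong₂ _+_
  (begin
    coeff (product (powerSum u) f) m * coeff g n
      ≡⟨ cong (_* coeff g n) (coeff-powerSum-∙ u f m) ⟩
    divide u (coeff f) m * coeff g n
      ≡⟨ ℚₚ.*-comm (divide u (coeff f) m) (coeff g n) ⟩
    coeff g n * divide u (coeff f) m
      ≡⟨ divide-* u (coeff g n) (coeff f) m ⟨
    divide u (λ a → coeff g n * coeff f a) m
      ≡⟨ divide-ext u m (λ a → ℚₚ.*-comm (coeff g n) (coeff f a)) ⟩
    divide u (λ a → coeff f a * coeff g n) m ∎)
  (begin
    (s * coeff f m) * coeff (product (powerSum u) g) n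
      ≡⟨ cong ((s * coeff f m) *_) (coeff-powerSum-∙ u g n) ⟩
    (s * coeff f m) * divide u (coeff g) n
      ≡⟨ ℚₚ.*-assoc s (coeff f m) (divide u (coeff g) n) ⟩
    s * (coeff f m * divide u (coeff g) n)
      ≡⟨ cong (s *_) (divide-* u (coeff f m) (coeff g) n) ⟨
    s * divide u (λ b → coeff f m * coeff g b) n ∎)
  where
  open ≡-Reasoning
  s : ℚ
  s = sgn (∣ m ∣ₘ ℙ.* ∣ u ∣₁)

coeff-contract : ∀ m X n → coeff (⟦ contract {Λ-space} m ⟧ X) n ≡ evaluate X m n
coeff-contract m 0ₜ       n = ≡.refl
coeff-contract m (X +ₜ Y) n = cong₂ _+_ (coeff-contract m X n) (coeff-contract m Y n)
coeff-contract m (f ⊗ₑ g) n = ≡.refl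

evaluate-injective : ∀ X Y → (∀ m n → evaluate X m n ≡ evaluate Y m n) → X ≈[ Λ⊗Λ ] Y
evaluate-injective X Y X≈Y = contract-injective {Λ-space} X Y λ m n →
  ≡.trans (coeff-contract m X n) (≡.trans (X≈Y m n) (sym (coeff-contract m Y n)))

evaluate-cong : ∀ {X Y} → X ≈[ Λ⊗Λ ] Y → ∀ m n → evaluate X m n ≡ evaluate Y m n
evaluate-cong X≈Y m n = _⟶_.⟦⟧-cong evaluate₂ X≈Y (m , n)

one-++ : ∀ m n → one (m ++ n) ≡ one m * one n
one-++ []      n = sym (ℚₚ.*-identityˡ (one n))
one-++ (u ∷ m) n = begin
  one (u ∷ (m ++ n))        ≡⟨ one-∷ u (m ++ n) ⟩
  one₁ u * one (m ++ n)     ≡⟨ cong (one₁ u *_) (one-++ m n) ⟩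
  one₁ u * (one m * one n)  ≡⟨ ℚₚ.*-assoc (one₁ u) (one m) (one n) ⟨
  (one₁ u * one m) * one n  ≡⟨ cong (_* one n) (one-∷ u m) ⟨
  one (u ∷ m) * one n       ∎
  where open ≡-Reasoning

-- The coproduct of a product of primitive elements: each letter goes to one of the two tensor
-- factors, with the sign of what it passes.
unshuffle : Word → ∣ Λ⊗Λ ∣
unshuffle = iterate Λ-leibniz (𝟙 ⊗ₑ 𝟙)

evaluate-unshuffle : ∀ κ m n → evaluate (unshuffle κ) m n ≡ coeff (powers κ) (m ++ n)
evaluate-unshuffle []      m n = ≡.trans (cong₂ _*_ (coeff-𝟙 m) (coeff-𝟙 n))
  (sym (≡.trans (coeff-𝟙 (m ++ n)) (one-++ m n)))
evaluate-unshuffle (u ∷ κ) m n = begin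
  evaluate (⟦ Λ-leibniz u ⟧ (unshuffle κ)) m n
    ≡⟨ evaluate-leibniz u (unshuffle κ) m n ⟩
  divide u (λ a → evaluate (unshuffle κ) a n) m + sgn (∣ m ∣ₘ ℙ.* ∣ u ∣₁) * divide u (λ b → evaluate (unshuffle κ) m b) n
    ≡⟨ cong₂ (λ x y → x + sgn (∣ m ∣ₘ ℙ.* ∣ u ∣₁) * y)
         (divide-ext u m λ a → evaluate-unshuffle κ a n) (divide-ext u n λ b → evaluate-unshuffle κ m b) ⟩
  divide u (λ a → coeff (powers κ) (a ++ n)) m + sgn (∣ m ∣ₘ ℙ.* ∣ u ∣₁) * divide u (λ b → coeff (powers κ) (m ++ b)) n
    ≡⟨ divide-++ u (coeff (powers κ)) m n ⟨
  divide u (coeff (powers κ)) (m ++ n)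
    ≡⟨ coeff-powerSum-∙ u (powers κ) (m ++ n) ⟨
  coeff (powers (u ∷ κ)) (m ++ n) ∎
  where open ≡-Reasoning

-- As a function of two sets of variables, `unshuffle κ` is `powers κ` on their union, whose
-- supersymmetry is known; injectivity of evaluation carries it back to tensors.
unshuffle-supersymmetric : Delete.Supersymmetric Λ⊗Λ unshuffle
unshuffle-supersymmetric {μ} {ν} π = evaluate-injective (unshuffle μ) (sgn (inversions π) ·ₜ unshuffle ν) λ m n → begin
  evaluate (unshuffle μ) m n
    ≡⟨ evaluate-unshuffle μ m n ⟩
  coeff (powers μ) (m ++ n)
    ≡⟨ powers-supersymmetric π (m ++ n) ⟩
  sgn (inversions π) * coeff (powers ν) (m ++ n)
    ≡⟨ cong (sgn (inversions π) *_) (evaluate-unshuffle ν m n) ⟨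
  sgn (inversions π) * evaluate (unshuffle ν) m n
    ≡⟨ _⟶_.*ₗ-homo evaluate₂ (sgn (inversions π)) (unshuffle ν) (m , n) ⟨
  evaluate (sgn (inversions π) ·ₜ unshuffle ν) m n ∎
  where open ≡-Reasoning

Λ-Δ : Λ-space ⟶ Λ⊗Λ
Λ-Δ = universal {Λ⊗Λ} {unshuffle} unshuffle-supersymmetric

Λ-Δ-powers : ∀ κ → ⟦ Λ-Δ ⟧ (powers κ) ≈[ Λ⊗Λ ] unshuffle κ
Λ-Δ-powers = universal-powers {Λ⊗Λ} {unshuffle} unshuffle-supersymmetric

onUnionₗ : Λ-space ⟶ Functions₂
onUnionₗ = mkLinear onUnion (λ f≈ mn → f≈ (proj₁ mn ++ proj₂ mn)) (λ _ _ _ → ≡.refl) (λ _ _ _ → ≡.refl)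

evaluate-Δ : ∀ f m n → evaluate (⟦ Λ-Δ ⟧ f) m n ≡ coeff f (m ++ n)
evaluate-Δ f m n = ext-powers {Functions₂} (evaluate₂ ∘ₗ Λ-Δ) onUnionₗ
  (λ κ mn → ≡.trans (evaluate-cong (Λ-Δ-powers κ) (proj₁ mn) (proj₂ mn)) (evaluate-unshuffle κ (proj₁ mn) (proj₂ mn)))
  f (m , n)

Λ-Δ-isCoproduct : IsCoproduct Λ-Δ
Λ-Δ-isCoproduct f F = mk⇔
  (λ F≈f → evaluate-injective F (⟦ Λ-Δ ⟧ f) λ m n → ≡.trans (F≈f (m , n)) (sym (evaluate-Δ f m n)))
  (λ F≈Δf mn → ≡.trans (evaluate-cong F≈Δf (proj₁ mn) (proj₂ mn)) (evaluate-Δ f (proj₁ mn) (proj₂ mn)))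

-- Cocommutativity, counit and coassociativity

symmetric-++-comm : ∀ {G} → Delete.Supersymmetric ℚ-space G → ∀ m n → G (m ++ n) ≡ sgn (∣ m ∣ₘ ℙ.* ∣ n ∣ₘ) * G (n ++ m)
symmetric-++-comm {G} S []      n = sym (≡.trans (ℚₚ.*-identityˡ (G (n ++ []))) (cong G (Listₚ.++-identityʳ n)))
symmetric-++-comm {G} S (u ∷ m) n = begin
  G (u ∷ (m ++ n))
    ≡⟨ symmetric-++-comm (λ π → S (prep u π)) m n ⟩
  sgn (∣ m ∣ₘ ℙ.* ∣ n ∣ₘ) * G (u ∷ (n ++ m))
    -- `shift` brings `u` to the front, whereas here it must leave the front; the sign is its own
    -- inverse.
    ≡⟨ cong (sgn (∣ m ∣ₘ ℙ.* ∣ n ∣ₘ) *_) (sgn-self-cancel (∣ u ∣₁ ℙ.* ∣ n ∣ₘ) (G (u ∷ (n ++ m)))) ⟨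
  sgn (∣ m ∣ₘ ℙ.* ∣ n ∣ₘ) * (sgn (∣ u ∣₁ ℙ.* ∣ n ∣ₘ) * (sgn (∣ u ∣₁ ℙ.* ∣ n ∣ₘ) * G (u ∷ (n ++ m))))
    ≡⟨ cong (λ x → sgn (∣ m ∣ₘ ℙ.* ∣ n ∣ₘ) * (sgn (∣ u ∣₁ ℙ.* ∣ n ∣ₘ) * x))
         (≡.trans (S (proj₁ (shift n u m))) (cong (λ p → sgn p * G (u ∷ (n ++ m))) (proj₂ (shift n u m)))) ⟨
  sgn (∣ m ∣ₘ ℙ.* ∣ n ∣ₘ) * (sgn (∣ u ∣₁ ℙ.* ∣ n ∣ₘ) * G (n ++ u ∷ m))
    ≡⟨ signs₂ (∣ m ∣ₘ ℙ.* ∣ n ∣ₘ) (∣ u ∣₁ ℙ.* ∣ n ∣ₘ) (G (n ++ u ∷ m)) ⟩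
  sgn ((∣ u ∣₁ ℙ.* ∣ n ∣ₘ) ℙ.+ (∣ m ∣ₘ ℙ.* ∣ n ∣ₘ)) * G (n ++ u ∷ m)
    ≡⟨ cong (λ p → sgn p * G (n ++ u ∷ m))
         (≡.trans (cong (ℙ._* ∣ n ∣ₘ) (∣∣-∷ u m)) (ℙₚ.*-distribʳ-+ ∣ n ∣ₘ ∣ u ∣₁ ∣ m ∣ₘ)) ⟨
  sgn (∣ u ∷ m ∣ₘ ℙ.* ∣ n ∣ₘ) * G (n ++ u ∷ m) ∎
  where open ≡-Reasoning

swapped : Functions₂ ⟶ Functions₂
swapped = mkLinear (λ F mn → sgn (∣ proj₁ mn ∣ₘ ℙ.* ∣ proj₂ mn ∣ₘ) * F (proj₂ mn , proj₁ mn))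
  (λ F≈ mn → cong (sgn (∣ proj₁ mn ∣ₘ ℙ.* ∣ proj₂ mn ∣ₘ) *_) (F≈ (proj₂ mn , proj₁ mn)))
  (λ F G mn → ℚₚ.*-distribˡ-+ (sgn (∣ proj₁ mn ∣ₘ ℙ.* ∣ proj₂ mn ∣ₘ)) (F (proj₂ mn , proj₁ mn)) (G (proj₂ mn , proj₁ mn)))
  (λ r F mn → *-swap (sgn (∣ proj₁ mn ∣ₘ ℙ.* ∣ proj₂ mn ∣ₘ)) r (F (proj₂ mn , proj₁ mn)))

-- At fixed monomials `m` and `n`, exactly one of the four parity components of `τ` survives, the
-- one selected by their parities.
evaluate-τ : ∀ X m n → evaluate (⟦ SΛ.τ ⟧ X) m n ≡ sgn (∣ m ∣ₘ ℙ.* ∣ n ∣ₘ) * evaluate X n m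
evaluate-τ X m n = ext-⊗ {Λ-space} {Λ-space} {Functions₂} (evaluate₂ ∘ₗ SΛ.τ) (swapped ∘ₗ evaluate₂)
  (λ f g mn → term ∣ proj₁ mn ∣ₘ ∣ proj₂ mn ∣ₘ (coeff f (proj₂ mn)) (coeff g (proj₁ mn))) X (m , n)
  where
  term : ∀ p q x y →
    (((sgn (0ℙ ℙ.* 0ℙ) * (δ 0ℙ p * y)) * (δ 0ℙ q * x) + (sgn (0ℙ ℙ.* 1ℙ) * (δ 1ℙ p * y)) * (δ 0ℙ q * x))
      + (sgn (1ℙ ℙ.* 0ℙ) * (δ 0ℙ p * y)) * (δ 1ℙ q * x)) + (sgn (1ℙ ℙ.* 1ℙ) * (δ 1ℙ p * y)) * (δ 1ℙ q * x)
    ≡ sgn (p ℙ.* q) * (x * y)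
  term 0ℙ 0ℙ = solve 2 (λ x y →
    (((con 1ℚ :* (con 1ℚ :* y)) :* (con 1ℚ :* x) :+ (con 1ℚ :* (con 0ℚ :* y)) :* (con 1ℚ :* x))
      :+ (con 1ℚ :* (con 1ℚ :* y)) :* (con 0ℚ :* x)) :+ (con (- 1ℚ) :* (con 0ℚ :* y)) :* (con 0ℚ :* x)
    := con 1ℚ :* (x :* y)) ≡.refl
  term 0ℙ 1ℙ = solve 2 (λ x y →
    (((con 1ℚ :* (con 1ℚ :* y)) :* (con 0ℚ :* x) :+ (con 1ℚ :* (con 0ℚ :* y)) :* (con 0ℚ :* x))
      :+ (con 1ℚ :* (con 1ℚ :* y)) :* (con 1ℚ :* x)) :+ (con (- 1ℚ) :* (con 0ℚ :* y)) :* (con 1ℚ :* x)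
    := con 1ℚ :* (x :* y)) ≡.refl
  term 1ℙ 0ℙ = solve 2 (λ x y →
    (((con 1ℚ :* (con 0ℚ :* y)) :* (con 1ℚ :* x) :+ (con 1ℚ :* (con 1ℚ :* y)) :* (con 1ℚ :* x))
      :+ (con 1ℚ :* (con 0ℚ :* y)) :* (con 0ℚ :* x)) :+ (con (- 1ℚ) :* (con 1ℚ :* y)) :* (con 0ℚ :* x)
    := con 1ℚ :* (x :* y)) ≡.refl
  term 1ℙ 1ℙ = solve 2 (λ x y →
    (((con 1ℚ :* (con 0ℚ :* y)) :* (con 0ℚ :* x) :+ (con 1ℚ :* (con 1ℚ :* y)) :* (con 0ℚ :* x))
      :+ (con 1ℚ :* (con 0ℚ :* y)) :* (con 1ℚ :* x)) :+ (con (- 1ℚ) :* (con 1ℚ :* y)) :* (con 1ℚ :* x)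
    := con (- 1ℚ) :* (x :* y)) ≡.refl

Λ-Δ-cocommutative : SΛ.τ ∘ₗ Λ-Δ ≐ Λ-Δ
Λ-Δ-cocommutative f = evaluate-injective (⟦ SΛ.τ ⟧ (⟦ Λ-Δ ⟧ f)) (⟦ Λ-Δ ⟧ f) λ m n → begin
  evaluate (⟦ SΛ.τ ⟧ (⟦ Λ-Δ ⟧ f)) m n                     ≡⟨ evaluate-τ (⟦ Λ-Δ ⟧ f) m n ⟩
  sgn (∣ m ∣ₘ ℙ.* ∣ n ∣ₘ) * evaluate (⟦ Λ-Δ ⟧ f) n m   ≡⟨ cong (sgn (∣ m ∣ₘ ℙ.* ∣ n ∣ₘ) *_) (evaluate-Δ f n m) ⟩
  sgn (∣ m ∣ₘ ℙ.* ∣ n ∣ₘ) * coeff f (n ++ m)         ≡⟨ symmetric-++-comm (SymmetricFunction.symmetric f) m n ⟨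
  coeff f (m ++ n)                                   ≡⟨ evaluate-Δ f m n ⟨
  evaluate (⟦ Λ-Δ ⟧ f) m n                             ∎
  where open ≡-Reasoning

coeff-counitˡ : ∀ X m → coeff (⟦ unitorˡ {Λ-space} ∘ₗ (Λ-counit ⊗₁ idₗ) ⟧ X) m ≡ evaluate X [] m
coeff-counitˡ 0ₜ       m = ≡.refl
coeff-counitˡ (X +ₜ Y) m = cong₂ _+_ (coeff-counitˡ X m) (coeff-counitˡ Y m)
coeff-counitˡ (f ⊗ₑ g) m = ≡.refl

coeff-counitʳ : ∀ X m → coeff (⟦ unitorʳ {Λ-space} ∘ₗ (idₗ ⊗₁ Λ-counit) ⟧ X) m ≡ evaluate X m []
coeff-counitʳ 0ₜ       m = ≡.refl
coeff-counitʳ (X +ₜ Y) m = cong₂ _+_ (coeff-counitʳ X m) (coeff-counitʳ Y m)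
coeff-counitʳ (f ⊗ₑ g) m = ℚₚ.*-comm (coeff g []) (coeff f m)

Λ-Δ-counitˡ : unitorˡ {Λ-space} ∘ₗ (Λ-counit ⊗₁ idₗ) ∘ₗ Λ-Δ ≐ idₗ
Λ-Δ-counitˡ f m = ≡.trans (coeff-counitˡ (⟦ Λ-Δ ⟧ f) m) (evaluate-Δ f [] m)

Λ-Δ-counitʳ : unitorʳ {Λ-space} ∘ₗ (idₗ ⊗₁ Λ-counit) ∘ₗ Λ-Δ ≐ idₗ
Λ-Δ-counitʳ f m = ≡.trans (coeff-counitʳ (⟦ Λ-Δ ⟧ f) m)
  (≡.trans (evaluate-Δ f m []) (cong (coeff f) (Listₚ.++-identityʳ m)))

evaluate₃ : ∣ Λ-space ⊗ Λ⊗Λ ∣ → Monomial → Monomial → Monomial → ℚ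
evaluate₃ X m n k = evaluate (⟦ contract {Λ⊗Λ} m ⟧ X) n k

evaluate₃-assocʳ : ∀ X g m n k →
  evaluate₃ (⟦ assocʳ {Λ-space} {Λ-space} {Λ-space} ⟧ (X ⊗ₑ g)) m n k ≡ evaluate X m n * coeff g k
evaluate₃-assocʳ 0ₜ       g m n k = sym (ℚₚ.*-zeroˡ (coeff g k))
evaluate₃-assocʳ (X +ₜ Y) g m n k = ≡.trans
  (cong₂ _+_ (evaluate₃-assocʳ X g m n k) (evaluate₃-assocʳ Y g m n k))
  (sym (ℚₚ.*-distribʳ-+ (coeff g k) (evaluate X m n) (evaluate Y m n)))
evaluate₃-assocʳ (f ⊗ₑ h) g m n k = ≡.refl

evaluate₃-Δ⊗1 : ∀ X m n k →
  evaluate₃ (⟦ assocʳ {Λ-space} {Λ-space} {Λ-space} ∘ₗ (Λ-Δ ⊗₁ idₗ) ⟧ X) m n k ≡ evaluate X (m ++ n) k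
evaluate₃-Δ⊗1 0ₜ       m n k = ≡.refl
evaluate₃-Δ⊗1 (X +ₜ Y) m n k = cong₂ _+_ (evaluate₃-Δ⊗1 X m n k) (evaluate₃-Δ⊗1 Y m n k)
evaluate₃-Δ⊗1 (f ⊗ₑ g) m n k = ≡.trans (evaluate₃-assocʳ (⟦ Λ-Δ ⟧ f) g m n k) (cong (_* coeff g k) (evaluate-Δ f m n))

evaluate₃-1⊗Δ : ∀ X m n k →
  evaluate₃ (⟦ _⊗₁_ {Λ-space} {Λ-space} {Λ-space} {Λ⊗Λ} idₗ Λ-Δ ⟧ X) m n k ≡ evaluate X m (n ++ k)
evaluate₃-1⊗Δ 0ₜ       m n k = ≡.refl
evaluate₃-1⊗Δ (X +ₜ Y) m n k = cong₂ _+_ (evaluate₃-1⊗Δ X m n k) (evaluate₃-1⊗Δ Y m n k)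
evaluate₃-1⊗Δ (f ⊗ₑ g) m n k = ≡.trans (_⟶_.*ₗ-homo evaluate₂ (coeff f m) (⟦ Λ-Δ ⟧ g) (n , k))
  (cong (coeff f m *_) (evaluate-Δ g n k))

-- On functions of three sets of variables, coassociativity is associativity of concatenation of
-- monomials.
Λ-Δ-coassoc : assocʳ {Λ-space} {Λ-space} {Λ-space} ∘ₗ (Λ-Δ ⊗₁ idₗ) ∘ₗ Λ-Δ ≐ (idₗ ⊗₁ Λ-Δ) ∘ₗ Λ-Δ
Λ-Δ-coassoc f = contract-injective {Λ⊗Λ} L R λ m → evaluate-injective (⟦ contract {Λ⊗Λ} m ⟧ L) (⟦ contract {Λ⊗Λ} m ⟧ R) λ n k → begin
  evaluate₃ L m n k                   ≡⟨ evaluate₃-Δ⊗1 (⟦ Λ-Δ ⟧ f) m n k ⟩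
  evaluate (⟦ Λ-Δ ⟧ f) (m ++ n) k       ≡⟨ evaluate-Δ f (m ++ n) k ⟩
  coeff f ((m ++ n) ++ k)             ≡⟨ cong (coeff f) (Listₚ.++-assoc m n k) ⟩
  coeff f (m ++ (n ++ k))             ≡⟨ evaluate-Δ f m (n ++ k) ⟨
  evaluate (⟦ Λ-Δ ⟧ f) m (n ++ k)       ≡⟨ evaluate₃-1⊗Δ (⟦ Λ-Δ ⟧ f) m n k ⟨
  evaluate₃ R m n k                   ∎
  where
  open ≡-Reasoning
  L R : ∣ Λ-space ⊗ Λ⊗Λ ∣
  L = ⟦ assocʳ {Λ-space} {Λ-space} {Λ-space} ∘ₗ (Λ-Δ ⊗₁ idₗ) ⟧ (⟦ Λ-Δ ⟧ f)
  R = ⟦ _⊗₁_ {Λ-space} {Λ-space} {Λ-space} {Λ⊗Λ} idₗ Λ-Δ ⟧ (⟦ Λ-Δ ⟧ f)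

Λ-Δ-𝟙 : ⟦ Λ-Δ ⟧ 𝟙 ≈[ Λ⊗Λ ] 𝟙 ⊗ₑ 𝟙
Λ-Δ-𝟙 = Λ-Δ-powers []

-- Superalgebras generated by primitive elements

products : (A : SuperSpace) → (SuperSpace.space A ⊗ SuperSpace.space A ⟶ SuperSpace.space A) →
  (ℚ-space ⟶ SuperSpace.space A) → (Factor → ∣ SuperSpace.space A ∣) → Word → ∣ SuperSpace.space A ∣
products A mult u P []      = ⟦ u ⟧ 1ℚ
products A mult u P (w ∷ κ) = ⟦ mult ⟧ (P w ⊗ₑ products A mult u P κ)

-- The structure of Λ used for the remaining axioms: an algebra generated by
-- supercommuting primitive elements P u, on which the supersymmetric functions of words
-- define linear maps.
record GeneratedByPrimitives (A : SuperSpace)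
  (mult : SuperSpace.space A ⊗ SuperSpace.space A ⟶ SuperSpace.space A)
  (u : ℚ-space ⟶ SuperSpace.space A)
  (Δ : SuperSpace.space A ⟶ SuperSpace.space A ⊗ SuperSpace.space A)
  (ε : SuperSpace.space A ⟶ ℚ-space) : Set₁ where
  open SuperSpace A using (space)
  open LeftModule space
  open HopfStructure A mult u Δ ε using (_∙_; 𝟏)
  open Super A

  field
    P     : Factor → ∣ space ∣
    twist : Parity → space ⟶ space

  p : Factor → space ⟶ space
  p w = mult ∘ₗ insertˡ (P w)

  generated : Word → ∣ space ∣
  generated = products A mult u P

  field
    ∙-assoc     : ∀ x y z → (x ∙ y) ∙ z ≈ᴹ x ∙ (y ∙ z)
    ∙-identityˡ : ∀ x → 𝟏 ∙ x ≈ᴹ x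
    P-comm      : Supercommute p
    ext         : ∀ {V} (h k : space ⟶ V) → (∀ κ → ⟦ h ⟧ (generated κ) ≈[ V ] ⟦ k ⟧ (generated κ)) → h ≐ k
    free        : ∀ {V} {Φ} → Delete.Supersymmetric V Φ → ∃ λ (h : space ⟶ V) → ∀ κ → ⟦ h ⟧ (generated κ) ≈[ V ] Φ κ
    -- Since the parity of `generated κ` is known, the sign rule for an `x` of mixed parity is a
    -- twist of `x`, without the sum over parities in the definition of `τ`.
    τ-generated : ∀ κ x → ⟦ τ ⟧ (x ⊗ₑ generated κ) ≈[ space ⊗ space ] generated κ ⊗ₑ ⟦ twist ∣ κ ∣ₘ ⟧ x
    twist-∙     : ∀ q x y → ⟦ twist q ⟧ (x ∙ y) ≈ᴹ ⟦ twist q ⟧ x ∙ ⟦ twist q ⟧ y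
    twist-𝟏     : ∀ q → ⟦ twist q ⟧ 𝟏 ≈ᴹ 𝟏
    twist-P     : ∀ q w → ⟦ twist q ⟧ (P w) ≈ᴹ (sgn (∣ w ∣₁ ℙ.* q) *ₗ P w)
    Δ-𝟏         : ⟦ Δ ⟧ 𝟏 ≈[ space ⊗ space ] 𝟏 ⊗ₑ 𝟏
    Δ-P         : ∀ w x → ⟦ Δ ⟧ (P w ∙ x) ≈[ space ⊗ space ]
                  ⟦ _⊗₁_ {space} {space} {space} {space} (p w) idₗ ⟧ (⟦ Δ ⟧ x) +ₜ ⟦ twist ∣ w ∣₁ ⊗₁ p w ⟧ (⟦ Δ ⟧ x)
    ε-𝟏         : ⟦ ε ⟧ 𝟏 ≡ 1ℚ
    ε-P         : ∀ w x → ⟦ ε ⟧ (P w ∙ x) ≡ 0ℚ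

-- Multiplicativity of the coproduct

module Bialgebra {A mult u Δ ε} (G : GeneratedByPrimitives A mult u Δ ε) where
  open SuperSpace A using (space)
  open LeftModule space
  open HopfStructure A mult u Δ ε using (_∙_; 𝟏; _∙₂_)
  open Super A
  open GeneratedByPrimitives G
  open Sum space using (_·_; ·-congʳ; ·-congˡ; ·-comm)
  private
    module ℝ = SetoidReasoning ≈ᴹ-setoid
    module ℝ₂ = SetoidReasoning (LeftModule.≈ᴹ-setoid (space ⊗ space))

  Space₂ Space₄ : Space
  Space₂ = space ⊗ space
  Space₄ = Space₂ ⊗ Space₂

  ∙-cong : ∀ {x x′ y y′} → x ≈ᴹ x′ → y ≈ᴹ y′ → x ∙ y ≈ᴹ x′ ∙ y′
  ∙-cong p q = _⟶_.⟦⟧-cong mult (⊗-cong p q)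

  ∙-·ˡ : ∀ r x y → (r · x) ∙ y ≈ᴹ r · (x ∙ y)
  ∙-·ˡ r x y = _⟶_.*ₗ-homo mult r (x ⊗ₑ y)

  ∙-·ʳ : ∀ r x y → x ∙ (r · y) ≈ᴹ r · (x ∙ y)
  ∙-·ʳ r x y = _⟶_.*ₗ-homo (mult ∘ₗ insertˡ x) r y

  twist-p : ∀ q w x → ⟦ twist q ⟧ (P w ∙ x) ≈ᴹ sgn (∣ w ∣₁ ℙ.* q) · (P w ∙ ⟦ twist q ⟧ x)
  twist-p q w x = begin
    ⟦ twist q ⟧ (P w ∙ x)                           ≈⟨ twist-∙ q (P w) x ⟩
    ⟦ twist q ⟧ (P w) ∙ ⟦ twist q ⟧ x               ≈⟨ ∙-cong (twist-P q w) ≈ᴹ-refl ⟩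
    (sgn (∣ w ∣₁ ℙ.* q) · P w) ∙ ⟦ twist q ⟧ x      ≈⟨ ∙-·ˡ (sgn (∣ w ∣₁ ℙ.* q)) (P w) (⟦ twist q ⟧ x) ⟩
    sgn (∣ w ∣₁ ℙ.* q) · (P w ∙ ⟦ twist q ⟧ x)      ∎
    where open ℝ

  twist-generated : ∀ q κ → ⟦ twist q ⟧ (generated κ) ≈ᴹ sgn (∣ κ ∣ₘ ℙ.* q) · generated κ
  twist-generated q []      = ≈ᴹ-trans (twist-𝟏 q) (≈ᴹ-sym (*ₗ-identityˡ 𝟏))
  twist-generated q (w ∷ κ) = begin
    ⟦ twist q ⟧ (P w ∙ generated κ)
      ≈⟨ twist-p q w (generated κ) ⟩
    s · (P w ∙ ⟦ twist q ⟧ (generated κ))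
      ≈⟨ ·-congʳ s (≈ᴹ-trans (∙-cong ≈ᴹ-refl (twist-generated q κ)) (∙-·ʳ t (P w) (generated κ))) ⟩
    s · t · (P w ∙ generated κ)
      ≈⟨ *ₗ-assoc s t (P w ∙ generated κ) ⟨
    (s * t) · (P w ∙ generated κ)
      ≈⟨ ·-congˡ (P w ∙ generated κ) (≡.trans (sym (sgn-+ (∣ w ∣₁ ℙ.* q) (∣ κ ∣ₘ ℙ.* q)))
           (cong sgn (≡.trans (sym (ℙₚ.*-distribʳ-+ q ∣ w ∣₁ ∣ κ ∣ₘ)) (cong (ℙ._* q) (sym (∣∣-∷ w κ)))))) ⟩
    sgn (∣ w ∷ κ ∣ₘ ℙ.* q) · (P w ∙ generated κ) ∎
    where
    open ℝ
    s t : ℚ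
    s = sgn (∣ w ∣₁ ℙ.* q)
    t = sgn (∣ κ ∣ₘ ℙ.* q)

  twist-comm : ∀ q r x → ⟦ twist q ⟧ (⟦ twist r ⟧ x) ≈ᴹ ⟦ twist r ⟧ (⟦ twist q ⟧ x)
  twist-comm q r = ext (twist q ∘ₗ twist r) (twist r ∘ₗ twist q) λ κ → ≈ᴹ-trans (twice q r κ)
    (≈ᴹ-trans (·-comm (sgn (∣ κ ∣ₘ ℙ.* r)) (sgn (∣ κ ∣ₘ ℙ.* q)) (generated κ)) (≈ᴹ-sym (twice r q κ)))
    where
    twice : ∀ q r κ → ⟦ twist q ⟧ (⟦ twist r ⟧ (generated κ)) ≈ᴹ sgn (∣ κ ∣ₘ ℙ.* r) · sgn (∣ κ ∣ₘ ℙ.* q) · generated κ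
    twice q r κ = ≈ᴹ-trans (_⟶_.⟦⟧-cong (twist q) (twist-generated r κ))
      (≈ᴹ-trans (_⟶_.*ₗ-homo (twist q) _ _) (·-congʳ _ (twist-generated q κ)))

  leibniz : Factor → Space₂ ⟶ Space₂
  leibniz w = (p w ⊗₁ idₗ) ⊕ (twist ∣ w ∣₁ ⊗₁ p w)

  -- On pure tensors `τ-middle` computes to the inner `τ` inside the linear map `around`, so
  -- `τ-generated` may be applied beneath it.
  τ-middle-generated : ∀ x y κ z →
    ⟦ τ-middle ⟧ ((x ⊗ₑ y) ⊗ₑ (generated κ ⊗ₑ z)) ≈[ Space₄ ] (x ⊗ₑ generated κ) ⊗ₑ (⟦ twist ∣ κ ∣ₘ ⟧ y ⊗ₑ z)
  τ-middle-generated x y κ z = _⟶_.⟦⟧-cong around (τ-generated κ y)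
    where
    around : Space₂ ⟶ Space₄
    around = assocˡ {space} {space} {Space₂} ∘ₗ insertˡ x ∘ₗ assocʳ {space} {space} {space} ∘ₗ insertʳ z

  mult₂ : Space₄ ⟶ Space₂
  mult₂ = (mult ⊗₁ mult) ∘ₗ τ-middle

  mult₂-generated : ∀ x y κ z →
    (x ⊗ₑ y) ∙₂ (generated κ ⊗ₑ z) ≈[ Space₂ ] (x ∙ generated κ) ⊗ₑ (⟦ twist ∣ κ ∣ₘ ⟧ y ∙ z)
  mult₂-generated x y κ z = _⟶_.⟦⟧-cong (mult ⊗₁ mult) (τ-middle-generated x y κ z)

  -- `leibniz w` is left multiplication by the coproduct of `P w`, so this is a case of
  -- associativity of `_∙₂_`. In the second term both sides move `P w` past `generated κ` and so
  -- acquire the same sign `s`.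
  leibniz-∙₂-generated : ∀ w x y κ z →
    ⟦ leibniz w ⟧ (x ⊗ₑ y) ∙₂ (generated κ ⊗ₑ z) ≈[ Space₂ ] ⟦ leibniz w ⟧ ((x ⊗ₑ y) ∙₂ (generated κ ⊗ₑ z))
  leibniz-∙₂-generated w x y κ z = begin
    ((P w ∙ x) ⊗ₑ y +ₜ t x ⊗ₑ (P w ∙ y)) ∙₂ (k ⊗ₑ z)
      ≈⟨ _⟶_.+ᴹ-homo (mult₂ ∘ₗ insertʳ (k ⊗ₑ z)) ((P w ∙ x) ⊗ₑ y) (t x ⊗ₑ (P w ∙ y)) ⟩
    ((P w ∙ x) ⊗ₑ y) ∙₂ (k ⊗ₑ z) +ₜ (t x ⊗ₑ (P w ∙ y)) ∙₂ (k ⊗ₑ z)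
      ≈⟨ +-cong (mult₂-generated (P w ∙ x) y κ z) (mult₂-generated (t x) (P w ∙ y) κ z) ⟩
    ((P w ∙ x) ∙ k) ⊗ₑ (q y ∙ z) +ₜ (t x ∙ k) ⊗ₑ (q (P w ∙ y) ∙ z)
      ≈⟨ +-cong (⊗-cong (∙-assoc (P w) x k) ≈ᴹ-refl) second ⟩
    (P w ∙ (x ∙ k)) ⊗ₑ (q y ∙ z) +ₜ t (x ∙ k) ⊗ₑ (P w ∙ (q y ∙ z))
      ≈⟨ _⟶_.⟦⟧-cong (leibniz w) (mult₂-generated x y κ z) ⟨
    ⟦ leibniz w ⟧ ((x ⊗ₑ y) ∙₂ (k ⊗ₑ z)) ∎
    where
    open ℝ₂
    k : ∣ space ∣
    k = generated κ
    t q : ∣ space ∣ → ∣ space ∣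
    t = ⟦ twist ∣ w ∣₁ ⟧
    q = ⟦ twist ∣ κ ∣ₘ ⟧
    s : ℚ
    s = sgn (∣ w ∣₁ ℙ.* ∣ κ ∣ₘ)
    q-p : q (P w ∙ y) ∙ z ≈ᴹ s · (P w ∙ (q y ∙ z))
    q-p = ≈ᴹ-trans (∙-cong (twist-p ∣ κ ∣ₘ w y) ≈ᴹ-refl)
      (≈ᴹ-trans (∙-·ˡ s (P w ∙ q y) z) (·-congʳ s (∙-assoc (P w) (q y) z)))
    t-∙ : t (x ∙ k) ≈ᴹ s · (t x ∙ k)
    t-∙ = ≈ᴹ-trans (twist-∙ ∣ w ∣₁ x k) (≈ᴹ-trans
      (∙-cong ≈ᴹ-refl (≈ᴹ-trans (twist-generated ∣ w ∣₁ κ) (·-congˡ k (cong sgn (ℙₚ.*-comm ∣ κ ∣ₘ ∣ w ∣₁)))))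
      (∙-·ʳ s (t x) k))
    second : (t x ∙ k) ⊗ₑ (q (P w ∙ y) ∙ z) ≈[ Space₂ ] t (x ∙ k) ⊗ₑ (P w ∙ (q y ∙ z))
    second = ≈-trans (⊗-cong ≈ᴹ-refl q-p) (≈-trans (⊗-scale s (t x ∙ k) (P w ∙ (q y ∙ z)))
      (⊗-cong (≈ᴹ-sym t-∙) ≈ᴹ-refl))

  leibniz-∙₂ : ∀ w X Y → ⟦ leibniz w ⟧ X ∙₂ Y ≈[ Space₂ ] ⟦ leibniz w ⟧ (X ∙₂ Y)
  leibniz-∙₂ w X Y = ext-⊗ (mult₂ ∘ₗ insertʳ Y ∘ₗ leibniz w) (leibniz w ∘ₗ mult₂ ∘ₗ insertʳ Y)
    (λ x y → ext-⊗ (mult₂ ∘ₗ insertˡ (⟦ leibniz w ⟧ (x ⊗ₑ y))) (leibniz w ∘ₗ mult₂ ∘ₗ insertˡ (x ⊗ₑ y))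
      (λ k z → ext
        (mult₂ ∘ₗ insertˡ (⟦ leibniz w ⟧ (x ⊗ₑ y)) ∘ₗ insertʳ z)
        (leibniz w ∘ₗ mult₂ ∘ₗ insertˡ (x ⊗ₑ y) ∘ₗ insertʳ z)
        (λ κ → leibniz-∙₂-generated w x y κ z) k) Y) X

  ∙₂-identityˡ : ∀ Y → (𝟏 ⊗ₑ 𝟏) ∙₂ Y ≈[ Space₂ ] Y
  ∙₂-identityˡ = ext-⊗ (mult₂ ∘ₗ insertˡ (𝟏 ⊗ₑ 𝟏)) idₗ λ y z →
    ext (mult₂ ∘ₗ insertˡ (𝟏 ⊗ₑ 𝟏) ∘ₗ insertʳ z) (insertʳ z)
      (λ κ → ≈-trans (mult₂-generated 𝟏 𝟏 κ z) (⊗-cong (∙-identityˡ (generated κ))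
        (≈ᴹ-trans (∙-cong (twist-𝟏 ∣ κ ∣ₘ) ≈ᴹ-refl) (∙-identityˡ z)))) y

  -- By `ext` the left factor is a product of generators. Its generators are peeled off one by one:
  -- `Δ-P` turns each into `leibniz w`, which leaves the product by `leibniz-∙₂`.
  Δ-∙ : ∀ x y → ⟦ Δ ⟧ (x ∙ y) ≈[ Space₂ ] ⟦ Δ ⟧ x ∙₂ ⟦ Δ ⟧ y
  Δ-∙ x y = ext (Δ ∘ₗ mult ∘ₗ insertʳ y) (mult₂ ∘ₗ insertʳ (⟦ Δ ⟧ y) ∘ₗ Δ) on-generated x
    where
    on-generated : ∀ κ → ⟦ Δ ⟧ (generated κ ∙ y) ≈[ Space₂ ] ⟦ Δ ⟧ (generated κ) ∙₂ ⟦ Δ ⟧ y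
    on-generated [] = begin
      ⟦ Δ ⟧ (𝟏 ∙ y)             ≈⟨ _⟶_.⟦⟧-cong Δ (∙-identityˡ y) ⟩
      ⟦ Δ ⟧ y                   ≈⟨ ∙₂-identityˡ (⟦ Δ ⟧ y) ⟨
      (𝟏 ⊗ₑ 𝟏) ∙₂ ⟦ Δ ⟧ y       ≈⟨ _⟶_.⟦⟧-cong (mult₂ ∘ₗ insertʳ (⟦ Δ ⟧ y)) Δ-𝟏 ⟨
      ⟦ Δ ⟧ 𝟏 ∙₂ ⟦ Δ ⟧ y        ∎
      where open ℝ₂
    on-generated (w ∷ κ) = begin
      ⟦ Δ ⟧ ((P w ∙ generated κ) ∙ y)
        ≈⟨ _⟶_.⟦⟧-cong Δ (∙-assoc (P w) (generated κ) y) ⟩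
      ⟦ Δ ⟧ (P w ∙ (generated κ ∙ y))
        ≈⟨ Δ-P w (generated κ ∙ y) ⟩
      ⟦ leibniz w ⟧ (⟦ Δ ⟧ (generated κ ∙ y))
        ≈⟨ _⟶_.⟦⟧-cong (leibniz w) (on-generated κ) ⟩
      ⟦ leibniz w ⟧ (⟦ Δ ⟧ (generated κ) ∙₂ ⟦ Δ ⟧ y)
        ≈⟨ leibniz-∙₂ w (⟦ Δ ⟧ (generated κ)) (⟦ Δ ⟧ y) ⟨
      ⟦ leibniz w ⟧ (⟦ Δ ⟧ (generated κ)) ∙₂ ⟦ Δ ⟧ y
        ≈⟨ _⟶_.⟦⟧-cong (mult₂ ∘ₗ insertʳ (⟦ Δ ⟧ y)) (Δ-P w (generated κ)) ⟨
      ⟦ Δ ⟧ (P w ∙ generated κ) ∙₂ ⟦ Δ ⟧ y ∎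
      where open ℝ₂

-- The antipode

module Antipode {A mult u Δ ε} (G : GeneratedByPrimitives A mult u Δ ε) where
  open SuperSpace A using (space)
  open LeftModule space
  open HopfStructure A mult u Δ ε using (_∙_; 𝟏)
  open Super A
  open GeneratedByPrimitives G
  open Bialgebra G
  open Sum space using (_·_; ·-congʳ; ·-congˡ; ·-comm)
  open SetoidReasoning ≈ᴹ-setoid

  -p : Factor → space ⟶ space
  -p w = (- 1ℚ) ⋆ p w

  -p-comm : Supercommute -p
  -p-comm v w x = begin
    - 1ℚ · (P v ∙ (- 1ℚ · (P w ∙ x)))     ≈⟨ ·-congʳ (- 1ℚ) (∙-·ʳ (- 1ℚ) (P v) (P w ∙ x)) ⟩
    - 1ℚ · - 1ℚ · (P v ∙ (P w ∙ x))       ≈⟨ ·-congʳ (- 1ℚ) (·-congʳ (- 1ℚ) (P-comm v w x)) ⟩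
    - 1ℚ · - 1ℚ · s · (P w ∙ (P v ∙ x))   ≈⟨ ·-congʳ (- 1ℚ) (·-comm (- 1ℚ) s (P w ∙ (P v ∙ x))) ⟩
    - 1ℚ · s · - 1ℚ · (P w ∙ (P v ∙ x))   ≈⟨ ·-comm (- 1ℚ) s (- 1ℚ · (P w ∙ (P v ∙ x))) ⟩
    s · - 1ℚ · - 1ℚ · (P w ∙ (P v ∙ x))   ≈⟨ ·-congʳ s (·-congʳ (- 1ℚ) (∙-·ʳ (- 1ℚ) (P w) (P v ∙ x))) ⟨
    s · - 1ℚ · (P w ∙ (- 1ℚ · (P v ∙ x))) ∎
    where
    s : ℚ
    s = sgn (∣ v ∣₁ ℙ.* ∣ w ∣₁)

  -- The antipode of a supercommutative algebra keeps the order of products, so a word in the `P w`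
  -- goes to the same word in their negatives.
  S : space ⟶ space
  S = proj₁ (free {space} {iterate -p 𝟏} (iterate-supersymmetric {L = -p} -p-comm 𝟏))

  S-generated : ∀ κ → ⟦ S ⟧ (generated κ) ≈ᴹ iterate -p 𝟏 κ
  S-generated = proj₂ (free {space} {iterate -p 𝟏} (iterate-supersymmetric {L = -p} -p-comm 𝟏))

  S-p : ∀ w x → ⟦ S ⟧ (P w ∙ x) ≈ᴹ - 1ℚ · (P w ∙ ⟦ S ⟧ x)
  S-p w = ext (S ∘ₗ p w) (-p w ∘ₗ S) λ κ →
    ≈ᴹ-trans (S-generated (w ∷ κ)) (_⟶_.⟦⟧-cong (-p w) (≈ᴹ-sym (S-generated κ)))

  twist-S : ∀ q x → ⟦ twist q ⟧ (⟦ S ⟧ x) ≈ᴹ ⟦ S ⟧ (⟦ twist q ⟧ x)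
  twist-S q = ext (twist q ∘ₗ S) (S ∘ₗ twist q) on-generated
    where
    on-generated : ∀ κ → ⟦ twist q ⟧ (⟦ S ⟧ (generated κ)) ≈ᴹ ⟦ S ⟧ (⟦ twist q ⟧ (generated κ))
    on-generated [] = begin
      ⟦ twist q ⟧ (⟦ S ⟧ 𝟏)   ≈⟨ _⟶_.⟦⟧-cong (twist q) (S-generated []) ⟩
      ⟦ twist q ⟧ 𝟏           ≈⟨ twist-𝟏 q ⟩
      𝟏                       ≈⟨ S-generated [] ⟨
      ⟦ S ⟧ 𝟏                 ≈⟨ _⟶_.⟦⟧-cong S (twist-𝟏 q) ⟨
      ⟦ S ⟧ (⟦ twist q ⟧ 𝟏)   ∎
    on-generated (w ∷ κ) = begin
      ⟦ twist q ⟧ (⟦ S ⟧ (P w ∙ g))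
        ≈⟨ _⟶_.⟦⟧-cong (twist q) (S-p w g) ⟩
      ⟦ twist q ⟧ (- 1ℚ · (P w ∙ ⟦ S ⟧ g))
        ≈⟨ _⟶_.*ₗ-homo (twist q) (- 1ℚ) (P w ∙ ⟦ S ⟧ g) ⟩
      - 1ℚ · ⟦ twist q ⟧ (P w ∙ ⟦ S ⟧ g)
        ≈⟨ ·-congʳ (- 1ℚ) (≈ᴹ-trans (twist-p q w (⟦ S ⟧ g)) (·-congʳ s (∙-cong ≈ᴹ-refl (on-generated κ)))) ⟩
      - 1ℚ · s · (P w ∙ ⟦ S ⟧ (⟦ twist q ⟧ g))
        ≈⟨ ·-comm (- 1ℚ) s (P w ∙ ⟦ S ⟧ (⟦ twist q ⟧ g)) ⟩
      s · - 1ℚ · (P w ∙ ⟦ S ⟧ (⟦ twist q ⟧ g))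
        ≈⟨ ·-congʳ s (S-p w (⟦ twist q ⟧ g)) ⟨
      s · ⟦ S ⟧ (P w ∙ ⟦ twist q ⟧ g)
        ≈⟨ _⟶_.*ₗ-homo S s (P w ∙ ⟦ twist q ⟧ g) ⟨
      ⟦ S ⟧ (s · (P w ∙ ⟦ twist q ⟧ g))
        ≈⟨ _⟶_.⟦⟧-cong S (twist-p q w g) ⟨
      ⟦ S ⟧ (⟦ twist q ⟧ (P w ∙ g)) ∎
      where
      g : ∣ space ∣
      g = generated κ
      s : ℚ
      s = sgn (∣ w ∣₁ ℙ.* q)

  -- Supercommutativity of a generator with an arbitrary element: the twist carries the sign of
  -- moving `P w` past `x`.
  twist-P-comm : ∀ w x y → ⟦ twist ∣ w ∣₁ ⟧ x ∙ (P w ∙ y) ≈ᴹ P w ∙ (x ∙ y)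
  twist-P-comm w x y = ext (mult ∘ₗ insertʳ (P w ∙ y) ∘ₗ twist ∣ w ∣₁) (p w ∘ₗ mult ∘ₗ insertʳ y) on-generated x
    where
    on-generated : ∀ κ → ⟦ twist ∣ w ∣₁ ⟧ (generated κ) ∙ (P w ∙ y) ≈ᴹ P w ∙ (generated κ ∙ y)
    on-generated [] = begin
      ⟦ twist ∣ w ∣₁ ⟧ 𝟏 ∙ (P w ∙ y)   ≈⟨ ∙-cong (twist-𝟏 ∣ w ∣₁) ≈ᴹ-refl ⟩
      𝟏 ∙ (P w ∙ y)                    ≈⟨ ∙-identityˡ (P w ∙ y) ⟩
      P w ∙ y                          ≈⟨ ∙-cong ≈ᴹ-refl (∙-identityˡ y) ⟨
      P w ∙ (𝟏 ∙ y)                    ∎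
    on-generated (v ∷ κ) = begin
      ⟦ twist ∣ w ∣₁ ⟧ (P v ∙ g) ∙ (P w ∙ y)
        ≈⟨ ∙-cong (twist-p ∣ w ∣₁ v g) ≈ᴹ-refl ⟩
      (s · (P v ∙ ⟦ twist ∣ w ∣₁ ⟧ g)) ∙ (P w ∙ y)
        ≈⟨ ∙-·ˡ s (P v ∙ ⟦ twist ∣ w ∣₁ ⟧ g) (P w ∙ y) ⟩
      s · ((P v ∙ ⟦ twist ∣ w ∣₁ ⟧ g) ∙ (P w ∙ y))
        ≈⟨ ·-congʳ s (∙-assoc (P v) (⟦ twist ∣ w ∣₁ ⟧ g) (P w ∙ y)) ⟩
      s · (P v ∙ (⟦ twist ∣ w ∣₁ ⟧ g ∙ (P w ∙ y)))
        ≈⟨ ·-congʳ s (∙-cong ≈ᴹ-refl (on-generated κ)) ⟩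
      s · (P v ∙ (P w ∙ (g ∙ y)))
        ≈⟨ ·-congˡ (P v ∙ (P w ∙ (g ∙ y))) (cong sgn (ℙₚ.*-comm ∣ v ∣₁ ∣ w ∣₁)) ⟩
      sgn (∣ w ∣₁ ℙ.* ∣ v ∣₁) · (P v ∙ (P w ∙ (g ∙ y)))
        ≈⟨ P-comm w v (g ∙ y) ⟨
      P w ∙ (P v ∙ (g ∙ y))
        ≈⟨ ∙-cong ≈ᴹ-refl (∙-assoc (P v) g y) ⟨
      P w ∙ ((P v ∙ g) ∙ y) ∎
      where
      g : ∣ space ∣
      g = generated κ
      s : ℚ
      s = sgn (∣ v ∣₁ ℙ.* ∣ w ∣₁)

  -- If h turns the Leibniz rule into zero, then h ∘ Δ is determined by its value at 𝟏.
  convolution-unit : (h : Space₂ ⟶ space) → (∀ w x y → ⟦ h ⟧ (⟦ leibniz w ⟧ (x ⊗ₑ y)) ≈ᴹ 0ᴹ) →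
    ⟦ h ⟧ (𝟏 ⊗ₑ 𝟏) ≈ᴹ 𝟏 → h ∘ₗ Δ ≐ u ∘ₗ ε
  convolution-unit h h-leibniz h-𝟏 = ext (h ∘ₗ Δ) (u ∘ₗ ε) on-generated
    where
    vanish : ∀ w X → ⟦ h ⟧ (⟦ leibniz w ⟧ X) ≈ᴹ 0ᴹ
    vanish w X = ≈ᴹ-trans (ext-⊗ (h ∘ₗ leibniz w) (0ℚ ⋆ (h ∘ₗ leibniz w))
      (λ x y → ≈ᴹ-trans (h-leibniz w x y) (≈ᴹ-sym (*ₗ-zeroˡ (⟦ h ⟧ (⟦ leibniz w ⟧ (x ⊗ₑ y)))))) X)
      (*ₗ-zeroˡ (⟦ h ⟧ (⟦ leibniz w ⟧ X)))
    on-generated : ∀ κ → ⟦ h ⟧ (⟦ Δ ⟧ (generated κ)) ≈ᴹ ⟦ u ⟧ (⟦ ε ⟧ (generated κ))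
    on-generated [] = begin
      ⟦ h ⟧ (⟦ Δ ⟧ 𝟏)   ≈⟨ _⟶_.⟦⟧-cong h Δ-𝟏 ⟩
      ⟦ h ⟧ (𝟏 ⊗ₑ 𝟏)    ≈⟨ h-𝟏 ⟩
      𝟏                 ≈⟨ _⟶_.⟦⟧-cong u ε-𝟏 ⟨
      ⟦ u ⟧ (⟦ ε ⟧ 𝟏)   ∎
    on-generated (w ∷ κ) = begin
      ⟦ h ⟧ (⟦ Δ ⟧ (P w ∙ generated κ))           ≈⟨ _⟶_.⟦⟧-cong h (Δ-P w (generated κ)) ⟩
      ⟦ h ⟧ (⟦ leibniz w ⟧ (⟦ Δ ⟧ (generated κ))) ≈⟨ vanish w (⟦ Δ ⟧ (generated κ)) ⟩
      0ᴹ                                          ≈⟨ _⟶_.0ᴹ-homo u ⟨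
      ⟦ u ⟧ 0ℚ                                    ≈⟨ _⟶_.⟦⟧-cong u (ε-P w (generated κ)) ⟨
      ⟦ u ⟧ (⟦ ε ⟧ (P w ∙ generated κ))           ∎

  negated-cancelˡ : ∀ x → (- 1ℚ · x) +ᴹ x ≈ᴹ 0ᴹ
  negated-cancelˡ x = ≈ᴹ-trans (+ᴹ-comm (- 1ℚ · x) x) (zero-difference space x x ≈ᴹ-refl)

  antipodeˡ : mult ∘ₗ (S ⊗₁ idₗ) ∘ₗ Δ ≐ u ∘ₗ ε
  antipodeˡ = convolution-unit (mult ∘ₗ (S ⊗₁ idₗ))
    (λ w x y → begin
      ⟦ mult ⟧ (⟦ S ⟧ (P w ∙ x) ⊗ₑ y +ₜ ⟦ S ⟧ (⟦ twist ∣ w ∣₁ ⟧ x) ⊗ₑ (P w ∙ y))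
        ≈⟨ _⟶_.+ᴹ-homo mult (⟦ S ⟧ (P w ∙ x) ⊗ₑ y) (⟦ S ⟧ (⟦ twist ∣ w ∣₁ ⟧ x) ⊗ₑ (P w ∙ y)) ⟩
      ⟦ S ⟧ (P w ∙ x) ∙ y +ᴹ ⟦ S ⟧ (⟦ twist ∣ w ∣₁ ⟧ x) ∙ (P w ∙ y)
        ≈⟨ +ᴹ-cong (∙-cong (S-p w x) ≈ᴹ-refl) (∙-cong (≈ᴹ-sym (twist-S ∣ w ∣₁ x)) ≈ᴹ-refl) ⟩
      (- 1ℚ · (P w ∙ ⟦ S ⟧ x)) ∙ y +ᴹ ⟦ twist ∣ w ∣₁ ⟧ (⟦ S ⟧ x) ∙ (P w ∙ y)
        -- With `P w` moved to the front, the second term is the opposite of the first.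
        ≈⟨ +ᴹ-cong (≈ᴹ-trans (∙-·ˡ (- 1ℚ) (P w ∙ ⟦ S ⟧ x) y) (·-congʳ (- 1ℚ) (∙-assoc (P w) (⟦ S ⟧ x) y)))
             (twist-P-comm w (⟦ S ⟧ x) y) ⟩
      (- 1ℚ · (P w ∙ (⟦ S ⟧ x ∙ y))) +ᴹ P w ∙ (⟦ S ⟧ x ∙ y)
        ≈⟨ negated-cancelˡ (P w ∙ (⟦ S ⟧ x ∙ y)) ⟩
      0ᴹ ∎)
    (≈ᴹ-trans (∙-cong (S-generated []) ≈ᴹ-refl) (∙-identityˡ 𝟏))

  antipodeʳ : mult ∘ₗ (idₗ ⊗₁ S) ∘ₗ Δ ≐ u ∘ₗ ε
  antipodeʳ = convolution-unit (mult ∘ₗ (idₗ ⊗₁ S))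
    (λ w x y → begin
      ⟦ mult ⟧ ((P w ∙ x) ⊗ₑ ⟦ S ⟧ y +ₜ ⟦ twist ∣ w ∣₁ ⟧ x ⊗ₑ ⟦ S ⟧ (P w ∙ y))
        ≈⟨ _⟶_.+ᴹ-homo mult ((P w ∙ x) ⊗ₑ ⟦ S ⟧ y) (⟦ twist ∣ w ∣₁ ⟧ x ⊗ₑ ⟦ S ⟧ (P w ∙ y)) ⟩
      (P w ∙ x) ∙ ⟦ S ⟧ y +ᴹ ⟦ twist ∣ w ∣₁ ⟧ x ∙ ⟦ S ⟧ (P w ∙ y)
        ≈⟨ +ᴹ-cong (∙-assoc (P w) x (⟦ S ⟧ y)) (∙-cong ≈ᴹ-refl (S-p w y)) ⟩
      P w ∙ (x ∙ ⟦ S ⟧ y) +ᴹ ⟦ twist ∣ w ∣₁ ⟧ x ∙ (- 1ℚ · (P w ∙ ⟦ S ⟧ y))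
        ≈⟨ +ᴹ-cong ≈ᴹ-refl (≈ᴹ-trans (∙-·ʳ (- 1ℚ) (⟦ twist ∣ w ∣₁ ⟧ x) (P w ∙ ⟦ S ⟧ y))
             (·-congʳ (- 1ℚ) (twist-P-comm w x (⟦ S ⟧ y)))) ⟩
      P w ∙ (x ∙ ⟦ S ⟧ y) +ᴹ (- 1ℚ · (P w ∙ (x ∙ ⟦ S ⟧ y)))
        ≈⟨ zero-difference space (P w ∙ (x ∙ ⟦ S ⟧ y)) (P w ∙ (x ∙ ⟦ S ⟧ y)) ≈ᴹ-refl ⟩
      0ᴹ ∎)
    (≈ᴹ-trans (∙-cong ≈ᴹ-refl (S-generated [])) (∙-identityˡ 𝟏))

-- Derivations dual to the generators

indicator-cong : ∀ v w (r : Factor → ℚ) → [ w ≡ v ] * r v ≡ [ w ≡ v ] * r w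
indicator-cong v w r with w ≟ v
... | yes ≡.refl = ≡.refl
... | no  w≢v    = ≡.trans (cong (_* r v) ([≢]-zero w≢v)) (≡.trans (ℚₚ.*-zeroˡ (r v))
  (sym (≡.trans (cong (_* r w) ([≢]-zero w≢v)) (ℚₚ.*-zeroˡ (r w)))))

-- For words of equal length the number of matchings is a coefficient of `powers κ`, whose parity is
-- known.
matchings-parity : ∀ κ μ → matchings κ μ ≡ 0ℚ ⊎ ∣ μ ∣ₘ ≡ ∣ κ ∣ₘ
matchings-parity κ μ = by-length (length κ ℕₚ.≟ length μ)
  where
  ∣monomial∣ : ∀ μ → ∣ monomial μ ∣ₘ ≡ ∣ μ ∣ₘ
  ∣monomial∣ []      = ≡.refl
  ∣monomial∣ (v ∷ μ) = ≡.trans (∣∣-∷ (letter v) (monomial μ))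
    (≡.trans (cong (∣ v ∣₁ ℙ.+_) (∣monomial∣ μ)) (sym (∣∣-∷ v μ)))
  by-length : Dec (length κ ≡ length μ) → matchings κ μ ≡ 0ℚ ⊎ ∣ μ ∣ₘ ≡ ∣ κ ∣ₘ
  by-length (no  κ≢μ) = inj₁ (matchings-length κ μ κ≢μ)
  by-length (yes κ≡μ) = map-⊎
    (λ ≡0 → ≡.trans (sym (coeff-powers κ μ (ℕₚ.≤-reflexive κ≡μ))) ≡0)
    (λ ∣μ∣ → ≡.trans (sym (∣monomial∣ μ)) ∣μ∣)
    (powers-parity κ (monomial μ))

module Derivation {A mult u Δ ε} (G : GeneratedByPrimitives A mult u Δ ε) where
  open SuperSpace A using (space)
  open LeftModule space
  open HopfStructure A mult u Δ ε using (_∙_; 𝟏)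
  open Super A using (_⊕_)
  open GeneratedByPrimitives G
  open Bialgebra G
  open Antipode G
  open Sum space using (_·_; ·-congʳ; ·-congˡ; ·-comm; +-interchangeᴹ)
  open Delete space using (delete; sgn-self-·)
  open SetoidReasoning ≈ᴹ-setoid

  indicator-· : ∀ v w (r : Factor → ℚ) x → [ w ≡ v ] · (r v · x) ≈ᴹ [ w ≡ v ] · (r w · x)
  indicator-· v w r x = ≈ᴹ-trans (≈ᴹ-sym (*ₗ-assoc [ w ≡ v ] (r v) x))
    (≈ᴹ-trans (·-congˡ x (indicator-cong v w r)) (*ₗ-assoc [ w ≡ v ] (r w) x))

  -- x + x′ η with η² = 0; the second coordinate of p w + [ w ≡ v ] η carries the
  -- derivative.
  Dual : Space
  Dual = DirectProduct.leftModule space space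

  dual : Factor → Factor → Dual ⟶ Dual
  dual v w = mkLinear
    (λ x → P w ∙ proj₁ x , P w ∙ proj₂ x +ᴹ ([ w ≡ v ] · ⟦ twist ∣ v ∣₁ ⟧ (proj₁ x)))
    (λ x≈ → _⟶_.⟦⟧-cong (p w) (proj₁ x≈) , +ᴹ-cong (_⟶_.⟦⟧-cong (p w) (proj₂ x≈)) (_⟶_.⟦⟧-cong q (proj₁ x≈)))
    (λ x y → _⟶_.+ᴹ-homo (p w) (proj₁ x) (proj₁ y) , ≈ᴹ-trans
      (+ᴹ-cong (_⟶_.+ᴹ-homo (p w) (proj₂ x) (proj₂ y)) (_⟶_.+ᴹ-homo q (proj₁ x) (proj₁ y)))
      (+-interchangeᴹ (P w ∙ proj₂ x) (P w ∙ proj₂ y) (⟦ q ⟧ (proj₁ x)) (⟦ q ⟧ (proj₁ y))))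
    (λ r x → _⟶_.*ₗ-homo (p w) r (proj₁ x) , ≈ᴹ-trans
      (+ᴹ-cong (_⟶_.*ₗ-homo (p w) r (proj₂ x)) (_⟶_.*ₗ-homo q r (proj₁ x)))
      (≈ᴹ-sym (*ₗ-distribˡ r (P w ∙ proj₂ x) (⟦ q ⟧ (proj₁ x)))))
    where
    q : space ⟶ space
    q = [ w ≡ v ] ⋆ twist ∣ v ∣₁

  p-· : ∀ w r x → P w ∙ (r · x) ≈ᴹ r · (P w ∙ x)
  p-· w = _⟶_.*ₗ-homo (p w)

  p-+ : ∀ w x y → P w ∙ (x +ᴹ y) ≈ᴹ P w ∙ x +ᴹ P w ∙ y
  p-+ w = _⟶_.+ᴹ-homo (p w)

  dual-comm : ∀ v → Supercommute (dual v)
  dual-comm v w y (f , f′) = P-comm w y f , (begin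
    P w ∙ (P y ∙ f′ +ᴹ ([ y ≡ v ] · t f)) +ᴹ ([ w ≡ v ] · t (P y ∙ f))
      ≈⟨ +ᴹ-cong (expand w y) (twisted w y) ⟩
    (P w ∙ (P y ∙ f′) +ᴹ ([ y ≡ v ] · (P w ∙ t f))) +ᴹ (s · ([ w ≡ v ] · (P y ∙ t f)))
      ≈⟨ +ᴹ-assoc _ _ _ ⟩
    P w ∙ (P y ∙ f′) +ᴹ (([ y ≡ v ] · (P w ∙ t f)) +ᴹ (s · ([ w ≡ v ] · (P y ∙ t f))))
      ≈⟨ +ᴹ-cong (P-comm w y f′) (≈ᴹ-trans (+ᴹ-comm _ _) (+ᴹ-cong ≈ᴹ-refl step₁)) ⟩
    (s · (P y ∙ (P w ∙ f′))) +ᴹ ((s · ([ w ≡ v ] · (P y ∙ t f))) +ᴹ (s · ([ y ≡ v ] · t (P w ∙ f))))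
      ≈⟨ +ᴹ-assoc _ _ _ ⟨
    ((s · (P y ∙ (P w ∙ f′))) +ᴹ (s · ([ w ≡ v ] · (P y ∙ t f)))) +ᴹ (s · ([ y ≡ v ] · t (P w ∙ f)))
      ≈⟨ +ᴹ-cong (≈ᴹ-trans (≈ᴹ-sym (*ₗ-distribˡ s _ _)) (·-congʳ s (≈ᴹ-sym (expand y w)))) ≈ᴹ-refl ⟩
    (s · (P y ∙ (P w ∙ f′ +ᴹ ([ w ≡ v ] · t f)))) +ᴹ (s · ([ y ≡ v ] · t (P w ∙ f)))
      ≈⟨ *ₗ-distribˡ s _ _ ⟨
    s · (P y ∙ (P w ∙ f′ +ᴹ ([ w ≡ v ] · t f)) +ᴹ ([ y ≡ v ] · t (P w ∙ f))) ∎)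
    where
    t : ∣ space ∣ → ∣ space ∣
    t = ⟦ twist ∣ v ∣₁ ⟧
    s : ℚ
    s = sgn (∣ w ∣₁ ℙ.* ∣ y ∣₁)
    expand : ∀ w y → P w ∙ (P y ∙ f′ +ᴹ ([ y ≡ v ] · t f)) ≈ᴹ P w ∙ (P y ∙ f′) +ᴹ ([ y ≡ v ] · (P w ∙ t f))
    expand w y = ≈ᴹ-trans (p-+ w _ _) (+ᴹ-cong ≈ᴹ-refl (p-· w [ y ≡ v ] (t f)))
    twisted : ∀ w y → [ w ≡ v ] · t (P y ∙ f) ≈ᴹ sgn (∣ w ∣₁ ℙ.* ∣ y ∣₁) · ([ w ≡ v ] · (P y ∙ t f))
    twisted w y = begin
      [ w ≡ v ] · t (P y ∙ f)
        ≈⟨ ·-congʳ [ w ≡ v ] (≈ᴹ-trans (twist-p ∣ v ∣₁ y f) (·-congˡ _ (cong sgn (ℙₚ.*-comm ∣ y ∣₁ ∣ v ∣₁)))) ⟩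
      [ w ≡ v ] · (sgn (∣ v ∣₁ ℙ.* ∣ y ∣₁) · (P y ∙ t f))
        ≈⟨ indicator-· v w (λ x → sgn (∣ x ∣₁ ℙ.* ∣ y ∣₁)) (P y ∙ t f) ⟩
      [ w ≡ v ] · (sgn (∣ w ∣₁ ℙ.* ∣ y ∣₁) · (P y ∙ t f))
        ≈⟨ ·-comm [ w ≡ v ] _ _ ⟩
      sgn (∣ w ∣₁ ℙ.* ∣ y ∣₁) · ([ w ≡ v ] · (P y ∙ t f)) ∎
    step₁ : [ y ≡ v ] · (P w ∙ t f) ≈ᴹ s · ([ y ≡ v ] · t (P w ∙ f))
    step₁ = begin
      [ y ≡ v ] · (P w ∙ t f)
        ≈⟨ sgn-self-· (∣ w ∣₁ ℙ.* ∣ y ∣₁) ([ y ≡ v ] · (P w ∙ t f)) ⟨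
      s · (s · ([ y ≡ v ] · (P w ∙ t f)))
        ≈⟨ ·-congʳ s (·-congˡ _ (cong sgn (ℙₚ.*-comm ∣ w ∣₁ ∣ y ∣₁))) ⟩
      s · (sgn (∣ y ∣₁ ℙ.* ∣ w ∣₁) · ([ y ≡ v ] · (P w ∙ t f)))
        ≈⟨ ·-congʳ s (twisted y w) ⟨
      s · ([ y ≡ v ] · t (P w ∙ f)) ∎

  private
    dual-lift : ∀ v → ∃ λ (h : space ⟶ Dual) → ∀ κ → ⟦ h ⟧ (generated κ) ≈[ Dual ] iterate (dual v) (𝟏 , 0ᴹ) κ
    dual-lift v = free {Dual} {iterate (dual v) (𝟏 , 0ᴹ)} (iterate-supersymmetric {Dual} {dual v} (dual-comm v) (𝟏 , 0ᴹ))

  ∂ : Factor → space ⟶ space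
  ∂ v = mkLinear (λ x → proj₂ (h x)) (λ x≈y → proj₂ (_⟶_.⟦⟧-cong (proj₁ (dual-lift v)) x≈y))
    (λ x y → proj₂ (_⟶_.+ᴹ-homo (proj₁ (dual-lift v)) x y)) (λ r x → proj₂ (_⟶_.*ₗ-homo (proj₁ (dual-lift v)) r x))
    where
    h : ∣ space ∣ → ∣ Dual ∣
    h = ⟦ proj₁ (dual-lift v) ⟧

  ∂-𝟏 : ∀ v → ⟦ ∂ v ⟧ 𝟏 ≈ᴹ 0ᴹ
  ∂-𝟏 v = proj₂ (proj₂ (dual-lift v) [])

  -- `∂ v` acts from the right: it passes `x` on the way to `P w`, whence the twist. This side fits
  -- the pairing of tensors, where the sign comes from moving `a` past `g` in ⟨ f ⊗ g , a ⊗ b ⟩.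
  ∂-p : ∀ v w x → ⟦ ∂ v ⟧ (P w ∙ x) ≈ᴹ P w ∙ ⟦ ∂ v ⟧ x +ᴹ ([ w ≡ v ] · ⟦ twist ∣ v ∣₁ ⟧ x)
  ∂-p v w = ext (∂ v ∘ₗ p w) ((p w ∘ₗ ∂ v) ⊕ ([ w ≡ v ] ⋆ twist ∣ v ∣₁)) λ κ → begin
    ⟦ ∂ v ⟧ (generated (w ∷ κ))
      ≈⟨ proj₂ (proj₂ (dual-lift v) (w ∷ κ)) ⟩
    P w ∙ proj₂ (iterate (dual v) (𝟏 , 0ᴹ) κ) +ᴹ ([ w ≡ v ] · ⟦ twist ∣ v ∣₁ ⟧ (proj₁ (iterate (dual v) (𝟏 , 0ᴹ) κ)))
      ≈⟨ +ᴹ-cong (∙-cong ≈ᴹ-refl (≈ᴹ-sym (proj₂ (proj₂ (dual-lift v) κ))))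
           (·-congʳ [ w ≡ v ] (_⟶_.⟦⟧-cong (twist ∣ v ∣₁) (first κ))) ⟩
    P w ∙ ⟦ ∂ v ⟧ (generated κ) +ᴹ ([ w ≡ v ] · ⟦ twist ∣ v ∣₁ ⟧ (generated κ)) ∎
    where
    first : ∀ κ → proj₁ (iterate (dual v) (𝟏 , 0ᴹ) κ) ≈ᴹ generated κ
    first []      = ≈ᴹ-refl
    first (y ∷ κ) = _⟶_.⟦⟧-cong (p y) (first κ)

  -- The derivation `∂ v` changes parity by `∣ v ∣₁`, which accounts for the sign.
  ∂-twist : ∀ v q x → ⟦ ∂ v ⟧ (⟦ twist q ⟧ x) ≈ᴹ sgn (∣ v ∣₁ ℙ.* q) · ⟦ twist q ⟧ (⟦ ∂ v ⟧ x)
  ∂-twist v q = ext (∂ v ∘ₗ twist q) (sgn (∣ v ∣₁ ℙ.* q) ⋆ (twist q ∘ₗ ∂ v)) on-generated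
    where
    t : ∣ space ∣ → ∣ space ∣
    t = ⟦ twist q ⟧
    s : Factor → ℚ
    s w = sgn (∣ w ∣₁ ℙ.* q)
    on-generated : ∀ κ → ⟦ ∂ v ⟧ (t (generated κ)) ≈ᴹ s v · t (⟦ ∂ v ⟧ (generated κ))
    on-generated [] = begin
      ⟦ ∂ v ⟧ (t 𝟏)             ≈⟨ _⟶_.⟦⟧-cong (∂ v) (twist-𝟏 q) ⟩
      ⟦ ∂ v ⟧ 𝟏                 ≈⟨ ∂-𝟏 v ⟩
      0ᴹ                        ≈⟨ _⟶_.0ᴹ-homo (s v ⋆ twist q) ⟨
      s v · t 0ᴹ                ≈⟨ _⟶_.⟦⟧-cong (s v ⋆ twist q) (∂-𝟏 v) ⟨
      s v · t (⟦ ∂ v ⟧ 𝟏)       ∎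
    on-generated (w ∷ κ) = begin
      ⟦ ∂ v ⟧ (t (P w ∙ g))
        ≈⟨ _⟶_.⟦⟧-cong (∂ v) (twist-p q w g) ⟩
      ⟦ ∂ v ⟧ (s w · (P w ∙ t g))
        ≈⟨ _⟶_.*ₗ-homo (∂ v) (s w) (P w ∙ t g) ⟩
      s w · ⟦ ∂ v ⟧ (P w ∙ t g)
        ≈⟨ ·-congʳ (s w) (≈ᴹ-trans (∂-p v w (t g)) (+ᴹ-cong
             (≈ᴹ-trans (∙-cong ≈ᴹ-refl (on-generated κ)) (p-· w (s v) (t (⟦ ∂ v ⟧ g))))
             (·-congʳ [ w ≡ v ] (twist-comm ∣ v ∣₁ q g)))) ⟩
      s w · ((s v · (P w ∙ t (⟦ ∂ v ⟧ g))) +ᴹ ([ w ≡ v ] · t (⟦ twist ∣ v ∣₁ ⟧ g)))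
        ≈⟨ *ₗ-distribˡ (s w) _ _ ⟩
      (s w · (s v · (P w ∙ t (⟦ ∂ v ⟧ g)))) +ᴹ (s w · ([ w ≡ v ] · t (⟦ twist ∣ v ∣₁ ⟧ g)))
        ≈⟨ +ᴹ-cong (·-comm (s w) (s v) _) (≈ᴹ-trans (·-comm (s w) [ w ≡ v ] _)
             (≈ᴹ-trans (≈ᴹ-sym (indicator-· v w s (t (⟦ twist ∣ v ∣₁ ⟧ g)))) (·-comm [ w ≡ v ] (s v) _))) ⟩
      (s v · (s w · (P w ∙ t (⟦ ∂ v ⟧ g)))) +ᴹ (s v · ([ w ≡ v ] · t (⟦ twist ∣ v ∣₁ ⟧ g)))
        ≈⟨ *ₗ-distribˡ (s v) _ _ ⟨
      s v · ((s w · (P w ∙ t (⟦ ∂ v ⟧ g))) +ᴹ ([ w ≡ v ] · t (⟦ twist ∣ v ∣₁ ⟧ g)))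
        ≈⟨ ·-congʳ (s v) (+ᴹ-cong (twist-p q w (⟦ ∂ v ⟧ g)) (_⟶_.*ₗ-homo (twist q) [ w ≡ v ] _)) ⟨
      s v · (t (P w ∙ ⟦ ∂ v ⟧ g) +ᴹ t ([ w ≡ v ] · ⟦ twist ∣ v ∣₁ ⟧ g))
        ≈⟨ ·-congʳ (s v) (≈ᴹ-trans (_⟶_.⟦⟧-cong (twist q) (∂-p v w g)) (_⟶_.+ᴹ-homo (twist q) _ _)) ⟨
      s v · t (⟦ ∂ v ⟧ (P w ∙ g)) ∎
      where
      g : ∣ space ∣
      g = generated κ

  -- In `twice-p`, exchanging `v` and `y` interchanges the two indicator terms up to the sign `s`,
  -- which squares to 1.
  ∂-∂ : ∀ v y x → ⟦ ∂ v ⟧ (⟦ ∂ y ⟧ x) ≈ᴹ sgn (∣ v ∣₁ ℙ.* ∣ y ∣₁) · ⟦ ∂ y ⟧ (⟦ ∂ v ⟧ x)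
  ∂-∂ v y = ext (∂ v ∘ₗ ∂ y) (s ⋆ (∂ y ∘ₗ ∂ v)) on-generated
    where
    s : ℚ
    s = sgn (∣ v ∣₁ ℙ.* ∣ y ∣₁)
    twice-𝟏 : ∀ v y → ⟦ ∂ v ⟧ (⟦ ∂ y ⟧ 𝟏) ≈ᴹ 0ᴹ
    twice-𝟏 v y = ≈ᴹ-trans (_⟶_.⟦⟧-cong (∂ v) (∂-𝟏 y)) (_⟶_.0ᴹ-homo (∂ v))
    twice-p : ∀ v y w g → ⟦ ∂ v ⟧ (⟦ ∂ y ⟧ (P w ∙ g)) ≈ᴹ P w ∙ ⟦ ∂ v ⟧ (⟦ ∂ y ⟧ g) +ᴹ
      (([ w ≡ v ] · ⟦ twist ∣ v ∣₁ ⟧ (⟦ ∂ y ⟧ g)) +ᴹ ([ w ≡ y ] · (sgn (∣ v ∣₁ ℙ.* ∣ y ∣₁) · ⟦ twist ∣ y ∣₁ ⟧ (⟦ ∂ v ⟧ g))))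
    twice-p v y w g = begin
      ⟦ ∂ v ⟧ (⟦ ∂ y ⟧ (P w ∙ g))
        ≈⟨ _⟶_.⟦⟧-cong (∂ v) (∂-p y w g) ⟩
      ⟦ ∂ v ⟧ (P w ∙ ⟦ ∂ y ⟧ g +ᴹ ([ w ≡ y ] · ⟦ twist ∣ y ∣₁ ⟧ g))
        ≈⟨ _⟶_.+ᴹ-homo (∂ v) _ _ ⟩
      ⟦ ∂ v ⟧ (P w ∙ ⟦ ∂ y ⟧ g) +ᴹ ⟦ ∂ v ⟧ ([ w ≡ y ] · ⟦ twist ∣ y ∣₁ ⟧ g)
        ≈⟨ +ᴹ-cong (∂-p v w (⟦ ∂ y ⟧ g))
             (≈ᴹ-trans (_⟶_.*ₗ-homo (∂ v) [ w ≡ y ] _) (·-congʳ [ w ≡ y ] (∂-twist v ∣ y ∣₁ g))) ⟩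
      (P w ∙ ⟦ ∂ v ⟧ (⟦ ∂ y ⟧ g) +ᴹ ([ w ≡ v ] · ⟦ twist ∣ v ∣₁ ⟧ (⟦ ∂ y ⟧ g))) +ᴹ _
        ≈⟨ +ᴹ-assoc _ _ _ ⟩
      P w ∙ ⟦ ∂ v ⟧ (⟦ ∂ y ⟧ g) +ᴹ
      (([ w ≡ v ] · ⟦ twist ∣ v ∣₁ ⟧ (⟦ ∂ y ⟧ g)) +ᴹ ([ w ≡ y ] · (sgn (∣ v ∣₁ ℙ.* ∣ y ∣₁) · ⟦ twist ∣ y ∣₁ ⟧ (⟦ ∂ v ⟧ g)))) ∎
    on-generated : ∀ κ → ⟦ ∂ v ⟧ (⟦ ∂ y ⟧ (generated κ)) ≈ᴹ s · ⟦ ∂ y ⟧ (⟦ ∂ v ⟧ (generated κ))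
    on-generated [] = ≈ᴹ-trans (twice-𝟏 v y) (≈ᴹ-sym (≈ᴹ-trans (·-congʳ s (twice-𝟏 y v)) (*ₗ-zeroʳ s)))
    on-generated (w ∷ κ) = begin
      ⟦ ∂ v ⟧ (⟦ ∂ y ⟧ (P w ∙ g))
        ≈⟨ twice-p v y w g ⟩
      P w ∙ ⟦ ∂ v ⟧ (⟦ ∂ y ⟧ g) +ᴹ (([ w ≡ v ] · a) +ᴹ ([ w ≡ y ] · (s · b)))
        ≈⟨ +ᴹ-cong (≈ᴹ-trans (∙-cong ≈ᴹ-refl (on-generated κ)) (p-· w s (⟦ ∂ y ⟧ (⟦ ∂ v ⟧ g))))
             (≈ᴹ-trans (+ᴹ-comm _ _) (+ᴹ-cong (·-comm [ w ≡ y ] s b) back)) ⟩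
      (s · (P w ∙ ⟦ ∂ y ⟧ (⟦ ∂ v ⟧ g))) +ᴹ ((s · ([ w ≡ y ] · b)) +ᴹ (s · ([ w ≡ v ] · (sgn (∣ y ∣₁ ℙ.* ∣ v ∣₁) · a))))
        ≈⟨ +ᴹ-cong ≈ᴹ-refl (*ₗ-distribˡ s _ _) ⟨
      (s · (P w ∙ ⟦ ∂ y ⟧ (⟦ ∂ v ⟧ g))) +ᴹ (s · (([ w ≡ y ] · b) +ᴹ ([ w ≡ v ] · (sgn (∣ y ∣₁ ℙ.* ∣ v ∣₁) · a))))
        ≈⟨ *ₗ-distribˡ s _ _ ⟨
      s · (P w ∙ ⟦ ∂ y ⟧ (⟦ ∂ v ⟧ g) +ᴹ (([ w ≡ y ] · b) +ᴹ ([ w ≡ v ] · (sgn (∣ y ∣₁ ℙ.* ∣ v ∣₁) · a))))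
        ≈⟨ ·-congʳ s (twice-p y v w g) ⟨
      s · ⟦ ∂ y ⟧ (⟦ ∂ v ⟧ (P w ∙ g)) ∎
      where
      g a b : ∣ space ∣
      g = generated κ
      a = ⟦ twist ∣ v ∣₁ ⟧ (⟦ ∂ y ⟧ g)
      b = ⟦ twist ∣ y ∣₁ ⟧ (⟦ ∂ v ⟧ g)
      back : [ w ≡ v ] · a ≈ᴹ s · ([ w ≡ v ] · (sgn (∣ y ∣₁ ℙ.* ∣ v ∣₁) · a))
      back = begin
        [ w ≡ v ] · a
          ≈⟨ sgn-self-· (∣ v ∣₁ ℙ.* ∣ y ∣₁) ([ w ≡ v ] · a) ⟨
        s · (s · ([ w ≡ v ] · a))
          ≈⟨ ·-congʳ s (·-comm s [ w ≡ v ] a) ⟩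
        s · ([ w ≡ v ] · (s · a))
          ≈⟨ ·-congʳ s (·-congʳ [ w ≡ v ] (·-congˡ a (cong sgn (ℙₚ.*-comm ∣ v ∣₁ ∣ y ∣₁)))) ⟩
        s · ([ w ≡ v ] · (sgn (∣ y ∣₁ ℙ.* ∣ v ∣₁) · a)) ∎

  ∂-∙ : ∀ v x y → ⟦ ∂ v ⟧ (x ∙ y) ≈ᴹ ⟦ ∂ v ⟧ x ∙ ⟦ twist ∣ v ∣₁ ⟧ y +ᴹ x ∙ ⟦ ∂ v ⟧ y
  ∂-∙ v x y = ext (∂ v ∘ₗ mult ∘ₗ insertʳ y)
    ((mult ∘ₗ insertʳ (t y) ∘ₗ ∂ v) ⊕ (mult ∘ₗ insertʳ (⟦ ∂ v ⟧ y))) on-generated x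
    where
    t : ∣ space ∣ → ∣ space ∣
    t = ⟦ twist ∣ v ∣₁ ⟧
    on-generated : ∀ κ → ⟦ ∂ v ⟧ (generated κ ∙ y) ≈ᴹ ⟦ ∂ v ⟧ (generated κ) ∙ t y +ᴹ generated κ ∙ ⟦ ∂ v ⟧ y
    on-generated [] = begin
      ⟦ ∂ v ⟧ (𝟏 ∙ y)                     ≈⟨ _⟶_.⟦⟧-cong (∂ v) (∙-identityˡ y) ⟩
      ⟦ ∂ v ⟧ y                           ≈⟨ +ᴹ-identityˡ (⟦ ∂ v ⟧ y) ⟨
      0ᴹ +ᴹ ⟦ ∂ v ⟧ y                     ≈⟨ +ᴹ-cong (≈ᴹ-trans (∙-cong (∂-𝟏 v) ≈ᴹ-refl) (_⟶_.0ᴹ-homo (mult ∘ₗ insertʳ (t y))))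
                                               (∙-identityˡ (⟦ ∂ v ⟧ y)) ⟨
      ⟦ ∂ v ⟧ 𝟏 ∙ t y +ᴹ 𝟏 ∙ ⟦ ∂ v ⟧ y    ∎
    on-generated (w ∷ κ) = begin
      ⟦ ∂ v ⟧ ((P w ∙ g) ∙ y)
        ≈⟨ _⟶_.⟦⟧-cong (∂ v) (∙-assoc (P w) g y) ⟩
      ⟦ ∂ v ⟧ (P w ∙ (g ∙ y))
        ≈⟨ ∂-p v w (g ∙ y) ⟩
      P w ∙ ⟦ ∂ v ⟧ (g ∙ y) +ᴹ ([ w ≡ v ] · t (g ∙ y))
        ≈⟨ +ᴹ-cong (≈ᴹ-trans (∙-cong ≈ᴹ-refl (on-generated κ)) (p-+ w _ _))
             (≈ᴹ-trans (·-congʳ [ w ≡ v ] (twist-∙ ∣ v ∣₁ g y)) (≈ᴹ-sym (∙-·ˡ [ w ≡ v ] (t g) (t y)))) ⟩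
      (P w ∙ (⟦ ∂ v ⟧ g ∙ t y) +ᴹ P w ∙ (g ∙ ⟦ ∂ v ⟧ y)) +ᴹ ([ w ≡ v ] · t g) ∙ t y
        ≈⟨ +ᴹ-cong (+ᴹ-cong (∙-assoc (P w) (⟦ ∂ v ⟧ g) (t y)) (∙-assoc (P w) g (⟦ ∂ v ⟧ y))) ≈ᴹ-refl ⟨
      ((P w ∙ ⟦ ∂ v ⟧ g) ∙ t y +ᴹ (P w ∙ g) ∙ ⟦ ∂ v ⟧ y) +ᴹ ([ w ≡ v ] · t g) ∙ t y
        ≈⟨ ≈ᴹ-trans (+ᴹ-assoc _ _ _) (≈ᴹ-trans (+ᴹ-cong ≈ᴹ-refl (+ᴹ-comm _ _)) (≈ᴹ-sym (+ᴹ-assoc _ _ _))) ⟩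
      ((P w ∙ ⟦ ∂ v ⟧ g) ∙ t y +ᴹ ([ w ≡ v ] · t g) ∙ t y) +ᴹ (P w ∙ g) ∙ ⟦ ∂ v ⟧ y
        ≈⟨ +ᴹ-cong (_⟶_.+ᴹ-homo (mult ∘ₗ insertʳ (t y)) (P w ∙ ⟦ ∂ v ⟧ g) ([ w ≡ v ] · t g)) ≈ᴹ-refl ⟨
      (P w ∙ ⟦ ∂ v ⟧ g +ᴹ ([ w ≡ v ] · t g)) ∙ t y +ᴹ (P w ∙ g) ∙ ⟦ ∂ v ⟧ y
        ≈⟨ +ᴹ-cong (∙-cong (∂-p v w g) ≈ᴹ-refl) ≈ᴹ-refl ⟨
      ⟦ ∂ v ⟧ (P w ∙ g) ∙ t y +ᴹ (P w ∙ g) ∙ ⟦ ∂ v ⟧ y ∎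
      where
      g : ∣ space ∣
      g = generated κ

  ∂-S : ∀ v x → ⟦ ∂ v ⟧ (⟦ S ⟧ x) ≈ᴹ - 1ℚ · ⟦ S ⟧ (⟦ ∂ v ⟧ x)
  ∂-S v = ext (∂ v ∘ₗ S) ((- 1ℚ) ⋆ (S ∘ₗ ∂ v)) on-generated
    where
    t : ∣ space ∣ → ∣ space ∣
    t = ⟦ twist ∣ v ∣₁ ⟧
    on-generated : ∀ κ → ⟦ ∂ v ⟧ (⟦ S ⟧ (generated κ)) ≈ᴹ - 1ℚ · ⟦ S ⟧ (⟦ ∂ v ⟧ (generated κ))
    on-generated [] = begin
      ⟦ ∂ v ⟧ (⟦ S ⟧ 𝟏)           ≈⟨ _⟶_.⟦⟧-cong (∂ v) (S-generated []) ⟩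
      ⟦ ∂ v ⟧ 𝟏                   ≈⟨ ∂-𝟏 v ⟩
      0ᴹ                          ≈⟨ _⟶_.0ᴹ-homo ((- 1ℚ) ⋆ S) ⟨
      - 1ℚ · ⟦ S ⟧ 0ᴹ             ≈⟨ _⟶_.⟦⟧-cong ((- 1ℚ) ⋆ S) (∂-𝟏 v) ⟨
      - 1ℚ · ⟦ S ⟧ (⟦ ∂ v ⟧ 𝟏)    ∎
    on-generated (w ∷ κ) = begin
      ⟦ ∂ v ⟧ (⟦ S ⟧ (P w ∙ g))
        ≈⟨ _⟶_.⟦⟧-cong (∂ v) (S-p w g) ⟩
      ⟦ ∂ v ⟧ (- 1ℚ · (P w ∙ ⟦ S ⟧ g))
        ≈⟨ _⟶_.*ₗ-homo (∂ v) (- 1ℚ) (P w ∙ ⟦ S ⟧ g) ⟩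
      - 1ℚ · ⟦ ∂ v ⟧ (P w ∙ ⟦ S ⟧ g)
        ≈⟨ ·-congʳ (- 1ℚ) (≈ᴹ-trans (∂-p v w (⟦ S ⟧ g)) (+ᴹ-cong
             (≈ᴹ-trans (∙-cong ≈ᴹ-refl (on-generated κ)) (p-· w (- 1ℚ) (⟦ S ⟧ (⟦ ∂ v ⟧ g))))
             (·-congʳ [ w ≡ v ] (twist-S ∣ v ∣₁ g)))) ⟩
      - 1ℚ · ((- 1ℚ · (P w ∙ ⟦ S ⟧ (⟦ ∂ v ⟧ g))) +ᴹ ([ w ≡ v ] · ⟦ S ⟧ (t g)))
        ≈⟨ ·-congʳ (- 1ℚ) (+ᴹ-cong (S-p w (⟦ ∂ v ⟧ g)) (_⟶_.*ₗ-homo S [ w ≡ v ] (t g))) ⟨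
      - 1ℚ · (⟦ S ⟧ (P w ∙ ⟦ ∂ v ⟧ g) +ᴹ ⟦ S ⟧ ([ w ≡ v ] · t g))
        ≈⟨ ·-congʳ (- 1ℚ) (≈ᴹ-trans (_⟶_.⟦⟧-cong S (∂-p v w g)) (_⟶_.+ᴹ-homo S _ _)) ⟨
      - 1ℚ · ⟦ S ⟧ (⟦ ∂ v ⟧ (P w ∙ g)) ∎
      where
      g : ∣ space ∣
      g = generated κ

  -- `∂ w` passes the letters after the removed one, `delete w` those before it. The two parities
  -- differ by |μ| + |w|, the same at every position, so one common sign relates the two operations.
  ∂-generated : ∀ w μ → ⟦ ∂ w ⟧ (generated μ) ≈ᴹ sgn (∣ w ∣₁ ℙ.* (∣ μ ∣ₘ ℙ.+ ∣ w ∣₁)) · delete w generated μ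
  ∂-generated w []      = ≈ᴹ-trans (∂-𝟏 w) (≈ᴹ-sym (*ₗ-zeroʳ (sgn (∣ w ∣₁ ℙ.* (0ℙ ℙ.+ ∣ w ∣₁)))))
  ∂-generated w (v ∷ μ) = begin
    ⟦ ∂ w ⟧ (P v ∙ generated μ)
      ≈⟨ ∂-p w v (generated μ) ⟩
    P v ∙ ⟦ ∂ w ⟧ (generated μ) +ᴹ ([ v ≡ w ] · ⟦ twist ∣ w ∣₁ ⟧ (generated μ))
      ≈⟨ +ᴹ-cong (≈ᴹ-trans (∙-cong ≈ᴹ-refl (∂-generated w μ)) (p-· v a (delete w generated μ)))
           (·-congʳ [ v ≡ w ] (twist-generated ∣ w ∣₁ μ)) ⟩
    (a · (P v ∙ delete w generated μ)) +ᴹ ([ v ≡ w ] · (sgn (∣ μ ∣ₘ ℙ.* ∣ w ∣₁) · generated μ))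
      ≈⟨ +ᴹ-cong later matched ⟩
    (s · (sgn (∣ w ∣₁ ℙ.* ∣ v ∣₁) · delete w (λ ν → generated (v ∷ ν)) μ)) +ᴹ (s · ([ w ≡ v ] · generated μ))
      ≈⟨ +ᴹ-comm _ _ ⟩
    (s · ([ w ≡ v ] · generated μ)) +ᴹ (s · (sgn (∣ w ∣₁ ℙ.* ∣ v ∣₁) · delete w (λ ν → generated (v ∷ ν)) μ))
      ≈⟨ *ₗ-distribˡ s _ _ ⟨
    s · delete w generated (v ∷ μ) ∎
    where
    a s : ℚ
    a = sgn (∣ w ∣₁ ℙ.* (∣ μ ∣ₘ ℙ.+ ∣ w ∣₁))
    s = sgn (∣ w ∣₁ ℙ.* (∣ v ∷ μ ∣ₘ ℙ.+ ∣ w ∣₁))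
    s≡ : ∀ v → sgn (∣ w ∣₁ ℙ.* (∣ v ∷ μ ∣ₘ ℙ.+ ∣ w ∣₁)) ≡ sgn (∣ w ∣₁ ℙ.* ∣ v ∣₁) * a
    s≡ v = ≡.trans (cong (λ q → sgn (∣ w ∣₁ ℙ.* q)) (≡.trans (cong (ℙ._+ ∣ w ∣₁) (∣∣-∷ v μ)) (ℙₚ.+-assoc ∣ v ∣₁ ∣ μ ∣ₘ ∣ w ∣₁)))
      (sgn-distribˡ ∣ w ∣₁ ∣ v ∣₁ (∣ μ ∣ₘ ℙ.+ ∣ w ∣₁))
    later : a · (P v ∙ delete w generated μ) ≈ᴹ s · (sgn (∣ w ∣₁ ℙ.* ∣ v ∣₁) · delete w (λ ν → generated (v ∷ ν)) μ)
    later = begin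
      a · (P v ∙ delete w generated μ)
        ≈⟨ ·-congʳ a (delete-natural (p v) w generated μ) ⟨
      a · d
        ≈⟨ ·-congʳ a (sgn-self-· (∣ w ∣₁ ℙ.* ∣ v ∣₁) d) ⟨
      a · (t · (t · d))
        ≈⟨ ·-comm a t (t · d) ⟩
      t · (a · (t · d))
        ≈⟨ *ₗ-assoc t a (t · d) ⟨
      (t * a) · (t · d)
        ≈⟨ ·-congˡ (t · d) (s≡ v) ⟨
      s · (t · d) ∎
      where
      t : ℚ
      t = sgn (∣ w ∣₁ ℙ.* ∣ v ∣₁)
      d : ∣ space ∣
      d = delete w (λ ν → generated (v ∷ ν)) μ
    loop : ∀ p q → sgn (q ℙ.* p) ≡ sgn (p ℙ.* p) * sgn (p ℙ.* (q ℙ.+ p))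
    loop 0ℙ 0ℙ = ≡.refl
    loop 0ℙ 1ℙ = ≡.refl
    loop 1ℙ 0ℙ = ≡.refl
    loop 1ℙ 1ℙ = ≡.refl
    matched : [ v ≡ w ] · (sgn (∣ μ ∣ₘ ℙ.* ∣ w ∣₁) · generated μ) ≈ᴹ s · ([ w ≡ v ] · generated μ)
    matched = begin
      [ v ≡ w ] · (sgn (∣ μ ∣ₘ ℙ.* ∣ w ∣₁) · generated μ)
        ≈⟨ ·-congʳ [ v ≡ w ] (·-congˡ (generated μ) (≡.trans (loop ∣ w ∣₁ ∣ μ ∣ₘ) (sym (s≡ w)))) ⟩
      [ v ≡ w ] · (sgn (∣ w ∣₁ ℙ.* (∣ w ∷ μ ∣ₘ ℙ.+ ∣ w ∣₁)) · generated μ)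
        ≈⟨ indicator-· w v (λ x → sgn (∣ w ∣₁ ℙ.* (∣ x ∷ μ ∣ₘ ℙ.+ ∣ w ∣₁))) (generated μ) ⟩
      [ v ≡ w ] · (s · generated μ)
        ≈⟨ ·-comm [ v ≡ w ] s (generated μ) ⟩
      s · ([ v ≡ w ] · generated μ)
        ≈⟨ ·-congʳ s (·-congˡ (generated μ) ([≡]-sym v w)) ⟩
      s · ([ w ≡ v ] · generated μ) ∎

-- The pairing

module Pairing {A mult u Δ ε} (G : GeneratedByPrimitives A mult u Δ ε) where
  open SuperSpace A using (space)
  open LeftModule space
  open HopfStructure A mult u Δ ε using (_∙_; 𝟏)
  open Super A using (_⊕_; τ-middle)
  open GeneratedByPrimitives G
  open Bialgebra G
  open Antipode G
  open Derivation G
  open Sum space using (_·_; ·-congʳ; ·-congˡ)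
  open ≡-Reasoning

  ext-ℚ : (h k : space ⟶ ℚ-space) → (∀ κ → ⟦ h ⟧ (generated κ) ≡ ⟦ k ⟧ (generated κ)) → ∀ x → ⟦ h ⟧ x ≡ ⟦ k ⟧ x
  ext-ℚ = ext {ℚ-space}

  derivative : Word → space ⟶ ℚ-space
  derivative []      = ε
  derivative (w ∷ κ) = derivative κ ∘ₗ ∂ w

  derivative-symmetric : ∀ {μ ν} (π : μ ↭ ν) x → ⟦ derivative μ ⟧ x ≡ sgn (inversions π) * ⟦ derivative ν ⟧ x
  derivative-symmetric {μ} refl x = sym (ℚₚ.*-identityˡ (⟦ derivative μ ⟧ x))
  derivative-symmetric (prep w π) x = derivative-symmetric π (⟦ ∂ w ⟧ x)
  derivative-symmetric (swap {xs = μ} {ys = ν} v w π) x = begin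
    ⟦ derivative μ ⟧ (⟦ ∂ w ⟧ (⟦ ∂ v ⟧ x))
      ≡⟨ derivative-symmetric π (⟦ ∂ w ⟧ (⟦ ∂ v ⟧ x)) ⟩
    t * ⟦ derivative ν ⟧ (⟦ ∂ w ⟧ (⟦ ∂ v ⟧ x))
      ≡⟨ cong (t *_) (≡.trans (_⟶_.⟦⟧-cong (derivative ν) (∂-∂ w v x)) (_⟶_.*ₗ-homo (derivative ν) _ _)) ⟩
    t * (sgn (∣ w ∣₁ ℙ.* ∣ v ∣₁) * ⟦ derivative ν ⟧ (⟦ ∂ v ⟧ (⟦ ∂ w ⟧ x)))
      ≡⟨ cong (λ q → t * (sgn q * ⟦ derivative ν ⟧ (⟦ ∂ v ⟧ (⟦ ∂ w ⟧ x)))) (ℙₚ.*-comm ∣ w ∣₁ ∣ v ∣₁) ⟩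
    t * (sgn (∣ v ∣₁ ℙ.* ∣ w ∣₁) * ⟦ derivative ν ⟧ (⟦ ∂ v ⟧ (⟦ ∂ w ⟧ x)))
      ≡⟨ signs₂ (inversions π) (∣ v ∣₁ ℙ.* ∣ w ∣₁) (⟦ derivative ν ⟧ (⟦ ∂ v ⟧ (⟦ ∂ w ⟧ x))) ⟩
    sgn ((∣ v ∣₁ ℙ.* ∣ w ∣₁) ℙ.+ inversions π) * ⟦ derivative ν ⟧ (⟦ ∂ v ⟧ (⟦ ∂ w ⟧ x)) ∎
    where
    t : ℚ
    t = sgn (inversions π)
  derivative-symmetric (trans {κ} {μ} {ν} π ρ) x = begin
    ⟦ derivative κ ⟧ x
      ≡⟨ derivative-symmetric π x ⟩
    sgn (inversions π) * ⟦ derivative μ ⟧ x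
      ≡⟨ cong (sgn (inversions π) *_) (derivative-symmetric ρ x) ⟩
    sgn (inversions π) * (sgn (inversions ρ) * ⟦ derivative ν ⟧ x)
      ≡⟨ ℚₚ.*-assoc (sgn (inversions π)) (sgn (inversions ρ)) (⟦ derivative ν ⟧ x) ⟨
    (sgn (inversions π) * sgn (inversions ρ)) * ⟦ derivative ν ⟧ x
      ≡⟨ cong (_* ⟦ derivative ν ⟧ x) (sgn-+ (inversions π) (inversions ρ)) ⟨
    sgn (inversions π ℙ.+ inversions ρ) * ⟦ derivative ν ⟧ x ∎

  Functionals : Space
  Functionals = Functions ∣ space ∣

  derivatives : ∃ λ (h : space ⟶ Functionals) → ∀ κ → ⟦ h ⟧ (generated κ) ≈[ Functionals ] ⟦ derivative κ ⟧
  derivatives = free {Functionals} {λ κ → ⟦ derivative κ ⟧} derivative-symmetric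

  pair : ∣ space ∣ → ∣ space ∣ → ℚ
  pair x a = ⟦ proj₁ derivatives ⟧ a x

  pair-generated : ∀ x κ → pair x (generated κ) ≡ ⟦ derivative κ ⟧ x
  pair-generated x κ = proj₂ derivatives κ x

  pairWith : ∣ space ∣ → space ⟶ ℚ-space
  pairWith x = mkLinear (pair x) (λ a≈b → _⟶_.⟦⟧-cong (proj₁ derivatives) a≈b x)
    (λ a b → _⟶_.+ᴹ-homo (proj₁ derivatives) a b x) (λ r a → _⟶_.*ₗ-homo (proj₁ derivatives) r a x)

  pair-bilinear : Bilinear space space ℚ-space
  pair-bilinear = record
    { on = pair
    ; on-cong = λ {x} {x′} {a} {a′} x≈ a≈ → ≡.trans (_⟶_.⟦⟧-cong (pairWith x) a≈) (congˡ x≈ a′)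
    ; +ˡ = λ x y → ext-ℚ (pairWith (x +ᴹ y)) (pairWith x ⊕ pairWith y) λ κ →
        ≡.trans (pair-generated (x +ᴹ y) κ) (≡.trans (_⟶_.+ᴹ-homo (derivative κ) x y)
          (sym (cong₂ _+_ (pair-generated x κ) (pair-generated y κ))))
    ; +ʳ = λ x → _⟶_.+ᴹ-homo (pairWith x)
    ; *ˡ = λ r x → ext-ℚ (pairWith (r · x)) (r ⋆ pairWith x) λ κ →
        ≡.trans (pair-generated (r · x) κ) (≡.trans (_⟶_.*ₗ-homo (derivative κ) r x) (cong (r *_) (sym (pair-generated x κ))))
    ; *ʳ = λ r x → _⟶_.*ₗ-homo (pairWith x) r
    }
    where
    congˡ : ∀ {x y} → x ≈ᴹ y → ∀ a → pair x a ≡ pair y a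
    congˡ {x} {y} x≈y = ext-ℚ (pairWith x) (pairWith y) λ κ →
      ≡.trans (pair-generated x κ) (≡.trans (_⟶_.⟦⟧-cong (derivative κ) x≈y) (sym (pair-generated y κ)))

  pairing : space ⊗ space ⟶ ℚ-space
  pairing = lift pair-bilinear

  pair-congˡ : ∀ {x y} → x ≈ᴹ y → ∀ a → pair x a ≡ pair y a
  pair-congˡ x≈y a = Bilinear.on-cong pair-bilinear x≈y ≈ᴹ-refl

  pair-congʳ : ∀ x {a b} → a ≈ᴹ b → pair x a ≡ pair x b
  pair-congʳ x = _⟶_.⟦⟧-cong (pairWith x)

  pair-+ˡ : ∀ x y a → pair (x +ᴹ y) a ≡ pair x a + pair y a
  pair-+ˡ = Bilinear.+ˡ pair-bilinear

  pair-·ˡ : ∀ r x a → pair (r · x) a ≡ r * pair x a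
  pair-·ˡ = Bilinear.*ˡ pair-bilinear

  pair-·ʳ : ∀ r x a → pair x (r · a) ≡ r * pair x a
  pair-·ʳ r x = _⟶_.*ₗ-homo (pairWith x) r

  pair-0ˡ : ∀ a → pair 0ᴹ a ≡ 0ℚ
  pair-0ˡ a = _⟶_.0ᴹ-homo (pairing ∘ₗ insertʳ a)

  pair-𝟏ʳ : ∀ x → pair x 𝟏 ≡ ⟦ ε ⟧ x
  pair-𝟏ʳ x = pair-generated x []

  pair-pʳ : ∀ x w a → pair x (P w ∙ a) ≡ pair (⟦ ∂ w ⟧ x) a
  pair-pʳ x w = ext-ℚ (pairWith x ∘ₗ p w) (pairWith (⟦ ∂ w ⟧ x)) λ κ →
    ≡.trans (pair-generated x (w ∷ κ)) (sym (pair-generated (⟦ ∂ w ⟧ x) κ))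

  -- Such an `h` fixes 1 and sends multiples of a generator to multiples of it, where `ε` vanishes.
  ε-invariant : (h : space ⟶ space) → ⟦ h ⟧ 𝟏 ≈ᴹ 𝟏 → (∀ w x → ∃ λ r → ∃ λ y → ⟦ h ⟧ (P w ∙ x) ≈ᴹ r · (P w ∙ y)) →
    ∀ x → ⟦ ε ⟧ (⟦ h ⟧ x) ≡ ⟦ ε ⟧ x
  ε-invariant h h-𝟏 h-p = ext-ℚ (ε ∘ₗ h) ε on-generated
    where
    on-generated : ∀ κ → ⟦ ε ⟧ (⟦ h ⟧ (generated κ)) ≡ ⟦ ε ⟧ (generated κ)
    on-generated []      = _⟶_.⟦⟧-cong ε h-𝟏
    on-generated (w ∷ κ) = begin
      ⟦ ε ⟧ (⟦ h ⟧ (P w ∙ generated κ))   ≡⟨ _⟶_.⟦⟧-cong ε (proj₂ (proj₂ (h-p w (generated κ)))) ⟩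
      ⟦ ε ⟧ (r · (P w ∙ y))               ≡⟨ _⟶_.*ₗ-homo ε r (P w ∙ y) ⟩
      r * ⟦ ε ⟧ (P w ∙ y)                 ≡⟨ cong (r *_) (ε-P w y) ⟩
      r * 0ℚ                              ≡⟨ ℚₚ.*-zeroʳ r ⟩
      0ℚ                                  ≡⟨ ε-P w (generated κ) ⟨
      ⟦ ε ⟧ (P w ∙ generated κ)           ∎
      where
      r : ℚ
      r = proj₁ (h-p w (generated κ))
      y : ∣ space ∣
      y = proj₁ (proj₂ (h-p w (generated κ)))

  ε-twist : ∀ q x → ⟦ ε ⟧ (⟦ twist q ⟧ x) ≡ ⟦ ε ⟧ x
  ε-twist q = ε-invariant (twist q) (twist-𝟏 q) λ w x → sgn (∣ w ∣₁ ℙ.* q) , ⟦ twist q ⟧ x , twist-p q w x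

  ε-S : ∀ x → ⟦ ε ⟧ (⟦ S ⟧ x) ≡ ⟦ ε ⟧ x
  ε-S = ε-invariant S (S-generated []) λ w x → - 1ℚ , ⟦ S ⟧ x , S-p w x

  ε-∙ : ∀ x y → ⟦ ε ⟧ (x ∙ y) ≡ ⟦ ε ⟧ x * ⟦ ε ⟧ y
  ε-∙ x y = ext-ℚ (ε ∘ₗ mult ∘ₗ insertʳ y) (multiples {ℚ-space} (⟦ ε ⟧ y) ∘ₗ ε) on-generated x
    where
    on-generated : ∀ κ → ⟦ ε ⟧ (generated κ ∙ y) ≡ ⟦ ε ⟧ (generated κ) * ⟦ ε ⟧ y
    on-generated [] = ≡.trans (_⟶_.⟦⟧-cong ε (∙-identityˡ y))
      (sym (≡.trans (cong (_* ⟦ ε ⟧ y) ε-𝟏) (ℚₚ.*-identityˡ (⟦ ε ⟧ y))))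
    on-generated (w ∷ κ) = begin
      ⟦ ε ⟧ ((P w ∙ generated κ) ∙ y)       ≡⟨ _⟶_.⟦⟧-cong ε (∙-assoc (P w) (generated κ) y) ⟩
      ⟦ ε ⟧ (P w ∙ (generated κ ∙ y))       ≡⟨ ε-P w (generated κ ∙ y) ⟩
      0ℚ                                    ≡⟨ ℚₚ.*-zeroˡ (⟦ ε ⟧ y) ⟨
      0ℚ * ⟦ ε ⟧ y                          ≡⟨ cong (_* ⟦ ε ⟧ y) (ε-P w (generated κ)) ⟨
      ⟦ ε ⟧ (P w ∙ generated κ) * ⟦ ε ⟧ y   ∎

  pair-twist : ∀ q x a → pair (⟦ twist q ⟧ x) a ≡ pair x (⟦ twist q ⟧ a)
  pair-twist q x a = ext-ℚ (pairWith (t x)) (pairWith x ∘ₗ twist q) (λ κ → on-generated κ x) a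
    where
    t : ∣ space ∣ → ∣ space ∣
    t = ⟦ twist q ⟧
    on-generated : ∀ κ x → pair (t x) (generated κ) ≡ pair x (t (generated κ))
    on-generated [] x = begin
      pair (t x) 𝟏     ≡⟨ pair-𝟏ʳ (t x) ⟩
      ⟦ ε ⟧ (t x)      ≡⟨ ε-twist q x ⟩
      ⟦ ε ⟧ x          ≡⟨ pair-𝟏ʳ x ⟨
      pair x 𝟏         ≡⟨ pair-congʳ x (twist-𝟏 q) ⟨
      pair x (t 𝟏)     ∎
    on-generated (w ∷ κ) x = begin
      pair (t x) (P w ∙ g)                   ≡⟨ pair-pʳ (t x) w g ⟩
      pair (⟦ ∂ w ⟧ (t x)) g                 ≡⟨ pair-congˡ (∂-twist w q x) g ⟩
      pair (s · t (⟦ ∂ w ⟧ x)) g             ≡⟨ pair-·ˡ s (t (⟦ ∂ w ⟧ x)) g ⟩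
      s * pair (t (⟦ ∂ w ⟧ x)) g             ≡⟨ cong (s *_) (on-generated κ (⟦ ∂ w ⟧ x)) ⟩
      s * pair (⟦ ∂ w ⟧ x) (t g)             ≡⟨ cong (s *_) (pair-pʳ x w (t g)) ⟨
      s * pair x (P w ∙ t g)                 ≡⟨ pair-·ʳ s x (P w ∙ t g) ⟨
      pair x (s · (P w ∙ t g))               ≡⟨ pair-congʳ x (twist-p q w g) ⟨
      pair x (t (P w ∙ g))                   ∎
      where
      g : ∣ space ∣
      g = generated κ
      s : ℚ
      s = sgn (∣ w ∣₁ ℙ.* q)

  -- Multiplication by `P w` and `∂ w` are adjoint in the first argument too. The induction compares
  -- `∂-p` on the two sides; their indicator terms agree because twists are self-adjoint.
  pair-pˡ : ∀ w x a → pair (P w ∙ x) a ≡ pair x (⟦ ∂ w ⟧ a)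
  pair-pˡ w x a = ext-ℚ (pairWith (P w ∙ x)) (pairWith x ∘ₗ ∂ w) (λ κ → on-generated κ x) a
    where
    on-generated : ∀ κ x → pair (P w ∙ x) (generated κ) ≡ pair x (⟦ ∂ w ⟧ (generated κ))
    on-generated [] x = begin
      pair (P w ∙ x) 𝟏        ≡⟨ pair-𝟏ʳ (P w ∙ x) ⟩
      ⟦ ε ⟧ (P w ∙ x)         ≡⟨ ε-P w x ⟩
      0ℚ                      ≡⟨ _⟶_.0ᴹ-homo (pairWith x) ⟨
      pair x 0ᴹ               ≡⟨ pair-congʳ x (∂-𝟏 w) ⟨
      pair x (⟦ ∂ w ⟧ 𝟏)      ∎
    on-generated (v ∷ κ) x = begin
      pair (P w ∙ x) (P v ∙ g)
        ≡⟨ pair-pʳ (P w ∙ x) v g ⟩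
      pair (⟦ ∂ v ⟧ (P w ∙ x)) g
        ≡⟨ pair-congˡ (∂-p v w x) g ⟩
      pair (P w ∙ ⟦ ∂ v ⟧ x +ᴹ ([ w ≡ v ] · ⟦ twist ∣ v ∣₁ ⟧ x)) g
        ≡⟨ pair-+ˡ (P w ∙ ⟦ ∂ v ⟧ x) ([ w ≡ v ] · ⟦ twist ∣ v ∣₁ ⟧ x) g ⟩
      pair (P w ∙ ⟦ ∂ v ⟧ x) g + pair ([ w ≡ v ] · ⟦ twist ∣ v ∣₁ ⟧ x) g
        ≡⟨ cong₂ _+_ (on-generated κ (⟦ ∂ v ⟧ x)) matched ⟩
      pair (⟦ ∂ v ⟧ x) (⟦ ∂ w ⟧ g) + pair x ([ v ≡ w ] · ⟦ twist ∣ w ∣₁ ⟧ g)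
        ≡⟨ cong (_+ pair x ([ v ≡ w ] · ⟦ twist ∣ w ∣₁ ⟧ g)) (pair-pʳ x v (⟦ ∂ w ⟧ g)) ⟨
      pair x (P v ∙ ⟦ ∂ w ⟧ g) + pair x ([ v ≡ w ] · ⟦ twist ∣ w ∣₁ ⟧ g)
        ≡⟨ _⟶_.+ᴹ-homo (pairWith x) (P v ∙ ⟦ ∂ w ⟧ g) ([ v ≡ w ] · ⟦ twist ∣ w ∣₁ ⟧ g) ⟨
      pair x (P v ∙ ⟦ ∂ w ⟧ g +ᴹ ([ v ≡ w ] · ⟦ twist ∣ w ∣₁ ⟧ g))
        ≡⟨ pair-congʳ x (∂-p w v g) ⟨
      pair x (⟦ ∂ w ⟧ (P v ∙ g)) ∎
      where
      g : ∣ space ∣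
      g = generated κ
      matched : pair ([ w ≡ v ] · ⟦ twist ∣ v ∣₁ ⟧ x) g ≡ pair x ([ v ≡ w ] · ⟦ twist ∣ w ∣₁ ⟧ g)
      matched = begin
        pair ([ w ≡ v ] · ⟦ twist ∣ v ∣₁ ⟧ x) g      ≡⟨ pair-·ˡ [ w ≡ v ] (⟦ twist ∣ v ∣₁ ⟧ x) g ⟩
        [ w ≡ v ] * pair (⟦ twist ∣ v ∣₁ ⟧ x) g      ≡⟨ indicator-cong v w (λ y → pair (⟦ twist ∣ y ∣₁ ⟧ x) g) ⟩
        [ w ≡ v ] * pair (⟦ twist ∣ w ∣₁ ⟧ x) g      ≡⟨ cong₂ _*_ ([≡]-sym w v) (pair-twist ∣ w ∣₁ x g) ⟩
        [ v ≡ w ] * pair x (⟦ twist ∣ w ∣₁ ⟧ g)      ≡⟨ pair-·ʳ [ v ≡ w ] x (⟦ twist ∣ w ∣₁ ⟧ g) ⟨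
        pair x ([ v ≡ w ] · ⟦ twist ∣ w ∣₁ ⟧ g)      ∎

  pair-𝟏ˡ : ∀ a → pair 𝟏 a ≡ ⟦ ε ⟧ a
  pair-𝟏ˡ = ext-ℚ (pairWith 𝟏) ε on-generated
    where
    on-generated : ∀ κ → pair 𝟏 (generated κ) ≡ ⟦ ε ⟧ (generated κ)
    on-generated []      = pair-𝟏ʳ 𝟏
    on-generated (w ∷ κ) = begin
      pair 𝟏 (P w ∙ generated κ)       ≡⟨ pair-pʳ 𝟏 w (generated κ) ⟩
      pair (⟦ ∂ w ⟧ 𝟏) (generated κ)   ≡⟨ pair-congˡ (∂-𝟏 w) (generated κ) ⟩
      pair 0ᴹ (generated κ)            ≡⟨ pair-0ˡ (generated κ) ⟩
      0ℚ                               ≡⟨ ε-P w (generated κ) ⟨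
      ⟦ ε ⟧ (P w ∙ generated κ)        ∎

  -- Multiplication by `P w` has the same adjoint in either argument, by `pair-pˡ` and `pair-pʳ`, so
  -- no sign appears.
  pair-sym : ∀ x a → pair x a ≡ pair a x
  pair-sym x a = ext-ℚ (pairing ∘ₗ insertʳ a) (pairWith a) (λ κ → on-generated κ a) x
    where
    on-generated : ∀ κ a → pair (generated κ) a ≡ pair a (generated κ)
    on-generated []      a = ≡.trans (pair-𝟏ˡ a) (sym (pair-𝟏ʳ a))
    on-generated (w ∷ κ) a = begin
      pair (P w ∙ generated κ) a       ≡⟨ pair-pˡ w (generated κ) a ⟩
      pair (generated κ) (⟦ ∂ w ⟧ a)   ≡⟨ on-generated κ (⟦ ∂ w ⟧ a) ⟩
      pair (⟦ ∂ w ⟧ a) (generated κ)   ≡⟨ pair-pʳ a w (generated κ) ⟨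
      pair a (P w ∙ generated κ)       ∎

  pair-S : ∀ x a → pair (⟦ S ⟧ x) a ≡ pair x (⟦ S ⟧ a)
  pair-S x a = ext-ℚ (pairWith (⟦ S ⟧ x)) (pairWith x ∘ₗ S) (λ κ → on-generated κ x) a
    where
    on-generated : ∀ κ x → pair (⟦ S ⟧ x) (generated κ) ≡ pair x (⟦ S ⟧ (generated κ))
    on-generated [] x = begin
      pair (⟦ S ⟧ x) 𝟏     ≡⟨ pair-𝟏ʳ (⟦ S ⟧ x) ⟩
      ⟦ ε ⟧ (⟦ S ⟧ x)      ≡⟨ ε-S x ⟩
      ⟦ ε ⟧ x              ≡⟨ pair-𝟏ʳ x ⟨
      pair x 𝟏             ≡⟨ pair-congʳ x (S-generated []) ⟨
      pair x (⟦ S ⟧ 𝟏)     ∎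
    on-generated (w ∷ κ) x = begin
      pair (⟦ S ⟧ x) (P w ∙ g)               ≡⟨ pair-pʳ (⟦ S ⟧ x) w g ⟩
      pair (⟦ ∂ w ⟧ (⟦ S ⟧ x)) g             ≡⟨ pair-congˡ (∂-S w x) g ⟩
      pair (- 1ℚ · ⟦ S ⟧ (⟦ ∂ w ⟧ x)) g      ≡⟨ pair-·ˡ (- 1ℚ) (⟦ S ⟧ (⟦ ∂ w ⟧ x)) g ⟩
      - 1ℚ * pair (⟦ S ⟧ (⟦ ∂ w ⟧ x)) g      ≡⟨ cong (- 1ℚ *_) (on-generated κ (⟦ ∂ w ⟧ x)) ⟩
      - 1ℚ * pair (⟦ ∂ w ⟧ x) (⟦ S ⟧ g)      ≡⟨ cong (- 1ℚ *_) (pair-pʳ x w (⟦ S ⟧ g)) ⟨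
      - 1ℚ * pair x (P w ∙ ⟦ S ⟧ g)          ≡⟨ pair-·ʳ (- 1ℚ) x (P w ∙ ⟦ S ⟧ g) ⟨
      pair x (- 1ℚ · (P w ∙ ⟦ S ⟧ g))        ≡⟨ pair-congʳ x (S-p w g) ⟨
      pair x (⟦ S ⟧ (P w ∙ g))               ∎
      where
      g : ∣ space ∣
      g = generated κ

  twist-+ : ∀ q r x → ⟦ twist (q ℙ.+ r) ⟧ x ≈ᴹ ⟦ twist r ⟧ (⟦ twist q ⟧ x)
  twist-+ q r = ext (twist (q ℙ.+ r)) (twist r ∘ₗ twist q) λ κ →
    ≈ᴹ-trans (twist-generated (q ℙ.+ r) κ) (≈ᴹ-trans (·-congˡ (generated κ) (sgn-distribˡ ∣ κ ∣ₘ q r))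
      (≈ᴹ-trans (*ₗ-assoc _ _ _) (≈ᴹ-sym (≈ᴹ-trans (_⟶_.⟦⟧-cong (twist r) (twist-generated q κ))
        (≈ᴹ-trans (_⟶_.*ₗ-homo (twist r) _ _) (·-congʳ _ (twist-generated r κ)))))))

  -- ⟨ κ , μ ⟩ vanishes unless κ and μ have the same parity.
  pair-even : ∀ κ μ q → sgn (∣ κ ∣ₘ ℙ.* q) * pair (generated κ) (generated μ) ≡ sgn (∣ μ ∣ₘ ℙ.* q) * pair (generated κ) (generated μ)
  pair-even κ μ q = begin
    sgn (∣ κ ∣ₘ ℙ.* q) * pair (generated κ) (generated μ)   ≡⟨ pair-·ˡ _ (generated κ) (generated μ) ⟨
    pair (sgn (∣ κ ∣ₘ ℙ.* q) · generated κ) (generated μ)   ≡⟨ pair-congˡ (twist-generated q κ) (generated μ) ⟨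
    pair (⟦ twist q ⟧ (generated κ)) (generated μ)          ≡⟨ pair-twist q (generated κ) (generated μ) ⟩
    pair (generated κ) (⟦ twist q ⟧ (generated μ))          ≡⟨ pair-congʳ (generated κ) (twist-generated q μ) ⟩
    pair (generated κ) (sgn (∣ μ ∣ₘ ℙ.* q) · generated μ)   ≡⟨ pair-·ʳ _ (generated κ) (generated μ) ⟩
    sgn (∣ μ ∣ₘ ℙ.* q) * pair (generated κ) (generated μ)   ∎

  -- The pairing of tensors is a parameter to keep it from being unfolded.
  module Tensors (pairing₂ : Space₄ ⟶ ℚ-space)
    (pair₂-generated : ∀ x y κ b → ⟦ pairing₂ ⟧ ((x ⊗ₑ y) ⊗ₑ (generated κ ⊗ₑ b)) ≡ pair x (generated κ) * pair (⟦ twist ∣ κ ∣ₘ ⟧ y) b)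
    where

    pair₂ : ∣ Space₂ ∣ → ∣ Space₂ ∣ → ℚ
    pair₂ X Y = ⟦ pairing₂ ⟧ (X ⊗ₑ Y)

    -- The adjoint of multiplication by the coproduct of `P v` is the derivation `∂ v` on tensors,
    -- with the same signs as in `∂-∙`.
    pair₂-leibniz-generated : ∀ x y v κ b → pair₂ (x ⊗ₑ y) (⟦ leibniz v ⟧ (generated κ ⊗ₑ b))
      ≡ pair₂ (⟦ ∂ v ⟧ x ⊗ₑ ⟦ twist ∣ v ∣₁ ⟧ y) (generated κ ⊗ₑ b) + pair₂ (x ⊗ₑ ⟦ ∂ v ⟧ y) (generated κ ⊗ₑ b)
    pair₂-leibniz-generated x y v κ b = begin
      pair₂ (x ⊗ₑ y) (generated (v ∷ κ) ⊗ₑ b +ₜ ⟦ twist ∣ v ∣₁ ⟧ g ⊗ₑ (P v ∙ b))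
        ≡⟨ _⟶_.+ᴹ-homo (pairing₂ ∘ₗ insertˡ (x ⊗ₑ y)) (generated (v ∷ κ) ⊗ₑ b) (⟦ twist ∣ v ∣₁ ⟧ g ⊗ₑ (P v ∙ b)) ⟩
      pair₂ (x ⊗ₑ y) (generated (v ∷ κ) ⊗ₑ b) + pair₂ (x ⊗ₑ y) (⟦ twist ∣ v ∣₁ ⟧ g ⊗ₑ (P v ∙ b))
        ≡⟨ cong₂ _+_ left right ⟩
      pair₂ (⟦ ∂ v ⟧ x ⊗ₑ ⟦ twist ∣ v ∣₁ ⟧ y) (g ⊗ₑ b) + pair₂ (x ⊗ₑ ⟦ ∂ v ⟧ y) (g ⊗ₑ b) ∎
      where
      g : ∣ space ∣
      g = generated κ
      t : ∣ space ∣ → ∣ space ∣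
      t = ⟦ twist ∣ κ ∣ₘ ⟧
      s : ℚ
      s = sgn (∣ κ ∣ₘ ℙ.* ∣ v ∣₁)
      left : pair₂ (x ⊗ₑ y) (generated (v ∷ κ) ⊗ₑ b) ≡ pair₂ (⟦ ∂ v ⟧ x ⊗ₑ ⟦ twist ∣ v ∣₁ ⟧ y) (g ⊗ₑ b)
      left = begin
        pair₂ (x ⊗ₑ y) (generated (v ∷ κ) ⊗ₑ b)
          ≡⟨ pair₂-generated x y (v ∷ κ) b ⟩
        pair x (P v ∙ g) * pair (⟦ twist ∣ v ∷ κ ∣ₘ ⟧ y) b
          ≡⟨ cong₂ _*_ (pair-pʳ x v g) (≡.trans (cong (λ q → pair (⟦ twist q ⟧ y) b) (∣∣-∷ v κ))
               (pair-congˡ (twist-+ ∣ v ∣₁ ∣ κ ∣ₘ y) b)) ⟩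
        pair (⟦ ∂ v ⟧ x) g * pair (t (⟦ twist ∣ v ∣₁ ⟧ y)) b
          ≡⟨ pair₂-generated (⟦ ∂ v ⟧ x) (⟦ twist ∣ v ∣₁ ⟧ y) κ b ⟨
        pair₂ (⟦ ∂ v ⟧ x ⊗ₑ ⟦ twist ∣ v ∣₁ ⟧ y) (g ⊗ₑ b) ∎
      right : pair₂ (x ⊗ₑ y) (⟦ twist ∣ v ∣₁ ⟧ g ⊗ₑ (P v ∙ b)) ≡ pair₂ (x ⊗ₑ ⟦ ∂ v ⟧ y) (g ⊗ₑ b)
      right = begin
        pair₂ (x ⊗ₑ y) (⟦ twist ∣ v ∣₁ ⟧ g ⊗ₑ (P v ∙ b))
          ≡⟨ _⟶_.⟦⟧-cong (pairing₂ ∘ₗ insertˡ (x ⊗ₑ y) ∘ₗ insertʳ (P v ∙ b)) (twist-generated ∣ v ∣₁ κ) ⟩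
        pair₂ (x ⊗ₑ y) ((s · g) ⊗ₑ (P v ∙ b))
          ≡⟨ _⟶_.*ₗ-homo (pairing₂ ∘ₗ insertˡ (x ⊗ₑ y)) s (g ⊗ₑ (P v ∙ b)) ⟩
        s * pair₂ (x ⊗ₑ y) (g ⊗ₑ (P v ∙ b))
          ≡⟨ cong (s *_) (pair₂-generated x y κ (P v ∙ b)) ⟩
        s * (pair x g * pair (t y) (P v ∙ b))
          ≡⟨ cong (λ z → s * (pair x g * z)) (≡.trans (pair-pʳ (t y) v b)
               (≡.trans (pair-congˡ (∂-twist v ∣ κ ∣ₘ y) b) (pair-·ˡ (sgn (∣ v ∣₁ ℙ.* ∣ κ ∣ₘ)) (t (⟦ ∂ v ⟧ y)) b))) ⟩
        s * (pair x g * (sgn (∣ v ∣₁ ℙ.* ∣ κ ∣ₘ) * pair (t (⟦ ∂ v ⟧ y)) b))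
          ≡⟨ cong (λ q → s * (pair x g * (sgn q * pair (t (⟦ ∂ v ⟧ y)) b))) (ℙₚ.*-comm ∣ v ∣₁ ∣ κ ∣ₘ) ⟩
        s * (pair x g * (s * pair (t (⟦ ∂ v ⟧ y)) b))
          ≡⟨ cong (s *_) (*-swap (pair x g) s (pair (t (⟦ ∂ v ⟧ y)) b)) ⟩
        s * (s * (pair x g * pair (t (⟦ ∂ v ⟧ y)) b))
          -- One sign comes from twisting `g`, the other from moving `∂ v` past the twist of `y`;
          -- they cancel.
          ≡⟨ sgn-self-cancel (∣ κ ∣ₘ ℙ.* ∣ v ∣₁) (pair x g * pair (t (⟦ ∂ v ⟧ y)) b) ⟩
        pair x g * pair (t (⟦ ∂ v ⟧ y)) b
          ≡⟨ pair₂-generated x (⟦ ∂ v ⟧ y) κ b ⟨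
        pair₂ (x ⊗ₑ ⟦ ∂ v ⟧ y) (g ⊗ₑ b) ∎

    pair₂-leibniz : ∀ x y v X → pair₂ (x ⊗ₑ y) (⟦ leibniz v ⟧ X)
      ≡ pair₂ (⟦ ∂ v ⟧ x ⊗ₑ ⟦ twist ∣ v ∣₁ ⟧ y) X + pair₂ (x ⊗ₑ ⟦ ∂ v ⟧ y) X
    pair₂-leibniz x y v = ext-⊗ L R λ a b → ext-ℚ (L ∘ₗ insertʳ b) (R ∘ₗ insertʳ b) (λ κ → pair₂-leibniz-generated x y v κ b) a
      where
      L R : Space₂ ⟶ ℚ-space
      L = pairing₂ ∘ₗ insertˡ (x ⊗ₑ y) ∘ₗ leibniz v
      R = (pairing₂ ∘ₗ insertˡ (⟦ ∂ v ⟧ x ⊗ₑ ⟦ twist ∣ v ∣₁ ⟧ y)) ⊕ (pairing₂ ∘ₗ insertˡ (x ⊗ₑ ⟦ ∂ v ⟧ y))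

    -- Induction on the generators of `a`: each turns into `∂ v` on the left, where `∂-∙` and
    -- `pair₂-leibniz` expand alike.
    pair-∙ˡ : ∀ x y a → pair (x ∙ y) a ≡ pair₂ (x ⊗ₑ y) (⟦ Δ ⟧ a)
    pair-∙ˡ x y a = ext-ℚ (pairWith (x ∙ y)) (pairing₂ ∘ₗ insertˡ (x ⊗ₑ y) ∘ₗ Δ) (λ κ → on-generated κ x y) a
      where
      on-generated : ∀ κ x y → pair (x ∙ y) (generated κ) ≡ pair₂ (x ⊗ₑ y) (⟦ Δ ⟧ (generated κ))
      on-generated [] x y = begin
        pair (x ∙ y) 𝟏
          ≡⟨ pair-𝟏ʳ (x ∙ y) ⟩
        ⟦ ε ⟧ (x ∙ y)
          ≡⟨ ε-∙ x y ⟩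
        ⟦ ε ⟧ x * ⟦ ε ⟧ y
          ≡⟨ cong₂ _*_ (pair-𝟏ʳ x) (≡.trans (pair-𝟏ʳ (⟦ twist 0ℙ ⟧ y)) (ε-twist 0ℙ y)) ⟨
        pair x 𝟏 * pair (⟦ twist 0ℙ ⟧ y) 𝟏
          ≡⟨ pair₂-generated x y [] 𝟏 ⟨
        pair₂ (x ⊗ₑ y) (𝟏 ⊗ₑ 𝟏)
          ≡⟨ _⟶_.⟦⟧-cong (pairing₂ ∘ₗ insertˡ (x ⊗ₑ y)) Δ-𝟏 ⟨
        pair₂ (x ⊗ₑ y) (⟦ Δ ⟧ 𝟏) ∎
      on-generated (v ∷ κ) x y = begin
        pair (x ∙ y) (P v ∙ g)
          ≡⟨ pair-pʳ (x ∙ y) v g ⟩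
        pair (⟦ ∂ v ⟧ (x ∙ y)) g
          ≡⟨ pair-congˡ (∂-∙ v x y) g ⟩
        pair (⟦ ∂ v ⟧ x ∙ ⟦ twist ∣ v ∣₁ ⟧ y +ᴹ x ∙ ⟦ ∂ v ⟧ y) g
          ≡⟨ pair-+ˡ (⟦ ∂ v ⟧ x ∙ ⟦ twist ∣ v ∣₁ ⟧ y) (x ∙ ⟦ ∂ v ⟧ y) g ⟩
        pair (⟦ ∂ v ⟧ x ∙ ⟦ twist ∣ v ∣₁ ⟧ y) g + pair (x ∙ ⟦ ∂ v ⟧ y) g
          ≡⟨ cong₂ _+_ (on-generated κ (⟦ ∂ v ⟧ x) (⟦ twist ∣ v ∣₁ ⟧ y)) (on-generated κ x (⟦ ∂ v ⟧ y)) ⟩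
        pair₂ (⟦ ∂ v ⟧ x ⊗ₑ ⟦ twist ∣ v ∣₁ ⟧ y) (⟦ Δ ⟧ g) + pair₂ (x ⊗ₑ ⟦ ∂ v ⟧ y) (⟦ Δ ⟧ g)
          ≡⟨ pair₂-leibniz x y v (⟦ Δ ⟧ g) ⟨
        pair₂ (x ⊗ₑ y) (⟦ leibniz v ⟧ (⟦ Δ ⟧ g))
          ≡⟨ _⟶_.⟦⟧-cong (pairing₂ ∘ₗ insertˡ (x ⊗ₑ y)) (Δ-P v g) ⟨
        pair₂ (x ⊗ₑ y) (⟦ Δ ⟧ (P v ∙ g)) ∎
        where
        g : ∣ space ∣
        g = generated κ

    -- The two sides carry the signs of |ρ||μ| and |ρ||κ|, which agree by `pair-even` wherever `κ`
    -- and `μ` pair nontrivially.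
    pair₂-sym-generated : ∀ κ ρ μ b → pair₂ (generated κ ⊗ₑ generated ρ) (generated μ ⊗ₑ b)
      ≡ pair₂ (generated μ ⊗ₑ b) (generated κ ⊗ₑ generated ρ)
    pair₂-sym-generated κ ρ μ b = begin
      pair₂ (k ⊗ₑ r) (m ⊗ₑ b)
        ≡⟨ pair₂-generated k r μ b ⟩
      pair k m * pair (⟦ twist ∣ μ ∣ₘ ⟧ r) b
        ≡⟨ cong (pair k m *_) (≡.trans (pair-congˡ (twist-generated ∣ μ ∣ₘ ρ) b) (pair-·ˡ _ r b)) ⟩
      pair k m * (sgn (∣ ρ ∣ₘ ℙ.* ∣ μ ∣ₘ) * pair r b)
        ≡⟨ regroup (pair k m) (sgn (∣ ρ ∣ₘ ℙ.* ∣ μ ∣ₘ)) (pair r b) ⟩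
      (sgn (∣ ρ ∣ₘ ℙ.* ∣ μ ∣ₘ) * pair k m) * pair r b
        ≡⟨ cong (_* pair r b) (≡.trans (cong (λ q → sgn q * pair k m) (ℙₚ.*-comm ∣ ρ ∣ₘ ∣ μ ∣ₘ))
             (≡.trans (sym (pair-even κ μ ∣ ρ ∣ₘ)) (cong (λ q → sgn q * pair k m) (ℙₚ.*-comm ∣ κ ∣ₘ ∣ ρ ∣ₘ)))) ⟩
      (sgn (∣ ρ ∣ₘ ℙ.* ∣ κ ∣ₘ) * pair k m) * pair r b
        ≡⟨ regroup (pair k m) (sgn (∣ ρ ∣ₘ ℙ.* ∣ κ ∣ₘ)) (pair r b) ⟨
      pair k m * (sgn (∣ ρ ∣ₘ ℙ.* ∣ κ ∣ₘ) * pair r b)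
        ≡⟨ cong (pair k m *_) (≡.trans (pair-congˡ (twist-generated ∣ κ ∣ₘ ρ) b) (pair-·ˡ _ r b)) ⟨
      pair k m * pair (⟦ twist ∣ κ ∣ₘ ⟧ r) b
        ≡⟨ cong₂ _*_ (pair-sym k m) (≡.trans (pair-twist ∣ κ ∣ₘ r b) (pair-sym r (⟦ twist ∣ κ ∣ₘ ⟧ b))) ⟩
      pair m k * pair (⟦ twist ∣ κ ∣ₘ ⟧ b) r
        ≡⟨ pair₂-generated m b κ r ⟨
      pair₂ (m ⊗ₑ b) (k ⊗ₑ r) ∎
      where
      k r m : ∣ space ∣
      k = generated κ
      r = generated ρ
      m = generated μ
      regroup : ∀ x s y → x * (s * y) ≡ (s * x) * y
      regroup = solve 3 (λ x s y → x :* (s :* y) := (s :* x) :* y) ≡.refl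

    pair₂-sym : ∀ X Y → pair₂ X Y ≡ pair₂ Y X
    pair₂-sym X Y = ext-⊗ (against Y) (of Y) (λ x y →
        ext-ℚ (against Y ∘ₗ insertʳ y) (of Y ∘ₗ insertʳ y) (λ κ →
          ext-ℚ (against Y ∘ₗ insertˡ (generated κ)) (of Y ∘ₗ insertˡ (generated κ)) (λ ρ →
            ext-⊗ (of (generated κ ⊗ₑ generated ρ)) (against (generated κ ⊗ₑ generated ρ)) (λ a b →
              ext-ℚ (of (generated κ ⊗ₑ generated ρ) ∘ₗ insertʳ b) (against (generated κ ⊗ₑ generated ρ) ∘ₗ insertʳ b)
                (λ μ → pair₂-sym-generated κ ρ μ b) a) Y) y) x) X
      where
      of against : ∣ Space₂ ∣ → Space₂ ⟶ ℚ-space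
      of Z = pairing₂ ∘ₗ insertˡ Z
      against Z = pairing₂ ∘ₗ insertʳ Z

    pair-∙ʳ : ∀ x a b → pair x (a ∙ b) ≡ pair₂ (⟦ Δ ⟧ x) (a ⊗ₑ b)
    pair-∙ʳ x a b = begin
      pair x (a ∙ b)                ≡⟨ pair-sym x (a ∙ b) ⟩
      pair (a ∙ b) x                ≡⟨ pair-∙ˡ a b x ⟩
      pair₂ (a ⊗ₑ b) (⟦ Δ ⟧ x)      ≡⟨ pair₂-sym (a ⊗ₑ b) (⟦ Δ ⟧ x) ⟩
      pair₂ (⟦ Δ ⟧ x) (a ⊗ₑ b)      ∎

  pairing₂ : Space₄ ⟶ ℚ-space
  pairing₂ = unitorˡ ∘ₗ (pairing ⊗₁ pairing) ∘ₗ τ-middle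

  pair₂-generated : ∀ x y κ b →
    ⟦ pairing₂ ⟧ ((x ⊗ₑ y) ⊗ₑ (generated κ ⊗ₑ b)) ≡ pair x (generated κ) * pair (⟦ twist ∣ κ ∣ₘ ⟧ y) b
  pair₂-generated x y κ b = _⟶_.⟦⟧-cong (unitorˡ {ℚ-space} ∘ₗ (pairing ⊗₁ pairing)) (τ-middle-generated x y κ b)

  open Tensors pairing₂ pair₂-generated public using (pair-∙ˡ; pair-∙ʳ)

  -- (-1)^(m(m-1)/2), where m is the fermionic degree.
  ω : Word → ℚ
  ω []      = 1ℚ
  ω (w ∷ κ) = sgn (∣ w ∣₁ ℙ.* ∣ κ ∣ₘ) * ω κ

  ω-self : ∀ κ → ω κ * ω κ ≡ 1ℚ
  ω-self []      = ≡.refl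
  ω-self (w ∷ κ) = ≡.trans (regroup (sgn (∣ w ∣₁ ℙ.* ∣ κ ∣ₘ)) (ω κ))
    (cong₂ _*_ (sgn-self (∣ w ∣₁ ℙ.* ∣ κ ∣ₘ)) (ω-self κ))
    where
    regroup : ∀ s x → (s * x) * (s * x) ≡ (s * s) * (x * x)
    regroup = solve 2 (λ s x → (s :* x) :* (s :* x) := (s :* s) :* (x :* x)) ≡.refl

  -- `∂-generated` contributes the exponent |w|(|μ| + |w|). Where the matchings are nonzero, |μ| =
  -- |w| + |κ|, and |w||κ| remains: the step in the recursion of `ω`.
  pair-matchings : ∀ κ μ → pair (generated κ) (generated μ) ≡ ω κ * matchings κ μ
  pair-matchings [] [] = ≡.trans (pair-𝟏ʳ 𝟏) ε-𝟏
  pair-matchings [] (v ∷ μ) = ≡.trans (pair-𝟏ˡ (generated (v ∷ μ))) (ε-P v (generated μ))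
  pair-matchings (w ∷ κ) μ = begin
    pair (P w ∙ generated κ) (generated μ)
      ≡⟨ pair-pˡ w (generated κ) (generated μ) ⟩
    pair (generated κ) (⟦ ∂ w ⟧ (generated μ))
      ≡⟨ ≡.trans (pair-congʳ (generated κ) (∂-generated w μ)) (pair-·ʳ s (generated κ) _) ⟩
    s * pair (generated κ) (Delete.delete space w generated μ)
      ≡⟨ cong (s *_) (delete-natural (pairWith (generated κ)) w generated μ) ⟨
    s * deleteℚ w (λ ν → pair (generated κ) (generated ν)) μ
      ≡⟨ cong (s *_) (≡.trans (deleteℚ-ext w μ (pair-matchings κ)) (deleteℚ-· w (ω κ) (matchings κ) μ)) ⟩
    s * (ω κ * matchings (w ∷ κ) μ)
      ≡⟨ by-parity (matchings-parity (w ∷ κ) μ) ⟩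
    (sgn (∣ w ∣₁ ℙ.* ∣ κ ∣ₘ) * ω κ) * matchings (w ∷ κ) μ ∎
    where
    s : ℚ
    s = sgn (∣ w ∣₁ ℙ.* (∣ μ ∣ₘ ℙ.+ ∣ w ∣₁))
    cancel : ∀ p q → (p ℙ.+ q) ℙ.+ p ≡ q
    cancel 0ℙ 0ℙ = ≡.refl
    cancel 0ℙ 1ℙ = ≡.refl
    cancel 1ℙ 0ℙ = ≡.refl
    cancel 1ℙ 1ℙ = ≡.refl
    by-parity : matchings (w ∷ κ) μ ≡ 0ℚ ⊎ ∣ μ ∣ₘ ≡ ∣ w ∷ κ ∣ₘ →
      s * (ω κ * matchings (w ∷ κ) μ) ≡ (sgn (∣ w ∣₁ ℙ.* ∣ κ ∣ₘ) * ω κ) * matchings (w ∷ κ) μ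
    by-parity (inj₁ ≡0) = ≡.trans (cong (λ x → s * (ω κ * x)) ≡0) (≡.trans (zero-product s (ω κ) (sgn (∣ w ∣₁ ℙ.* ∣ κ ∣ₘ)))
      (sym (cong ((sgn (∣ w ∣₁ ℙ.* ∣ κ ∣ₘ) * ω κ) *_) ≡0)))
      where
      zero-product : ∀ s x t → s * (x * 0ℚ) ≡ (t * x) * 0ℚ
      zero-product = solve 3 (λ s x t → s :* (x :* con 0ℚ) := (t :* x) :* con 0ℚ) ≡.refl
    by-parity (inj₂ ∣μ∣) = ≡.trans (sym (ℚₚ.*-assoc s (ω κ) (matchings (w ∷ κ) μ)))
      (cong (λ q → (sgn (∣ w ∣₁ ℙ.* q) * ω κ) * matchings (w ∷ κ) μ)
        (≡.trans (cong (ℙ._+ ∣ w ∣₁) (≡.trans ∣μ∣ (∣∣-∷ w κ))) (cancel ∣ w ∣₁ ∣ κ ∣ₘ)))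

-- Assembly of the Hopf algebra and its self-duality

module HopfAlgebra {A mult u Δ ε} (G : GeneratedByPrimitives A mult u Δ ε) where
  open SuperSpace A using (space)
  open LeftModule space
  open HopfStructure A mult u Δ ε
  open GeneratedByPrimitives G using (∙-assoc; ∙-identityˡ; Δ-𝟏; ε-𝟏)

  isHopfAlgebra : (∀ x → x ∙ 𝟏 ≈ᴹ x) → assocʳ ∘ₗ (Δ ⊗₁ idₗ) ∘ₗ Δ ≐ (idₗ ⊗₁ Δ) ∘ₗ Δ →
    unitorˡ ∘ₗ (ε ⊗₁ idₗ) ∘ₗ Δ ≐ idₗ → unitorʳ ∘ₗ (idₗ ⊗₁ ε) ∘ₗ Δ ≐ idₗ → IsHopfAlgebra
  isHopfAlgebra ∙-identityʳ coassoc counitˡ counitʳ = record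
    { ∙-assoc     = ∙-assoc
    ; ∙-identityˡ = ∙-identityˡ
    ; ∙-identityʳ = ∙-identityʳ
    ; coassoc     = coassoc
    ; counitˡ     = counitˡ
    ; counitʳ     = counitʳ
    ; Δ-∙         = Bialgebra.Δ-∙ G
    ; Δ-𝟏         = Δ-𝟏
    ; ε-∙         = Pairing.ε-∙ G
    ; ε-𝟏         = ε-𝟏
    ; S           = Antipode.S G
    ; antipodeˡ   = Antipode.antipodeˡ G
    ; antipodeʳ   = Antipode.antipodeʳ G
    }

  selfDual : ∀ ∙-identityʳ coassoc counitˡ counitʳ →
    (∀ x → (∀ y → Pairing.pair G y x ≡ 0ℚ) → x ≈ᴹ 0ᴹ) →
    SelfDual (isHopfAlgebra ∙-identityʳ coassoc counitˡ counitʳ)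
  selfDual _ _ _ _ nondegenerate = record
    { pairing        = pairing
    ; nondegenerateˡ = λ x x⊥ → nondegenerate x λ y → ≡.trans (pair-sym y x) (x⊥ y)
    ; nondegenerateʳ = nondegenerate
    ; ∙-Δ            = pair-∙ˡ
    ; Δ-∙            = pair-∙ʳ
    ; 𝟏-ε            = pair-𝟏ˡ
    ; ε-𝟏            = pair-𝟏ʳ
    ; S-S            = pair-S
    }
    where open Pairing G

-- The superalgebra Λ

twist-parity : ∀ {p} f → HasParity p (coeff f) → ∀ q → ⟦ Λ-twist q ⟧ f ≈Λ (sgn (p ℙ.* q) ·Λ f)
twist-parity f fₚ q m = sgn-parity fₚ q m

twist-product : ∀ p f g → ⟦ Λ-twist p ⟧ (product f g) ≈Λ product (⟦ Λ-twist p ⟧ f) (⟦ Λ-twist p ⟧ g)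
twist-product p f g m = ≡.trans
  (sym (∑-* m (sgn (∣ m ∣ₘ ℙ.* p)) (λ m₁ m₂ → coeff f m₁ * coeff g m₂)))
  (∑-congᵖ m λ m₁ m₂ m≡ → ≡.trans
    (cong (_* (coeff f m₁ * coeff g m₂)) (≡.trans (cong (λ q → sgn (q ℙ.* p)) m≡)
      (≡.trans (cong sgn (ℙₚ.*-distribʳ-+ p ∣ m₁ ∣ₘ ∣ m₂ ∣ₘ)) (sgn-+ (∣ m₁ ∣ₘ ℙ.* p) (∣ m₂ ∣ₘ ℙ.* p)))))
    (regroup (sgn (∣ m₁ ∣ₘ ℙ.* p)) (sgn (∣ m₂ ∣ₘ ℙ.* p)) (coeff f m₁) (coeff g m₂)))
  where
  regroup : ∀ s t x y → (s * t) * (x * y) ≡ (s * x) * (t * y)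
  regroup = solve 4 (λ s t x y → (s :* t) :* (x :* y) := (s :* x) :* (t :* y)) ≡.refl

τ-twist : ∀ {p} f g → HasParity p (coeff f) → ⟦ SΛ.τ ⟧ (g ⊗ₑ f) ≈[ Λ⊗Λ ] f ⊗ₑ ⟦ Λ-twist p ⟧ g
τ-twist {p} f g fₚ = evaluate-injective (⟦ SΛ.τ ⟧ (g ⊗ₑ f)) (f ⊗ₑ ⟦ Λ-twist p ⟧ g) λ m n → begin
  evaluate (⟦ SΛ.τ ⟧ (g ⊗ₑ f)) m n
    ≡⟨ evaluate-τ (g ⊗ₑ f) m n ⟩
  sgn (∣ m ∣ₘ ℙ.* ∣ n ∣ₘ) * (coeff g n * coeff f m)
    ≡⟨ solve 3 (λ s x y → s :* (x :* y) := (s :* y) :* x) ≡.refl (sgn (∣ m ∣ₘ ℙ.* ∣ n ∣ₘ)) (coeff g n) (coeff f m) ⟩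
  (sgn (∣ m ∣ₘ ℙ.* ∣ n ∣ₘ) * coeff f m) * coeff g n
    ≡⟨ cong (_* coeff g n) (sgn-parity fₚ ∣ n ∣ₘ m) ⟩
  (sgn (p ℙ.* ∣ n ∣ₘ) * coeff f m) * coeff g n
    ≡⟨ cong (λ q → (sgn q * coeff f m) * coeff g n) (ℙₚ.*-comm p ∣ n ∣ₘ) ⟩
  (sgn (∣ n ∣ₘ ℙ.* p) * coeff f m) * coeff g n
    ≡⟨ solve 3 (λ s x y → (s :* y) :* x := y :* (s :* x)) ≡.refl (sgn (∣ n ∣ₘ ℙ.* p)) (coeff g n) (coeff f m) ⟩
  coeff f m * (sgn (∣ n ∣ₘ ℙ.* p) * coeff g n) ∎
  where open ≡-Reasoning

Λ-Δ-powerSum : ∀ u f → ⟦ Λ-Δ ⟧ (product (powerSum u) f) ≈[ Λ⊗Λ ] ⟦ Λ-leibniz u ⟧ (⟦ Λ-Δ ⟧ f)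
Λ-Δ-powerSum u f = evaluate-injective (⟦ Λ-Δ ⟧ (product (powerSum u) f)) (⟦ Λ-leibniz u ⟧ (⟦ Λ-Δ ⟧ f)) λ m n → begin
  evaluate (⟦ Λ-Δ ⟧ (product (powerSum u) f)) m n
    ≡⟨ evaluate-Δ (product (powerSum u) f) m n ⟩
  coeff (product (powerSum u) f) (m ++ n)
    ≡⟨ coeff-powerSum-∙ u f (m ++ n) ⟩
  divide u (coeff f) (m ++ n)
    ≡⟨ divide-++ u (coeff f) m n ⟩
  divide u (λ a → coeff f (a ++ n)) m + sgn (∣ m ∣ₘ ℙ.* ∣ u ∣₁) * divide u (λ b → coeff f (m ++ b)) n
    ≡⟨ cong₂ (λ x y → x + sgn (∣ m ∣ₘ ℙ.* ∣ u ∣₁) * y)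
         (divide-ext u m λ a → evaluate-Δ f a n) (divide-ext u n λ b → evaluate-Δ f m b) ⟨
  divide u (λ a → evaluate (⟦ Λ-Δ ⟧ f) a n) m + sgn (∣ m ∣ₘ ℙ.* ∣ u ∣₁) * divide u (λ b → evaluate (⟦ Λ-Δ ⟧ f) m b) n
    ≡⟨ evaluate-leibniz u (⟦ Λ-Δ ⟧ f) m n ⟨
  evaluate (⟦ Λ-leibniz u ⟧ (⟦ Λ-Δ ⟧ f)) m n ∎
  where open ≡-Reasoning

-- `iterate` and `products` meet only by induction on the word, hence the transports along this
-- equality below.
powers≡ : ∀ κ → powers κ ≡ products Λ Λ-mult Λ-unit powerSum κ
powers≡ []      = ≡.refl
powers≡ (u ∷ κ) = cong (product (powerSum u)) (powers≡ κ)

ext-words : ∀ {V} (h k : Λ-space ⟶ V) → (∀ κ → ⟦ h ⟧ (products Λ Λ-mult Λ-unit powerSum κ) ≈[ V ] ⟦ k ⟧ (products Λ Λ-mult Λ-unit powerSum κ)) → h ≐ k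
ext-words {V} h k h≈k = ext-powers {V} h k λ κ →
  ≡.subst (λ f → ⟦ h ⟧ f ≈[ V ] ⟦ k ⟧ f) (sym (powers≡ κ)) (h≈k κ)

words-free : ∀ {V} {Φ} → Delete.Supersymmetric V Φ → ∃ λ (h : Λ-space ⟶ V) → ∀ κ → ⟦ h ⟧ (products Λ Λ-mult Λ-unit powerSum κ) ≈[ V ] Φ κ
words-free {V} {Φ} S = universal {V} {Φ} S , λ κ →
  ≡.subst (λ f → ⟦ universal {V} {Φ} S ⟧ f ≈[ V ] Φ κ) (powers≡ κ) (universal-powers {V} {Φ} S κ)

τ-words : ∀ κ g → ⟦ SΛ.τ ⟧ (g ⊗ₑ products Λ Λ-mult Λ-unit powerSum κ) ≈[ Λ⊗Λ ] products Λ Λ-mult Λ-unit powerSum κ ⊗ₑ ⟦ Λ-twist ∣ κ ∣ₘ ⟧ g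
τ-words κ g = ≡.subst (λ f → ⟦ SΛ.τ ⟧ (g ⊗ₑ f) ≈[ Λ⊗Λ ] f ⊗ₑ ⟦ Λ-twist ∣ κ ∣ₘ ⟧ g) (powers≡ κ) (τ-twist (powers κ) g (powers-parity κ))

Λ-generated : GeneratedByPrimitives Λ Λ-mult Λ-unit Λ-Δ Λ-counit
Λ-generated = record
  { P           = powerSum
  ; twist       = Λ-twist
  ; ∙-assoc     = product-assoc
  ; ∙-identityˡ = product-identityˡ
  ; P-comm      = powerSum-swap
  ; ext         = ext-words
  ; free        = words-free
  ; τ-generated = τ-words
  ; twist-∙     = twist-product
  ; twist-𝟏     = λ q m → ≡.trans (twist-parity 𝟙 𝟙-parity q m) (ℚₚ.*-identityˡ (coeff 𝟙 m))
  ; twist-P     = λ q w → twist-parity (powerSum w) (power-parity w) q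
  ; Δ-𝟏         = Λ-Δ-𝟙
  ; Δ-P         = Λ-Δ-powerSum
  ; ε-𝟏         = ≡.refl
  ; ε-P         = λ w f → ℚₚ.*-zeroˡ (coeff f [])
  }

-- Nondegeneracy of the pairing

open Pairing Λ-generated using (pair; pairWith; ω; ω-self; pair-matchings)

pair-powers : ∀ μ κ → pair (products Λ Λ-mult Λ-unit powerSum μ) (powers κ) ≡ ω μ * matchings μ κ
pair-powers μ κ = ≡.trans (cong (pair (products Λ Λ-mult Λ-unit powerSum μ)) (powers≡ κ)) (pair-matchings μ κ)

pair-total : ∀ μ X → pair (products Λ Λ-mult Λ-unit powerSum μ) (total X) ≡ ω μ * weigh {ℚ-space} (λ κ → matchings κ μ) X
pair-total μ X = begin
  pair y (total X)
    ≡⟨ map-sum (pairWith y) X (λ t → proj₂ t ·Λ powers (proj₁ t)) ⟩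
  sumOver X (λ t → pair y (proj₂ t ·Λ powers (proj₁ t)))
    ≡⟨ ℚ-sum.sum-ext X (λ t → ≡.trans (_⟶_.*ₗ-homo (pairWith y) (proj₂ t) (powers (proj₁ t)))
         (≡.trans (cong (proj₂ t *_) (≡.trans (pair-powers μ (proj₁ t)) (cong (ω μ *_) (matchings-sym μ (proj₁ t)))))
           (regroup (proj₂ t) (ω μ) (matchings (proj₁ t) μ)))) ⟩
  sumOver X (λ t → ω μ * (matchings (proj₁ t) μ * proj₂ t))
    ≡⟨ sum-* X (ω μ) (λ t → matchings (proj₁ t) μ * proj₂ t) ⟩
  ω μ * weigh {ℚ-space} (λ κ → matchings κ μ) X ∎
  where
  open ≡-Reasoning
  y : SymmetricFunction
  y = products Λ Λ-mult Λ-unit powerSum μ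
  regroup : ∀ q w x → q * (w * x) ≡ w * (x * q)
  regroup = solve 3 (λ q w x → q :* (w :* x) := w :* (x :* q)) ≡.refl

-- Pairing an expansion `X` of `f` with the product of power sums for `μ` gives `ω μ` times the sum
-- of `X` weighted by matchings with `μ`. As `ω μ` is its own inverse, all these sums vanish, which
-- is the hypothesis of `combine-vanish`.
pair-nondegenerate : ∀ f → (∀ g → pair g f ≡ 0ℚ) → f ≈Λ Λᴹ.0ᴹ
pair-nondegenerate f f⊥ m = ≡.trans (f≈ m) (total-zero m)
  where
  open ≡-Reasoning
  X : Combination ℚ-space
  X = proj₁ (spanned f)
  f≈ : f ≈Λ total X
  f≈ = proj₂ (spanned f)
  zero-sum : ∀ μ → weigh {ℚ-space} (λ κ → matchings κ μ) X ≡ 0ℚ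
  zero-sum μ = begin
    W                   ≡⟨ ℚₚ.*-identityˡ W ⟨
    1ℚ * W              ≡⟨ cong (_* W) (ω-self μ) ⟨
    (ω μ * ω μ) * W     ≡⟨ ℚₚ.*-assoc (ω μ) (ω μ) W ⟩
    ω μ * (ω μ * W)     ≡⟨ cong (ω μ *_) (pair-total μ X) ⟨
    ω μ * pair y (total X) ≡⟨ cong (ω μ *_) (_⟶_.⟦⟧-cong (pairWith y) {f} {total X} f≈) ⟨
    ω μ * pair y f      ≡⟨ cong (ω μ *_) (f⊥ y) ⟩
    ω μ * 0ℚ            ≡⟨ ℚₚ.*-zeroʳ (ω μ) ⟩
    0ℚ                  ∎
    where
    W : ℚ
    W = weigh {ℚ-space} (λ κ → matchings κ μ) X
    y : SymmetricFunction
    y = products Λ Λ-mult Λ-unit powerSum μ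
  total-zero : total X ≈Λ Λᴹ.0ᴹ
  total-zero n = ≡.trans (sym (value-combine {Λ-space} powers X n))
    (_⟶_.⟦⟧-cong (unitorʳ {Λ-space}) (combine-vanish {ℚ-space} {Λ-space} {powers} powers-supersymmetric X zero-sum) n)

proposition4p8 : ∃ λ (Δ : Λ-space ⟶ Λ-space ⊗ Λ-space) →
    let open HopfStructure Λ Λ-mult Λ-unit Δ Λ-counit in
    IsCoproduct Δ × Cocommutative × Σ IsHopfAlgebra SelfDual
proposition4p8 = Λ-Δ , Λ-Δ-isCoproduct , Λ-Δ-cocommutative
  , isHopfAlgebra product-identityʳ Λ-Δ-coassoc Λ-Δ-counitˡ Λ-Δ-counitʳ
  , selfDual product-identityʳ Λ-Δ-coassoc Λ-Δ-counitˡ Λ-Δ-counitʳ pair-nondegenerate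
  where open HopfAlgebra Λ-generated
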